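{- Let $k\ge2$ be an integer. Then, as $x\to\infty$, $$\mathop{\sum\nolimits'}_{N(\alpha)\le x}{\mathfrak t}^{(e)}_k(\alpha)=C_kx+O\bigl(x^{1/2}\log^{3+4(k-1)/3}x\bigr),\qquad \mathop{\sum\nolimits'}_{N(\alpha)\le x}{\mathfrak t}^{(e)}_{k*}(\alpha)=C_{k*}x+O\bigl(x^{1/2}\log^{3+2(k^2+k-2)/3}x\bigr),$$ where $$C_k=\frac{\pi}{4}\prod_{\mathfrak p}\Bigl(1+\sum_{a=2}^\infty\frac{\tau_k(a)-\tau_k(a-1)}{N^a({\mathfrak p})}\Bigr),\qquad C_{k*}=\frac{\pi}{4}\prod_{\mathfrak p}\Bigl(1+\sum_{a=2}^\infty\frac{{\mathfrak t}_k(a)-{\mathfrak t}_k(a-1)}{N^a({\mathfrak p})}\Bigr).$$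
   Context: $\mathbb{Z}[i]$ is the ring of Gaussian integers, $N(a+bi)=a^2+b^2$. $\sum'$ denotes summation over nonzero Gaussian integers taken up to associates (one representative from each class $\{\alpha,-\alpha,i\alpha,-i\alpha\}$), and the products are over Gaussian primes ${\mathfrak p}$ taken up to associates. $\tau_k(a)$ is the number of ordered $k$-tuples of positive integers with product $a$; ${\mathfrak t}_k(a)$ is the number of ordered $k$-tuples of nonzero Gaussian integers, each taken up to associates, whose product is associated to $a$ (equivalently, ordered $k$-tuples of ideals of $\mathbb{Z}[i]$ with product $a\mathbb{Z}[i]$). ${\mathfrak t}^{(e)}_k$ and ${\mathfrak t}^{(e)}_{k*}$ are the multiplicative functions on nonzero Gaussian integers given by ${\mathfrak t}^{(e)}_k(\varepsilon{\mathfrak p}_1^{a_1}\cdots{\mathfrak p}_r^{a_r})=\prod_j\tau_k(a_j)$ and ${\mathfrak t}^{(e)}_{k*}(\varepsilon{\mathfrak p}_1^{a_1}\cdots{\mathfrak p}_r^{a_r})=\prod_j{\mathfrak t}_k(a_j)$ for a unit $\varepsilon$ and pairwise non-associated Gaussian primes ${\mathfrak p}_j$. -}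

module Defs where

open import Algebra.Bundles using (CommutativeRing; Semiring)
import Algebra.Definitions.RawMagma as MagmaDefs
import Algebra.Definitions.RawSemiring as RawDefs
open import Data.Empty using (⊥-elim)
open import Data.Integer.Base as ℤ using (ℤ; +_; -[1+_]; +[1+_])
import Data.Integer.DivMod as ℤ
import Data.Integer.Properties as ℤ
import Data.Integer.Tactic.RingSolver as ℤ-Solver
open import Data.List.Base
  using (List; []; _∷_; _++_; map; foldr; filter; length; upTo; cartesianProductWith)
open import Data.List.Extrema.Nat using (max)
open import Data.List.Membership.Propositional using (_∈_; find; lose)
open import Data.List.Membership.Propositional.Properties
  using (∈-cartesianProductWith⁺; ∈-upTo⁺; ∈-map⁺; ∈-++⁺ˡ; ∈-++⁺ʳ)
import Data.List.Membership.DecPropositional as DecMembership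
open import Data.List.Relation.Unary.All as All using (All; all?)
open import Data.List.Relation.Unary.Any using (Any; any?)
open import Data.Nat.Base as ℕ using (ℕ; zero; suc)
import Data.Nat.Properties as ℕ
import Data.Nat.ListAction as ℕ
open import Data.Product.Base using (∃; _×_; _,_; proj₁; proj₂)
open import Data.Rational.Base as ℚ using (ℚ; 0ℚ; 1ℚ; ½)
open import Data.Rational.Literals using (fromℤ)
import Data.Rational.Properties as ℚ
open import Data.Rational.Solver using (module +-*-Solver)
import Data.Rational.Unnormalised.Base as ℚᵘ
import Data.Rational.Unnormalised.Properties as ℚᵘ
open import Data.Sum.Base as Sum using (_⊎_; inj₁; inj₂)
open import Data.Vec.Base using (Vec; []; _∷_; foldr′)
open import Level using (0ℓ)
open import Relation.Binary.PropositionalEquality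
  using (_≡_; _≢_; refl; sym; trans; cong; cong₂; subst; subst₂; isEquivalence)
open import Relation.Nullary using (Dec; yes; no; map′; _×-dec_; _⊎-dec_; _→-dec_)

open +-*-Solver using (solve; _:=_; _:+_; _:*_; _:-_; :-_; con)
open ℚ.≤-Reasoning

fromℕℚ : ℕ → ℚ
fromℕℚ n = fromℤ (+ n)

-- The reciprocal, extended by 1/0 = 0.
recip : ℚ → ℚ
recip p with p ℚ.≟ 0ℚ
... | yes _  = 0ℚ
... | no p≢0 = ℚ.1/_ p ⦃ ℚ.≢-nonZero p≢0 ⦄

module ℚ-Lemmas where

  *-monoˡ-≤ : ∀ {r p q} → 0ℚ ℚ.≤ r → p ℚ.≤ q → r ℚ.* p ℚ.≤ r ℚ.* q
  *-monoˡ-≤ {r} 0≤r = ℚ.*-monoˡ-≤-nonNeg r ⦃ ℚ.nonNegative 0≤r ⦄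

  *-monoʳ-≤ : ∀ {r p q} → 0ℚ ℚ.≤ r → p ℚ.≤ q → p ℚ.* r ℚ.≤ q ℚ.* r
  *-monoʳ-≤ {r} 0≤r = ℚ.*-monoʳ-≤-nonNeg r ⦃ ℚ.nonNegative 0≤r ⦄

  *-mono-≤ : ∀ {p q r s} → 0ℚ ℚ.≤ p → 0ℚ ℚ.≤ s → p ℚ.≤ q → r ℚ.≤ s →
             p ℚ.* r ℚ.≤ q ℚ.* s
  *-mono-≤ 0≤p 0≤s p≤q r≤s = ℚ.≤-trans (*-monoˡ-≤ 0≤p r≤s) (*-monoʳ-≤ 0≤s p≤q)

  *-cancelˡ-≤ : ∀ {r p q} → 0ℚ ℚ.< r → r ℚ.* p ℚ.≤ r ℚ.* q → p ℚ.≤ q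
  *-cancelˡ-≤ {r} 0<r = ℚ.*-cancelˡ-≤-pos r ⦃ ℚ.positive 0<r ⦄

  0≤* : ∀ {p q} → 0ℚ ℚ.≤ p → 0ℚ ℚ.≤ q → 0ℚ ℚ.≤ p ℚ.* q
  0≤* {p} {q} 0≤p 0≤q = ℚ.nonNegative⁻¹ (p ℚ.* q)
    ⦃ ℚ.nonNeg*nonNeg⇒nonNeg p ⦃ ℚ.nonNegative 0≤p ⦄ q ⦃ ℚ.nonNegative 0≤q ⦄ ⦄

  0<* : ∀ {p q} → 0ℚ ℚ.< p → 0ℚ ℚ.< q → 0ℚ ℚ.< p ℚ.* q
  0<* {p} {q} 0<p 0<q = ℚ.positive⁻¹ (p ℚ.* q)
    ⦃ ℚ.pos*pos⇒pos p ⦃ ℚ.positive 0<p ⦄ q ⦃ ℚ.positive 0<q ⦄ ⦄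

  0<½ : 0ℚ ℚ.< ½
  0<½ = ℚ.positive⁻¹ ½

  0<1 : 0ℚ ℚ.< 1ℚ
  0<1 = ℚ.positive⁻¹ 1ℚ

  0≤1 : 0ℚ ℚ.≤ 1ℚ
  0≤1 = ℚ.<⇒≤ 0<1

  half : ∀ ε → ½ ℚ.* ε ℚ.+ ½ ℚ.* ε ≡ ε
  half ε = trans (sym (ℚ.*-distribʳ-+ ε ½ ½)) (ℚ.*-identityˡ ε)

  0<half : ∀ {ε} → 0ℚ ℚ.< ε → 0ℚ ℚ.< ½ ℚ.* ε
  0<half = 0<* 0<½

  p≤∣p∣ : ∀ r → r ℚ.≤ ℚ.∣ r ∣
  p≤∣p∣ r with ℚ.≤-total 0ℚ r
  ... | inj₁ 0≤r = ℚ.≤-reflexive (sym (ℚ.0≤p⇒∣p∣≡p 0≤r))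
  ... | inj₂ r≤0 = ℚ.≤-trans r≤0 (ℚ.0≤∣p∣ r)

  ∣p-q∣≡∣q-p∣ : ∀ p q → ℚ.∣ p ℚ.- q ∣ ≡ ℚ.∣ q ℚ.- p ∣
  ∣p-q∣≡∣q-p∣ p q = trans (sym (ℚ.∣-p∣≡∣p∣ (p ℚ.- q)))
    (cong ℚ.∣_∣ (solve 2 (λ p q → :- (p :- q) := q :- p) refl p q))

  triangle : ∀ p q r → ℚ.∣ p ℚ.- r ∣ ℚ.≤ ℚ.∣ p ℚ.- q ∣ ℚ.+ ℚ.∣ q ℚ.- r ∣
  triangle p q r = begin
    ℚ.∣ p ℚ.- r ∣                       ≡⟨ cong ℚ.∣_∣ (solve 3 (λ p q r → p :- r := (p :- q) :+ (q :- r)) refl p q r) ⟩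
    ℚ.∣ (p ℚ.- q) ℚ.+ (q ℚ.- r) ∣       ≤⟨ ℚ.∣p+q∣≤∣p∣+∣q∣ (p ℚ.- q) (q ℚ.- r) ⟩
    ℚ.∣ p ℚ.- q ∣ ℚ.+ ℚ.∣ q ℚ.- r ∣     ∎

  ∣p∣≤ : ∀ {p r} → p ℚ.≤ r → ℚ.- p ℚ.≤ r → ℚ.∣ p ∣ ℚ.≤ r
  ∣p∣≤ {p} p≤r -p≤r with ℚ.∣p∣≡p∨∣p∣≡-p p
  ... | inj₁ eq = subst (ℚ._≤ _) (sym eq) p≤r
  ... | inj₂ eq = subst (ℚ._≤ _) (sym eq) -p≤r

  recip-inverse : ∀ {p} → p ≢ 0ℚ → p ℚ.* recip p ≡ 1ℚ
  recip-inverse {p} p≢0 with p ℚ.≟ 0ℚ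
  ... | yes p≡0 = ⊥-elim (p≢0 p≡0)
  ... | no p≢0′ = ℚ.*-inverseʳ p ⦃ ℚ.≢-nonZero p≢0′ ⦄

  >⇒≢ : ∀ {p} → 0ℚ ℚ.< p → p ≢ 0ℚ
  >⇒≢ 0<p p≡0 = ℚ.<-irrefl (sym p≡0) 0<p

  0<recip : ∀ {p} → 0ℚ ℚ.< p → 0ℚ ℚ.< recip p
  0<recip {p} 0<p = ℚ.*-cancelˡ-<-nonNeg p ⦃ ℚ.nonNegative (ℚ.<⇒≤ 0<p) ⦄
    (subst₂ ℚ._<_ (sym (ℚ.*-zeroʳ p)) (sym (recip-inverse (>⇒≢ 0<p))) 0<1)

  shrink : ∀ {B ε} → 0ℚ ℚ.< B → 0ℚ ℚ.< ε → ∃ λ δ → 0ℚ ℚ.< δ × B ℚ.* δ ≡ ε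
  shrink {B} {ε} 0<B 0<ε =
    recip B ℚ.* ε , 0<* (0<recip 0<B) 0<ε ,
    trans (sym (ℚ.*-assoc B (recip B) ε))
      (trans (cong (ℚ._* ε) (recip-inverse (>⇒≢ 0<B))) (ℚ.*-identityˡ ε))

  recip-≤ : ∀ {p r} → 0ℚ ℚ.< p → 1ℚ ℚ.≤ p ℚ.* r → recip p ℚ.≤ r
  recip-≤ {p} {r} 0<p 1≤pr = *-cancelˡ-≤ 0<p
    (subst (ℚ._≤ p ℚ.* r) (sym (recip-inverse (>⇒≢ 0<p))) 1≤pr)

  recip-antitone : ∀ {p q} → 0ℚ ℚ.< p → p ℚ.≤ q → recip q ℚ.≤ recip p
  recip-antitone {p} {q} 0<p p≤q = recip-≤ (ℚ.<-≤-trans 0<p p≤q)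
    (subst (ℚ._≤ q ℚ.* recip p) (recip-inverse (>⇒≢ 0<p)) (*-monoʳ-≤ (ℚ.<⇒≤ (0<recip 0<p)) p≤q))

  archimedean : ∀ {r} → 0ℚ ℚ.< r → ∃ λ n → 1ℚ ℚ.≤ fromℕℚ n ℚ.* r
  archimedean {ℚ.mkℚ +[1+ a ] d c} 0<r = suc d , ℚ.toℚᵘ-cancel-≤
    (ℚᵘ.≤-respʳ-≃ (ℚᵘ.≃-sym (ℚᵘ.≃-trans (ℚ.toℚᵘ-homo-* (fromℕℚ (suc d)) r) ℚᵘ.≃-refl))
      (ℚᵘ.*≤* (ℤ.+≤+ bound)))
    where
    r = ℚ.mkℚ +[1+ a ] d c
    bound : 1 ℕ.* (1 ℕ.* suc d) ℕ.≤ (suc d ℕ.* suc a) ℕ.* 1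
    bound = subst₂ ℕ._≤_
      (sym (trans (ℕ.*-identityˡ _) (ℕ.*-identityˡ _))) (sym (ℕ.*-identityʳ _))
      (ℕ.m≤m*n (suc d) (suc a))
  archimedean {ℚ.mkℚ (+ 0) d c} (ℚ.*<* (ℤ.+<+ ()))
  archimedean {ℚ.mkℚ -[1+ a ] d c} (ℚ.*<* ())

  fromℕℚ-mono : ∀ {m n} → m ℕ.≤ n → fromℕℚ m ℚ.≤ fromℕℚ n
  fromℕℚ-mono {m} {n} m≤n = ℚ.toℚᵘ-cancel-≤
    (ℚᵘ.*≤* (ℤ.*-monoʳ-≤-nonNeg (+ 1) (ℤ.+≤+ m≤n)))

  0≤fromℕℚ : ∀ n → 0ℚ ℚ.≤ fromℕℚ n
  0≤fromℕℚ n = fromℕℚ-mono {0} {n} ℕ.z≤n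

  fromℕℚ-suc : ∀ n → fromℕℚ (suc n) ≡ 1ℚ ℚ.+ fromℕℚ n
  fromℕℚ-suc n = ℚ.toℚᵘ-injective
    (ℚᵘ.≃-sym (ℚᵘ.≃-trans (ℚ.toℚᵘ-homo-+ 1ℚ (fromℕℚ n)) (ℚᵘ.*≡* num)))
    where
    num : (+ 1 ℤ.* + 1 ℤ.+ + n ℤ.* + 1) ℤ.* + 1 ≡ + suc n ℤ.* + 1
    num = cong (ℤ._* + 1) (cong (λ z → + 1 ℤ.+ z) (ℤ.*-identityʳ (+ n)))

  0<fromℕℚ-suc : ∀ n → 0ℚ ℚ.< fromℕℚ (suc n)
  0<fromℕℚ-suc n = ℚ.<-≤-trans 0<1 (fromℕℚ-mono {1} {suc n} (ℕ.s≤s ℕ.z≤n))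

  ∣recip∣ : ∀ n → ℚ.∣ recip (fromℕℚ (suc n)) ∣ ≡ recip (fromℕℚ (suc n))
  ∣recip∣ n = ℚ.0≤p⇒∣p∣≡p (ℚ.<⇒≤ (0<recip (0<fromℕℚ-suc n)))

  archimedean-recip : ∀ {r} → 0ℚ ℚ.< r → ∃ λ N → ∀ n → N ℕ.≤ n → recip (fromℕℚ (suc n)) ℚ.≤ r
  archimedean-recip {r} 0<r = proj₁ a , λ n N≤n → recip-≤ (0<fromℕℚ-suc n)
    (ℚ.≤-trans (proj₂ a) (*-monoʳ-≤ (ℚ.<⇒≤ 0<r) (fromℕℚ-mono {proj₁ a} {suc n} (ℕ.m≤n⇒m≤1+n N≤n))))
    where a = archimedean 0<r

open ℚ-Lemmas

Eventually : (ℕ → Set) → Set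
Eventually P = ∃ λ N → ∀ n → N ℕ.≤ n → P n

Cauchy : (ℕ → ℚ) → Set
Cauchy s = ∀ ε → 0ℚ ℚ.< ε →
  ∃ λ N → ∀ m n → N ℕ.≤ m → N ℕ.≤ n → ℚ.∣ s m ℚ.- s n ∣ ℚ.≤ ε

record ℝ : Set where
  constructor mkℝ
  field
    seq    : ℕ → ℚ
    cauchy : Cauchy seq

open ℝ public

infix 4 _≃_ _≤_ _<_

_≃_ : ℝ → ℝ → Set
x ≃ y = ∀ ε → 0ℚ ℚ.< ε → Eventually λ n → ℚ.∣ seq x n ℚ.- seq y n ∣ ℚ.≤ ε

_≤_ : ℝ → ℝ → Set
x ≤ y = ∀ ε → 0ℚ ℚ.< ε → Eventually λ n → seq x n ℚ.≤ seq y n ℚ.+ ε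

_<_ : ℝ → ℝ → Set
x < y = ∃ λ ε → 0ℚ ℚ.< ε × Eventually λ n → seq x n ℚ.+ ε ℚ.≤ seq y n

fromℚ : ℚ → ℝ
fromℚ q = mkℝ (λ _ → q) λ ε 0<ε → 0 , λ _ _ _ _ →
  subst (ℚ._≤ ε) (sym (cong ℚ.∣_∣ (ℚ.+-inverseʳ q))) (ℚ.<⇒≤ 0<ε)

fromℕ : ℕ → ℝ
fromℕ n = fromℚ (fromℕℚ n)

0ℝ 1ℝ : ℝ
0ℝ = fromℚ 0ℚ
1ℝ = fromℚ 1ℚ

module ℝ-Lemmas where

  eventually-× : ∀ {P Q : ℕ → Set} → Eventually P → Eventually Q →
                 Eventually λ n → P n × Q n
  eventually-× (M , p) (N , q) = M ℕ.⊔ N , λ n M⊔N≤n →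
    p n (ℕ.m⊔n≤o⇒m≤o M N M⊔N≤n) , q n (ℕ.m⊔n≤o⇒n≤o M N M⊔N≤n)

  bounded : ∀ x → ∃ λ B → 1ℚ ℚ.≤ B × Eventually λ n → ℚ.∣ seq x n ∣ ℚ.≤ B
  bounded x with cauchy x 1ℚ 0<1
  ... | N , c = B , 1≤B , N , λ n N≤n → begin
      ℚ.∣ seq x n ∣                                    ≡⟨ cong ℚ.∣_∣ (solve 2 (λ p q → p := (p :- q) :+ q) refl (seq x n) (seq x N)) ⟩
      ℚ.∣ (seq x n ℚ.- seq x N) ℚ.+ seq x N ∣          ≤⟨ ℚ.∣p+q∣≤∣p∣+∣q∣ (seq x n ℚ.- seq x N) (seq x N) ⟩
      ℚ.∣ seq x n ℚ.- seq x N ∣ ℚ.+ ℚ.∣ seq x N ∣      ≤⟨ ℚ.+-monoˡ-≤ _ (c n N N≤n ℕ.≤-refl) ⟩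
      B                                                ∎
    where
    B = 1ℚ ℚ.+ ℚ.∣ seq x N ∣
    1≤B : 1ℚ ℚ.≤ B
    1≤B = subst (ℚ._≤ B) (ℚ.+-identityʳ 1ℚ) (ℚ.+-monoʳ-≤ 1ℚ (ℚ.0≤∣p∣ (seq x N)))

  cauchy-+ : ∀ x y → Cauchy λ n → seq x n ℚ.+ seq y n
  cauchy-+ x y ε 0<ε with cauchy x (½ ℚ.* ε) (0<half 0<ε) | cauchy y (½ ℚ.* ε) (0<half 0<ε)
  ... | M , c | N , d = M ℕ.⊔ N , λ m n p q → begin
      ℚ.∣ (seq x m ℚ.+ seq y m) ℚ.- (seq x n ℚ.+ seq y n) ∣
        ≡⟨ cong ℚ.∣_∣ (solve 4 (λ a b c d → (a :+ b) :- (c :+ d) := (a :- c) :+ (b :- d)) refl (seq x m) (seq y m) (seq x n) (seq y n)) ⟩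
      ℚ.∣ (seq x m ℚ.- seq x n) ℚ.+ (seq y m ℚ.- seq y n) ∣
        ≤⟨ ℚ.∣p+q∣≤∣p∣+∣q∣ (seq x m ℚ.- seq x n) (seq y m ℚ.- seq y n) ⟩
      ℚ.∣ seq x m ℚ.- seq x n ∣ ℚ.+ ℚ.∣ seq y m ℚ.- seq y n ∣
        ≤⟨ ℚ.+-mono-≤ (c m n (ℕ.m⊔n≤o⇒m≤o M N p) (ℕ.m⊔n≤o⇒m≤o M N q))
                      (d m n (ℕ.m⊔n≤o⇒n≤o M N p) (ℕ.m⊔n≤o⇒n≤o M N q)) ⟩
      ½ ℚ.* ε ℚ.+ ½ ℚ.* ε
        ≡⟨ half ε ⟩
      ε ∎

  cauchy-neg : ∀ x → Cauchy λ n → ℚ.- seq x n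
  cauchy-neg x ε 0<ε with cauchy x ε 0<ε
  ... | N , c = N , λ m n p q → subst (ℚ._≤ ε)
    (trans (sym (ℚ.∣-p∣≡∣p∣ (seq x m ℚ.- seq x n)))
      (cong ℚ.∣_∣ (solve 2 (λ a b → :- (a :- b) := :- a :- :- b) refl (seq x m) (seq x n))))
    (c m n p q)

  cauchy-∣∣ : ∀ x → Cauchy λ n → ℚ.∣ seq x n ∣
  cauchy-∣∣ x ε 0<ε with cauchy x ε 0<ε
  ... | N , c = N , λ m n p q → ℚ.≤-trans (reverse-triangle (seq x m) (seq x n)) (c m n p q)
    where
    one-sided : ∀ p q → ℚ.∣ p ∣ ℚ.- ℚ.∣ q ∣ ℚ.≤ ℚ.∣ p ℚ.- q ∣
    one-sided p q = begin
      ℚ.∣ p ∣ ℚ.- ℚ.∣ q ∣                            ≡⟨ cong (λ r → ℚ.∣ r ∣ ℚ.- ℚ.∣ q ∣) (solve 2 (λ p q → p := (p :- q) :+ q) refl p q) ⟩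
      ℚ.∣ (p ℚ.- q) ℚ.+ q ∣ ℚ.- ℚ.∣ q ∣              ≤⟨ ℚ.+-monoˡ-≤ _ (ℚ.∣p+q∣≤∣p∣+∣q∣ (p ℚ.- q) q) ⟩
      ℚ.∣ p ℚ.- q ∣ ℚ.+ ℚ.∣ q ∣ ℚ.- ℚ.∣ q ∣          ≡⟨ solve 2 (λ a b → a :+ b :- b := a) refl ℚ.∣ p ℚ.- q ∣ ℚ.∣ q ∣ ⟩
      ℚ.∣ p ℚ.- q ∣                                  ∎
    reverse-triangle : ∀ p q → ℚ.∣ ℚ.∣ p ∣ ℚ.- ℚ.∣ q ∣ ∣ ℚ.≤ ℚ.∣ p ℚ.- q ∣
    reverse-triangle p q = ∣p∣≤ (one-sided p q) (begin
      ℚ.- (ℚ.∣ p ∣ ℚ.- ℚ.∣ q ∣)     ≡⟨ solve 2 (λ a b → :- (a :- b) := b :- a) refl ℚ.∣ p ∣ ℚ.∣ q ∣ ⟩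
      ℚ.∣ q ∣ ℚ.- ℚ.∣ p ∣           ≤⟨ one-sided q p ⟩
      ℚ.∣ q ℚ.- p ∣                 ≡⟨ ∣p-q∣≡∣q-p∣ q p ⟩
      ℚ.∣ p ℚ.- q ∣                 ∎)

  product-close : ∀ {A B α β} x₁ y₁ x₂ y₂ → 0ℚ ℚ.≤ α → 0ℚ ℚ.≤ β →
                  ℚ.∣ x₁ ∣ ℚ.≤ A → ℚ.∣ y₂ ∣ ℚ.≤ B →
                  ℚ.∣ x₁ ℚ.- x₂ ∣ ℚ.≤ β → ℚ.∣ y₁ ℚ.- y₂ ∣ ℚ.≤ α →
                  ℚ.∣ x₁ ℚ.* y₁ ℚ.- x₂ ℚ.* y₂ ∣ ℚ.≤ A ℚ.* α ℚ.+ B ℚ.* β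
  product-close {A} {B} {α} {β} x₁ y₁ x₂ y₂ 0≤α 0≤β x₁≤A y₂≤B dx dy = begin
    ℚ.∣ x₁ ℚ.* y₁ ℚ.- x₂ ℚ.* y₂ ∣
      ≡⟨ cong ℚ.∣_∣ (solve 4 (λ x₁ y₁ x₂ y₂ → x₁ :* y₁ :- x₂ :* y₂ := x₁ :* (y₁ :- y₂) :+ y₂ :* (x₁ :- x₂)) refl x₁ y₁ x₂ y₂) ⟩
    ℚ.∣ x₁ ℚ.* (y₁ ℚ.- y₂) ℚ.+ y₂ ℚ.* (x₁ ℚ.- x₂) ∣
      ≤⟨ ℚ.∣p+q∣≤∣p∣+∣q∣ (x₁ ℚ.* (y₁ ℚ.- y₂)) (y₂ ℚ.* (x₁ ℚ.- x₂)) ⟩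
    ℚ.∣ x₁ ℚ.* (y₁ ℚ.- y₂) ∣ ℚ.+ ℚ.∣ y₂ ℚ.* (x₁ ℚ.- x₂) ∣
      ≡⟨ cong₂ ℚ._+_ (ℚ.∣p*q∣≡∣p∣*∣q∣ x₁ (y₁ ℚ.- y₂)) (ℚ.∣p*q∣≡∣p∣*∣q∣ y₂ (x₁ ℚ.- x₂)) ⟩
    ℚ.∣ x₁ ∣ ℚ.* ℚ.∣ y₁ ℚ.- y₂ ∣ ℚ.+ ℚ.∣ y₂ ∣ ℚ.* ℚ.∣ x₁ ℚ.- x₂ ∣
      ≤⟨ ℚ.+-mono-≤ (*-mono-≤ (ℚ.0≤∣p∣ x₁) 0≤α x₁≤A dy) (*-mono-≤ (ℚ.0≤∣p∣ y₂) 0≤β y₂≤B dx) ⟩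
    A ℚ.* α ℚ.+ B ℚ.* β ∎

  cauchy-* : ∀ x y → Cauchy λ n → seq x n ℚ.* seq y n
  cauchy-* x y ε 0<ε = N , λ m n N≤m N≤n → subst (_ ℚ.≤_) sum≡ε
    (product-close (seq x m) (seq y m) (seq x n) (seq y n) (ℚ.<⇒≤ 0<α) (ℚ.<⇒≤ 0<β)
      (proj₂ (proj₂ (proj₂ bx)) m (≤₁ N≤m)) (proj₂ (proj₂ (proj₂ by)) n (≤₂ N≤n))
      (proj₂ cx m n (≤₃ N≤m) (≤₃ N≤n)) (proj₂ cy m n (≤₄ N≤m) (≤₄ N≤n)))
    where
    bx = bounded x
    by = bounded y
    sx = shrink (ℚ.<-≤-trans 0<1 (proj₁ (proj₂ bx))) (0<half 0<ε)
    sy = shrink (ℚ.<-≤-trans 0<1 (proj₁ (proj₂ by))) (0<half 0<ε)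
    α = proj₁ sx
    β = proj₁ sy
    0<α = proj₁ (proj₂ sx)
    0<β = proj₁ (proj₂ sy)
    cx = cauchy x β 0<β
    cy = cauchy y α 0<α
    N₁ = proj₁ (proj₂ (proj₂ bx))
    N₂ = proj₁ (proj₂ (proj₂ by))
    N₃ = proj₁ cx
    N₄ = proj₁ cy
    N = (N₁ ℕ.⊔ N₂) ℕ.⊔ (N₃ ℕ.⊔ N₄)
    ≤₁ : ∀ {n} → N ℕ.≤ n → N₁ ℕ.≤ n
    ≤₁ N≤n = ℕ.m⊔n≤o⇒m≤o N₁ N₂ (ℕ.m⊔n≤o⇒m≤o (N₁ ℕ.⊔ N₂) (N₃ ℕ.⊔ N₄) N≤n)
    ≤₂ : ∀ {n} → N ℕ.≤ n → N₂ ℕ.≤ n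
    ≤₂ N≤n = ℕ.m⊔n≤o⇒n≤o N₁ N₂ (ℕ.m⊔n≤o⇒m≤o (N₁ ℕ.⊔ N₂) (N₃ ℕ.⊔ N₄) N≤n)
    ≤₃ : ∀ {n} → N ℕ.≤ n → N₃ ℕ.≤ n
    ≤₃ N≤n = ℕ.m⊔n≤o⇒m≤o N₃ N₄ (ℕ.m⊔n≤o⇒n≤o (N₁ ℕ.⊔ N₂) (N₃ ℕ.⊔ N₄) N≤n)
    ≤₄ : ∀ {n} → N ℕ.≤ n → N₄ ℕ.≤ n
    ≤₄ N≤n = ℕ.m⊔n≤o⇒n≤o N₃ N₄ (ℕ.m⊔n≤o⇒n≤o (N₁ ℕ.⊔ N₂) (N₃ ℕ.⊔ N₄) N≤n)
    sum≡ε : proj₁ bx ℚ.* α ℚ.+ proj₁ by ℚ.* β ≡ ε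
    sum≡ε = trans (cong₂ ℚ._+_ (proj₂ (proj₂ sx)) (proj₂ (proj₂ sy))) (half ε)

  -- | 1/a - 1/b | = | b - a | / (a b) ≤ | b - a | / δ².
  cauchy-recip : ∀ x → 0ℝ < x → Cauchy λ n → recip (seq x n)
  cauchy-recip x (δ , 0<δ , M , δ≤) ε 0<ε with cauchy x (δ ℚ.* (δ ℚ.* ε)) (0<* 0<δ (0<* 0<δ 0<ε))
  ... | N , c = M ℕ.⊔ N , λ m n p q →
    recip-bound (positive m (ℕ.m⊔n≤o⇒m≤o M N p)) (positive n (ℕ.m⊔n≤o⇒m≤o M N q))
      (c m n (ℕ.m⊔n≤o⇒n≤o M N p) (ℕ.m⊔n≤o⇒n≤o M N q))
    where
    positive : ∀ n → M ℕ.≤ n → δ ℚ.≤ seq x n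
    positive n M≤n = subst (ℚ._≤ seq x n) (ℚ.+-identityˡ δ) (δ≤ n M≤n)

    recip-bound : ∀ {p q} → δ ℚ.≤ p → δ ℚ.≤ q → ℚ.∣ p ℚ.- q ∣ ℚ.≤ δ ℚ.* (δ ℚ.* ε) →
                  ℚ.∣ recip p ℚ.- recip q ∣ ℚ.≤ ε
    recip-bound {p} {q} δ≤p δ≤q close = *-cancelˡ-≤ 0<δ (*-cancelˡ-≤ 0<δ (begin
      δ ℚ.* (δ ℚ.* d)                                       ≤⟨ *-mono-≤ (ℚ.<⇒≤ 0<δ) (0≤* 0≤q (ℚ.0≤∣p∣ (p′ ℚ.- q′))) δ≤p (*-monoʳ-≤ (ℚ.0≤∣p∣ (p′ ℚ.- q′)) δ≤q) ⟩
      p ℚ.* (q ℚ.* d)                                       ≡⟨ cong₂ (λ a b → a ℚ.* (b ℚ.* d)) (sym (ℚ.0≤p⇒∣p∣≡p 0≤p)) (sym (ℚ.0≤p⇒∣p∣≡p 0≤q)) ⟩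
      ℚ.∣ p ∣ ℚ.* (ℚ.∣ q ∣ ℚ.* ℚ.∣ p′ ℚ.- q′ ∣)             ≡⟨ cong (ℚ.∣ p ∣ ℚ.*_) (sym (ℚ.∣p*q∣≡∣p∣*∣q∣ q (p′ ℚ.- q′))) ⟩
      ℚ.∣ p ∣ ℚ.* ℚ.∣ q ℚ.* (p′ ℚ.- q′) ∣                   ≡⟨ sym (ℚ.∣p*q∣≡∣p∣*∣q∣ p (q ℚ.* (p′ ℚ.- q′))) ⟩
      ℚ.∣ p ℚ.* (q ℚ.* (p′ ℚ.- q′)) ∣                       ≡⟨ cong ℚ.∣_∣ (solve 4 (λ p q p′ q′ → p :* (q :* (p′ :- q′)) := q :* (p :* p′) :- p :* (q :* q′)) refl p q p′ q′) ⟩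
      ℚ.∣ q ℚ.* (p ℚ.* p′) ℚ.- p ℚ.* (q ℚ.* q′) ∣           ≡⟨ cong₂ (λ a b → ℚ.∣ q ℚ.* a ℚ.- p ℚ.* b ∣) (recip-inverse (>⇒≢ 0<p)) (recip-inverse (>⇒≢ 0<q)) ⟩
      ℚ.∣ q ℚ.* 1ℚ ℚ.- p ℚ.* 1ℚ ∣                           ≡⟨ cong₂ (λ a b → ℚ.∣ a ℚ.- b ∣) (ℚ.*-identityʳ q) (ℚ.*-identityʳ p) ⟩
      ℚ.∣ q ℚ.- p ∣                                         ≡⟨ ∣p-q∣≡∣q-p∣ q p ⟩
      ℚ.∣ p ℚ.- q ∣                                         ≤⟨ close ⟩
      δ ℚ.* (δ ℚ.* ε)                                       ∎))
      where
      p′ = recip p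
      q′ = recip q
      d = ℚ.∣ p′ ℚ.- q′ ∣
      0<p = ℚ.<-≤-trans 0<δ δ≤p
      0<q = ℚ.<-≤-trans 0<δ δ≤q
      0≤p = ℚ.<⇒≤ 0<p
      0≤q = ℚ.<⇒≤ 0<q

open ℝ-Lemmas

infixl 6 _+_ _-_
infixl 7 _*_
infix  8 -_

_+_ : ℝ → ℝ → ℝ
x + y = mkℝ (λ n → seq x n ℚ.+ seq y n) (cauchy-+ x y)

-_ : ℝ → ℝ
- x = mkℝ (λ n → ℚ.- seq x n) (cauchy-neg x)

_-_ : ℝ → ℝ → ℝ
x - y = x + - y

_*_ : ℝ → ℝ → ℝ
x * y = mkℝ (λ n → seq x n ℚ.* seq y n) (cauchy-* x y)

∣_∣ : ℝ → ℝ
∣ x ∣ = mkℝ (λ n → ℚ.∣ seq x n ∣) (cauchy-∣∣ x)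

inverse : (x : ℝ) → 0ℝ < x → ℝ
inverse x 0<x = mkℝ (λ n → recip (seq x n)) (cauchy-recip x 0<x)

infix 4 _⟶_

_⟶_ : (ℕ → ℝ) → ℝ → Set
f ⟶ l = ∀ ε → 0ℚ ℚ.< ε → Eventually λ n → ∣ f n - l ∣ ≤ fromℚ ε

∑< : ℕ → (ℕ → ℝ) → ℝ
∑< zero    a = 0ℝ
∑< (suc n) a = ∑< n a + a n

-- The ratio test, uniformly in the rational approximations of the terms.
record RatioTest (a : ℕ → ℝ) : Set where
  field
    ratio   : ℚ
    0≤ratio : 0ℚ ℚ.≤ ratio
    ratio<1 : ratio ℚ.< 1ℚ
    onset   : ℕ
    decay   : ∀ i j → onset ℕ.≤ i → onset ℕ.≤ j →
              ℚ.∣ seq (a (suc i)) j ∣ ℚ.≤ ratio ℚ.* ℚ.∣ seq (a i) j ∣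

module Series {a : ℕ → ℝ} (r : RatioTest a) where

  open RatioTest r

  gap : ℚ
  gap = 1ℚ ℚ.- ratio

  0<gap : 0ℚ ℚ.< gap
  0<gap = subst (ℚ._< gap) (ℚ.+-inverseʳ ratio) (ℚ.+-monoˡ-< (ℚ.- ratio) ratio<1)

  S : ℕ → ℕ → ℚ
  S n j = seq (∑< n a) j

  t : ℕ → ℕ → ℚ
  t n j = ℚ.∣ seq (a n) j ∣

  tail : ∀ k m j → onset ℕ.≤ m → onset ℕ.≤ j →
         gap ℚ.* ℚ.∣ S (k ℕ.+ m) j ℚ.- S m j ∣ ℚ.≤ t m j
  tail zero m j _ _ = begin
    gap ℚ.* ℚ.∣ S m j ℚ.- S m j ∣  ≡⟨ cong (λ z → gap ℚ.* ℚ.∣ z ∣) (ℚ.+-inverseʳ (S m j)) ⟩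
    gap ℚ.* 0ℚ                     ≡⟨ ℚ.*-zeroʳ gap ⟩
    0ℚ                             ≤⟨ ℚ.0≤∣p∣ (seq (a m) j) ⟩
    t m j                          ∎
  tail (suc k) m j s≤m s≤j = begin
    gap ℚ.* ℚ.∣ S (suc k ℕ.+ m) j ℚ.- S m j ∣
      ≡⟨ cong (λ l → gap ℚ.* ℚ.∣ S l j ℚ.- S m j ∣) (sym (ℕ.+-suc k m)) ⟩
    gap ℚ.* ℚ.∣ S (k ℕ.+ suc m) j ℚ.- S m j ∣
      ≤⟨ *-monoˡ-≤ (ℚ.<⇒≤ 0<gap) (triangle (S (k ℕ.+ suc m) j) (S (suc m) j) (S m j)) ⟩
    gap ℚ.* (A ℚ.+ ℚ.∣ S m j ℚ.+ seq (a m) j ℚ.- S m j ∣)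
      ≡⟨ cong (λ z → gap ℚ.* (A ℚ.+ ℚ.∣ z ∣)) (solve 2 (λ u v → u :+ v :- u := v) refl (S m j) (seq (a m) j)) ⟩
    gap ℚ.* (A ℚ.+ t m j)
      ≡⟨ ℚ.*-distribˡ-+ gap A (t m j) ⟩
    gap ℚ.* A ℚ.+ gap ℚ.* t m j
      ≤⟨ ℚ.+-monoˡ-≤ _ (ℚ.≤-trans (tail k (suc m) j (ℕ.m≤n⇒m≤1+n s≤m) s≤j) (decay m j s≤m s≤j)) ⟩
    ratio ℚ.* t m j ℚ.+ gap ℚ.* t m j
      ≡⟨ solve 3 (λ q o u → q :* u :+ (o :- q) :* u := o :* u) refl ratio 1ℚ (t m j) ⟩
    1ℚ ℚ.* t m j
      ≡⟨ ℚ.*-identityˡ (t m j) ⟩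
    t m j ∎
    where A = ℚ.∣ S (k ℕ.+ suc m) j ℚ.- S (suc m) j ∣

  -- Bernoulli: ratio ^ k * (1 + k gap) ≤ 1.
  geometric : ∀ k j → onset ℕ.≤ j →
              t (k ℕ.+ onset) j ℚ.* (1ℚ ℚ.+ fromℕℚ k ℚ.* gap) ℚ.≤ t onset j
  geometric zero j _ = ℚ.≤-reflexive
    (trans (cong (λ z → t onset j ℚ.* (1ℚ ℚ.+ z)) (ℚ.*-zeroˡ gap))
      (trans (cong (t onset j ℚ.*_) (ℚ.+-identityʳ 1ℚ)) (ℚ.*-identityʳ (t onset j))))
  geometric (suc k) j s≤j = begin
    t (suc k ℕ.+ onset) j ℚ.* (1ℚ ℚ.+ fromℕℚ (suc k) ℚ.* gap)
      ≡⟨ cong (λ z → t (suc k ℕ.+ onset) j ℚ.* (1ℚ ℚ.+ z ℚ.* gap)) (fromℕℚ-suc k) ⟩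
    t (suc k ℕ.+ onset) j ℚ.* (1ℚ ℚ.+ (1ℚ ℚ.+ fromℕℚ k) ℚ.* gap)
      ≤⟨ *-monoʳ-≤ 0≤w′ (decay (k ℕ.+ onset) j (ℕ.m≤n+m onset k) s≤j) ⟩
    ratio ℚ.* t (k ℕ.+ onset) j ℚ.* (1ℚ ℚ.+ (1ℚ ℚ.+ fromℕℚ k) ℚ.* gap)
      ≡⟨ cong (λ z → z ℚ.* t (k ℕ.+ onset) j ℚ.* (1ℚ ℚ.+ (1ℚ ℚ.+ fromℕℚ k) ℚ.* gap))
           (solve 2 (λ q o → q := o :- (o :- q)) refl ratio 1ℚ) ⟩
    (1ℚ ℚ.- gap) ℚ.* t (k ℕ.+ onset) j ℚ.* (1ℚ ℚ.+ (1ℚ ℚ.+ fromℕℚ k) ℚ.* gap)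
      ≡⟨ solve 3 (λ g u f → (con 1ℚ :- g) :* u :* (con 1ℚ :+ (con 1ℚ :+ f) :* g)
                         := u :* (con 1ℚ :+ f :* g) :- u :* ((con 1ℚ :+ f) :* (g :* g))) refl gap (t (k ℕ.+ onset) j) (fromℕℚ k) ⟩
    t (k ℕ.+ onset) j ℚ.* w ℚ.- e
      ≤⟨ ℚ.+-monoʳ-≤ (t (k ℕ.+ onset) j ℚ.* w) (ℚ.neg-antimono-≤ 0≤e) ⟩
    t (k ℕ.+ onset) j ℚ.* w ℚ.+ 0ℚ
      ≡⟨ ℚ.+-identityʳ _ ⟩
    t (k ℕ.+ onset) j ℚ.* w
      ≤⟨ geometric k j s≤j ⟩
    t onset j ∎
    where
    w = 1ℚ ℚ.+ fromℕℚ k ℚ.* gap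
    0≤1+k : 0ℚ ℚ.≤ 1ℚ ℚ.+ fromℕℚ k
    0≤1+k = ℚ.+-mono-≤ 0≤1 (0≤fromℕℚ k)
    0≤w′ : 0ℚ ℚ.≤ 1ℚ ℚ.+ (1ℚ ℚ.+ fromℕℚ k) ℚ.* gap
    0≤w′ = ℚ.+-mono-≤ 0≤1 (0≤* 0≤1+k (ℚ.<⇒≤ 0<gap))
    e = t (k ℕ.+ onset) j ℚ.* ((1ℚ ℚ.+ fromℕℚ k) ℚ.* (gap ℚ.* gap))
    0≤e : 0ℚ ℚ.≤ e
    0≤e = 0≤* (ℚ.0≤∣p∣ (seq (a (k ℕ.+ onset)) j)) (0≤* 0≤1+k (0≤* (ℚ.<⇒≤ 0<gap) (ℚ.<⇒≤ 0<gap)))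

  uniform : ∀ η → 0ℚ ℚ.< η → ∃ λ M → ∃ λ N → ∀ n j → M ℕ.≤ n → N ℕ.≤ j →
            ℚ.∣ S n j ℚ.- S M j ∣ ℚ.≤ η
  uniform η 0<η = N₀ , N , bound
    where
    b = bounded (a onset)
    M = proj₁ b
    J = proj₁ (proj₂ (proj₂ b))
    0<M = ℚ.<-≤-trans 0<1 (proj₁ (proj₂ b))
    d = shrink 0<M (0<* 0<gap (0<* 0<gap 0<η))
    δ = proj₁ d
    arch = archimedean (proj₁ (proj₂ d))
    K = proj₁ arch
    N₀ = K ℕ.+ onset
    N = J ℕ.⊔ N₀
    w = 1ℚ ℚ.+ fromℕℚ K ℚ.* gap
    0<w : 0ℚ ℚ.< w
    0<w = ℚ.+-mono-<-≤ 0<1 (0≤* (0≤fromℕℚ K) (ℚ.<⇒≤ 0<gap))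
    M≤ : M ℚ.≤ w ℚ.* (gap ℚ.* η)
    M≤ = begin
      M                                        ≡⟨ sym (ℚ.*-identityʳ M) ⟩
      M ℚ.* 1ℚ                                 ≤⟨ *-monoˡ-≤ (ℚ.<⇒≤ 0<M) (proj₂ arch) ⟩
      M ℚ.* (fromℕℚ K ℚ.* δ)                   ≡⟨ solve 3 (λ M K δ → M :* (K :* δ) := K :* (M :* δ)) refl M (fromℕℚ K) δ ⟩
      fromℕℚ K ℚ.* (M ℚ.* δ)                   ≡⟨ cong (fromℕℚ K ℚ.*_) (proj₂ (proj₂ d)) ⟩
      fromℕℚ K ℚ.* (gap ℚ.* (gap ℚ.* η))       ≡⟨ sym (ℚ.*-assoc (fromℕℚ K) gap (gap ℚ.* η)) ⟩
      fromℕℚ K ℚ.* gap ℚ.* (gap ℚ.* η)         ≤⟨ *-monoʳ-≤ (0≤* (ℚ.<⇒≤ 0<gap) (ℚ.<⇒≤ 0<η)) Kg≤w ⟩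
      w ℚ.* (gap ℚ.* η)                        ∎
      where
      Kg≤w : fromℕℚ K ℚ.* gap ℚ.≤ w
      Kg≤w = subst (ℚ._≤ w) (ℚ.+-identityˡ (fromℕℚ K ℚ.* gap)) (ℚ.+-monoˡ-≤ (fromℕℚ K ℚ.* gap) 0≤1)
    small : ∀ j → N ℕ.≤ j → t N₀ j ℚ.≤ gap ℚ.* η
    small j N≤j = *-cancelˡ-≤ 0<w (begin
      w ℚ.* t N₀ j                ≡⟨ ℚ.*-comm w (t N₀ j) ⟩
      t N₀ j ℚ.* w                ≤⟨ geometric K j (ℕ.≤-trans (ℕ.m≤n+m onset K) (ℕ.m⊔n≤o⇒n≤o J N₀ N≤j)) ⟩
      t onset j                   ≤⟨ proj₂ (proj₂ (proj₂ b)) j (ℕ.m⊔n≤o⇒m≤o J N₀ N≤j) ⟩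
      M                           ≤⟨ M≤ ⟩
      w ℚ.* (gap ℚ.* η)           ∎)
    bound : ∀ n j → N₀ ℕ.≤ n → N ℕ.≤ j → ℚ.∣ S n j ℚ.- S N₀ j ∣ ℚ.≤ η
    bound n j N₀≤n N≤j = *-cancelˡ-≤ 0<gap (begin
      gap ℚ.* ℚ.∣ S n j ℚ.- S N₀ j ∣
        ≡⟨ cong (λ l → gap ℚ.* ℚ.∣ S l j ℚ.- S N₀ j ∣) (sym (ℕ.m∸n+n≡m N₀≤n)) ⟩
      gap ℚ.* ℚ.∣ S (n ℕ.∸ N₀ ℕ.+ N₀) j ℚ.- S N₀ j ∣
        ≤⟨ tail (n ℕ.∸ N₀) N₀ j (ℕ.m≤n+m onset K) (ℕ.≤-trans (ℕ.m≤n+m onset K) (ℕ.m⊔n≤o⇒n≤o J N₀ N≤j)) ⟩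
      t N₀ j
        ≤⟨ small j N≤j ⟩
      gap ℚ.* η ∎)

  diagonal-cauchy : Cauchy λ n → S n n
  diagonal-cauchy ε 0<ε = N , bound
    where
    u = uniform (½ ℚ.* (½ ℚ.* ε)) (0<half (0<half 0<ε))
    M = proj₁ u
    J = proj₁ (proj₂ u)
    c = cauchy (∑< M a) (½ ℚ.* ε) (0<half 0<ε)
    N = (M ℕ.⊔ J) ℕ.⊔ proj₁ c
    near : ∀ n → N ℕ.≤ n → ℚ.∣ S n n ℚ.- S M n ∣ ℚ.≤ ½ ℚ.* (½ ℚ.* ε)
    near n N≤n = proj₂ (proj₂ u) n n (ℕ.m⊔n≤o⇒m≤o M J M⊔J≤n) (ℕ.m⊔n≤o⇒n≤o M J M⊔J≤n)
      where M⊔J≤n = ℕ.m⊔n≤o⇒m≤o (M ℕ.⊔ J) (proj₁ c) N≤n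
    bound : ∀ m n → N ℕ.≤ m → N ℕ.≤ n → ℚ.∣ S m m ℚ.- S n n ∣ ℚ.≤ ε
    bound m n N≤m N≤n = begin
      ℚ.∣ S m m ℚ.- S n n ∣
        ≤⟨ triangle (S m m) (S M m) (S n n) ⟩
      ℚ.∣ S m m ℚ.- S M m ∣ ℚ.+ ℚ.∣ S M m ℚ.- S n n ∣
        ≤⟨ ℚ.+-mono-≤ (near m N≤m) (triangle (S M m) (S M n) (S n n)) ⟩
      η ℚ.+ (ℚ.∣ S M m ℚ.- S M n ∣ ℚ.+ ℚ.∣ S M n ℚ.- S n n ∣)
        ≡⟨ cong (λ z → η ℚ.+ (ℚ.∣ S M m ℚ.- S M n ∣ ℚ.+ z)) (∣p-q∣≡∣q-p∣ (S M n) (S n n)) ⟩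
      η ℚ.+ (ℚ.∣ S M m ℚ.- S M n ∣ ℚ.+ ℚ.∣ S n n ℚ.- S M n ∣)
        ≤⟨ ℚ.+-monoʳ-≤ η (ℚ.+-mono-≤ (proj₂ c m n (ℕ.m⊔n≤o⇒n≤o (M ℕ.⊔ J) (proj₁ c) N≤m) (ℕ.m⊔n≤o⇒n≤o (M ℕ.⊔ J) (proj₁ c) N≤n)) (near n N≤n)) ⟩
      η ℚ.+ (½ ℚ.* ε ℚ.+ η)
        ≡⟨ solve 2 (λ η h → η :+ (h :+ η) := (η :+ η) :+ h) refl η (½ ℚ.* ε) ⟩
      (η ℚ.+ η) ℚ.+ ½ ℚ.* ε
        ≡⟨ cong (ℚ._+ ½ ℚ.* ε) (half (½ ℚ.* ε)) ⟩
      ½ ℚ.* ε ℚ.+ ½ ℚ.* ε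
        ≡⟨ half ε ⟩
      ε ∎
      where η = ½ ℚ.* (½ ℚ.* ε)

-- The sum of a series passing the ratio test, as the diagonal of its partial
-- sums; ∑∞-converges shows that it is their limit.
∑∞ : (a : ℕ → ℝ) → RatioTest a → ℝ
∑∞ a r = mkℝ (λ n → seq (∑< n a) n) (Series.diagonal-cauchy r)

∑∞-converges : ∀ {a} (r : RatioTest a) → (λ n → ∑< n a) ⟶ ∑∞ a r
∑∞-converges {a} r ε 0<ε = M , λ n M≤n δ 0<δ → N ℕ.⊔ M , λ j p → begin
    ℚ.∣ S n j ℚ.- S j j ∣
      ≤⟨ triangle (S n j) (S M j) (S j j) ⟩
    ℚ.∣ S n j ℚ.- S M j ∣ ℚ.+ ℚ.∣ S M j ℚ.- S j j ∣
      ≡⟨ cong (ℚ.∣ S n j ℚ.- S M j ∣ ℚ.+_) (∣p-q∣≡∣q-p∣ (S M j) (S j j)) ⟩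
    ℚ.∣ S n j ℚ.- S M j ∣ ℚ.+ ℚ.∣ S j j ℚ.- S M j ∣
      ≤⟨ ℚ.+-mono-≤ (proj₂ (proj₂ u) n j M≤n (ℕ.m⊔n≤o⇒m≤o N M p))
                    (proj₂ (proj₂ u) j j (ℕ.m⊔n≤o⇒n≤o N M p) (ℕ.m⊔n≤o⇒m≤o N M p)) ⟩
    ½ ℚ.* ε ℚ.+ ½ ℚ.* ε
      ≡⟨ half ε ⟩
    ε
      ≡⟨ sym (ℚ.+-identityʳ ε) ⟩
    ε ℚ.+ 0ℚ
      ≤⟨ ℚ.+-monoʳ-≤ ε (ℚ.<⇒≤ 0<δ) ⟩
    ε ℚ.+ δ ∎
  where
  open Series r
  u = uniform (½ ℚ.* ε) (0<half 0<ε)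
  M = proj₁ u
  N = proj₁ (proj₂ u)

expTerm : ℝ → ℕ → ℝ
expTerm x zero    = 1ℝ
expTerm x (suc i) = expTerm x i * (x * fromℚ (recip (fromℕℚ (suc i))))

expTerm-ratio : ∀ x → RatioTest (expTerm x)
expTerm-ratio x = record
  { ratio   = ½
  ; 0≤ratio = ℚ.<⇒≤ 0<½
  ; ratio<1 = ℚ.*<* (ℤ.+<+ (ℕ.s≤s (ℕ.s≤s ℕ.z≤n)))
  ; onset   = N
  ; decay   = λ i j N≤i N≤j → begin
      ℚ.∣ T i j ℚ.* (seq x j ℚ.* r i) ∣
        ≡⟨ ℚ.∣p*q∣≡∣p∣*∣q∣ (T i j) (seq x j ℚ.* r i) ⟩
      ℚ.∣ T i j ∣ ℚ.* ℚ.∣ seq x j ℚ.* r i ∣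
        ≡⟨ cong (ℚ.∣ T i j ∣ ℚ.*_) (trans (ℚ.∣p*q∣≡∣p∣*∣q∣ (seq x j) (r i)) (cong (ℚ.∣ seq x j ∣ ℚ.*_) (∣recip∣ i))) ⟩
      ℚ.∣ T i j ∣ ℚ.* (ℚ.∣ seq x j ∣ ℚ.* r i)
        ≤⟨ *-monoˡ-≤ (ℚ.0≤∣p∣ (T i j)) (*-mono-≤ (ℚ.0≤∣p∣ (seq x j)) (ℚ.<⇒≤ 0<δ)
             (proj₂ (proj₂ (proj₂ b)) j (ℕ.m⊔n≤o⇒m≤o J K N≤j)) (proj₂ a i (ℕ.m⊔n≤o⇒n≤o J K N≤i))) ⟩
      ℚ.∣ T i j ∣ ℚ.* (proj₁ b ℚ.* proj₁ d)
        ≡⟨ cong (ℚ.∣ T i j ∣ ℚ.*_) (proj₂ (proj₂ d)) ⟩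
      ℚ.∣ T i j ∣ ℚ.* ½
        ≡⟨ ℚ.*-comm ℚ.∣ T i j ∣ ½ ⟩
      ½ ℚ.* ℚ.∣ T i j ∣ ∎
  }
  where
  T : ℕ → ℕ → ℚ
  T i j = seq (expTerm x i) j
  r : ℕ → ℚ
  r i = recip (fromℕℚ (suc i))
  b = bounded x
  d = shrink (ℚ.<-≤-trans 0<1 (proj₁ (proj₂ b))) 0<½
  0<δ = proj₁ (proj₂ d)
  a = archimedean-recip 0<δ
  J = proj₁ (proj₂ (proj₂ b))
  K = proj₁ a
  N = J ℕ.⊔ K

exp : ℝ → ℝ
exp x = ∑∞ (expTerm x) (expTerm-ratio x)

oddPower : ℝ → ℕ → ℝ
oddPower z zero    = z
oddPower z (suc i) = oddPower z i * (z * z)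

-- The terms of artanh z = z + z³/3 + z⁵/5 + …
artanhTerm : ℝ → ℕ → ℝ
artanhTerm z i = oddPower z i * fromℚ (recip (fromℕℚ (suc (2 ℕ.* i))))

artanhTerm-ratio : ∀ z ρ → 0ℚ ℚ.≤ ρ → ρ ℚ.< 1ℚ →
                   Eventually (λ j → ℚ.∣ seq z j ∣ ℚ.≤ ρ) → RatioTest (artanhTerm z)
artanhTerm-ratio z ρ 0≤ρ ρ<1 (N , z≤ρ) = record
  { ratio   = ρ
  ; 0≤ratio = 0≤ρ
  ; ratio<1 = ρ<1
  ; onset   = N
  ; decay   = λ i j _ N≤j → begin
      ℚ.∣ T i j ℚ.* (seq z j ℚ.* seq z j) ℚ.* r (suc i) ∣
        ≡⟨ ℚ.∣p*q∣≡∣p∣*∣q∣ (T i j ℚ.* (seq z j ℚ.* seq z j)) (r (suc i)) ⟩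
      ℚ.∣ T i j ℚ.* (seq z j ℚ.* seq z j) ∣ ℚ.* ℚ.∣ r (suc i) ∣
        ≡⟨ cong₂ ℚ._*_ (trans (ℚ.∣p*q∣≡∣p∣*∣q∣ (T i j) (seq z j ℚ.* seq z j))
             (cong (ℚ.∣ T i j ∣ ℚ.*_) (ℚ.∣p*q∣≡∣p∣*∣q∣ (seq z j) (seq z j)))) (∣recip∣ (2 ℕ.* suc i)) ⟩
      ℚ.∣ T i j ∣ ℚ.* (ℚ.∣ seq z j ∣ ℚ.* ℚ.∣ seq z j ∣) ℚ.* r (suc i)
        ≤⟨ *-mono-≤ (0≤* (ℚ.0≤∣p∣ (T i j)) (0≤* (ℚ.0≤∣p∣ (seq z j)) (ℚ.0≤∣p∣ (seq z j)))) (0≤r i)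
             (*-monoˡ-≤ (ℚ.0≤∣p∣ (T i j)) (*-mono-≤ (ℚ.0≤∣p∣ (seq z j)) 0≤1 (z≤ρ j N≤j) (ℚ.≤-trans (z≤ρ j N≤j) (ℚ.<⇒≤ ρ<1))))
             (recip-antitone (0<fromℕℚ-suc (2 ℕ.* i))
               (fromℕℚ-mono {suc (2 ℕ.* i)} {suc (2 ℕ.* suc i)} (ℕ.s≤s (ℕ.*-monoʳ-≤ 2 (ℕ.n≤1+n i))))) ⟩
      ℚ.∣ T i j ∣ ℚ.* (ρ ℚ.* 1ℚ) ℚ.* r i
        ≡⟨ cong (λ q → ℚ.∣ T i j ∣ ℚ.* q ℚ.* r i) (ℚ.*-identityʳ ρ) ⟩
      ℚ.∣ T i j ∣ ℚ.* ρ ℚ.* r i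
        ≡⟨ solve 3 (λ t q r → t :* q :* r := q :* (t :* r)) refl ℚ.∣ T i j ∣ ρ (r i) ⟩
      ρ ℚ.* (ℚ.∣ T i j ∣ ℚ.* r i)
        ≡⟨ cong (ρ ℚ.*_) (trans (cong (ℚ.∣ T i j ∣ ℚ.*_) (sym (∣recip∣ (2 ℕ.* i)))) (sym (ℚ.∣p*q∣≡∣p∣*∣q∣ (T i j) (r i)))) ⟩
      ρ ℚ.* ℚ.∣ T i j ℚ.* r i ∣ ∎
  }
  where
  T : ℕ → ℕ → ℚ
  T i j = seq (oddPower z i) j
  r : ℕ → ℚ
  r i = recip (fromℕℚ (suc (2 ℕ.* i)))
  0≤r : ∀ i → 0ℚ ℚ.≤ r i
  0≤r i = ℚ.<⇒≤ (0<recip (0<fromℕℚ-suc (2 ℕ.* i)))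

0<x⇒0<x+1 : ∀ {x} → 0ℝ < x → 0ℝ < x + 1ℝ
0<x⇒0<x+1 {x} (δ , 0<δ , N , δ≤) = δ , 0<δ , N , λ n N≤n → begin
  0ℚ ℚ.+ δ          ≤⟨ δ≤ n N≤n ⟩
  seq x n           ≡⟨ sym (ℚ.+-identityʳ (seq x n)) ⟩
  seq x n ℚ.+ 0ℚ    ≤⟨ ℚ.+-monoʳ-≤ (seq x n) 0≤1 ⟩
  seq x n ℚ.+ 1ℚ    ∎

1<x⇒0<x : ∀ {x} → 1ℝ < x → 0ℝ < x
1<x⇒0<x (δ , 0<δ , N , δ≤) = δ , 0<δ , N , λ n N≤n →
  ℚ.≤-trans (ℚ.+-monoˡ-≤ δ 0≤1) (δ≤ n N≤n)

cayley : (x : ℝ) → 0ℝ < x → ℝ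
cayley x 0<x = (x - 1ℝ) * inverse (x + 1ℝ) (0<x⇒0<x+1 {x} 0<x)

cayley-ratio : ∀ x 0<x → RatioTest (artanhTerm (cayley x 0<x))
cayley-ratio x 0<x@(ε , 0<ε , K , ε≤) =
  artanhTerm-ratio (cayley x 0<x) ρ 0≤ρ ρ<1 (J ℕ.⊔ K , bound)
  where
  b = bounded x
  B = proj₁ b
  1≤B = proj₁ (proj₂ b)
  J = proj₁ (proj₂ (proj₂ b))
  δ = ε ℚ.⊓ 1ℚ
  0<δ : 0ℚ ℚ.< δ
  0<δ with ℚ.⊓-sel ε 1ℚ
  ... | inj₁ eq = subst (0ℚ ℚ.<_) (sym eq) 0<ε
  ... | inj₂ eq = subst (0ℚ ℚ.<_) (sym eq) 0<1
  d = shrink (ℚ.<-≤-trans 0<1 1≤B) 0<δ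
  s = proj₁ d
  0<s = proj₁ (proj₂ d)
  Bs≡δ = proj₂ (proj₂ d)
  s≤δ : s ℚ.≤ δ
  s≤δ = subst₂ ℚ._≤_ (ℚ.*-identityˡ s) Bs≡δ (*-monoʳ-≤ (ℚ.<⇒≤ 0<s) 1≤B)
  s≤1 : s ℚ.≤ 1ℚ
  s≤1 = ℚ.≤-trans s≤δ (ℚ.p⊓q≤q ε 1ℚ)
  ρ = 1ℚ ℚ.- s
  0≤ρ : 0ℚ ℚ.≤ ρ
  0≤ρ = subst (ℚ._≤ ρ) (ℚ.+-inverseʳ s) (ℚ.+-monoˡ-≤ (ℚ.- s) s≤1)
  ρ<1 : ρ ℚ.< 1ℚ
  ρ<1 = subst (ρ ℚ.<_) (ℚ.+-identityʳ 1ℚ) (ℚ.+-monoʳ-< 1ℚ (ℚ.neg-antimono-< 0<s))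

  -- ∣ p - 1 ∣ ≤ (1 - s) (p + 1) when s ≤ δ ≤ p ≤ B and B s = δ ≤ 1.
  numerator : ∀ p → δ ℚ.≤ p → p ℚ.≤ B → ℚ.∣ p ℚ.- 1ℚ ∣ ℚ.≤ ρ ℚ.* (p ℚ.+ 1ℚ)
  numerator p δ≤p p≤B = ∣p∣≤
    (begin
      p ℚ.- 1ℚ                                  ≡⟨ solve 1 (λ p → p :- con 1ℚ := (p :+ con 1ℚ) :- (con 1ℚ :+ con 1ℚ)) refl p ⟩
      (p ℚ.+ 1ℚ) ℚ.- (1ℚ ℚ.+ 1ℚ)                ≤⟨ ℚ.+-monoʳ-≤ (p ℚ.+ 1ℚ) (ℚ.neg-antimono-≤ (ℚ.+-mono-≤ ps≤1 s≤1)) ⟩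
      (p ℚ.+ 1ℚ) ℚ.- (p ℚ.* s ℚ.+ s)            ≡⟨ factor ⟩
      ρ ℚ.* (p ℚ.+ 1ℚ)                          ∎)
    (begin
      ℚ.- (p ℚ.- 1ℚ)                            ≡⟨ solve 1 (λ p → :- (p :- con 1ℚ) := (p :+ con 1ℚ) :- (p :+ p)) refl p ⟩
      (p ℚ.+ 1ℚ) ℚ.- (p ℚ.+ p)                  ≤⟨ ℚ.+-monoʳ-≤ (p ℚ.+ 1ℚ) (ℚ.neg-antimono-≤ (ℚ.+-mono-≤ ps≤p (ℚ.≤-trans s≤δ δ≤p))) ⟩
      (p ℚ.+ 1ℚ) ℚ.- (p ℚ.* s ℚ.+ s)            ≡⟨ factor ⟩
      ρ ℚ.* (p ℚ.+ 1ℚ)                          ∎)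
    where
    factor : (p ℚ.+ 1ℚ) ℚ.- (p ℚ.* s ℚ.+ s) ≡ ρ ℚ.* (p ℚ.+ 1ℚ)
    factor = solve 2 (λ p s → (p :+ con 1ℚ) :- (p :* s :+ s) := (con 1ℚ :- s) :* (p :+ con 1ℚ)) refl p s
    0≤p : 0ℚ ℚ.≤ p
    0≤p = ℚ.≤-trans (ℚ.<⇒≤ 0<δ) δ≤p
    ps≤1 : p ℚ.* s ℚ.≤ 1ℚ
    ps≤1 = ℚ.≤-trans (*-monoʳ-≤ (ℚ.<⇒≤ 0<s) p≤B) (ℚ.≤-trans (ℚ.≤-reflexive Bs≡δ) (ℚ.p⊓q≤q ε 1ℚ))
    ps≤p : p ℚ.* s ℚ.≤ p
    ps≤p = subst (p ℚ.* s ℚ.≤_) (ℚ.*-identityʳ p) (*-monoˡ-≤ 0≤p s≤1)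

  quotient : ∀ p → δ ℚ.≤ p → p ℚ.≤ B → ℚ.∣ (p ℚ.- 1ℚ) ℚ.* recip (p ℚ.+ 1ℚ) ∣ ℚ.≤ ρ
  quotient p δ≤p p≤B = begin
    ℚ.∣ (p ℚ.- 1ℚ) ℚ.* recip (p ℚ.+ 1ℚ) ∣          ≡⟨ ℚ.∣p*q∣≡∣p∣*∣q∣ (p ℚ.- 1ℚ) (recip (p ℚ.+ 1ℚ)) ⟩
    ℚ.∣ p ℚ.- 1ℚ ∣ ℚ.* ℚ.∣ recip (p ℚ.+ 1ℚ) ∣      ≡⟨ cong (ℚ.∣ p ℚ.- 1ℚ ∣ ℚ.*_) (ℚ.0≤p⇒∣p∣≡p 0≤r) ⟩
    ℚ.∣ p ℚ.- 1ℚ ∣ ℚ.* recip (p ℚ.+ 1ℚ)            ≤⟨ *-monoʳ-≤ 0≤r (numerator p δ≤p p≤B) ⟩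
    ρ ℚ.* (p ℚ.+ 1ℚ) ℚ.* recip (p ℚ.+ 1ℚ)          ≡⟨ ℚ.*-assoc ρ (p ℚ.+ 1ℚ) (recip (p ℚ.+ 1ℚ)) ⟩
    ρ ℚ.* ((p ℚ.+ 1ℚ) ℚ.* recip (p ℚ.+ 1ℚ))        ≡⟨ cong (ρ ℚ.*_) (recip-inverse (>⇒≢ 0<p+1)) ⟩
    ρ ℚ.* 1ℚ                                       ≡⟨ ℚ.*-identityʳ ρ ⟩
    ρ                                              ∎
    where
    0<p+1 : 0ℚ ℚ.< p ℚ.+ 1ℚ
    0<p+1 = ℚ.+-mono-< (ℚ.<-≤-trans 0<δ δ≤p) 0<1
    0≤r = ℚ.<⇒≤ (0<recip 0<p+1)

  bound : ∀ j → J ℕ.⊔ K ℕ.≤ j → ℚ.∣ seq (cayley x 0<x) j ∣ ℚ.≤ ρ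
  bound j J⊔K≤j = quotient (seq x j)
    (ℚ.≤-trans (ℚ.p⊓q≤p ε 1ℚ) ε≤x)
    (ℚ.≤-trans (ℚ.≤-reflexive (sym (ℚ.0≤p⇒∣p∣≡p (ℚ.≤-trans (ℚ.<⇒≤ 0<ε) ε≤x))))
      (proj₂ (proj₂ (proj₂ b)) j (ℕ.m⊔n≤o⇒m≤o J K J⊔K≤j)))
    where
    ε≤x : ε ℚ.≤ seq x j
    ε≤x = subst (ℚ._≤ seq x j) (ℚ.+-identityˡ ε) (ε≤ j (ℕ.m⊔n≤o⇒n≤o J K J⊔K≤j))

-- From log x = 2 artanh ((x - 1) / (x + 1)).
log : (x : ℝ) → 0ℝ < x → ℝ
log x 0<x = fromℕ 2 * ∑∞ (artanhTerm (cayley x 0<x)) (cayley-ratio x 0<x)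

infixr 8 _^⟨_⟩_

_^⟨_⟩_ : (x : ℝ) → 0ℝ < x → ℚ → ℝ
x ^⟨ 0<x ⟩ q = exp (fromℚ q * log x 0<x)

artanh-lower : ∀ z ζ j → 0ℚ ℚ.≤ ζ → ζ ℚ.≤ seq z j → ∀ n → ζ ℚ.≤ seq (∑< (suc n) (artanhTerm z)) j
artanh-lower z ζ j 0≤ζ ζ≤z = lower
  where
  0≤z : 0ℚ ℚ.≤ seq z j
  0≤z = ℚ.≤-trans 0≤ζ ζ≤z

  0≤odd : ∀ i → 0ℚ ℚ.≤ seq (oddPower z i) j
  0≤odd zero    = 0≤z
  0≤odd (suc i) = 0≤* (0≤odd i) (0≤* 0≤z 0≤z)

  lower : ∀ n → ζ ℚ.≤ seq (∑< (suc n) (artanhTerm z)) j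
  lower zero    = ℚ.≤-trans ζ≤z (ℚ.≤-reflexive
    (sym (trans (ℚ.+-identityˡ _) (ℚ.*-identityʳ (seq z j)))))
  lower (suc n) = ℚ.≤-trans (ℚ.≤-reflexive (sym (ℚ.+-identityʳ ζ)))
    (ℚ.+-mono-≤ (lower n) (0≤* (0≤odd (suc n)) (ℚ.<⇒≤ (0<recip (0<fromℕℚ-suc (2 ℕ.* suc n))))))

log-positive : ∀ x (0<x : 0ℝ < x) → 1ℝ < x → 0ℝ < log x 0<x
log-positive x 0<x (δ , 0<δ , K , δ≤) =
  fromℕℚ 2 ℚ.* ζ , 0<* (0<fromℕℚ-suc 1) 0<ζ , suc (J ℕ.⊔ K) , bound
  where
  b = bounded x
  B = proj₁ b
  J = proj₁ (proj₂ (proj₂ b))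
  ζ = δ ℚ.* recip (B ℚ.+ 1ℚ)
  0<ζ : 0ℚ ℚ.< ζ
  0<ζ = 0<* 0<δ (0<recip (ℚ.+-mono-< (ℚ.<-≤-trans 0<1 (proj₁ (proj₂ b))) 0<1))

  quotient : ∀ p → 1ℚ ℚ.+ δ ℚ.≤ p → p ℚ.≤ B → ζ ℚ.≤ (p ℚ.- 1ℚ) ℚ.* recip (p ℚ.+ 1ℚ)
  quotient p 1+δ≤p p≤B = *-mono-≤ (ℚ.<⇒≤ 0<δ) (ℚ.<⇒≤ (0<recip 0<p+1)) δ≤p-1
    (recip-antitone 0<p+1 (ℚ.+-monoˡ-≤ 1ℚ p≤B))
    where
    δ≤p-1 : δ ℚ.≤ p ℚ.- 1ℚ
    δ≤p-1 = subst (ℚ._≤ p ℚ.- 1ℚ) (solve 2 (λ d o → o :+ d :- o := d) refl δ 1ℚ) (ℚ.+-monoˡ-≤ (ℚ.- 1ℚ) 1+δ≤p)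
    0<p+1 : 0ℚ ℚ.< p ℚ.+ 1ℚ
    0<p+1 = ℚ.+-mono-< (ℚ.<-≤-trans (ℚ.+-mono-< 0<1 0<δ) 1+δ≤p) 0<1

  bound : ∀ n → suc (J ℕ.⊔ K) ℕ.≤ n → 0ℚ ℚ.+ fromℕℚ 2 ℚ.* ζ ℚ.≤ seq (log x 0<x) n
  bound n@(suc m) p = ℚ.≤-trans (ℚ.≤-reflexive (ℚ.+-identityˡ (fromℕℚ 2 ℚ.* ζ)))
    (*-monoˡ-≤ (0≤fromℕℚ 2) (artanh-lower (cayley x 0<x) ζ n (ℚ.<⇒≤ 0<ζ)
      (quotient (seq x n) (δ≤ n (ℕ.m⊔n≤o⇒n≤o J K J⊔K≤n))
        (ℚ.≤-trans (p≤∣p∣ (seq x n)) (proj₂ (proj₂ (proj₂ b)) n (ℕ.m⊔n≤o⇒m≤o J K J⊔K≤n)))) m))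
    where
    J⊔K≤n : J ℕ.⊔ K ℕ.≤ n
    J⊔K≤n = ℕ.≤-trans (ℕ.n≤1+n (J ℕ.⊔ K)) p

alternating : ℕ → ℚ
alternating zero    = 1ℚ
alternating (suc i) = ℚ.- alternating i

-- 1 - 1/3 + 1/5 - … ± 1/(2 n - 1)
leibniz : ℕ → ℚ
leibniz zero    = 0ℚ
leibniz (suc n) = leibniz n ℚ.+ alternating n ℚ.* recip (fromℕℚ (suc (2 ℕ.* n)))

leibniz-cauchy : Cauchy leibniz
leibniz-cauchy ε 0<ε = N , λ m n N≤m N≤n → begin
    ℚ.∣ leibniz m ℚ.- leibniz n ∣
      ≤⟨ triangle (leibniz m) (leibniz N) (leibniz n) ⟩
    ℚ.∣ leibniz m ℚ.- leibniz N ∣ ℚ.+ ℚ.∣ leibniz N ℚ.- leibniz n ∣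
      ≡⟨ cong (ℚ.∣ leibniz m ℚ.- leibniz N ∣ ℚ.+_) (∣p-q∣≡∣q-p∣ (leibniz N) (leibniz n)) ⟩
    ℚ.∣ leibniz m ℚ.- leibniz N ∣ ℚ.+ ℚ.∣ leibniz n ℚ.- leibniz N ∣
      ≤⟨ ℚ.+-mono-≤ (near m N≤m) (near n N≤n) ⟩
    ½ ℚ.* ε ℚ.+ ½ ℚ.* ε
      ≡⟨ half ε ⟩
    ε ∎
  where
  c : ℕ → ℚ
  c n = recip (fromℕℚ (suc (2 ℕ.* n)))
  0≤c : ∀ n → 0ℚ ℚ.≤ c n
  0≤c n = ℚ.<⇒≤ (0<recip (0<fromℕℚ-suc (2 ℕ.* n)))
  c-antitone : ∀ n → c (suc n) ℚ.≤ c n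
  c-antitone n = recip-antitone (0<fromℕℚ-suc (2 ℕ.* n))
    (fromℕℚ-mono {suc (2 ℕ.* n)} {suc (2 ℕ.* suc n)} (ℕ.s≤s (ℕ.*-monoʳ-≤ 2 (ℕ.n≤1+n n))))

  block : ℕ → ℕ → ℚ
  block zero    m = 0ℚ
  block (suc k) m = c m ℚ.- block k (suc m)

  block-bounds : ∀ k m → 0ℚ ℚ.≤ block k m × block k m ℚ.≤ c m
  block-bounds zero    m = ℚ.≤-refl , 0≤c m
  block-bounds (suc k) m with block-bounds k (suc m)
  ... | 0≤b , b≤c =
    subst (ℚ._≤ block (suc k) m) (ℚ.+-inverseʳ (c m))
      (ℚ.+-monoʳ-≤ (c m) (ℚ.neg-antimono-≤ (ℚ.≤-trans b≤c (c-antitone m)))) ,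
    subst (block (suc k) m ℚ.≤_) (ℚ.+-identityʳ (c m)) (ℚ.+-monoʳ-≤ (c m) (ℚ.neg-antimono-≤ 0≤b))

  leibniz-block : ∀ k m → leibniz (k ℕ.+ m) ℚ.- leibniz m ≡ alternating m ℚ.* block k m
  leibniz-block zero    m = trans (ℚ.+-inverseʳ (leibniz m)) (sym (ℚ.*-zeroʳ (alternating m)))
  leibniz-block (suc k) m = trans (cong (λ l → leibniz l ℚ.- leibniz m) (sym (ℕ.+-suc k m)))
    (trans (solve 3 (λ a b e → a :- b := (a :- (b :+ e)) :+ e) refl
              (leibniz (k ℕ.+ suc m)) (leibniz m) (alternating m ℚ.* c m))
      (trans (cong (ℚ._+ alternating m ℚ.* c m) (leibniz-block k (suc m)))
        (solve 3 (λ s d c → :- s :* d :+ s :* c := s :* (c :- d)) refl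
           (alternating m) (block k (suc m)) (c m))))

  ∣alternating∣ : ∀ m → ℚ.∣ alternating m ∣ ≡ 1ℚ
  ∣alternating∣ zero    = refl
  ∣alternating∣ (suc m) = trans (ℚ.∣-p∣≡∣p∣ (alternating m)) (∣alternating∣ m)

  a = archimedean-recip (0<half 0<ε)
  N = proj₁ a

  near : ∀ n → N ℕ.≤ n → ℚ.∣ leibniz n ℚ.- leibniz N ∣ ℚ.≤ ½ ℚ.* ε
  near n N≤n = begin
    ℚ.∣ leibniz n ℚ.- leibniz N ∣
      ≡⟨ cong (λ l → ℚ.∣ leibniz l ℚ.- leibniz N ∣) (sym (ℕ.m∸n+n≡m N≤n)) ⟩
    ℚ.∣ leibniz (k ℕ.+ N) ℚ.- leibniz N ∣
      ≡⟨ trans (cong ℚ.∣_∣ (leibniz-block k N)) (ℚ.∣p*q∣≡∣p∣*∣q∣ (alternating N) (block k N)) ⟩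
    ℚ.∣ alternating N ∣ ℚ.* ℚ.∣ block k N ∣
      ≡⟨ cong₂ ℚ._*_ (∣alternating∣ N) (ℚ.0≤p⇒∣p∣≡p (proj₁ (block-bounds k N))) ⟩
    1ℚ ℚ.* block k N
      ≡⟨ ℚ.*-identityˡ (block k N) ⟩
    block k N
      ≤⟨ proj₂ (block-bounds k N) ⟩
    c N
      ≤⟨ proj₂ a (2 ℕ.* N) (ℕ.m≤m+n N (N ℕ.+ 0)) ⟩
    ½ ℚ.* ε ∎
    where k = n ℕ.∸ N

-- π as the limit of 4 (1 - 1/3 + 1/5 - …).
π : ℝ
π = fromℕ 4 * mkℝ leibniz leibniz-cauchy

-- ⌊x⌋ = n, as a relation: the floor of a Cauchy real is not computable.
IsFloor : ℝ → ℕ → Set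
IsFloor x n = fromℕ n ≤ x × x < fromℕ (suc n)

infix 7 _+i_

record ℤ[i] : Set where
  constructor _+i_
  field
    re : ℤ
    im : ℤ

open ℤ[i] public

infixl 6 _+ᵍ_
infixl 7 _*ᵍ_

_+ᵍ_ : ℤ[i] → ℤ[i] → ℤ[i]
(a +i b) +ᵍ (c +i d) = (a ℤ.+ c) +i (b ℤ.+ d)

_*ᵍ_ : ℤ[i] → ℤ[i] → ℤ[i]
(a +i b) *ᵍ (c +i d) = (a ℤ.* c ℤ.- b ℤ.* d) +i (a ℤ.* d ℤ.+ b ℤ.* c)

-ᵍ_ : ℤ[i] → ℤ[i]
-ᵍ (a +i b) = (ℤ.- a) +i (ℤ.- b)

0ᵍ 1ᵍ iᵍ : ℤ[i]
0ᵍ = (+ 0) +i (+ 0)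
1ᵍ = (+ 1) +i (+ 0)
iᵍ = (+ 0) +i (+ 1)

ℤ[i]-commutativeRing : CommutativeRing 0ℓ 0ℓ
ℤ[i]-commutativeRing = record
  { Carrier = ℤ[i]
  ; _≈_     = _≡_
  ; _+_     = _+ᵍ_
  ; _*_     = _*ᵍ_
  ; -_      = -ᵍ_
  ; 0#      = 0ᵍ
  ; 1#      = 1ᵍ
  ; isCommutativeRing = record
    { isRing = record
      { +-isAbelianGroup = record
        { isGroup = record
          { isMonoid = record
            { isSemigroup = record
              { isMagma = record { isEquivalence = isEquivalence ; ∙-cong = cong₂ _+ᵍ_ }
              ; assoc   = λ { (a +i b) (c +i d) (e +i f) → cong₂ _+i_ (ℤ.+-assoc a c e) (ℤ.+-assoc b d f) }
              }
            ; identity = (λ { (a +i b) → cong₂ _+i_ (ℤ.+-identityˡ a) (ℤ.+-identityˡ b) })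
                       , (λ { (a +i b) → cong₂ _+i_ (ℤ.+-identityʳ a) (ℤ.+-identityʳ b) })
            }
          ; inverse = (λ { (a +i b) → cong₂ _+i_ (ℤ.+-inverseˡ a) (ℤ.+-inverseˡ b) })
                    , (λ { (a +i b) → cong₂ _+i_ (ℤ.+-inverseʳ a) (ℤ.+-inverseʳ b) })
          ; ⁻¹-cong = cong -ᵍ_
          }
        ; comm = λ { (a +i b) (c +i d) → cong₂ _+i_ (ℤ.+-comm a c) (ℤ.+-comm b d) }
        }
      ; *-cong     = cong₂ _*ᵍ_
      ; *-assoc    = λ { (a +i b) (c +i d) (e +i f) → cong₂ _+i_ (*-assoc-re a b c d e f) (*-assoc-im a b c d e f) }
      ; *-identity = *-identityˡ , λ α → trans (*-comm α 1ᵍ) (*-identityˡ α)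
      ; distrib    = *-distribˡ , λ α β γ → trans (*-comm (β +ᵍ γ) α)
                       (trans (*-distribˡ α β γ) (cong₂ _+ᵍ_ (*-comm α β) (*-comm α γ)))
      }
    ; *-comm = *-comm
    }
  }
  where
  *-assoc-re : ∀ a b c d e f →
    (a ℤ.* c ℤ.- b ℤ.* d) ℤ.* e ℤ.- (a ℤ.* d ℤ.+ b ℤ.* c) ℤ.* f ≡
    a ℤ.* (c ℤ.* e ℤ.- d ℤ.* f) ℤ.- b ℤ.* (c ℤ.* f ℤ.+ d ℤ.* e)
  *-assoc-re = ℤ-Solver.solve-∀
  *-assoc-im : ∀ a b c d e f →
    (a ℤ.* c ℤ.- b ℤ.* d) ℤ.* f ℤ.+ (a ℤ.* d ℤ.+ b ℤ.* c) ℤ.* e ≡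
    a ℤ.* (c ℤ.* f ℤ.+ d ℤ.* e) ℤ.+ b ℤ.* (c ℤ.* e ℤ.- d ℤ.* f)
  *-assoc-im = ℤ-Solver.solve-∀
  *-comm : ∀ α β → α *ᵍ β ≡ β *ᵍ α
  *-comm (a +i b) (c +i d) = cong₂ _+i_ (re-comm a b c d) (im-comm a b c d)
    where
    re-comm : ∀ a b c d → a ℤ.* c ℤ.- b ℤ.* d ≡ c ℤ.* a ℤ.- d ℤ.* b
    re-comm = ℤ-Solver.solve-∀
    im-comm : ∀ a b c d → a ℤ.* d ℤ.+ b ℤ.* c ≡ c ℤ.* b ℤ.+ d ℤ.* a
    im-comm = ℤ-Solver.solve-∀
  *-identityˡ : ∀ α → 1ᵍ *ᵍ α ≡ α
  *-identityˡ (a +i b) = cong₂ _+i_ (re-id a b) (im-id a b)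
    where
    re-id : ∀ a b → + 1 ℤ.* a ℤ.- + 0 ℤ.* b ≡ a
    re-id = ℤ-Solver.solve-∀
    im-id : ∀ a b → + 1 ℤ.* b ℤ.+ + 0 ℤ.* a ≡ b
    im-id = ℤ-Solver.solve-∀
  *-distribˡ : ∀ α β γ → α *ᵍ (β +ᵍ γ) ≡ α *ᵍ β +ᵍ α *ᵍ γ
  *-distribˡ (a +i b) (c +i d) (e +i f) = cong₂ _+i_ (re-dist a b c d e f) (im-dist a b c d e f)
    where
    re-dist : ∀ a b c d e f → a ℤ.* (c ℤ.+ e) ℤ.- b ℤ.* (d ℤ.+ f) ≡
      (a ℤ.* c ℤ.- b ℤ.* d) ℤ.+ (a ℤ.* e ℤ.- b ℤ.* f)
    re-dist = ℤ-Solver.solve-∀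
    im-dist : ∀ a b c d e f → a ℤ.* (d ℤ.+ f) ℤ.+ b ℤ.* (c ℤ.+ e) ≡
      (a ℤ.* d ℤ.+ b ℤ.* c) ℤ.+ (a ℤ.* f ℤ.+ b ℤ.* e)
    im-dist = ℤ-Solver.solve-∀

open RawDefs (Semiring.rawSemiring (CommutativeRing.semiring ℤ[i]-commutativeRing)) public
  using (Prime; mkPrime)
  renaming (_∣_ to _∣ᵍ_; _^_ to _^ᵍ_)
open MagmaDefs (Semiring.*-rawMagma (CommutativeRing.semiring ℤ[i]-commutativeRing)) using (_,_)

norm : ℤ[i] → ℕ
norm (a +i b) = ℤ.∣ a ∣ ℕ.* ℤ.∣ a ∣ ℕ.+ ℤ.∣ b ∣ ℕ.* ℤ.∣ b ∣

associates : ℤ[i] → List ℤ[i]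
associates α = α ∷ -ᵍ α ∷ iᵍ *ᵍ α ∷ -ᵍ (iᵍ *ᵍ α) ∷ []

infix 4 _≟ᵍ_

_≟ᵍ_ : (α β : ℤ[i]) → Dec (α ≡ β)
(a +i b) ≟ᵍ (c +i d) = map′ (λ { (refl , refl) → refl }) (λ { refl → refl , refl })
  (a ℤ.≟ c ×-dec b ℤ.≟ d)

open DecMembership _≟ᵍ_ public using () renaming (_∈?_ to _∈ᵍ?_)

box : ℕ → List ℤ[i]
box n = cartesianProductWith _+i_ interval interval
  where interval = map +_ (upTo (suc n)) ++ map -[1+_] (upTo n)

residues : ℕ → List ℤ[i]
residues n = cartesianProductWith (λ a b → (+ a) +i (+ b)) (upTo n) (upTo n)

module ℤ[i]-Lemmas where

  +norm : ∀ α → + norm α ≡ re α ℤ.* re α ℤ.+ im α ℤ.* im α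
  +norm (a +i b) = trans (ℤ.pos-+ (ℤ.∣ a ∣ ℕ.* ℤ.∣ a ∣) (ℤ.∣ b ∣ ℕ.* ℤ.∣ b ∣)) (cong₂ ℤ._+_ (square a) (square b))
    where
    square : ∀ i → + (ℤ.∣ i ∣ ℕ.* ℤ.∣ i ∣) ≡ i ℤ.* i
    square (+ n)    = ℤ.pos-* n n
    square -[1+ n ] = refl

  norm-* : ∀ α β → norm (α *ᵍ β) ≡ norm α ℕ.* norm β
  norm-* α@(a +i b) β@(c +i d) = ℤ.+-injective (trans (+norm (α *ᵍ β))
    (trans (brahmagupta a b c d)
      (trans (cong₂ ℤ._*_ (sym (+norm α)) (sym (+norm β))) (sym (ℤ.pos-* (norm α) (norm β))))))
    where
    brahmagupta : ∀ a b c d →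
      (a ℤ.* c ℤ.- b ℤ.* d) ℤ.* (a ℤ.* c ℤ.- b ℤ.* d) ℤ.+ (a ℤ.* d ℤ.+ b ℤ.* c) ℤ.* (a ℤ.* d ℤ.+ b ℤ.* c) ≡
      (a ℤ.* a ℤ.+ b ℤ.* b) ℤ.* (c ℤ.* c ℤ.+ d ℤ.* d)
    brahmagupta = ℤ-Solver.solve-∀

  n≤n² : ∀ n → n ℕ.≤ n ℕ.* n
  n≤n² zero    = ℕ.z≤n
  n≤n² (suc n) = ℕ.m≤m*n (suc n) (suc n)

  ∣re∣≤norm : ∀ α → ℤ.∣ re α ∣ ℕ.≤ norm α
  ∣re∣≤norm (a +i b) = ℕ.≤-trans (n≤n² ℤ.∣ a ∣) (ℕ.m≤m+n (ℤ.∣ a ∣ ℕ.* ℤ.∣ a ∣) (ℤ.∣ b ∣ ℕ.* ℤ.∣ b ∣))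

  ∣im∣≤norm : ∀ α → ℤ.∣ im α ∣ ℕ.≤ norm α
  ∣im∣≤norm (a +i b) = ℕ.≤-trans (n≤n² ℤ.∣ b ∣) (ℕ.m≤n+m (ℤ.∣ b ∣ ℕ.* ℤ.∣ b ∣) (ℤ.∣ a ∣ ℕ.* ℤ.∣ a ∣))

  norm≡0⇒≡0 : ∀ α → norm α ≡ 0 → α ≡ 0ᵍ
  norm≡0⇒≡0 α eq = cong₂ _+i_ (ℤ.∣i∣≡0⇒i≡0 (vanish {ℤ.∣ re α ∣} (∣re∣≤norm α))) (ℤ.∣i∣≡0⇒i≡0 (vanish {ℤ.∣ im α ∣} (∣im∣≤norm α)))
    where
    vanish : ∀ {m} → m ℕ.≤ norm α → m ≡ 0
    vanish {m} m≤ = ℕ.n≤0⇒n≡0 (subst (m ℕ.≤_) eq m≤)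

  norm-nonZero : ∀ {α} → α ≢ 0ᵍ → ℕ.NonZero (norm α)
  norm-nonZero {α} α≢0 = ℕ.≢-nonZero (λ eq → α≢0 (norm≡0⇒≡0 α eq))

  ∈-box : ∀ {n} α → norm α ℕ.≤ n → α ∈ box n
  ∈-box {n} α N≤n = ∈-cartesianProductWith⁺ _+i_
    (∈-interval (ℕ.≤-trans (∣re∣≤norm α) N≤n)) (∈-interval (ℕ.≤-trans (∣im∣≤norm α) N≤n))
    where
    ∈-interval : ∀ {i} → ℤ.∣ i ∣ ℕ.≤ n → i ∈ map +_ (upTo (suc n)) ++ map -[1+_] (upTo n)
    ∈-interval {+ k}     k≤n = ∈-++⁺ˡ (∈-map⁺ +_ (∈-upTo⁺ (ℕ.s≤s k≤n)))
    ∈-interval { -[1+ k ]} k<n = ∈-++⁺ʳ (map +_ (upTo (suc n))) (∈-map⁺ -[1+_] (∈-upTo⁺ k<n))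

  ∣-shift⁺ : ∀ {p ρ} γ → p ∣ᵍ ρ → p ∣ᵍ ρ +ᵍ γ *ᵍ p
  ∣-shift⁺ {p} {ρ} γ (κ , eq) = (κ +ᵍ γ) , trans (distribʳ p κ γ) (cong (_+ᵍ γ *ᵍ p) eq)
    where open CommutativeRing ℤ[i]-commutativeRing using (distribʳ)

  ∣-shift⁻ : ∀ {p ρ} γ → p ∣ᵍ ρ +ᵍ γ *ᵍ p → p ∣ᵍ ρ
  ∣-shift⁻ {p} {ρ} γ (κ , eq) = (κ +ᵍ -ᵍ γ) , (trans (distribʳ p κ (-ᵍ γ))
    (trans (cong (_+ᵍ -ᵍ γ *ᵍ p) eq) (trans (+-assoc ρ (γ *ᵍ p) (-ᵍ γ *ᵍ p))
      (trans (cong (ρ +ᵍ_) (trans (sym (distribʳ p γ (-ᵍ γ)))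
        (trans (cong (_*ᵍ p) (-‿inverseʳ γ)) (zeroˡ p)))) (+-identityʳ ρ)))))
    where open CommutativeRing ℤ[i]-commutativeRing
            using (distribʳ; +-assoc; -‿inverseʳ; zeroˡ; +-identityʳ)

  conj : ℤ[i] → ℤ[i]
  conj (a +i b) = a +i (ℤ.- b)

  conj-* : ∀ p → conj p *ᵍ p ≡ (+ norm p) +i (+ 0)
  conj-* p@(c +i d) = cong₂ _+i_ (trans (re-eq c d) (sym (+norm p))) (im-eq c d)
    where
    re-eq : ∀ c d → c ℤ.* c ℤ.- (ℤ.- d) ℤ.* d ≡ c ℤ.* c ℤ.+ d ℤ.* d
    re-eq = ℤ-Solver.solve-∀
    im-eq : ∀ c d → c ℤ.* d ℤ.+ (ℤ.- d) ℤ.* c ≡ + 0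
    im-eq = ℤ-Solver.solve-∀

  *-integer : ∀ q t m → (q +i t) *ᵍ (m +i (+ 0)) ≡ (q ℤ.* m) +i (t ℤ.* m)
  *-integer q t m = cong₂ _+i_ (re-eq q t m) (im-eq q t m)
    where
    re-eq : ∀ q t m → q ℤ.* m ℤ.- t ℤ.* + 0 ≡ q ℤ.* m
    re-eq = ℤ-Solver.solve-∀
    im-eq : ∀ q t m → q ℤ.* + 0 ℤ.+ t ℤ.* m ≡ t ℤ.* m
    im-eq = ℤ-Solver.solve-∀

  reduce : ∀ {p} → p ≢ 0ᵍ → ∀ α → ∃ λ ρ → ρ ∈ residues (norm p) × ∃ λ γ → α ≡ ρ +ᵍ γ *ᵍ p
  reduce {p} p≢0 α =
    ρ ,
    ∈-cartesianProductWith⁺ (λ a b → (+ a) +i (+ b))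
      (∈-upTo⁺ (ℤ.n%ℕd<d (re α) n)) (∈-upTo⁺ (ℤ.n%ℕd<d (im α) n)) ,
    κ *ᵍ conj p ,
    trans (cong₂ _+i_ (ℤ.a≡a%ℕn+[a/ℕn]*n (re α) n) (ℤ.a≡a%ℕn+[a/ℕn]*n (im α) n))
      (cong (ρ +ᵍ_) (sym (trans (*-assoc κ (conj p) p)
        (trans (cong (κ *ᵍ_) (conj-* p)) (*-integer (re κ) (im κ) (+ n))))))
    where
    open CommutativeRing ℤ[i]-commutativeRing using (*-assoc)
    n = norm p
    instance
      n≢0 : ℕ.NonZero n
      n≢0 = norm-nonZero p≢0
    ρ = (+ (re α ℤ.%ℕ n)) +i (+ (im α ℤ.%ℕ n))
    κ = (re α ℤ./ℕ n) +i (im α ℤ./ℕ n)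

  *-shiftʳ : ∀ ρ γ p β → (ρ +ᵍ γ *ᵍ p) *ᵍ β ≡ ρ *ᵍ β +ᵍ (γ *ᵍ β) *ᵍ p
  *-shiftʳ ρ γ p β = trans (distribʳ β ρ (γ *ᵍ p)) (cong (ρ *ᵍ β +ᵍ_)
    (trans (*-assoc γ p β) (trans (cong (γ *ᵍ_) (*-comm p β)) (sym (*-assoc γ β p)))))
    where open CommutativeRing ℤ[i]-commutativeRing using (distribʳ; *-assoc; *-comm)

  *-shiftˡ : ∀ ρ σ δ p → ρ *ᵍ (σ +ᵍ δ *ᵍ p) ≡ ρ *ᵍ σ +ᵍ (ρ *ᵍ δ) *ᵍ p
  *-shiftˡ ρ σ δ p = trans (distribˡ ρ σ (δ *ᵍ p)) (cong (ρ *ᵍ σ +ᵍ_) (sym (*-assoc ρ δ p)))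
    where open CommutativeRing ℤ[i]-commutativeRing using (distribˡ; *-assoc)

open ℤ[i]-Lemmas

infix 4 _∣ᵍ?_

_∣ᵍ?_ : (α β : ℤ[i]) → Dec (α ∣ᵍ β)
α ∣ᵍ? β with β ≟ᵍ 0ᵍ
... | yes refl = yes (0ᵍ , CommutativeRing.zeroˡ ℤ[i]-commutativeRing α)
... | no β≢0   = map′ from to (any? (λ κ → κ *ᵍ α ≟ᵍ β) (box (norm β)))
  where
  from : Any (λ κ → κ *ᵍ α ≡ β) (box (norm β)) → α ∣ᵍ β
  from found = let κ , _ , eq = find found in κ , eq
  to : α ∣ᵍ β → Any (λ κ → κ *ᵍ α ≡ β) (box (norm β))
  to (κ , refl) = lose (∈-box κ (subst (norm κ ℕ.≤_) (sym (norm-* κ α))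
    (ℕ.m≤m*n (norm κ) (norm α) ⦃ norm-nonZero α≢0 ⦄))) refl
    where
    α≢0 : α ≢ 0ᵍ
    α≢0 refl = β≢0 (CommutativeRing.zeroʳ ℤ[i]-commutativeRing κ)

prime? : (p : ℤ[i]) → Dec (Prime p)
prime? p with p ≟ᵍ 0ᵍ | p ∣ᵍ? 1ᵍ
... | yes p≡0 | _       = no λ P → Prime.p≉0 P p≡0
... | no _    | yes p∣1 = no λ P → Prime.p∤1 P p∣1
... | no p≢0  | no p∤1  = map′ from to (all? (λ ρ → all? (λ σ → split? ρ σ) rs) rs)
  where
  rs = residues (norm p)
  Split : ℤ[i] → ℤ[i] → Set
  Split ρ σ = p ∣ᵍ ρ *ᵍ σ → p ∣ᵍ ρ ⊎ p ∣ᵍ σ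
  split? : ∀ ρ σ → Dec (Split ρ σ)
  split? ρ σ = (p ∣ᵍ? ρ *ᵍ σ) →-dec ((p ∣ᵍ? ρ) ⊎-dec (p ∣ᵍ? σ))
  to : Prime p → All (λ ρ → All (Split ρ) rs) rs
  to P = All.universal (λ ρ → All.universal (λ σ → Prime.split-∣ P) rs) rs
  from : All (λ ρ → All (Split ρ) rs) rs → Prime p
  from splits = mkPrime p≢0 p∤1 split
    where
    split′ : ∀ ρ σ γ δ → ρ ∈ rs → σ ∈ rs → Split (ρ +ᵍ γ *ᵍ p) (σ +ᵍ δ *ᵍ p)
    split′ ρ σ γ δ ρ∈ σ∈ p∣αβ = Sum.map (∣-shift⁺ γ) (∣-shift⁺ δ)
      (All.lookup (All.lookup splits ρ∈) σ∈
        (∣-shift⁻ (ρ *ᵍ δ) (subst (p ∣ᵍ_) (*-shiftˡ ρ σ δ p)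
          (∣-shift⁻ (γ *ᵍ (σ +ᵍ δ *ᵍ p)) (subst (p ∣ᵍ_) (*-shiftʳ ρ γ p (σ +ᵍ δ *ᵍ p)) p∣αβ)))))
    split : ∀ {α β} → Split α β
    split {α} {β} = let ρ , ρ∈ , γ , α≡ = reduce p≢0 α
                        σ , σ∈ , δ , β≡ = reduce p≢0 β
                    in subst₂ Split (sym α≡) (sym β≡) (split′ ρ σ γ δ ρ∈ σ∈)

-- Every nonzero Gaussian integer has exactly one associate a + b i with
-- a > 0 and b ≥ 0. These are the ones among them with norm at most n.
representatives : ℕ → List ℤ[i]
representatives n = filter (λ α → norm α ℕ.≤? n)
  (cartesianProductWith (λ a b → (+ suc a) +i (+ b)) (upTo n) (upTo (suc n)))

primes : ℕ → List ℤ[i]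
primes n = filter prime? (representatives n)

tuples : {A : Set} (k : ℕ) → List A → List (Vec A k)
tuples zero    xs = [] ∷ []
tuples (suc k) xs = cartesianProductWith _∷_ xs (tuples k xs)

-- τ k a is meaningful for a > 0 only; all factors are then at most a.
τ : ℕ → ℕ → ℕ
τ k a = length (filter (λ v → foldr′ ℕ._*_ 1 v ℕ.≟ a) (tuples k (map suc (upTo a))))

-- 𝔱 k α is meaningful for α ≠ 0 only; all factors then have norm at most norm α.
-- Each factor is represented by its associate a + b i with a > 0 and b ≥ 0.
𝔱 : ℕ → ℤ[i] → ℕ
𝔱 k α = length (filter (λ v → foldr′ _*ᵍ_ 1ᵍ v ∈ᵍ? associates α) (tuples k (representatives (norm α))))

-- The largest e with p ^ e dividing α. As norm p ≥ 2 for p prime, e ≤ norm α.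
valuation : ℤ[i] → ℤ[i] → ℕ
valuation p α = max 0 (filter (λ e → p ^ᵍ e ∣ᵍ? α) (upTo (suc (norm α))))

-- The function ε p₁^a₁ ⋯ pᵣ^aᵣ ↦ g a₁ ⋯ g aᵣ on nonzero Gaussian integers: the
-- pⱼ are, up to associates, the primes dividing α, and aⱼ is the valuation at pⱼ.
multiplicative : (ℕ → ℕ) → ℤ[i] → ℕ
multiplicative g α = ℕ.product (map (λ p → g (valuation p α)) (filter (_∣ᵍ? α) (primes (norm α))))

𝔱ℕ : ℕ → ℕ → ℕ
𝔱ℕ k a = 𝔱 k ((+ a) +i (+ 0))

𝔱ᵉ : ℕ → ℤ[i] → ℕ
𝔱ᵉ k = multiplicative (τ k)

𝔱ᵉ* : ℕ → ℤ[i] → ℕ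
𝔱ᵉ* k = multiplicative (𝔱ℕ k)

∑′ : ℕ → (ℤ[i] → ℕ) → ℕ
∑′ n f = ℕ.sum (map f (representatives n))

∏ : List ℝ → ℝ
∏ = foldr _*_ 1ℝ

eulerTerm : (ℕ → ℕ) → ℤ[i] → ℕ → ℝ
eulerTerm g p a = fromℚ (fromℤ (g a ℤ.⊖ g (a ℕ.∸ 1)) ℚ.* recip (fromℕℚ (norm p ℕ.^ a)))

-- P = ∏_p (1 + ∑_{a ≥ 2} (g(a) - g(a - 1)) / N(p)^a), including the convergence
-- of the sums and of the product, the primes being ordered by norm.
IsEulerProduct : (ℕ → ℕ) → ℝ → Set
IsEulerProduct g P = ∃ λ (factor : ℤ[i] → ℝ) →
  (∀ p → Prime p → (λ n → 1ℝ + ∑< n (λ j → eulerTerm g p (2 ℕ.+ j))) ⟶ factor p) ×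
  (λ n → ∏ (map factor (primes n))) ⟶ P

-- ∑′_{N(α) ≤ x} f(α) = C x + O(x^(1/2) log^c x) as x → ∞. As norms are natural
-- numbers, the sum up to x is the sum up to n = ⌊x⌋.
SummatoryAsymptotic : (ℤ[i] → ℕ) → ℝ → ℚ → Set
SummatoryAsymptotic f C c =
  ∃ λ (K : ℝ) → ∃ λ (x₀ : ℝ) → ∀ x (1<x : 1ℝ < x) → x₀ ≤ x → ∀ n → IsFloor x n →
  let 0<x     = 1<x⇒0<x {x} 1<x
      0<log-x = log-positive x 0<x 1<x
  in ∣ fromℕ (∑′ n f) - C * x ∣ ≤ K * (x ^⟨ 0<x ⟩ ½ * log x 0<x ^⟨ 0<log-x ⟩ c)

{-# OPTIONS --safe #-}
-- Write the function as the sum over divisors of a function h supported on square-full numbers. Removing one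
-- prime p from a finite list of primes expresses the sum over N(α) ≤ n as Σ h(a) times the sum over
-- N(α) ≤ n / N(p)^a; induction on the list, which needs no unique factorisation, reduces everything to the
-- circle problem. There the error O(√n) follows by sorting the points according to max(a , b) and comparing
-- with Riemann sums of 1 / (1 + t²), hence with the Leibniz series. The error becomes √n times a product over
-- N(p) ≤ n of factors 1 + M / N(p) + …, where M = h(2), and this is O(log^(M + 2) n): a product of factors
-- 1 + N(p)^(-1) is dominated by the sum of N(α)^(-1) over all α with bounded norm, up to a slight damping.
-- The exponent M + 2 is below the one required. All estimates are carried out with rational numbers and
-- transferred to logarithms and powers at the end through lower bounds for exp and log.
module Submission where

open import Algebra.Bundles using (CommutativeRing; Semiring)
import Algebra.Definitions.RawMagma as MagmaDefs
import Algebra.Properties.CommutativeSemiring.Exp as Exp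
open import Data.Empty using (⊥-elim)
open import Data.Integer.Base using (ℤ; -[1+_])
import Data.Integer.Base as ℤ using (+_; _*_; _+_; -_; _-_; _⊖_; _≤_; +≤+)
import Data.Integer.Properties as ℤ using ([1+m]⊖[1+n]≡m⊖n; pos-*)
import Data.Integer.Tactic.RingSolver as ℤ using (ring)
open import Data.List.Base
  using (List; []; _∷_; _++_; map; filter; length; upTo; applyUpTo; cartesianProductWith)
open import Data.List.Membership.Propositional using (_∈_; lose)
open import Data.List.Membership.Propositional.Properties
  using (∈-filter⁺; ∈-filter⁻; ∈-map⁺; ∈-map⁻; ∈-++⁺ˡ; ∈-++⁺ʳ; ∈-++⁻; ∈-∃++; ∈-upTo⁺;
         ∈-cartesianProductWith⁺; ∈-cartesianProductWith⁻)
open import Data.List.Membership.Propositional.Properties.WithK using (unique∧set⇒bag)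
open import Data.List.Properties using (filter-++; length-++; length-map; length-filter; length-upTo)
open import Data.List.Relation.Binary.BagAndSetEquality using (∼bag⇒↭)
open import Data.List.Relation.Binary.Permutation.Propositional using (_↭_)
import Data.List.Relation.Binary.Permutation.Propositional as ↭ using (refl; prep; swap; trans)
open import Data.List.Relation.Unary.All using (All; []; _∷_)
import Data.List.Relation.Unary.All as All using (lookup; tabulate; zipWith)
open import Data.List.Relation.Unary.AllPairs using (AllPairs; []; _∷_)
open import Data.List.Relation.Unary.Any using (here; there)
open import Data.List.Relation.Unary.Unique.Propositional using (Unique)
import Data.List.Relation.Unary.Unique.Propositional.Properties as Unique
  using (++⁺; cartesianProductWith⁺; filter⁺; upTo⁺)
open import Data.Nat.Base using (ℕ; zero; suc; z≤n; s≤s)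
import Data.Nat.Base as ℕ
  using (_+_; _*_; _∸_; _^_; _⊔_; _/_; _≤_; _<_; s≤s⁻¹; NonZero; >-nonZero; >-nonZero⁻¹)
import Data.Nat.DivMod as ℕ using (/-monoˡ-≤; m*n/n≡m; m/n*n≤m; m/n/o≡m/[n*o]; n/1≡n)
import Data.Nat.ListAction as ℕ using (product; sum)
import Data.Nat.Properties as ℕ
  using (*-assoc; *-cancelˡ-≡; *-cancelˡ-≤; *-comm; *-distribˡ-+; *-distribˡ-∸; *-identityʳ; *-identityˡ;
         *-mono-<; *-mono-≤; *-monoʳ-≤; *-monoˡ-≤; *-suc; *-zeroʳ; +-assoc; +-comm; +-identityʳ; +-mono-≤;
         +-monoʳ-≤; +-monoˡ-≤; 1+n≰n; <-irrefl; <-trans; <-≤-trans; _<?_; <⇒≤; <⇒≱; ^-distribˡ-+-*;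
         ^-monoʳ-<; ^-monoʳ-≤; ^-monoˡ-≤; m*n≡0⇒m≡0∨n≡0; m*n≡1⇒n≡1; m<n⇒m<1+n; m^n>0; m∸n+n≡m; m≤m*n;
         m≤m+n; m≤m⊔n; m≤n*m; m≤n+m; m≤n⇒m<n∨m≡n; m≤n⇒m≤1+n; m≤n⊔m; m⊔n≤o⇒m≤o; m⊔n≤o⇒n≤o; n<1+n;
         n<1⇒n≡0; n≤0⇒n≡0; n≤1+n; ∸-monoˡ-≤; _≟_; ≤-<-connex; ≤-<-trans; ≤-antisym; ≤-refl; ≤-reflexive;
         ≤-total; ≤-totalOrder; ≤-trans; _≤?_; ≮⇒≥; ≰⇒>)
import Data.List.Extrema ℕ.≤-totalOrder as Extrema using (argmax-all; v≤max⁺)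
import Data.Nat.Tactic.RingSolver as ℕ using (ring)
open import Data.Product.Base using (∃; _×_; _,_; proj₁; proj₂)
open import Data.Rational.Base using (ℚ; 0ℚ; 1ℚ; ½)
import Data.Rational.Base as ℚ using (_/_; _+_; positive)
import Data.Rational.Base as ℚ-Operations using (_+_; _*_; _-_; -_; _≤_; _<_; ∣_∣)
open import Data.Rational.Literals using (fromℤ)
import Data.Rational.Properties as ℚ
  using (*-assoc; *-comm; *-distribʳ-+; *-distribˡ-+; *-identityʳ; *-identityˡ; *-monoˡ-<-pos; *-zeroʳ;
         *-zeroˡ; +-*-commutativeRing; +-assoc; +-comm; +-identityʳ; +-identityˡ; +-inverseʳ; +-mono-<-≤;
         +-mono-≤; +-monoʳ-<; +-monoʳ-≤; +-monoˡ-<; +-monoˡ-≤; 0≤p⇒∣p∣≡p; 0≤∣p∣; <-irrefl; <-≤-trans;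
         _<?_; <⇒≤; neg-antimono-<; neg-antimono-≤; nonNegative⁻¹; positive⁻¹; toℚᵘ-cancel-≤;
         toℚᵘ-fromℚᵘ; ∣-p∣≡∣p∣; ∣p*q∣≡∣p∣*∣q∣; ∣p+q∣≤∣p∣+∣q∣; ∣p-q∣≤∣p∣+∣q∣; _≟_; ≤-<-trans; module ≤-Reasoning;
         ≤-antisym; ≤-refl; ≤-reflexive; ≤-total; ≤-trans; _≤?_; ≮⇒≥; ≰⇒>)
import Data.Rational.Unnormalised.Base as ℚᵘ using (mkℚᵘ; *≤*)
import Data.Rational.Unnormalised.Properties as ℚᵘ using (≃-sym; ≤-respʳ-≃)
open import Data.Sum.Base using (_⊎_; inj₁; inj₂; [_,_]′)
open import Data.Vec.Base using (Vec; []; _∷_; foldr′; replicate)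
open import Function.Base using (_∘_; id; case_of_)
open import Function.Bundles using (mk⇔)
open import Level using (0ℓ)
open import Relation.Binary.PropositionalEquality
  using (_≡_; _≢_; refl; sym; trans; cong; cong₂; subst; subst₂; module ≡-Reasoning)
open import Relation.Nullary using (Dec; yes; no; ¬_)
open import Relation.Nullary.Decidable.Core using (dec⇒maybe)
open import Relation.Unary using (Pred; Decidable)
import Tactic.RingSolver.NonReflective as RingSolver
open import Tactic.RingSolver.Core.AlmostCommutativeRing using (AlmostCommutativeRing; fromCommutativeRing)
open import Defs hiding (_+_; _*_; _-_; -_; _≤_; _<_; ∣_∣; _≃_)
open ℚ-Lemmas
open RingSolver ℕ.ring using () renaming (solve to solve-ℕ)
open RingSolver ℤ.ring using () renaming (solve to solve-ℤ)
open ℤ[i]-Lemmas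

-- A constructive real is only a Cauchy sequence, so C, √x and log x are not numbers to calculate
-- with. Everything is therefore proved at a single index T, which serves as the index of the
-- approximations themselves: π / 4 is represented by `leibniz T`, the Euler factor at p by
-- `factorᵀ g T p`, and for T ≥ n the estimates hold with constants that do not depend on T. The
-- statement about reals is then read off at all large T. Square roots are avoided by carrying a
-- rational r with n / d ≤ r² through the induction over primes; the main term contains the exact
-- quotient n / d, not its floor, so that the main terms add up without error. In the exponent M +
-- 2, the number M comes from the term h(2) / N(p). One further unit absorbs all terms from
-- N(p)^(-3/2) on, which together are at most 1 / N(p) for large p, and the last unit pays for the
-- damping.

-- Inequalities for rationals, their reciprocals and their powers.

module Rationals where

  open ℚ-Operations using (_+_; _*_; _-_; -_; _≤_; _<_; ∣_∣)
  open ℚ.≤-Reasoning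
  open Exp (CommutativeRing.commutativeSemiring ℚ.+-*-commutativeRing) public
    using (_^_; ^-homo-*; ^-assocʳ; ^-distrib-*)

  ℚ-ring : AlmostCommutativeRing 0ℓ 0ℓ
  ℚ-ring = fromCommutativeRing ℚ.+-*-commutativeRing λ x → dec⇒maybe (0ℚ ℚ.≟ x)

  open RingSolver ℚ-ring public using (Κ; _⊕_; _⊗_; ⊝_) renaming (solve to solve-ℚ)

  <⇒≱ : ∀ {p q} → p < q → ¬ q ≤ p
  <⇒≱ p<q q≤p = ℚ.<-irrefl refl (ℚ.<-≤-trans p<q q≤p)

  -- Splits a polynomial inequality into an identity for the ring solver and the nonnegativity of
  -- the difference `e`.
  ≤-by : ∀ {p q} e → q ≡ p + e → 0ℚ ≤ e → p ≤ q
  ≤-by {p} e refl 0≤e = subst (_≤ p + e) (ℚ.+-identityʳ p) (ℚ.+-monoʳ-≤ p 0≤e)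

  p≤q⇒0≤q-p : ∀ {p q} → p ≤ q → 0ℚ ≤ q - p
  p≤q⇒0≤q-p {p} {q} p≤q = subst (_≤ q - p) (ℚ.+-inverseʳ p) (ℚ.+-monoˡ-≤ (- p) p≤q)

  0≤+ : ∀ {p q} → 0ℚ ≤ p → 0ℚ ≤ q → 0ℚ ≤ p + q
  0≤+ = ℚ.+-mono-≤

  p≤p+q : ∀ {p q} → 0ℚ ≤ q → p ≤ p + q
  p≤p+q {p} {q} = ≤-by q refl

  q≤p+q : ∀ {p q} → 0ℚ ≤ p → q ≤ p + q
  q≤p+q {p} {q} = ≤-by p (ℚ.+-comm p q)

  square≥0 : ∀ p → 0ℚ ≤ p * p
  square≥0 p with ℚ.≤-total 0ℚ p
  ... | inj₁ 0≤p = 0≤* 0≤p 0≤p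
  ... | inj₂ p≤0 = subst (0ℚ ≤_) (eq p) (0≤* 0≤-p 0≤-p)
    where
    0≤-p = ℚ.neg-antimono-≤ p≤0
    eq = solve-ℚ 1 (λ p → ⊝ p ⊗ ⊝ p , p ⊗ p) refl

  -- Takes the place of the monotonicity of the square root, so that a rational r with y ≤ r² can
  -- stand for √y.
  square-cancel-≤ : ∀ {p q} → 0ℚ ≤ q → p * p ≤ q * q → p ≤ q
  square-cancel-≤ {p} {q} 0≤q p²≤q² with p ℚ.≤? q
  ... | yes p≤q = p≤q
  ... | no p≰q = ⊥-elim (<⇒≱ (ℚ.≤-<-trans (*-monoˡ-≤ 0≤q (ℚ.<⇒≤ q<p))
                    (ℚ.*-monoˡ-<-pos p ⦃ ℚ.positive (ℚ.≤-<-trans 0≤q q<p) ⦄ q<p)) p²≤q²)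
    where q<p = ℚ.≰⇒> p≰q

  ≤-scale : ∀ {p q r} → 0ℚ ≤ p → 1ℚ ≤ q → r ≤ p → r ≤ p * q
  ≤-scale {p} {q} 0≤p 1≤q r≤p =
    ℚ.≤-trans r≤p (subst (_≤ p * q) (ℚ.*-identityʳ p) (*-monoˡ-≤ 0≤p 1≤q))

  1≤* : ∀ {p q} → 1ℚ ≤ p → 1ℚ ≤ q → 1ℚ ≤ p * q
  1≤* 1≤p 1≤q = ≤-scale (ℚ.≤-trans 0≤1 1≤p) 1≤q 1≤p

  0≤^ : ∀ {p} n → 0ℚ ≤ p → 0ℚ ≤ p ^ n
  0≤^ zero 0≤p = 0≤1
  0≤^ (suc n) 0≤p = 0≤* 0≤p (0≤^ n 0≤p)

  0<^ : ∀ {p} n → 0ℚ < p → 0ℚ < p ^ n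
  0<^ zero 0<p = 0<1
  0<^ (suc n) 0<p = 0<* 0<p (0<^ n 0<p)

  1≤^ : ∀ {p} n → 1ℚ ≤ p → 1ℚ ≤ p ^ n
  1≤^ zero 1≤p = ℚ.≤-refl
  1≤^ (suc n) 1≤p = 1≤* 1≤p (1≤^ n 1≤p)

  ^≤1 : ∀ {p} n → 0ℚ ≤ p → p ≤ 1ℚ → p ^ n ≤ 1ℚ
  ^≤1 zero 0≤p p≤1 = ℚ.≤-refl
  ^≤1 (suc n) 0≤p p≤1 = *-mono-≤ 0≤p 0≤1 p≤1 (^≤1 n 0≤p p≤1)

  ^-monoˡ-≤ : ∀ {p q} n → 0ℚ ≤ p → p ≤ q → p ^ n ≤ q ^ n
  ^-monoˡ-≤ zero 0≤p p≤q = ℚ.≤-refl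
  ^-monoˡ-≤ (suc n) 0≤p p≤q = *-mono-≤ 0≤p (0≤^ n (ℚ.≤-trans 0≤p p≤q)) p≤q (^-monoˡ-≤ n 0≤p p≤q)

  ^-monoʳ-≤ : ∀ {p m n} → 1ℚ ≤ p → m ℕ.≤ n → p ^ m ≤ p ^ n
  ^-monoʳ-≤ {n = n} 1≤p z≤n = 1≤^ n 1≤p
  ^-monoʳ-≤ 1≤p (s≤s m≤n) = *-monoˡ-≤ (ℚ.≤-trans 0≤1 1≤p) (^-monoʳ-≤ 1≤p m≤n)

  1^ : ∀ n → 1ℚ ^ n ≡ 1ℚ
  1^ zero = refl
  1^ (suc n) = trans (ℚ.*-identityˡ _) (1^ n)

  fromℕℚ-+ : ∀ m n → fromℕℚ (m ℕ.+ n) ≡ fromℕℚ m + fromℕℚ n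
  fromℕℚ-+ zero n = sym (ℚ.+-identityˡ _)
  fromℕℚ-+ (suc m) n = trans (fromℕℚ-suc (m ℕ.+ n)) (trans (cong (1ℚ +_) (fromℕℚ-+ m n))
    (trans (sym (ℚ.+-assoc 1ℚ (fromℕℚ m) (fromℕℚ n))) (cong (_+ fromℕℚ n) (sym (fromℕℚ-suc m)))))

  fromℕℚ-* : ∀ m n → fromℕℚ (m ℕ.* n) ≡ fromℕℚ m * fromℕℚ n
  fromℕℚ-* zero n = sym (ℚ.*-zeroˡ (fromℕℚ n))
  fromℕℚ-* (suc m) n = trans (fromℕℚ-+ n (m ℕ.* n)) (trans (cong (fromℕℚ n +_) (fromℕℚ-* m n))
    (trans (eq (fromℕℚ m) (fromℕℚ n)) (cong (_* fromℕℚ n) (sym (fromℕℚ-suc m)))))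
    where
    eq = solve-ℚ 2 (λ m n → n ⊕ m ⊗ n , (Κ 1ℚ ⊕ m) ⊗ n) refl

  fromℕℚ-^ : ∀ m n → fromℕℚ (m ℕ.^ n) ≡ fromℕℚ m ^ n
  fromℕℚ-^ m zero = refl
  fromℕℚ-^ m (suc n) = trans (fromℕℚ-* m (m ℕ.^ n)) (cong (fromℕℚ m *_) (fromℕℚ-^ m n))

  fromℤ-⊖ : ∀ m n → fromℤ (m ℤ.⊖ n) ≡ fromℕℚ m - fromℕℚ n
  fromℤ-⊖ m zero = sym (ℚ.+-identityʳ _)
  fromℤ-⊖ zero (suc n) = sym (ℚ.+-identityˡ _)
  fromℤ-⊖ (suc m) (suc n) = trans (cong fromℤ (ℤ.[1+m]⊖[1+n]≡m⊖n m n)) (trans (fromℤ-⊖ m n)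
    (trans (eq (fromℕℚ m) (fromℕℚ n)) (cong₂ _-_ (sym (fromℕℚ-suc m)) (sym (fromℕℚ-suc n)))))
    where
    eq = solve-ℚ 2 (λ a b → a ⊕ ⊝ b , Κ 1ℚ ⊕ a ⊕ ⊝ (Κ 1ℚ ⊕ b)) refl

  0<fromℕℚ : ∀ {n} → 0 ℕ.< n → 0ℚ < fromℕℚ n
  0<fromℕℚ {suc n} _ = 0<fromℕℚ-suc n

  1≤fromℕℚ : ∀ {n} → 0 ℕ.< n → 1ℚ ≤ fromℕℚ n
  1≤fromℕℚ {n} = fromℕℚ-mono {1} {n}

  fromℕℚ-cancel-≤ : ∀ {m n} → fromℕℚ m ≤ fromℕℚ n → m ℕ.≤ n
  fromℕℚ-cancel-≤ {m} {n} p with m ℕ.≤? n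
  ... | yes m≤n = m≤n
  ... | no m≰n = ⊥-elim (<⇒≱ (ℚ.<-≤-trans n<1+n (fromℕℚ-mono (ℕ.≰⇒> m≰n))) p)
    where
    n<1+n : fromℕℚ n < fromℕℚ (suc n)
    n<1+n = subst₂ _<_ (ℚ.+-identityˡ _) (sym (fromℕℚ-suc n)) (ℚ.+-monoˡ-< (fromℕℚ n) 0<1)

  0≤recip : ∀ {p} → 0ℚ ≤ p → 0ℚ ≤ recip p
  0≤recip {p} 0≤p with 0ℚ ℚ.<? p
  ... | yes 0<p = ℚ.<⇒≤ (0<recip 0<p)
  ... | no 0≮p = subst (λ z → 0ℚ ≤ recip z) (ℚ.≤-antisym 0≤p (ℚ.≮⇒≥ 0≮p)) ℚ.≤-refl

  recip-unique : ∀ {p q} → p * q ≡ 1ℚ → q ≡ recip p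
  recip-unique {p} {q} pq≡1 = trans (sym (ℚ.*-identityʳ q)) (trans (cong (q *_) (sym (recip-inverse p≢0)))
    (trans (sym (ℚ.*-assoc q p (recip p))) (trans (cong (_* recip p) (trans (ℚ.*-comm q p) pq≡1)) (ℚ.*-identityˡ _))))
    where
    p≢0 : p ≢ 0ℚ
    p≢0 refl = case trans (sym pq≡1) (ℚ.*-zeroˡ q) of λ ()

  recip-* : ∀ {p q} → 0ℚ < p → 0ℚ < q → recip (p * q) ≡ recip p * recip q
  recip-* {p} {q} 0<p 0<q = sym (recip-unique {p * q} (trans (eq p q (recip p) (recip q))
    (cong₂ _*_ (recip-inverse (>⇒≢ 0<p)) (recip-inverse (>⇒≢ 0<q)))))
    where
    eq = solve-ℚ 4 (λ p q r s → p ⊗ q ⊗ (r ⊗ s) , p ⊗ r ⊗ (q ⊗ s)) refl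

  recip-^ : ∀ {p} n → 0ℚ < p → recip (p ^ n) ≡ recip p ^ n
  recip-^ zero 0<p = refl
  recip-^ {p} (suc n) 0<p = trans (recip-* 0<p (0<^ n 0<p)) (cong (recip p *_) (recip-^ n 0<p))

  recip≤1 : ∀ {p} → 1ℚ ≤ p → recip p ≤ 1ℚ
  recip≤1 1≤p = recip-antitone 0<1 1≤p

  ≤-recip : ∀ {p q r} → 0ℚ < q → p * q ≤ r → p ≤ r * recip q
  ≤-recip {p} {q} {r} 0<q pq≤r = subst (_≤ r * recip q)
    (trans (ℚ.*-assoc p q (recip q)) (trans (cong (p *_) (recip-inverse (>⇒≢ 0<q))) (ℚ.*-identityʳ p)))
    (*-monoʳ-≤ (ℚ.<⇒≤ (0<recip 0<q)) pq≤r)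

  recip-*≤ : ∀ {p q r} → 0ℚ < q → p ≤ r * q → p * recip q ≤ r
  recip-*≤ {p} {q} {r} 0<q p≤rq = subst (p * recip q ≤_)
    (trans (ℚ.*-assoc r q (recip q)) (trans (cong (r *_) (recip-inverse (>⇒≢ 0<q))) (ℚ.*-identityʳ r)))
    (*-monoʳ-≤ (ℚ.<⇒≤ (0<recip 0<q)) p≤rq)

  bernoulli : ∀ {d} n → 0ℚ ≤ d → 1ℚ + fromℕℚ n * d ≤ (1ℚ + d) ^ n
  bernoulli {d} zero 0≤d = ℚ.≤-reflexive (trans (cong (1ℚ +_) (ℚ.*-zeroˡ d)) (ℚ.+-identityʳ 1ℚ))
  bernoulli {d} (suc n) 0≤d = begin
    1ℚ + fromℕℚ (suc n) * d ≡⟨ cong (λ z → 1ℚ + z * d) (fromℕℚ-suc n) ⟩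
    1ℚ + (1ℚ + fromℕℚ n) * d ≤⟨ ≤-by _ (eq (fromℕℚ n) d) (0≤* (0≤fromℕℚ n) (square≥0 d)) ⟩
    (1ℚ + d) * (1ℚ + fromℕℚ n * d) ≤⟨ *-monoˡ-≤ (0≤+ 0≤1 0≤d) (bernoulli n 0≤d) ⟩
    (1ℚ + d) * (1ℚ + d) ^ n ∎
    where
    eq = solve-ℚ 2 (λ n d → (Κ 1ℚ ⊕ d) ⊗ (Κ 1ℚ ⊕ n ⊗ d) , Κ 1ℚ ⊕ (Κ 1ℚ ⊕ n) ⊗ d ⊕ n ⊗ (d ⊗ d)) refl

  -- Since (1 + d)(1 - (n + 1) d) = 1 - n d - (n + 1) d². This is the bound (1 + d)^n ≤ 1 / (1 - n
  -- d), multiplied out so that it makes sense for either sign of 1 - n d.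
  bernoulli⁻ : ∀ {d} n → 0ℚ ≤ d → (1ℚ + d) ^ n * (1ℚ - fromℕℚ n * d) ≤ 1ℚ
  bernoulli⁻ {d} zero 0≤d = ℚ.≤-reflexive (trans (ℚ.*-identityˡ _)
    (trans (cong (λ z → 1ℚ - z) (ℚ.*-zeroˡ d)) (ℚ.+-identityʳ 1ℚ)))
  bernoulli⁻ {d} (suc n) 0≤d = begin
    (1ℚ + d) * c * (1ℚ - fromℕℚ (suc n) * d) ≡⟨ cong (λ z → (1ℚ + d) * c * (1ℚ - z * d)) (fromℕℚ-suc n) ⟩
    (1ℚ + d) * c * (1ℚ - (1ℚ + fromℕℚ n) * d) ≤⟨ ≤-by _ (eq c (fromℕℚ n) d)
                                                       (0≤* (0≤^ n (0≤+ 0≤1 0≤d)) (0≤* (0≤+ 0≤1 (0≤fromℕℚ n)) (square≥0 d))) ⟩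
    c * (1ℚ - fromℕℚ n * d) ≤⟨ bernoulli⁻ n 0≤d ⟩
    1ℚ ∎
    where
    c = (1ℚ + d) ^ n
    eq = solve-ℚ 3 (λ c n d → c ⊗ (Κ 1ℚ ⊕ ⊝ (n ⊗ d)) , (Κ 1ℚ ⊕ d) ⊗ c ⊗ (Κ 1ℚ ⊕ ⊝ ((Κ 1ℚ ⊕ n) ⊗ d)) ⊕ c ⊗ ((Κ 1ℚ ⊕ n) ⊗ (d ⊗ d))) refl

open Rationals

-- Finite sums, finite products and indicator functions.

module Sums where

  open ℚ-Operations using (_+_; _*_; _-_; -_; _≤_; _<_; ∣_∣)
  open ℚ.≤-Reasoning

  private variable
    A B : Set

  ∑ : (A → ℚ) → List A → ℚ
  ∑ f [] = 0ℚ
  ∑ f (x ∷ xs) = f x + ∑ f xs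

  ∏ᶠ : (A → ℚ) → List A → ℚ
  ∏ᶠ f [] = 1ℚ
  ∏ᶠ f (x ∷ xs) = f x * ∏ᶠ f xs

  ∑≤ : ∀ {f g : A → ℚ} xs → (∀ {x} → x ∈ xs → f x ≤ g x) → ∑ f xs ≤ ∑ g xs
  ∑≤ [] le = ℚ.≤-refl
  ∑≤ (x ∷ xs) le = ℚ.+-mono-≤ (le (here refl)) (∑≤ xs (le ∘ there))

  ∑-cong : ∀ {f g : A → ℚ} xs → (∀ {x} → x ∈ xs → f x ≡ g x) → ∑ f xs ≡ ∑ g xs
  ∑-cong [] eq = refl
  ∑-cong (x ∷ xs) eq = cong₂ _+_ (eq (here refl)) (∑-cong xs (eq ∘ there))

  0≤∑ : ∀ {f : A → ℚ} xs → (∀ {x} → x ∈ xs → 0ℚ ≤ f x) → 0ℚ ≤ ∑ f xs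
  0≤∑ [] 0≤ = ℚ.≤-refl
  0≤∑ (x ∷ xs) 0≤ = 0≤+ (0≤ (here refl)) (0≤∑ xs (0≤ ∘ there))

  ∑-+ : ∀ (f g : A → ℚ) xs → ∑ (λ x → f x + g x) xs ≡ ∑ f xs + ∑ g xs
  ∑-+ f g [] = refl
  ∑-+ f g (x ∷ xs) = trans (cong (λ z → f x + g x + z) (∑-+ f g xs)) (eq (f x) (g x) (∑ f xs) (∑ g xs))
    where
    eq = solve-ℚ 4 (λ a b c d → a ⊕ b ⊕ (c ⊕ d) , a ⊕ c ⊕ (b ⊕ d)) refl

  ∑-* : ∀ c (f : A → ℚ) xs → ∑ (λ x → c * f x) xs ≡ c * ∑ f xs
  ∑-* c f [] = sym (ℚ.*-zeroʳ c)
  ∑-* c f (x ∷ xs) = trans (cong (c * f x +_) (∑-* c f xs)) (sym (ℚ.*-distribˡ-+ c (f x) (∑ f xs)))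

  ∑-const : ∀ c (xs : List A) → ∑ (λ _ → c) xs ≡ fromℕℚ (length xs) * c
  ∑-const c [] = sym (ℚ.*-zeroˡ c)
  ∑-const c (x ∷ xs) = trans (cong (c +_) (∑-const c xs))
    (trans (eq c (fromℕℚ (length xs))) (cong (_* c) (sym (fromℕℚ-suc (length xs)))))
    where
    eq = solve-ℚ 2 (λ c n → c ⊕ n ⊗ c , (Κ 1ℚ ⊕ n) ⊗ c) refl

  ∑-map : ∀ (f : B → ℚ) (k : A → B) xs → ∑ f (map k xs) ≡ ∑ (f ∘ k) xs
  ∑-map f k [] = refl
  ∑-map f k (x ∷ xs) = cong (f (k x) +_) (∑-map f k xs)

  ∑-++ : ∀ (f : A → ℚ) xs ys → ∑ f (xs ++ ys) ≡ ∑ f xs + ∑ f ys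
  ∑-++ f [] ys = sym (ℚ.+-identityˡ _)
  ∑-++ f (x ∷ xs) ys = trans (cong (f x +_) (∑-++ f xs ys)) (sym (ℚ.+-assoc (f x) (∑ f xs) (∑ f ys)))

  ∑-↭ : ∀ (f : A → ℚ) {xs ys} → xs ↭ ys → ∑ f xs ≡ ∑ f ys
  ∑-↭ f ↭.refl = refl
  ∑-↭ f (↭.prep x p) = cong (f x +_) (∑-↭ f p)
  ∑-↭ f (↭.swap {xs = xs} {ys} x y p) = trans (cong (λ z → f x + (f y + z)) (∑-↭ f p)) (eq (f x) (f y) (∑ f ys))
    where
    eq = solve-ℚ 3 (λ a b c → a ⊕ (b ⊕ c) , b ⊕ (a ⊕ c)) refl
  ∑-↭ f (↭.trans p q) = trans (∑-↭ f p) (∑-↭ f q)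

  ∏ᶠ-↭ : ∀ (f : A → ℚ) {xs ys} → xs ↭ ys → ∏ᶠ f xs ≡ ∏ᶠ f ys
  ∏ᶠ-↭ f ↭.refl = refl
  ∏ᶠ-↭ f (↭.prep x p) = cong (f x *_) (∏ᶠ-↭ f p)
  ∏ᶠ-↭ f (↭.swap {xs = xs} {ys} x y p) = trans (cong (λ z → f x * (f y * z)) (∏ᶠ-↭ f p)) (eq (f x) (f y) (∏ᶠ f ys))
    where
    eq = solve-ℚ 3 (λ a b c → a ⊗ (b ⊗ c) , b ⊗ (a ⊗ c)) refl
  ∏ᶠ-↭ f (↭.trans p q) = trans (∏ᶠ-↭ f p) (∏ᶠ-↭ f q)

  -- Sums and products over Gaussian integers are rearranged through this: lists without repetitions
  -- are compared as sets.
  unique-set⇒↭ : ∀ {xs ys : List A} → Unique xs → Unique ys →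
    (∀ {x} → x ∈ xs → x ∈ ys) → (∀ {x} → x ∈ ys → x ∈ xs) → xs ↭ ys
  unique-set⇒↭ u v f g = ∼bag⇒↭ (unique∧set⇒bag u v (mk⇔ f g))

  𝟙 : ∀ {P : Set} → Dec P → ℚ
  𝟙 (yes _) = 1ℚ
  𝟙 (no _) = 0ℚ

  0≤𝟙 : ∀ {P : Set} (d : Dec P) → 0ℚ ≤ 𝟙 d
  0≤𝟙 (yes _) = 0≤1
  0≤𝟙 (no _) = ℚ.≤-refl

  𝟙≤1 : ∀ {P : Set} (d : Dec P) → 𝟙 d ≤ 1ℚ
  𝟙≤1 (yes _) = ℚ.≤-refl
  𝟙≤1 (no _) = 0≤1

  𝟙-yes : ∀ {P : Set} (d : Dec P) → P → 𝟙 d ≡ 1ℚ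
  𝟙-yes (yes _) p = refl
  𝟙-yes (no ¬p) p = ⊥-elim (¬p p)

  𝟙-no : ∀ {P : Set} (d : Dec P) → ¬ P → 𝟙 d ≡ 0ℚ
  𝟙-no (yes p) ¬p = ⊥-elim (¬p p)
  𝟙-no (no _) ¬p = refl

  𝟙-cong : ∀ {P Q : Set} (d : Dec P) (e : Dec Q) → (P → Q) → (Q → P) → 𝟙 d ≡ 𝟙 e
  𝟙-cong (yes p) e f g = sym (𝟙-yes e (f p))
  𝟙-cong (no ¬p) e f g = sym (𝟙-no e (¬p ∘ g))

  ∑-filter : ∀ {P : Pred A 0ℓ} (P? : Decidable P) (f : A → ℚ) xs →
             ∑ f (filter P? xs) ≡ ∑ (λ x → 𝟙 (P? x) * f x) xs
  ∑-filter P? f [] = refl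
  ∑-filter P? f (x ∷ xs) with P? x
  ... | yes _ = cong₂ _+_ (sym (ℚ.*-identityˡ (f x))) (∑-filter P? f xs)
  ... | no _ = trans (∑-filter P? f xs) (sym (trans (cong (_+ _) (ℚ.*-zeroˡ (f x))) (ℚ.+-identityˡ _)))

  -- The head of `xs` is cut out of `ys`. As it does not recur in `xs`, the other entries lie in
  -- what is left of `ys`.
  ∑-⊆ : ∀ {f : A → ℚ} {xs ys} → Unique xs → (∀ {x} → x ∈ xs → x ∈ ys) → (∀ {x} → x ∈ ys → 0ℚ ≤ f x) →
        ∑ f xs ≤ ∑ f ys
  ∑-⊆ {xs = []} {ys} u sub 0≤ = 0≤∑ ys 0≤
  ∑-⊆ {f = f} {x ∷ xs} {ys} (x∉ ∷ u) sub 0≤ with ∈-∃++ (sub (here refl))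
  ... | as , bs , refl = begin
    f x + ∑ f xs ≤⟨ ℚ.+-monoʳ-≤ (f x) (∑-⊆ u sub′ (0≤ ∘ weaken)) ⟩
    f x + ∑ f (as ++ bs) ≡⟨ cong (f x +_) (∑-++ f as bs) ⟩
    f x + (∑ f as + ∑ f bs) ≡⟨ eq (f x) (∑ f as) (∑ f bs) ⟩
    ∑ f as + (f x + ∑ f bs) ≡⟨ ∑-++ f as (x ∷ bs) ⟨
    ∑ f (as ++ x ∷ bs) ∎
    where
    eq = solve-ℚ 3 (λ a b c → a ⊕ (b ⊕ c) , b ⊕ (a ⊕ c)) refl
    weaken : ∀ {y} → y ∈ as ++ bs → y ∈ as ++ x ∷ bs
    weaken y∈ with ∈-++⁻ as y∈
    ... | inj₁ p = ∈-++⁺ˡ p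
    ... | inj₂ p = ∈-++⁺ʳ as (there p)
    sub′ : ∀ {y} → y ∈ xs → y ∈ as ++ bs
    sub′ y∈ with ∈-++⁻ as (sub (there y∈))
    ... | inj₁ p = ∈-++⁺ˡ p
    ... | inj₂ (here refl) = ⊥-elim (All.lookup x∉ y∈ refl)
    ... | inj₂ (there p) = ∈-++⁺ʳ as p

  0≤∏ : ∀ {f : A → ℚ} xs → (∀ {x} → x ∈ xs → 0ℚ ≤ f x) → 0ℚ ≤ ∏ᶠ f xs
  0≤∏ [] 0≤ = 0≤1
  0≤∏ (x ∷ xs) 0≤ = 0≤* (0≤ (here refl)) (0≤∏ xs (0≤ ∘ there))

  ∏≤∏ : ∀ {f g : A → ℚ} xs → (∀ {x} → x ∈ xs → 0ℚ ≤ f x) → (∀ {x} → x ∈ xs → f x ≤ g x) → ∏ᶠ f xs ≤ ∏ᶠ g xs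
  ∏≤∏ [] 0≤ le = ℚ.≤-refl
  ∏≤∏ (x ∷ xs) 0≤ le = *-mono-≤ (0≤ (here refl)) (0≤∏ xs λ p → ℚ.≤-trans (0≤ (there p)) (le (there p)))
    (le (here refl)) (∏≤∏ xs (0≤ ∘ there) (le ∘ there))

  ∏-cong : ∀ {f g : A → ℚ} xs → (∀ {x} → x ∈ xs → f x ≡ g x) → ∏ᶠ f xs ≡ ∏ᶠ g xs
  ∏-cong [] eq = refl
  ∏-cong (x ∷ xs) eq = cong₂ _*_ (eq (here refl)) (∏-cong xs (eq ∘ there))

  ∏-* : ∀ (f g : A → ℚ) xs → ∏ᶠ (λ x → f x * g x) xs ≡ ∏ᶠ f xs * ∏ᶠ g xs
  ∏-* f g [] = refl
  ∏-* f g (x ∷ xs) = trans (cong (λ z → f x * g x * z) (∏-* f g xs)) (eq (f x) (g x) (∏ᶠ f xs) (∏ᶠ g xs))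
    where
    eq = solve-ℚ 4 (λ a b c d → a ⊗ b ⊗ (c ⊗ d) , a ⊗ c ⊗ (b ⊗ d)) refl

  ∏-^ : ∀ (f : A → ℚ) n xs → ∏ᶠ (λ x → f x ^ n) xs ≡ ∏ᶠ f xs ^ n
  ∏-^ f n [] = sym (1^ n)
  ∏-^ f n (x ∷ xs) = trans (cong (f x ^ n *_) (∏-^ f n xs)) (sym (^-distrib-* (f x) (∏ᶠ f xs) n))

  ∏-filter : ∀ {P : Pred A 0ℓ} (P? : Decidable P) (f : A → ℚ) xs → (∀ {x} → x ∈ xs → ¬ P x → f x ≡ 1ℚ) →
             ∏ᶠ f (filter P? xs) ≡ ∏ᶠ f xs
  ∏-filter P? f [] triv = refl
  ∏-filter P? f (x ∷ xs) triv with P? x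
  ... | yes _ = cong (f x *_) (∏-filter P? f xs (triv ∘ there))
  ... | no ¬p = trans (∏-filter P? f xs (triv ∘ there))
    (sym (trans (cong (_* ∏ᶠ f xs) (triv (here refl) ¬p)) (ℚ.*-identityˡ _)))

  ∑ⁿ : ℕ → (ℕ → ℚ) → ℚ
  ∑ⁿ zero f = 0ℚ
  ∑ⁿ (suc n) f = ∑ⁿ n f + f n

  ∑ⁿ-cong : ∀ n {f g : ℕ → ℚ} → (∀ i → i ℕ.< n → f i ≡ g i) → ∑ⁿ n f ≡ ∑ⁿ n g
  ∑ⁿ-cong zero eq = refl
  ∑ⁿ-cong (suc n) eq = cong₂ _+_ (∑ⁿ-cong n λ i i<n → eq i (ℕ.m<n⇒m<1+n i<n)) (eq n ℕ.≤-refl)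

  ∑ⁿ-≤ : ∀ n {f g : ℕ → ℚ} → (∀ i → i ℕ.< n → f i ≤ g i) → ∑ⁿ n f ≤ ∑ⁿ n g
  ∑ⁿ-≤ zero le = ℚ.≤-refl
  ∑ⁿ-≤ (suc n) le = ℚ.+-mono-≤ (∑ⁿ-≤ n λ i i<n → le i (ℕ.m<n⇒m<1+n i<n)) (le n ℕ.≤-refl)

  0≤∑ⁿ : ∀ n {f : ℕ → ℚ} → (∀ i → 0ℚ ≤ f i) → 0ℚ ≤ ∑ⁿ n f
  0≤∑ⁿ zero 0≤ = ℚ.≤-refl
  0≤∑ⁿ (suc n) 0≤ = 0≤+ (0≤∑ⁿ n 0≤) (0≤ n)

  ∑ⁿ-+ : ∀ n (f g : ℕ → ℚ) → ∑ⁿ n (λ i → f i + g i) ≡ ∑ⁿ n f + ∑ⁿ n g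
  ∑ⁿ-+ zero f g = refl
  ∑ⁿ-+ (suc n) f g = trans (cong (_+ (f n + g n)) (∑ⁿ-+ n f g)) (eq (∑ⁿ n f) (∑ⁿ n g) (f n) (g n))
    where
    eq = solve-ℚ 4 (λ a b c d → a ⊕ b ⊕ (c ⊕ d) , a ⊕ c ⊕ (b ⊕ d)) refl

  ∑ⁿ-* : ∀ n c (f : ℕ → ℚ) → ∑ⁿ n (λ i → c * f i) ≡ c * ∑ⁿ n f
  ∑ⁿ-* zero c f = sym (ℚ.*-zeroʳ c)
  ∑ⁿ-* (suc n) c f = trans (cong (_+ c * f n) (∑ⁿ-* n c f)) (sym (ℚ.*-distribˡ-+ c (∑ⁿ n f) (f n)))

  ∑ⁿ-const : ∀ n c → ∑ⁿ n (λ _ → c) ≡ fromℕℚ n * c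
  ∑ⁿ-const zero c = sym (ℚ.*-zeroˡ c)
  ∑ⁿ-const (suc n) c = trans (cong (_+ c) (∑ⁿ-const n c)) (trans (eq c (fromℕℚ n)) (cong (_* c) (sym (fromℕℚ-suc n))))
    where
    eq = solve-ℚ 2 (λ c n → n ⊗ c ⊕ c , (Κ 1ℚ ⊕ n) ⊗ c) refl

  ∣∑ⁿ∣ : ∀ n (f : ℕ → ℚ) → ∣ ∑ⁿ n f ∣ ≤ ∑ⁿ n (λ i → ∣ f i ∣)
  ∣∑ⁿ∣ zero f = ℚ.≤-refl
  ∣∑ⁿ∣ (suc n) f = ℚ.≤-trans (ℚ.∣p+q∣≤∣p∣+∣q∣ (∑ⁿ n f) (f n)) (ℚ.+-monoˡ-≤ ∣ f n ∣ (∣∑ⁿ∣ n f))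

  ∑ⁿ-suc : ∀ n (f : ℕ → ℚ) → ∑ⁿ (suc n) f ≡ f 0 + ∑ⁿ n (f ∘ suc)
  ∑ⁿ-suc zero f = trans (ℚ.+-identityˡ (f 0)) (sym (ℚ.+-identityʳ (f 0)))
  ∑ⁿ-suc (suc n) f = trans (cong (_+ f (suc n)) (∑ⁿ-suc n f)) (ℚ.+-assoc (f 0) (∑ⁿ n (f ∘ suc)) (f (suc n)))

  ∑ⁿ-mono : ∀ {m n} {f : ℕ → ℚ} → (∀ i → 0ℚ ≤ f i) → m ℕ.≤ n → ∑ⁿ m f ≤ ∑ⁿ n f
  ∑ⁿ-mono {m} {zero} 0≤ m≤n = ℚ.≤-reflexive (cong (λ l → ∑ⁿ l _) (ℕ.n≤0⇒n≡0 m≤n))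
  ∑ⁿ-mono {m} {suc n} 0≤ m≤n with ℕ.m≤n⇒m<n∨m≡n m≤n
  ... | inj₁ (s≤s m≤n′) = ℚ.≤-trans (∑ⁿ-mono 0≤ m≤n′) (p≤p+q (0≤ n))
  ... | inj₂ refl = ℚ.≤-refl

  ∑ⁿ-split : ∀ m n (f : ℕ → ℚ) → ∑ⁿ (n ℕ.+ m) f ≡ ∑ⁿ m f + ∑ⁿ n (λ i → f (i ℕ.+ m))
  ∑ⁿ-split m zero f = sym (ℚ.+-identityʳ _)
  ∑ⁿ-split m (suc n) f = trans (cong (_+ f (n ℕ.+ m)) (∑ⁿ-split m n f)) (ℚ.+-assoc (∑ⁿ m f) _ _)

  ∑-∑ⁿ : ∀ n (F : A → ℕ → ℚ) xs → ∑ (λ x → ∑ⁿ n (F x)) xs ≡ ∑ⁿ n (λ i → ∑ (λ x → F x i) xs)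
  ∑-∑ⁿ zero F xs = trans (∑-const 0ℚ xs) (ℚ.*-zeroʳ (fromℕℚ (length xs)))
  ∑-∑ⁿ (suc n) F xs = trans (∑-+ (λ x → ∑ⁿ n (F x)) (λ x → F x n) xs) (cong (_+ ∑ (λ x → F x n) xs) (∑-∑ⁿ n F xs))

  ∑ⁿ-swap : ∀ m n (F : ℕ → ℕ → ℚ) → ∑ⁿ m (λ i → ∑ⁿ n (F i)) ≡ ∑ⁿ n (λ j → ∑ⁿ m (λ i → F i j))
  ∑ⁿ-swap zero n F = sym (trans (∑ⁿ-const n 0ℚ) (ℚ.*-zeroʳ (fromℕℚ n)))
  ∑ⁿ-swap (suc m) n F = trans (cong (_+ ∑ⁿ n (F m)) (∑ⁿ-swap m n F)) (sym (∑ⁿ-+ n (λ j → ∑ⁿ m (λ i → F i j)) (F m)))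

  geometric-sum : ∀ n ρ → (1ℚ - ρ) * ∑ⁿ n (ρ ^_) ≡ 1ℚ - ρ ^ n
  geometric-sum zero ρ = ℚ.*-zeroʳ (1ℚ - ρ)
  geometric-sum (suc n) ρ = trans (ℚ.*-distribˡ-+ (1ℚ - ρ) (∑ⁿ n (ρ ^_)) (ρ ^ n))
    (trans (cong (_+ (1ℚ - ρ) * ρ ^ n) (geometric-sum n ρ)) (eq ρ (ρ ^ n)))
    where
    eq = solve-ℚ 2 (λ p q → Κ 1ℚ ⊕ ⊝ q ⊕ (Κ 1ℚ ⊕ ⊝ p) ⊗ q , Κ 1ℚ ⊕ ⊝ (p ⊗ q)) refl

  ∑-applyUpTo : ∀ (f : A → ℚ) g n → ∑ f (applyUpTo g n) ≡ ∑ⁿ n (f ∘ g)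
  ∑-applyUpTo f g zero = refl
  ∑-applyUpTo f g (suc n) = trans (cong (f (g 0) +_) (∑-applyUpTo f (g ∘ suc) n)) (sym (∑ⁿ-suc n (f ∘ g)))

open Sums

-- Units, associates and sums over multiples.

module Representatives where

  open MagmaDefs (Semiring.*-rawMagma (CommutativeRing.semiring ℤ[i]-commutativeRing)) using (_,_)
  open CommutativeRing ℤ[i]-commutativeRing public
    using () renaming (*-comm to *ᵍ-comm; *-assoc to *ᵍ-assoc; *-identityˡ to *ᵍ-identityˡ; *-identityʳ to *ᵍ-identityʳ;
                       zeroˡ to *ᵍ-zeroˡ; zeroʳ to *ᵍ-zeroʳ)

  ℤ[i]-ring : AlmostCommutativeRing 0ℓ 0ℓ
  ℤ[i]-ring = fromCommutativeRing ℤ[i]-commutativeRing λ α → dec⇒maybe (0ᵍ ≟ᵍ α)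

  open RingSolver ℤ[i]-ring public using () renaming (solve to solve-ℤ[i])

  *ᵍ-≢0 : ∀ {α β} → α ≢ 0ᵍ → β ≢ 0ᵍ → α *ᵍ β ≢ 0ᵍ
  *ᵍ-≢0 {α} {β} α≢0 β≢0 αβ≡0 = [ α≢0 ∘ norm≡0⇒≡0 α , β≢0 ∘ norm≡0⇒≡0 β ]′
    (ℕ.m*n≡0⇒m≡0∨n≡0 (norm α) (trans (sym (norm-* α β)) (cong norm αβ≡0)))

  *ᵍ-cancelˡ : ∀ {π α β} → π ≢ 0ᵍ → π *ᵍ α ≡ π *ᵍ β → α ≡ β
  *ᵍ-cancelˡ {π} {α} {β} π≢0 eq with α +ᵍ -ᵍ β ≟ᵍ 0ᵍ
  ... | yes α-β≡0 = trans (e₁ α β) (trans (cong (_+ᵍ β) α-β≡0) (CommutativeRing.+-identityˡ ℤ[i]-commutativeRing β))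
    where
    e₁ = solve-ℤ[i] 2 (λ α β → α , α ⊕ ⊝ β ⊕ β) refl
  ... | no α-β≢0 = ⊥-elim (*ᵍ-≢0 π≢0 α-β≢0 (trans (e₂ π α β)
      (trans (cong (_+ᵍ -ᵍ (π *ᵍ β)) eq) (CommutativeRing.-‿inverseʳ ℤ[i]-commutativeRing (π *ᵍ β)))))
    where
    e₂ = solve-ℤ[i] 3 (λ π α β → π ⊗ (α ⊕ ⊝ β) , π ⊗ α ⊕ ⊝ (π ⊗ β)) refl

  Unitᵍ : ℤ[i] → Set
  Unitᵍ u = ∃ λ u′ → u′ *ᵍ u ≡ 1ᵍ

  unit≢0 : ∀ {u} → Unitᵍ u → u ≢ 0ᵍ
  unit≢0 (u′ , eq) refl = case trans (sym eq) (*ᵍ-zeroʳ u′) of λ ()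

  unit-norm : ∀ {u} → Unitᵍ u → norm u ≡ 1
  unit-norm {u} (u′ , eq) = ℕ.m*n≡1⇒n≡1 (norm u′) (norm u) (trans (sym (norm-* u′ u)) (cong norm eq))

  norm-1⇒unit : ∀ {u} → norm u ≡ 1 → Unitᵍ u
  norm-1⇒unit {u} eq = conj u , trans (conj-* u) (cong (λ n → (ℤ.+ n) +i (ℤ.+ 0)) eq)

  unit-* : ∀ {u v} → Unitᵍ u → Unitᵍ v → Unitᵍ (u *ᵍ v)
  unit-* {u} {v} (u′ , eq) (v′ , eq′) = u′ *ᵍ v′ , trans (e u u′ v v′) (trans (cong₂ _*ᵍ_ eq eq′) (*ᵍ-identityˡ 1ᵍ))
    where
    e = solve-ℤ[i] 4 (λ u u′ v v′ → u′ ⊗ v′ ⊗ (u ⊗ v) , u′ ⊗ u ⊗ (v′ ⊗ v)) refl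

  unit-inverse : ∀ {u} ((u′ , _) : Unitᵍ u) → Unitᵍ u′
  unit-inverse {u} (u′ , eq) = u , trans (*ᵍ-comm u u′) eq

  norm-unit-* : ∀ {u} → Unitᵍ u → ∀ α → norm (u *ᵍ α) ≡ norm α
  norm-unit-* {u} U α = trans (norm-* u α) (trans (cong (ℕ._* norm α) (unit-norm U)) (ℕ.*-identityˡ _))

  unit-cases : ∀ u → norm u ≡ 1 → u ≡ 1ᵍ ⊎ u ≡ -ᵍ 1ᵍ ⊎ u ≡ iᵍ ⊎ u ≡ -ᵍ iᵍ
  unit-cases ((ℤ.+ 0) +i (ℤ.+ 1)) eq = inj₂ (inj₂ (inj₁ refl))
  unit-cases ((ℤ.+ 0) +i (-[1+ 0 ])) eq = inj₂ (inj₂ (inj₂ refl))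
  unit-cases ((ℤ.+ 1) +i (ℤ.+ 0)) eq = inj₁ refl
  unit-cases (-[1+ 0 ] +i (ℤ.+ 0)) eq = inj₂ (inj₁ refl)
  unit-cases ((ℤ.+ 0) +i (ℤ.+ 0)) ()
  unit-cases ((ℤ.+ 0) +i (ℤ.+ (suc (suc b)))) ()
  unit-cases ((ℤ.+ 0) +i (-[1+ suc b ])) ()
  unit-cases ((ℤ.+ 1) +i (ℤ.+ (suc b))) ()
  unit-cases ((ℤ.+ 1) +i (-[1+ b ])) ()
  unit-cases ((ℤ.+ (suc (suc a))) +i b) ()
  unit-cases (-[1+ 0 ] +i (ℤ.+ (suc b))) ()
  unit-cases (-[1+ 0 ] +i (-[1+ b ])) ()
  unit-cases (-[1+ suc a ] +i b) ()

  Quadrant : ℤ[i] → Set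
  Quadrant α = ∃ λ a → ∃ λ b → α ≡ (ℤ.+ suc a) +i (ℤ.+ b)

  quadrant≢0 : ∀ {α} → Quadrant α → α ≢ 0ᵍ
  quadrant≢0 (a , b , refl) ()

  quadrant-1 : Quadrant 1ᵍ
  quadrant-1 = 0 , 0 , refl

  neg-* : ∀ α → -ᵍ 1ᵍ *ᵍ α ≡ -ᵍ α
  neg-* (a +i b) = cong₂ _+i_ (re-eq a b) (im-eq a b)
    where
    re-eq = solve-ℤ 2 (λ a b → Κ -[1+ 0 ] ⊗ a ⊕ ⊝ (Κ (ℤ.+ 0) ⊗ b) , ⊝ a) refl
    im-eq = solve-ℤ 2 (λ a b → Κ -[1+ 0 ] ⊗ b ⊕ Κ (ℤ.+ 0) ⊗ a , ⊝ b) refl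

  i-* : ∀ a b → iᵍ *ᵍ (a +i b) ≡ (ℤ.- b) +i a
  i-* a b = cong₂ _+i_ (re-eq a b) (im-eq a b)
    where
    re-eq = solve-ℤ 2 (λ a b → Κ (ℤ.+ 0) ⊗ a ⊕ ⊝ (Κ (ℤ.+ 1) ⊗ b) , ⊝ b) refl
    im-eq = solve-ℤ 2 (λ a b → Κ (ℤ.+ 0) ⊗ b ⊕ Κ (ℤ.+ 1) ⊗ a , a) refl

  -i-* : ∀ a b → -ᵍ iᵍ *ᵍ (a +i b) ≡ b +i (ℤ.- a)
  -i-* a b = cong₂ _+i_ (re-eq a b) (im-eq a b)
    where
    re-eq = solve-ℤ 2 (λ a b → Κ (ℤ.+ 0) ⊗ a ⊕ ⊝ (Κ -[1+ 0 ] ⊗ b) , b) refl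
    im-eq = solve-ℤ 2 (λ a b → Κ (ℤ.+ 0) ⊗ b ⊕ Κ -[1+ 0 ] ⊗ a , ⊝ a) refl

  -- Multiplication of a + b i, where a > 0 and b ≥ 0, by -1, i and -i gives real part -a, real part
  -- -b and imaginary part -a respectively, so that only the unit 1 keeps the number in the
  -- quadrant.
  quadrant-unique : ∀ {u α} → Unitᵍ u → Quadrant α → Quadrant (u *ᵍ α) → u *ᵍ α ≡ α
  quadrant-unique {u} {α} U (a , b , α≡) (c , d , uα≡) =
    [ (λ u≡ → trans (cong (_*ᵍ α) u≡) (*ᵍ-identityˡ α))
    , [ (λ u≡ → ⊥-elim (negative a (trans (cong (ℤ.-_ ∘ re) (sym α≡)) (trans (sym (cong re (neg-* α))) (re≡ u≡)))))
    , [ (λ u≡ → ⊥-elim (nonpositive b (trans (cong (ℤ.-_ ∘ im) (sym α≡)) (trans (sym (cong re (i-* (re α) (im α)))) (re≡ u≡)))))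
    , (λ u≡ → ⊥-elim (negative′ a (trans (cong (ℤ.-_ ∘ re) (sym α≡)) (trans (sym (cong im (-i-* (re α) (im α)))) (im≡ u≡))))) ]′ ]′ ]′
    (unit-cases u (unit-norm U))
    where
    re≡ : ∀ {v} → u ≡ v → re (v *ᵍ α) ≡ ℤ.+ suc c
    re≡ u≡ = trans (cong (λ z → re (z *ᵍ α)) (sym u≡)) (cong re uα≡)
    im≡ : ∀ {v} → u ≡ v → im (v *ᵍ α) ≡ ℤ.+ d
    im≡ u≡ = trans (cong (λ z → im (z *ᵍ α)) (sym u≡)) (cong im uα≡)
    negative : ∀ a → ℤ.- (ℤ.+ suc a) ≢ ℤ.+ suc c
    negative a ()
    nonpositive : ∀ b → ℤ.- (ℤ.+ b) ≢ ℤ.+ suc c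
    nonpositive zero ()
    nonpositive (suc b) ()
    negative′ : ∀ a → ℤ.- (ℤ.+ suc a) ≢ ℤ.+ d
    negative′ a ()

  toQuadrant : ∀ α → α ≢ 0ᵍ → ∃ λ u → Unitᵍ u × Quadrant (u *ᵍ α)
  toQuadrant α@((ℤ.+ 0) +i (ℤ.+ 0)) α≢0 = ⊥-elim (α≢0 refl)
  toQuadrant α@((ℤ.+ 0) +i (ℤ.+ suc b)) α≢0 = -ᵍ iᵍ , (iᵍ , refl) , b , 0 , -i-* (ℤ.+ 0) (ℤ.+ suc b)
  toQuadrant α@((ℤ.+ suc a) +i (ℤ.+ b)) α≢0 = 1ᵍ , (1ᵍ , refl) , a , b , *ᵍ-identityˡ α
  toQuadrant α@((ℤ.+ a) +i -[1+ b ]) α≢0 = iᵍ , (-ᵍ iᵍ , refl) , b , a , i-* (ℤ.+ a) -[1+ b ]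
  toQuadrant α@(-[1+ a ] +i (ℤ.+ 0)) α≢0 = -ᵍ 1ᵍ , (-ᵍ 1ᵍ , refl) , a , 0 , neg-* α
  toQuadrant α@(-[1+ a ] +i (ℤ.+ suc b)) α≢0 = -ᵍ iᵍ , (iᵍ , refl) , b , suc a , -i-* -[1+ a ] (ℤ.+ suc b)
  toQuadrant α@(-[1+ a ] +i -[1+ b ]) α≢0 = -ᵍ 1ᵍ , (-ᵍ 1ᵍ , refl) , a , suc b , neg-* α

  -- The value at 0, which has no associate in the quadrant, is 0.
  rep : ℤ[i] → ℤ[i]
  rep α with α ≟ᵍ 0ᵍ
  ... | yes _ = 0ᵍ
  ... | no α≢0 = proj₁ (toQuadrant α α≢0) *ᵍ α

  rep-spec : ∀ α → α ≢ 0ᵍ → ∃ λ u → Unitᵍ u × rep α ≡ u *ᵍ α × Quadrant (rep α)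
  rep-spec α α≢0 with α ≟ᵍ 0ᵍ
  ... | yes α≡0 = ⊥-elim (α≢0 α≡0)
  ... | no α≢0′ = let u , U , q = toQuadrant α α≢0′ in u , U , refl , q

  ∈-representatives⁺ : ∀ n {α} → Quadrant α → norm α ℕ.≤ n → α ∈ representatives n
  ∈-representatives⁺ n {α} (a , b , refl) N≤n = ∈-filter⁺ (λ α → norm α ℕ.≤? n)
    (∈-cartesianProductWith⁺ (λ a b → (ℤ.+ suc a) +i (ℤ.+ b)) (∈-upTo⁺ (ℕ.≤-trans (∣re∣≤norm α) N≤n))
      (∈-upTo⁺ (s≤s (ℕ.≤-trans (∣im∣≤norm α) N≤n)))) N≤n

  ∈-representatives⁻ : ∀ n {α} → α ∈ representatives n → Quadrant α × norm α ℕ.≤ n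
  ∈-representatives⁻ n α∈ with ∈-filter⁻ (λ α → norm α ℕ.≤? n) α∈
  ... | α∈′ , N≤n with ∈-cartesianProductWith⁻ (λ a b → (ℤ.+ suc a) +i (ℤ.+ b)) (upTo n) (upTo (suc n)) α∈′
  ... | a , b , _ , _ , eq = (a , b , eq) , N≤n

  representatives-unique : ∀ n → Unique (representatives n)
  representatives-unique n = Unique.filter⁺ (λ α → norm α ℕ.≤? n)
    (Unique.cartesianProductWith⁺ _ (λ { refl → refl , refl }) (Unique.upTo⁺ n) (Unique.upTo⁺ (suc n)))

  unique-map : ∀ {A B : Set} {f : A → B} {xs} → (∀ {x y} → x ∈ xs → y ∈ xs → f x ≡ f y → x ≡ y) →
               Unique xs → Unique (map f xs)
  unique-map inj [] = []
  unique-map {f = f} {x ∷ xs} inj (x∉ ∷ u) =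
    All.tabulate (λ z∈ eq → let y , y∈ , z≡ = ∈-map⁻ f z∈
                            in All.lookup x∉ y∈ (inj (here refl) (there y∈) (trans eq z≡))) ∷
    unique-map (λ p q → inj (there p) (there q)) u

  m*n≤o⇒m≤o/n : ∀ {m n o} .⦃ _ : ℕ.NonZero n ⦄ → m ℕ.* n ℕ.≤ o → m ℕ.≤ o ℕ./ n
  m*n≤o⇒m≤o/n {m} {n} {o} le = subst (ℕ._≤ o ℕ./ n) (ℕ.m*n/n≡m m n) (ℕ./-monoˡ-≤ n le)

  m≤o/n⇒m*n≤o : ∀ {m n o} .⦃ _ : ℕ.NonZero n ⦄ → m ℕ.≤ o ℕ./ n → m ℕ.* n ℕ.≤ o
  m≤o/n⇒m*n≤o {m} {n} {o} le = ℕ.≤-trans (ℕ.*-monoˡ-≤ n le) (ℕ.m/n*n≤m o n)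

  AssociateInvariant : (ℤ[i] → ℚ) → Set
  AssociateInvariant F = ∀ {u} → Unitᵍ u → ∀ α → F (u *ᵍ α) ≡ F α

  -- The bijection is β ↦ π β; since π β may leave the quadrant, `rep` brings it back. Injectivity
  -- cancels π; it and surjectivity end with `quadrant-unique`.
  multiples-↭ : ∀ {π} n .⦃ _ : ℕ.NonZero (norm π) ⦄ → π ≢ 0ᵍ →
    filter (π ∣ᵍ?_) (representatives n) ↭ map (λ β → rep (π *ᵍ β)) (representatives (n ℕ./ norm π))
  multiples-↭ {π} n π≢0 = unique-set⇒↭
    (Unique.filter⁺ (π ∣ᵍ?_) (representatives-unique n))
    (unique-map inj (representatives-unique (n ℕ./ norm π)))
    to from
    where
    open ≡-Reasoning
    inj : ∀ {β γ} → β ∈ representatives (n ℕ./ norm π) → γ ∈ representatives (n ℕ./ norm π) →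
          rep (π *ᵍ β) ≡ rep (π *ᵍ γ) → β ≡ γ
    inj {β} {γ} β∈ γ∈ eq = trans (sym (quadrant-unique W qβ (subst Quadrant γ≡ qγ))) (sym γ≡)
      where
      qβ = proj₁ (∈-representatives⁻ (n ℕ./ norm π) β∈)
      qγ = proj₁ (∈-representatives⁻ (n ℕ./ norm π) γ∈)
      rβ = rep-spec (π *ᵍ β) (*ᵍ-≢0 π≢0 (quadrant≢0 qβ))
      rγ = rep-spec (π *ᵍ γ) (*ᵍ-≢0 π≢0 (quadrant≢0 qγ))
      u = proj₁ rβ
      U = proj₁ (proj₂ rβ)
      eu = proj₁ (proj₂ (proj₂ rβ))
      v = proj₁ rγ
      V = proj₁ (proj₂ rγ)
      v′ = proj₁ V
      ev′ = proj₂ V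
      ev = proj₁ (proj₂ (proj₂ rγ))
      W : Unitᵍ (v′ *ᵍ u)
      W = unit-* (unit-inverse V) U
      e₁ = solve-ℤ[i] 4 (λ π u v′ β → π ⊗ (v′ ⊗ u ⊗ β) , v′ ⊗ (u ⊗ (π ⊗ β))) refl
      γ≡ : γ ≡ v′ *ᵍ u *ᵍ β
      γ≡ = *ᵍ-cancelˡ π≢0 (sym (begin
        π *ᵍ (v′ *ᵍ u *ᵍ β) ≡⟨ e₁ π u v′ β ⟩
        v′ *ᵍ (u *ᵍ (π *ᵍ β)) ≡⟨ cong (v′ *ᵍ_) (trans (sym eu) (trans eq ev)) ⟩
        v′ *ᵍ (v *ᵍ (π *ᵍ γ)) ≡⟨ *ᵍ-assoc v′ v (π *ᵍ γ) ⟨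
        v′ *ᵍ v *ᵍ (π *ᵍ γ) ≡⟨ cong (_*ᵍ (π *ᵍ γ)) ev′ ⟩
        1ᵍ *ᵍ (π *ᵍ γ) ≡⟨ *ᵍ-identityˡ (π *ᵍ γ) ⟩
        π *ᵍ γ ∎))
    to : ∀ {α} → α ∈ filter (π ∣ᵍ?_) (representatives n) → α ∈ map (λ β → rep (π *ᵍ β)) (representatives (n ℕ./ norm π))
    to {α} α∈ with ∈-filter⁻ (π ∣ᵍ?_) α∈
    ... | α∈′ , (κ , refl) with ∈-representatives⁻ n α∈′
    ... | qα , N≤n = subst (_∈ _) α≡ (∈-map⁺ (λ β → rep (π *ᵍ β)) (∈-representatives⁺ (n ℕ./ norm π) qβ norm≤))
      where
      κ≢0 : κ ≢ 0ᵍ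
      κ≢0 refl = quadrant≢0 qα (*ᵍ-zeroˡ π)
      rκ = rep-spec κ κ≢0
      u = proj₁ rκ
      U = proj₁ (proj₂ rκ)
      qβ = proj₂ (proj₂ (proj₂ rκ))
      β≡ : rep κ ≡ u *ᵍ κ
      β≡ = proj₁ (proj₂ (proj₂ rκ))
      rπβ = rep-spec (π *ᵍ rep κ) (*ᵍ-≢0 π≢0 (quadrant≢0 qβ))
      v = proj₁ rπβ
      V = proj₁ (proj₂ rπβ)
      e₁ = solve-ℤ[i] 4 (λ π u v κ → v ⊗ (π ⊗ (u ⊗ κ)) , v ⊗ u ⊗ (κ ⊗ π)) refl
      eq : rep (π *ᵍ rep κ) ≡ v *ᵍ u *ᵍ (κ *ᵍ π)
      eq = trans (proj₁ (proj₂ (proj₂ rπβ))) (trans (cong (λ β → v *ᵍ (π *ᵍ β)) β≡) (e₁ π u v κ))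
      α≡ : rep (π *ᵍ rep κ) ≡ κ *ᵍ π
      α≡ = trans eq (quadrant-unique (unit-* V U) qα (subst Quadrant eq (proj₂ (proj₂ (proj₂ rπβ)))))
      norm≤ : norm (rep κ) ℕ.≤ n ℕ./ norm π
      norm≤ = subst (ℕ._≤ n ℕ./ norm π) (sym (trans (cong norm β≡) (norm-unit-* U κ)))
        (m*n≤o⇒m≤o/n (subst (ℕ._≤ n) (norm-* κ π) N≤n))
    from : ∀ {α} → α ∈ map (λ β → rep (π *ᵍ β)) (representatives (n ℕ./ norm π)) → α ∈ filter (π ∣ᵍ?_) (representatives n)
    from α∈ with ∈-map⁻ (λ β → rep (π *ᵍ β)) α∈
    ... | β , β∈ , refl with ∈-representatives⁻ (n ℕ./ norm π) β∈
    ... | qβ , N≤ = ∈-filter⁺ (π ∣ᵍ?_) (∈-representatives⁺ n q norm≤) ((u *ᵍ β) , trans (e₁ π u β) (sym eq))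
      where
      r = rep-spec (π *ᵍ β) (*ᵍ-≢0 π≢0 (quadrant≢0 qβ))
      u = proj₁ r
      U = proj₁ (proj₂ r)
      eq = proj₁ (proj₂ (proj₂ r))
      q = proj₂ (proj₂ (proj₂ r))
      e₁ = solve-ℤ[i] 3 (λ π u β → u ⊗ β ⊗ π , u ⊗ (π ⊗ β)) refl
      norm≤ : norm (rep (π *ᵍ β)) ℕ.≤ n
      norm≤ = subst (ℕ._≤ n) (sym (trans (cong norm eq) (trans (norm-unit-* U (π *ᵍ β)) (trans (norm-* π β) (ℕ.*-comm (norm π) (norm β))))))
        (m≤o/n⇒m*n≤o N≤)

  ∑-multiples : ∀ {π F} n .⦃ _ : ℕ.NonZero (norm π) ⦄ → π ≢ 0ᵍ → AssociateInvariant F →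
    ∑ F (filter (π ∣ᵍ?_) (representatives n)) ≡ ∑ (λ β → F (π *ᵍ β)) (representatives (n ℕ./ norm π))
  ∑-multiples {π} {F} n π≢0 inv = trans (∑-↭ F (multiples-↭ n π≢0))
    (trans (∑-map F (λ β → rep (π *ᵍ β)) (representatives (n ℕ./ norm π)))
      (∑-cong (representatives (n ℕ./ norm π)) λ {β} β∈ →
        let u , U , eq , _ = rep-spec (π *ᵍ β) (*ᵍ-≢0 π≢0 (quadrant≢0 (proj₁ (∈-representatives⁻ (n ℕ./ norm π) β∈))))
        in trans (cong F eq) (inv U (π *ᵍ β))))

open Representatives

-- Divisibility and valuations at Gaussian primes.

module Valuations where

  open ℚ-Operations using (_+_; _*_; _-_; -_; _≤_; _<_; ∣_∣)
  open MagmaDefs (Semiring.*-rawMagma (CommutativeRing.semiring ℤ[i]-commutativeRing)) using (_,_)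

  infixl 7 _÷_

  -- Division by 0 gives 0, so that quotients by norms can occur in statements without a `NonZero`
  -- instance.
  _÷_ : ℕ → ℕ → ℕ
  n ÷ zero = 0
  n ÷ d@(suc _) = n ℕ./ d

  ÷≡/ : ∀ n d .⦃ _ : ℕ.NonZero d ⦄ → n ÷ d ≡ n ℕ./ d
  ÷≡/ n (suc d) = refl

  ÷-* : ∀ n {d e} → 0 ℕ.< d → 0 ℕ.< e → n ÷ (d ℕ.* e) ≡ n ÷ d ÷ e
  ÷-* n {suc d} {suc e} _ _ = sym (ℕ.m/n/o≡m/[n*o] n (suc d) (suc e))

  ÷≤ : ∀ {d n} → 0 ℕ.< d → n ÷ d ℕ.* d ℕ.≤ n
  ÷≤ {suc d} {n} _ = ℕ.m/n*n≤m n (suc d)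

  ≤÷ : ∀ {m d n} → 0 ℕ.< d → m ℕ.* d ℕ.≤ n → m ℕ.≤ n ÷ d
  ≤÷ {d = suc d} _ = m*n≤o⇒m≤o/n

  prime≢0 : ∀ {p} → Prime p → p ≢ 0ᵍ
  prime≢0 = Prime.p≉0

  ∣ᵍ-trans : ∀ {α β γ} → α ∣ᵍ β → β ∣ᵍ γ → α ∣ᵍ γ
  ∣ᵍ-trans {α} (κ , refl) (μ , refl) = (μ *ᵍ κ) , *ᵍ-assoc μ κ α

  ∣ᵍ-*ˡ : ∀ {α β} γ → α ∣ᵍ β → α ∣ᵍ γ *ᵍ β
  ∣ᵍ-*ˡ {α} γ (κ , refl) = (γ *ᵍ κ) , *ᵍ-assoc γ κ α

  1∣ᵍ : ∀ α → 1ᵍ ∣ᵍ α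
  1∣ᵍ α = α , *ᵍ-identityʳ α

  ∣ᵍ-unit : ∀ {α β u} → Unitᵍ u → α ∣ᵍ u *ᵍ β → α ∣ᵍ β
  ∣ᵍ-unit {α} {β} {u} (u′ , eq) α∣ = subst (α ∣ᵍ_)
    (trans (sym (*ᵍ-assoc u′ u β)) (trans (cong (_*ᵍ β) eq) (*ᵍ-identityˡ β))) (∣ᵍ-*ˡ u′ α∣)

  norm-pos : ∀ {α} → α ≢ 0ᵍ → 0 ℕ.< norm α
  norm-pos {α} α≢0 = ℕ.>-nonZero⁻¹ (norm α) ⦃ norm-nonZero α≢0 ⦄

  ∣ᵍ⇒norm≤ : ∀ {α β} → β ≢ 0ᵍ → α ∣ᵍ β → norm α ℕ.≤ norm β
  ∣ᵍ⇒norm≤ {α} β≢0 (κ , refl) = subst (norm α ℕ.≤_) (sym (norm-* κ α))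
    (ℕ.m≤n*m (norm α) (norm κ) ⦃ norm-nonZero {κ} (λ { refl → β≢0 (*ᵍ-zeroˡ α) }) ⦄)

  2≤norm-prime : ∀ {p} → Prime p → 2 ℕ.≤ norm p
  2≤norm-prime {p} P with norm p in eq
  ... | 0 = ⊥-elim (prime≢0 P (norm≡0⇒≡0 p eq))
  ... | 1 = ⊥-elim (Prime.p∤1 P (norm-1⇒unit {p} eq .proj₁ , norm-1⇒unit {p} eq .proj₂))
  ... | suc (suc n) = s≤s (s≤s z≤n)

  norm-^ : ∀ p e → norm (p ^ᵍ e) ≡ norm p ℕ.^ e
  norm-^ p zero = refl
  norm-^ p (suc e) = trans (norm-* p (p ^ᵍ e)) (cong (norm p ℕ.*_) (norm-^ p e))

  ^≢0 : ∀ {p} → p ≢ 0ᵍ → ∀ e → p ^ᵍ e ≢ 0ᵍ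
  ^≢0 p≢0 zero ()
  ^≢0 p≢0 (suc e) = *ᵍ-≢0 p≢0 (^≢0 p≢0 e)

  ^-∣ᵍ : ∀ p {d e} → d ℕ.≤ e → p ^ᵍ d ∣ᵍ p ^ᵍ e
  ^-∣ᵍ p {e = e} z≤n = 1∣ᵍ (p ^ᵍ e)
  ^-∣ᵍ p {suc d} {suc e} (s≤s d≤e) with ^-∣ᵍ p d≤e
  ... | κ , eq = κ , trans (e₁ κ p (p ^ᵍ d)) (cong (p *ᵍ_) eq)
    where
    e₁ = solve-ℤ[i] 3 (λ κ p q → κ ⊗ (p ⊗ q) , p ⊗ (κ ⊗ q)) refl

  n<2^n : ∀ n → n ℕ.< 2 ℕ.^ n
  n<2^n zero = s≤s z≤n
  n<2^n (suc n) = ℕ.≤-trans (ℕ.+-mono-≤ (ℕ.≤-trans (s≤s z≤n) (n<2^n n)) (n<2^n n))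
    (ℕ.≤-reflexive (cong (2 ℕ.^ n ℕ.+_) (sym (ℕ.+-identityʳ _))))

  -- From e < 2^e ≤ N(p)^e ≤ N(α). Hence the list of exponents searched by `valuation` misses none.
  ^∣⇒<norm : ∀ {p α} → Prime p → α ≢ 0ᵍ → ∀ e → p ^ᵍ e ∣ᵍ α → e ℕ.< norm α
  ^∣⇒<norm {p} {α} P α≢0 e p^e∣α = ℕ.<-≤-trans (n<2^n e) (ℕ.≤-trans (ℕ.^-monoˡ-≤ e (2≤norm-prime P))
    (subst (ℕ._≤ norm α) (norm-^ p e) (∣ᵍ⇒norm≤ α≢0 p^e∣α)))

  module _ {p α} (P : Prime p) (α≢0 : α ≢ 0ᵍ) where

    private
      exponents : List ℕ
      exponents = filter (λ e → p ^ᵍ e ∣ᵍ? α) (upTo (suc (norm α)))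

    ^∣⇒≤valuation : ∀ {e} → p ^ᵍ e ∣ᵍ α → e ℕ.≤ valuation p α
    ^∣⇒≤valuation {e} p^e∣α = Extrema.v≤max⁺ 0 exponents
      (inj₂ (lose (∈-filter⁺ (λ e → p ^ᵍ e ∣ᵍ? α) (∈-upTo⁺ (ℕ.m<n⇒m<1+n (^∣⇒<norm P α≢0 e p^e∣α))) p^e∣α) ℕ.≤-refl))

    ^valuation∣ : p ^ᵍ valuation p α ∣ᵍ α
    ^valuation∣ = Extrema.argmax-all id {P = λ e → p ^ᵍ e ∣ᵍ α} (1∣ᵍ α)
      (All.tabulate λ e∈ → proj₂ (∈-filter⁻ (λ e → p ^ᵍ e ∣ᵍ? α) {xs = upTo (suc (norm α))} e∈))

    ≤valuation⇒^∣ : ∀ {e} → e ℕ.≤ valuation p α → p ^ᵍ e ∣ᵍ α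
    ≤valuation⇒^∣ e≤v = ∣ᵍ-trans (^-∣ᵍ p e≤v) ^valuation∣

    valuation<norm : valuation p α ℕ.< norm α
    valuation<norm = ^∣⇒<norm P α≢0 (valuation p α) ^valuation∣

  valuation-cong : ∀ {p α β} → Prime p → α ≢ 0ᵍ → β ≢ 0ᵍ →
    (∀ e → p ^ᵍ e ∣ᵍ α → p ^ᵍ e ∣ᵍ β) → (∀ e → p ^ᵍ e ∣ᵍ β → p ^ᵍ e ∣ᵍ α) → valuation p α ≡ valuation p β
  valuation-cong {p} {α} {β} P α≢0 β≢0 to from = ℕ.≤-antisym
    (^∣⇒≤valuation P β≢0 (to (valuation p α) (^valuation∣ P α≢0))) (^∣⇒≤valuation P α≢0 (from (valuation p β) (^valuation∣ P β≢0)))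

  valuation-unit : ∀ {p u} → Prime p → Unitᵍ u → ∀ α → valuation p (u *ᵍ α) ≡ valuation p α
  valuation-unit {p} {u} P U α = cases (α ≟ᵍ 0ᵍ)
    where
    cases : Dec (α ≡ 0ᵍ) → valuation p (u *ᵍ α) ≡ valuation p α
    cases (yes α≡0) = cong (valuation p) (trans (cong (u *ᵍ_) α≡0) (trans (*ᵍ-zeroʳ u) (sym α≡0)))
    cases (no α≢0) = valuation-cong P (*ᵍ-≢0 (unit≢0 U) α≢0) α≢0 (λ _ → ∣ᵍ-unit U) (λ _ → ∣ᵍ-*ˡ u)

  -- The factors q are removed one at a time: by the definition of a prime, q divides π or β, hence
  -- β. This does the work of unique factorisation.
  ^∣-cancel : ∀ {q π} → Prime q → ¬ q ∣ᵍ π → ∀ e {β} → q ^ᵍ e ∣ᵍ π *ᵍ β → q ^ᵍ e ∣ᵍ β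
  ^∣-cancel Q q∤π zero {β} _ = 1∣ᵍ β
  ^∣-cancel {q} {π} Q q∤π (suc e) {β} (κ , eq) = [ (λ q∣π → ⊥-elim (q∤π q∣π)) , step ]′
    (Prime.split-∣ Q {π} {β} ((κ *ᵍ q ^ᵍ e) , trans (e₁ κ q (q ^ᵍ e)) eq))
    where
    e₁ = solve-ℤ[i] 3 (λ κ q r → κ ⊗ r ⊗ q , κ ⊗ (q ⊗ r)) refl
    e₂ = solve-ℤ[i] 3 (λ κ q r → q ⊗ (κ ⊗ r) , κ ⊗ (q ⊗ r)) refl
    e₃ = solve-ℤ[i] 3 (λ π β q → π ⊗ (β ⊗ q) , q ⊗ (π ⊗ β)) refl
    step : q ∣ᵍ β → q ^ᵍ suc e ∣ᵍ β
    step (β′ , eq′) = extend (^∣-cancel Q q∤π e {β′} (κ , *ᵍ-cancelˡ (prime≢0 Q)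
      (trans (e₂ κ q (q ^ᵍ e)) (trans eq (trans (cong (π *ᵍ_) (sym eq′)) (e₃ π β′ q))))))
      where
      extend : q ^ᵍ e ∣ᵍ β′ → q ^ᵍ suc e ∣ᵍ β
      extend (μ , eq″) = μ , trans (sym (e₁ μ q (q ^ᵍ e))) (trans (cong (_*ᵍ q) eq″) eq′)

  ∤-^ : ∀ {q p} → Prime q → ¬ q ∣ᵍ p → ∀ e → ¬ q ∣ᵍ p ^ᵍ e
  ∤-^ Q q∤p zero q∣ = Prime.p∤1 Q q∣
  ∤-^ Q q∤p (suc e) q∣ = [ q∤p , ∤-^ Q q∤p e ]′ (Prime.split-∣ Q q∣)

  valuation-coprime-* : ∀ {q π} → Prime q → ¬ q ∣ᵍ π → ∀ β → β ≢ 0ᵍ → valuation q (π *ᵍ β) ≡ valuation q β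
  valuation-coprime-* {q} {π} Q q∤π β β≢0 = valuation-cong Q (*ᵍ-≢0 π≢0 β≢0) β≢0
    (λ e → ^∣-cancel Q q∤π e) (λ e → ∣ᵍ-*ˡ π)
    where
    π≢0 : π ≢ 0ᵍ
    π≢0 refl = q∤π (0ᵍ , *ᵍ-zeroˡ q)

  ∈-primes⁻ : ∀ n {p} → p ∈ primes n → Prime p × Quadrant p × norm p ℕ.≤ n
  ∈-primes⁻ n p∈ = let p∈′ , P = ∈-filter⁻ prime? p∈
                       q , N≤n = ∈-representatives⁻ n p∈′
                   in P , q , N≤n

  ∈-primes⁺ : ∀ n {p} → Prime p → Quadrant p → norm p ℕ.≤ n → p ∈ primes n
  ∈-primes⁺ n P q N≤n = ∈-filter⁺ prime? (∈-representatives⁺ n q N≤n) P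

  primes-unique : ∀ n → Unique (primes n)
  primes-unique n = Unique.filter⁺ prime? (representatives-unique n)

  -- Write p = κ q. Then p divides κ or q: the former would make q a unit, the latter makes κ a
  -- unit, so that p and q are associates in the same quadrant.
  prime-∣ᵍ⇒≡ : ∀ {p q} → Prime p → Prime q → Quadrant p → Quadrant q → q ∣ᵍ p → q ≡ p
  prime-∣ᵍ⇒≡ {p} {q} P Q p∈ q∈ (κ , eq) = [ ⊥-elim ∘ q-unit , associated ]′
    (Prime.split-∣ P {κ} {q} (1ᵍ , trans (*ᵍ-identityˡ p) (sym eq)))
    where
    e₁ = solve-ℤ[i] 3 (λ κ μ q → κ ⊗ (μ ⊗ q) , μ ⊗ (κ ⊗ q)) refl
    e₂ = solve-ℤ[i] 3 (λ κ μ q → q ⊗ (μ ⊗ κ) , μ ⊗ (κ ⊗ q)) refl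
    κ≢0 : κ ≢ 0ᵍ
    κ≢0 κ≡0 = prime≢0 P (trans (sym eq) (trans (cong (_*ᵍ q) κ≡0) (*ᵍ-zeroˡ q)))
    q-unit : ¬ p ∣ᵍ κ
    q-unit (μ , eq′) = Prime.p∤1 Q (μ , *ᵍ-cancelˡ κ≢0 (trans (e₁ κ μ q)
      (trans (cong (μ *ᵍ_) eq) (trans eq′ (sym (*ᵍ-identityʳ κ))))))
    associated : p ∣ᵍ q → q ≡ p
    associated (μ , eq′) = trans (sym (quadrant-unique (μ , *ᵍ-cancelˡ (prime≢0 Q)
      (trans (e₂ κ μ q) (trans (cong (μ *ᵍ_) eq) (trans eq′ (sym (*ᵍ-identityʳ q))))))
      q∈ (subst Quadrant (sym eq) p∈))) eq

open Valuations

-- Removing one prime from a multiplicative function.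

module Sieve where

  open ℚ-Operations using (_+_; _*_; _-_; -_; _≤_; _<_; ∣_∣)
  open ≡-Reasoning

  -- The exponents occurring in τ k and 𝔱ℕ k are positive; a prime not dividing α must contribute 1.
  extend : (ℕ → ℕ) → ℕ → ℚ
  extend g zero = 1ℚ
  extend g (suc a) = fromℕℚ (g (suc a))

  -- The multiplicative function with value G(a) at p^a that sees only the primes of the list. For
  -- the empty list it is constantly 1, and there the induction over primes meets the circle
  -- problem.
  local : (ℕ → ℚ) → List ℤ[i] → ℤ[i] → ℚ
  local G ps α = ∏ᶠ (λ p → G (valuation p α)) ps

  Primes : List ℤ[i] → Set
  Primes = All Prime

  Coprime : ℤ[i] → List ℤ[i] → Set
  Coprime π = All (λ q → ¬ q ∣ᵍ π)

  local-unit : ∀ G {ps} → Primes ps → AssociateInvariant (local G ps)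
  local-unit G Ps U α = ∏-cong _ λ p∈ → cong G (valuation-unit (All.lookup Ps p∈) U α)

  local-coprime-* : ∀ G {ps π} → Primes ps → Coprime π ps → ∀ β → β ≢ 0ᵍ → local G ps (π *ᵍ β) ≡ local G ps β
  local-coprime-* G Ps C β β≢0 = ∏-cong _ λ p∈ →
    cong G (valuation-coprime-* (All.lookup Ps p∈) (All.lookup C p∈) β β≢0)

  fromℕℚ-sum : ∀ {A : Set} (f : A → ℕ) xs → fromℕℚ (ℕ.sum (map f xs)) ≡ ∑ (fromℕℚ ∘ f) xs
  fromℕℚ-sum f [] = refl
  fromℕℚ-sum f (x ∷ xs) = trans (fromℕℚ-+ (f x) _) (cong (fromℕℚ (f x) +_) (fromℕℚ-sum f xs))

  fromℕℚ-product : ∀ {A : Set} (f : A → ℕ) xs → fromℕℚ (ℕ.product (map f xs)) ≡ ∏ᶠ (fromℕℚ ∘ f) xs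
  fromℕℚ-product f [] = refl
  fromℕℚ-product f (x ∷ xs) = trans (fromℕℚ-* (f x) _) (cong (fromℕℚ (f x) *_) (fromℕℚ-product f xs))

  p∣⇒p^1∣ : ∀ {p α} → p ∣ᵍ α → p ^ᵍ 1 ∣ᵍ α
  p∣⇒p^1∣ {p} {α} = subst (_∣ᵍ α) (sym (*ᵍ-identityʳ p))

  p^1∣⇒p∣ : ∀ {p α} → p ^ᵍ 1 ∣ᵍ α → p ∣ᵍ α
  p^1∣⇒p∣ {p} {α} = subst (_∣ᵍ α) (*ᵍ-identityʳ p)

  -- Primes up to n that do not divide α contribute `extend g 0`, which is 1. One list of primes
  -- thus serves all α with norm at most n.
  multiplicative-local : ∀ g n {α} → α ∈ representatives n →
    fromℕℚ (multiplicative g α) ≡ local (extend g) (primes n) α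
  multiplicative-local g n {α} α∈ = begin
    fromℕℚ (multiplicative g α)
      ≡⟨ fromℕℚ-product (λ p → g (valuation p α)) (filter (_∣ᵍ? α) (primes (norm α))) ⟩
    ∏ᶠ (λ p → fromℕℚ (g (valuation p α))) (filter (_∣ᵍ? α) (primes (norm α)))
      ≡⟨ ∏-cong (filter (_∣ᵍ? α) (primes (norm α))) nontrivial ⟩
    local (extend g) (filter (_∣ᵍ? α) (primes (norm α))) α
      ≡⟨ ∏ᶠ-↭ (λ p → extend g (valuation p α)) same ⟩
    local (extend g) (filter (_∣ᵍ? α) (primes n)) α
      ≡⟨ ∏-filter (_∣ᵍ? α) (λ p → extend g (valuation p α)) (primes n) trivial ⟩
    local (extend g) (primes n) α ∎
    where
    α≢0 = quadrant≢0 (proj₁ (∈-representatives⁻ n α∈))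
    extend-pos : ∀ {a} → 1 ℕ.≤ a → fromℕℚ (g a) ≡ extend g a
    extend-pos (s≤s _) = refl
    nontrivial : ∀ {p} → p ∈ filter (_∣ᵍ? α) (primes (norm α)) → fromℕℚ (g (valuation p α)) ≡ extend g (valuation p α)
    nontrivial p∈ = let p∈′ , p∣α = ∈-filter⁻ (_∣ᵍ? α) {xs = primes (norm α)} p∈
                    in extend-pos (^∣⇒≤valuation (proj₁ (∈-primes⁻ (norm α) p∈′)) α≢0 (p∣⇒p^1∣ p∣α))
    trivial : ∀ {p} → p ∈ primes n → ¬ p ∣ᵍ α → extend g (valuation p α) ≡ 1ℚ
    trivial {p} p∈ p∤α = cong (extend g) (ℕ.n<1⇒n≡0 (ℕ.≰⇒> λ 1≤v →
      p∤α (p^1∣⇒p∣ {p} (≤valuation⇒^∣ (proj₁ (∈-primes⁻ n p∈)) α≢0 1≤v))))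
    same : filter (_∣ᵍ? α) (primes (norm α)) ↭ filter (_∣ᵍ? α) (primes n)
    same = unique-set⇒↭ (Unique.filter⁺ (_∣ᵍ? α) (primes-unique (norm α))) (Unique.filter⁺ (_∣ᵍ? α) (primes-unique n))
      (λ p∈ → let p∈′ , p∣α = ∈-filter⁻ (_∣ᵍ? α) {xs = primes (norm α)} p∈
                  P , q , N≤ = ∈-primes⁻ (norm α) p∈′
              in ∈-filter⁺ (_∣ᵍ? α) (∈-primes⁺ n P q (ℕ.≤-trans N≤ (proj₂ (∈-representatives⁻ n α∈)))) p∣α)
      (λ p∈ → let p∈′ , p∣α = ∈-filter⁻ (_∣ᵍ? α) {xs = primes n} p∈
                  P , q , _ = ∈-primes⁻ n p∈′
              in ∈-filter⁺ (_∣ᵍ? α) (∈-primes⁺ (norm α) P q (∣ᵍ⇒norm≤ α≢0 p∣α)) p∣α)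

  -- The coefficients of 1 + Σ (g(a) - g(a-1)) z^a, so that g is the summatory function of Δ g.
  Δ : (ℕ → ℕ) → ℕ → ℚ
  Δ g zero = 1ℚ
  Δ g (suc a) = extend g (suc a) - extend g a

  -- The condition a ≤ v is kept as an indicator and the range is fixed by T, so that the sum over a
  -- can be exchanged with a sum over α, on which v depends.
  Δ-telescopes : ∀ g T v → v ℕ.≤ T → ∑ⁿ (suc T) (λ a → 𝟙 (a ℕ.≤? v) * Δ g a) ≡ extend g v
  Δ-telescopes g zero zero z≤n = refl
  Δ-telescopes g (suc T) v v≤ with ℕ.m≤n⇒m<n∨m≡n v≤
  ... | inj₁ (s≤s v≤T) = trans (cong₂ _+_ (Δ-telescopes g T v v≤T)
        (trans (cong (_* Δ g (suc T)) (𝟙-no (suc T ℕ.≤? v) (ℕ.<⇒≱ (s≤s v≤T)))) (ℚ.*-zeroˡ (Δ g (suc T))))) (ℚ.+-identityʳ _)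
  ... | inj₂ refl = trans (cong₂ _+_
        (trans (∑ⁿ-cong (suc T) λ a a<1+T → cong (_* Δ g a)
                 (𝟙-cong (a ℕ.≤? suc T) (a ℕ.≤? T) (λ _ → ℕ.s≤s⁻¹ a<1+T) ℕ.m≤n⇒m≤1+n))
               (Δ-telescopes g T T ℕ.≤-refl))
        (trans (cong (_* Δ g (suc T)) (𝟙-yes (suc T ℕ.≤? suc T) ℕ.≤-refl)) (ℚ.*-identityˡ (Δ g (suc T)))))
        (eq (extend g T) (extend g (suc T)))
    where
    eq = solve-ℚ 2 (λ a b → a ⊕ (b ⊕ ⊝ a) , b) refl

  summatory : (ℕ → ℕ) → List ℤ[i] → ℕ → ℚ
  summatory g ps n = ∑ (local (extend g) ps) (representatives n)

  ∑-multiples′ : ∀ {π F} n → π ≢ 0ᵍ → AssociateInvariant F →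
    ∑ (λ α → 𝟙 (π ∣ᵍ? α) * F α) (representatives n) ≡ ∑ (λ β → F (π *ᵍ β)) (representatives (n ÷ norm π))
  ∑-multiples′ {π} {F} n π≢0 inv = trans (sym (∑-filter (π ∣ᵍ?_) F (representatives n)))
    (trans (∑-multiples n π≢0 inv) (cong (λ m → ∑ (λ β → F (π *ᵍ β)) (representatives m)) (sym (÷≡/ n (norm π)))))
    where instance _ = norm-nonZero π≢0

  -- The value at the valuation of p is the sum of Δ g a over all p^a dividing α. Exchange the sums
  -- and write α = p^a β. Here β may still be divisible by p, but `local` over `ps` does not see p.
  -- The choice T ≥ n covers all valuations that occur.
  summatory-recursion : ∀ g {p ps} n T → n ℕ.≤ T → Prime p → Primes ps → Coprime p ps →
    summatory g (p ∷ ps) n ≡ ∑ⁿ (suc T) (λ a → Δ g a * summatory g ps (n ÷ norm p ℕ.^ a))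
  summatory-recursion g {p} {ps} n T n≤T P Ps C = begin
    ∑ (λ α → extend g (valuation p α) * f α) (representatives n)
      ≡⟨ ∑-cong (representatives n) expand ⟩
    ∑ (λ α → ∑ⁿ (suc T) λ a → Δ g a * (𝟙 (p ^ᵍ a ∣ᵍ? α) * f α)) (representatives n)
      ≡⟨ ∑-∑ⁿ (suc T) (λ α a → Δ g a * (𝟙 (p ^ᵍ a ∣ᵍ? α) * f α)) (representatives n) ⟩
    ∑ⁿ (suc T) (λ a → ∑ (λ α → Δ g a * (𝟙 (p ^ᵍ a ∣ᵍ? α) * f α)) (representatives n))
      ≡⟨ ∑ⁿ-cong (suc T) (λ a _ → trans (∑-* (Δ g a) (λ α → 𝟙 (p ^ᵍ a ∣ᵍ? α) * f α) (representatives n)) (cong (Δ g a *_) (sub a))) ⟩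
    ∑ⁿ (suc T) (λ a → Δ g a * summatory g ps (n ÷ norm p ℕ.^ a)) ∎
    where
    f = local (extend g) ps
    expand : ∀ {α} → α ∈ representatives n →
      extend g (valuation p α) * f α ≡ ∑ⁿ (suc T) λ a → Δ g a * (𝟙 (p ^ᵍ a ∣ᵍ? α) * f α)
    expand {α} α∈ = begin
      extend g v * f α
        ≡⟨ cong (_* f α) (Δ-telescopes g T v v≤T) ⟨
      ∑ⁿ (suc T) (λ a → 𝟙 (a ℕ.≤? v) * Δ g a) * f α
        ≡⟨ ℚ.*-comm _ (f α) ⟩
      f α * ∑ⁿ (suc T) (λ a → 𝟙 (a ℕ.≤? v) * Δ g a)
        ≡⟨ ∑ⁿ-* (suc T) (f α) (λ a → 𝟙 (a ℕ.≤? v) * Δ g a) ⟨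
      ∑ⁿ (suc T) (λ a → f α * (𝟙 (a ℕ.≤? v) * Δ g a))
        ≡⟨ ∑ⁿ-cong (suc T) (λ a _ → trans (cong (λ z → f α * (z * Δ g a))
             (𝟙-cong (a ℕ.≤? v) (p ^ᵍ a ∣ᵍ? α) (≤valuation⇒^∣ P α≢0) (^∣⇒≤valuation P α≢0)))
             (eq (f α) (𝟙 (p ^ᵍ a ∣ᵍ? α)) (Δ g a))) ⟩
      ∑ⁿ (suc T) (λ a → Δ g a * (𝟙 (p ^ᵍ a ∣ᵍ? α) * f α)) ∎
      where
      v = valuation p α
      α≢0 = quadrant≢0 (proj₁ (∈-representatives⁻ n α∈))
      v≤T : v ℕ.≤ T
      v≤T = ℕ.≤-trans (ℕ.<⇒≤ (valuation<norm P α≢0)) (ℕ.≤-trans (proj₂ (∈-representatives⁻ n α∈)) n≤T)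
      eq = solve-ℚ 3 (λ a b c → a ⊗ (b ⊗ c) , c ⊗ (b ⊗ a)) refl
    sub : ∀ a → ∑ (λ α → 𝟙 (p ^ᵍ a ∣ᵍ? α) * f α) (representatives n) ≡ summatory g ps (n ÷ norm p ℕ.^ a)
    sub a = begin
      ∑ (λ α → 𝟙 (p ^ᵍ a ∣ᵍ? α) * f α) (representatives n)
        ≡⟨ ∑-multiples′ {p ^ᵍ a} n (^≢0 (prime≢0 P) a) (local-unit (extend g) Ps) ⟩
      ∑ (λ β → f (p ^ᵍ a *ᵍ β)) (representatives (n ÷ norm (p ^ᵍ a)))
        ≡⟨ ∑-cong (representatives (n ÷ norm (p ^ᵍ a))) (λ {β} β∈ → local-coprime-* (extend g) Ps
             (All.zipWith (λ (Q , q∤p) → ∤-^ Q q∤p a) (Ps , C)) β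
             (quadrant≢0 (proj₁ (∈-representatives⁻ (n ÷ norm (p ^ᵍ a)) β∈)))) ⟩
      summatory g ps (n ÷ norm (p ^ᵍ a))
        ≡⟨ cong (λ N → summatory g ps (n ÷ N)) (norm-^ p a) ⟩
      summatory g ps (n ÷ norm p ℕ.^ a) ∎

  ∑′-summatory : ∀ g n → fromℕℚ (∑′ n (multiplicative g)) ≡ summatory g (primes n) n
  ∑′-summatory g n = trans (fromℕℚ-sum (multiplicative g) (representatives n))
    (∑-cong (representatives n) (multiplicative-local g n))

open Sieve

-- Lattice points of a quarter disc, counted by gnomons.

module LatticePoints where

  open ℚ-Operations using (_+_; _*_; _-_; -_; _≤_; _<_; ∣_∣)
  open ℚ.≤-Reasoning

  ∑-cartesianProductWith : ∀ {A B C : Set} (f : C → ℚ) (k : A → B → C) xs ys →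
    ∑ f (cartesianProductWith k xs ys) ≡ ∑ (λ x → ∑ (λ y → f (k x y)) ys) xs
  ∑-cartesianProductWith f k [] ys = refl
  ∑-cartesianProductWith f k (x ∷ xs) ys = trans (∑-++ f (map (k x) ys) (cartesianProductWith k xs ys))
    (cong₂ _+_ (∑-map f (k x) ys) (∑-cartesianProductWith f k xs ys))

  count : ℕ → ℚ
  count n = fromℕℚ (length (representatives n))

  module _ {P : Pred ℕ 0ℓ} (P? : Decidable P) (down : ∀ {i j} → i ℕ.≤ j → P j → P i) where

    -- Below N, a downward closed property amounts to i < k for a cutoff k. As `total` identifies k
    -- with a sum of indicators, two counts can be compared through their cutoffs.
    record Threshold (N : ℕ) : Set where
      field
        k : ℕ
        k≤N : k ℕ.≤ N
        below : ∀ {i} → i ℕ.< k → P i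
        above : k ℕ.< N → ¬ P k
        total : ∑ⁿ N (λ i → 𝟙 (P? i)) ≡ fromℕℚ k

    threshold : ∀ N → Threshold N
    threshold zero = record { k = 0 ; k≤N = z≤n ; below = λ () ; above = λ () ; total = refl }
    threshold (suc N) with threshold N | P? N in eq
    ... | t | yes PN = record
      { k = suc N ; k≤N = ℕ.≤-refl ; below = λ i≤N → down (ℕ.s≤s⁻¹ i≤N) PN ; above = λ 1+N<1+N → ⊥-elim (ℕ.<-irrefl refl 1+N<1+N)
      ; total = trans (cong₂ _+_ (trans total (cong fromℕℚ k≡N)) (cong 𝟙 eq)) (trans (ℚ.+-comm (fromℕℚ N) 1ℚ) (sym (fromℕℚ-suc N)))
      }
      where
      open Threshold t
      k≡N : k ≡ N
      k≡N with ℕ.m≤n⇒m<n∨m≡n k≤N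
      ... | inj₁ k<N = ⊥-elim (above k<N (down k≤N PN))
      ... | inj₂ eq = eq
    ... | t | no ¬PN = record
      { k = k ; k≤N = ℕ.m≤n⇒m≤1+n k≤N ; below = below
      ; above = λ k<1+N → [ above , (λ { refl → ¬PN }) ]′ (ℕ.m≤n⇒m<n∨m≡n (ℕ.s≤s⁻¹ k<1+N))
      ; total = trans (cong₂ _+_ total (cong 𝟙 eq)) (ℚ.+-identityʳ _)
      }
      where open Threshold t

  module Circle (n : ℕ) where

    χ : ℕ → ℕ → ℚ
    χ a b = 𝟙 (a ℕ.* a ℕ.+ b ℕ.* b ℕ.≤? n)

    χ-comm : ∀ a b → χ a b ≡ χ b a
    χ-comm a b = cong (λ z → 𝟙 (z ℕ.≤? n)) (ℕ.+-comm (a ℕ.* a) (b ℕ.* b))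

    count≡square : count n ≡ ∑ⁿ n (λ a → ∑ⁿ (suc n) (χ (suc a)))
    count≡square = ≡.begin
      fromℕℚ (length (representatives n))
        ≡.≡⟨ trans (sym (ℚ.*-identityʳ (count n))) (sym (∑-const 1ℚ (representatives n))) ⟩
      ∑ (λ _ → 1ℚ) (representatives n)
        ≡.≡⟨ ∑-filter (λ α → norm α ℕ.≤? n) (λ _ → 1ℚ) box′ ⟩
      ∑ (λ α → 𝟙 (norm α ℕ.≤? n) * 1ℚ) box′
        ≡.≡⟨ ∑-cong box′ (λ {α} _ → ℚ.*-identityʳ (𝟙 (norm α ℕ.≤? n))) ⟩
      ∑ (λ α → 𝟙 (norm α ℕ.≤? n)) box′
        ≡.≡⟨ ∑-cartesianProductWith (λ α → 𝟙 (norm α ℕ.≤? n)) (λ a b → (ℤ.+ suc a) +i (ℤ.+ b)) (upTo n) (upTo (suc n)) ⟩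
      ∑ (λ a → ∑ (χ (suc a)) (upTo (suc n))) (upTo n)
        ≡.≡⟨ ∑-cong (upTo n) (λ {a} _ → ∑-applyUpTo (χ (suc a)) id (suc n)) ⟩
      ∑ (λ a → ∑ⁿ (suc n) (χ (suc a))) (upTo n)
        ≡.≡⟨ ∑-applyUpTo (λ a → ∑ⁿ (suc n) (χ (suc a))) id n ⟩
      ∑ⁿ n (λ a → ∑ⁿ (suc n) (χ (suc a))) ≡.∎
      where
      module ≡ = ≡-Reasoning
      box′ : List ℤ[i]
      box′ = cartesianProductWith (λ a b → (ℤ.+ suc a) +i (ℤ.+ b)) (upTo n) (upTo (suc n))

    -- Points (c , b) with b < c and points (a , c) with 0 < a ≤ c, for c = suc c′.
    lower upper : ℕ → ℚ
    lower c′ = ∑ⁿ (suc c′) (χ (suc c′))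
    upper c′ = ∑ⁿ (suc c′) (λ a → χ (suc c′) (suc a))

    -- From m to m + 1 the square gains the row a = m + 1 and the column b = m + 1, which `χ-comm`
    -- reflects. Within a gnomon the larger coordinate c is constant, so that the other one divided
    -- by c is a slope in [0, 1].
    square≡gnomons : ∀ m → ∑ⁿ m (λ a → ∑ⁿ (suc m) (χ (suc a))) ≡ ∑ⁿ m (λ c → lower c + upper c)
    square≡gnomons zero = refl
    square≡gnomons (suc m) = trans (∑ⁿ-+ (suc m) (λ a → ∑ⁿ (suc m) (χ (suc a))) (λ a → χ (suc a) (suc m)))
      (trans (cong₂ _+_ (cong (_+ lower m) (square≡gnomons m)) (∑ⁿ-cong (suc m) λ a _ → χ-comm (suc a) (suc m)))
        (ℚ.+-assoc (∑ⁿ m (λ c → lower c + upper c)) (lower m) (upper m)))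

    module _ (s : ℕ) (s²≤n : s ℕ.* s ℕ.≤ n) (n<[1+s]² : n ℕ.< suc s ℕ.* suc s) where

      count≡gnomons : count n ≡ ∑ⁿ s (λ c → lower c + upper c)
      count≡gnomons = trans count≡square (trans (square≡gnomons n)
        (trans (cong (λ l → ∑ⁿ l (λ c → lower c + upper c)) (sym (ℕ.m∸n+n≡m s≤n)))
          (trans (∑ⁿ-split s (n ℕ.∸ s) (λ c → lower c + upper c))
            (trans (cong (∑ⁿ s (λ c → lower c + upper c) +_)
              (trans (∑ⁿ-cong (n ℕ.∸ s) λ i _ → vanish (i ℕ.+ s) (ℕ.m≤n+m s i)) (trans (∑ⁿ-const (n ℕ.∸ s) 0ℚ) (ℚ.*-zeroʳ (fromℕℚ (n ℕ.∸ s))))))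
              (ℚ.+-identityʳ _)))))
        where
        s≤n : s ℕ.≤ n
        s≤n = ℕ.≤-trans (n≤n² s) s²≤n
        χ-vanish : ∀ c b → s ℕ.≤ c → χ (suc c) b ≡ 0ℚ
        χ-vanish c b s≤c = 𝟙-no (suc c ℕ.* suc c ℕ.+ b ℕ.* b ℕ.≤? n) (ℕ.<⇒≱ (ℕ.<-≤-trans n<[1+s]²
          (ℕ.≤-trans (ℕ.*-mono-≤ (s≤s s≤c) (s≤s s≤c)) (ℕ.m≤m+n (suc c ℕ.* suc c) (b ℕ.* b)))))
        zeros : ∀ m {f : ℕ → ℚ} → (∀ i → f i ≡ 0ℚ) → ∑ⁿ m f ≡ 0ℚ
        zeros m eq = trans (∑ⁿ-cong m λ i _ → eq i) (trans (∑ⁿ-const m 0ℚ) (ℚ.*-zeroʳ (fromℕℚ m)))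
        vanish : ∀ c → s ℕ.≤ c → lower c + upper c ≡ 0ℚ
        vanish c s≤c = cong₂ _+_ (zeros (suc c) λ b → χ-vanish c b s≤c) (zeros (suc c) λ b → χ-vanish c (suc b) s≤c)

    X : ℕ → Pred ℕ 0ℓ
    X c b = c ℕ.* c ℕ.+ b ℕ.* b ℕ.≤ n

    X? : ∀ c → Decidable (X c)
    X? c b = c ℕ.* c ℕ.+ b ℕ.* b ℕ.≤? n

    X-down : ∀ c {i j} → i ℕ.≤ j → X c j → X c i
    X-down c i≤j = ℕ.≤-trans (ℕ.+-monoʳ-≤ (c ℕ.* c) (ℕ.*-mono-≤ i≤j i≤j))

    module Slopes (m : ℕ) (0<m : 0 ℕ.< m) where

      -- With denominators cleared: the point of abscissa c on the line of slope i / m lies in the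
      -- disc of radius √n.
      Y : ℕ → Pred ℕ 0ℓ
      Y c i = c ℕ.* c ℕ.* (m ℕ.* m ℕ.+ i ℕ.* i) ℕ.≤ m ℕ.* m ℕ.* n

      Y? : ∀ c → Decidable (Y c)
      Y? c i = c ℕ.* c ℕ.* (m ℕ.* m ℕ.+ i ℕ.* i) ℕ.≤? m ℕ.* m ℕ.* n

      Y-down : ∀ c {i j} → i ℕ.≤ j → Y c j → Y c i
      Y-down c i≤j = ℕ.≤-trans (ℕ.*-monoʳ-≤ (c ℕ.* c) (ℕ.+-monoʳ-≤ (m ℕ.* m) (ℕ.*-mono-≤ i≤j i≤j)))

      X⇒Y : ∀ {c b i} → i ℕ.* c ℕ.≤ m ℕ.* b → X c b → Y c i
      X⇒Y {c} {b} {i} ic≤mb x = ℕ.≤-trans (ℕ.≤-trans (ℕ.≤-reflexive (e₁ c m i))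
        (ℕ.≤-trans (ℕ.+-monoʳ-≤ (m ℕ.* m ℕ.* (c ℕ.* c)) (ℕ.*-mono-≤ ic≤mb ic≤mb)) (ℕ.≤-reflexive (e₂ c m b)))) (ℕ.*-monoʳ-≤ (m ℕ.* m) x)
        where
        e₁ = solve-ℕ 3 (λ c m i → c ⊗ c ⊗ (m ⊗ m ⊕ i ⊗ i) , m ⊗ m ⊗ (c ⊗ c) ⊕ i ⊗ c ⊗ (i ⊗ c)) refl
        e₂ = solve-ℕ 3 (λ c m b → m ⊗ m ⊗ (c ⊗ c) ⊕ m ⊗ b ⊗ (m ⊗ b) , m ⊗ m ⊗ (c ⊗ c ⊕ b ⊗ b)) refl

      Y⇒X : ∀ {c b i} → m ℕ.* b ℕ.≤ i ℕ.* c → Y c i → X c b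
      Y⇒X {c} {b} {i} mb≤ic y = ℕ.*-cancelˡ-≤ (m ℕ.* m) ⦃ ℕ.>-nonZero (ℕ.*-mono-≤ 0<m 0<m) ⦄ (ℕ.≤-trans (ℕ.≤-trans (ℕ.≤-reflexive (e₁ c m b))
        (ℕ.≤-trans (ℕ.+-monoʳ-≤ (m ℕ.* m ℕ.* (c ℕ.* c)) (ℕ.*-mono-≤ mb≤ic mb≤ic)) (ℕ.≤-reflexive (e₂ c m i)))) y)
        where
        e₁ = solve-ℕ 3 (λ c m b → m ⊗ m ⊗ (c ⊗ c ⊕ b ⊗ b) , m ⊗ m ⊗ (c ⊗ c) ⊕ m ⊗ b ⊗ (m ⊗ b)) refl
        e₂ = solve-ℕ 3 (λ c m i → m ⊗ m ⊗ (c ⊗ c) ⊕ i ⊗ c ⊗ (i ⊗ c) , c ⊗ c ⊗ (m ⊗ m ⊕ i ⊗ i)) refl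

      𝐘 : ℕ → ℕ → ℚ
      𝐘 c i = 𝟙 (Y? c i)

      module _ (c′ : ℕ) where
        private
          c = suc c′
          -- `tX` counts the ordinates 0 to c - 1 and `tX′` those from 1 to c; `tY` counts the
          -- slopes 0 to m - 1 and `tY′` those from 1 to m. The slopes from 0 on bound the points
          -- from above, the slopes from 1 on from below.
          tX = threshold (X? c) (X-down c) c
          tX′ = threshold (λ b → X? c (suc b)) (λ i≤j → X-down c (s≤s i≤j)) c
          tY = threshold (Y? c) (Y-down c) m
          tY′ = threshold (λ i → Y? c (suc i)) (λ i≤j → Y-down c (s≤s i≤j)) m
          open Threshold

        lift : ∀ {k l β U} → β ≡ fromℕℚ k → U ≡ fromℕℚ l → m ℕ.* k ℕ.≤ c ℕ.* l → fromℕℚ m * β ≤ fromℕℚ c * U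
        lift {k} {l} refl refl le = subst₂ _≤_ (fromℕℚ-* m k) (fromℕℚ-* c l) (fromℕℚ-mono le)

        lift′ : ∀ {k l β U} → β ≡ fromℕℚ k → U ≡ fromℕℚ l → c ℕ.* l ℕ.≤ m ℕ.* k → fromℕℚ c * U ≤ fromℕℚ m * β
        lift′ {k} {l} refl refl le = subst₂ _≤_ (fromℕℚ-* c l) (fromℕℚ-* m k) (fromℕℚ-mono le)

        -- A lattice point on the line with ordinate b forces all slopes i / m ≤ b / c.
        from-X : ∀ b → b ℕ.≤ c → X c b → m ℕ.* b ℕ.≤ c ℕ.* k tY
        from-X b b≤c x with ℕ.m≤n⇒m<n∨m≡n (k≤N tY)
        ... | inj₁ k<m = ℕ.≤-trans (ℕ.<⇒≤ (ℕ.≰⇒> λ ic≤mb → above tY k<m (X⇒Y {c} {b} {k tY} ic≤mb x))) (ℕ.≤-reflexive (ℕ.*-comm (k tY) c))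
        ... | inj₂ k≡m = ℕ.≤-trans (ℕ.*-monoʳ-≤ m b≤c) (ℕ.≤-reflexive (trans (ℕ.*-comm m c) (cong (c ℕ.*_) (sym k≡m))))

        -- If the slope i / m stays in the disc, an ordinate b outside satisfies c i ≤ m b. The
        -- first such b is `k tX` when counting from 0 and `suc (k tX′)` when counting from 1; if
        -- the count finds none, i ≤ m suffices.
        from-Y : ∀ i → i ℕ.≤ m → Y c i → c ℕ.* i ℕ.≤ m ℕ.* k tX × c ℕ.* i ℕ.≤ m ℕ.* suc (k tX′)
        from-Y i i≤m y = to-X , to-X′
          where
          ci≤mc : c ℕ.* i ℕ.≤ m ℕ.* c
          ci≤mc = ℕ.≤-trans (ℕ.*-monoʳ-≤ c i≤m) (ℕ.≤-reflexive (ℕ.*-comm c m))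
          not-X : ∀ b → ¬ X c b → c ℕ.* i ℕ.≤ m ℕ.* b
          not-X b ¬x = ℕ.≤-trans (ℕ.≤-reflexive (ℕ.*-comm c i)) (ℕ.<⇒≤ (ℕ.≰⇒> λ mb≤ic → ¬x (Y⇒X {c} {b} {i} mb≤ic y)))
          to-X : c ℕ.* i ℕ.≤ m ℕ.* k tX
          to-X = [ (λ k<c → not-X (k tX) (above tX k<c)) , (λ k≡c → subst (λ z → c ℕ.* i ℕ.≤ m ℕ.* z) (sym k≡c) ci≤mc) ]′
            (ℕ.m≤n⇒m<n∨m≡n (k≤N tX))
          to-X′ : c ℕ.* i ℕ.≤ m ℕ.* suc (k tX′)
          to-X′ = [ (λ k<c → not-X (suc (k tX′)) (above tX′ k<c))
                  , (λ k≡c → ℕ.≤-trans (subst (λ z → c ℕ.* i ℕ.≤ m ℕ.* z) (sym k≡c) ci≤mc) (ℕ.*-monoʳ-≤ m (ℕ.n≤1+n (k tX′)))) ]′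
            (ℕ.m≤n⇒m<n∨m≡n (k≤N tX′))

        upper≤ : fromℕℚ m * upper c′ ≤ fromℕℚ c * ∑ⁿ m (𝐘 c)
        upper≤ = lift (total tX′) (total tY) (bound (k tX′) refl)
          where
          bound : ∀ l → l ≡ k tX′ → m ℕ.* l ℕ.≤ c ℕ.* k tY
          bound zero _ = ℕ.≤-trans (ℕ.≤-reflexive (ℕ.*-zeroʳ m)) z≤n
          bound (suc l) eq = from-X (suc l) (subst (ℕ._≤ c) (sym eq) (k≤N tX′)) (below tX′ (ℕ.≤-reflexive eq))

        lower≤ : fromℕℚ m * lower c′ ≤ fromℕℚ c * ∑ⁿ m (𝐘 c) + fromℕℚ m
        lower≤ = subst₂ _≤_ (sym (cong (fromℕℚ m *_) (total tX))) (cong (λ z → fromℕℚ c * z + fromℕℚ m) (sym (total tY)))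
          (subst₂ _≤_ (fromℕℚ-* m (k tX)) (trans (fromℕℚ-+ (c ℕ.* k tY) m) (cong (_+ fromℕℚ m) (fromℕℚ-* c (k tY))))
            (fromℕℚ-mono (bound (k tX) refl)))
          where
          bound : ∀ l → l ≡ k tX → m ℕ.* l ℕ.≤ c ℕ.* k tY ℕ.+ m
          bound zero _ = ℕ.≤-trans (ℕ.≤-reflexive (ℕ.*-zeroʳ m)) z≤n
          -- The last admissible ordinate is l, one less than the cutoff; the difference costs the
          -- summand m.
          bound (suc l) eq = ℕ.≤-trans (ℕ.≤-reflexive (trans (ℕ.*-suc m l) (ℕ.+-comm m (m ℕ.* l))))
            (ℕ.+-monoˡ-≤ m (from-X l (ℕ.≤-trans (ℕ.n≤1+n l) (subst (ℕ._≤ c) (sym eq) (k≤N tX))) (below tX (ℕ.≤-reflexive eq))))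

        private
          from-Y′ : ∀ l → l ≡ k tY′ → c ℕ.* l ℕ.≤ m ℕ.* k tX × c ℕ.* l ℕ.≤ m ℕ.* suc (k tX′)
          from-Y′ zero _ = ℕ.≤-trans (ℕ.≤-reflexive (ℕ.*-zeroʳ c)) z≤n , ℕ.≤-trans (ℕ.≤-reflexive (ℕ.*-zeroʳ c)) z≤n
          from-Y′ (suc l) eq = from-Y (suc l) (subst (ℕ._≤ m) (sym eq) (k≤N tY′)) (below tY′ (ℕ.≤-reflexive eq))

        lower≥ : fromℕℚ c * ∑ⁿ m (𝐘 c ∘ suc) ≤ fromℕℚ m * lower c′
        lower≥ = lift′ (total tX) (total tY′) (proj₁ (from-Y′ (k tY′) refl))

        upper≥ : fromℕℚ c * ∑ⁿ m (𝐘 c ∘ suc) ≤ fromℕℚ m * upper c′ + fromℕℚ m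
        upper≥ = subst (fromℕℚ c * ∑ⁿ m (𝐘 c ∘ suc) ≤_)
          (trans (cong (fromℕℚ m *_) (fromℕℚ-suc (k tX′))) (trans (eq (fromℕℚ m) (fromℕℚ (k tX′)))
            (cong (λ z → fromℕℚ m * z + fromℕℚ m) (sym (total tX′)))))
          (lift′ refl (total tY′) (proj₂ (from-Y′ (k tY′) refl)))
          where
          eq = solve-ℚ 2 (λ m k → m ⊗ (Κ 1ℚ ⊕ k) , m ⊗ k ⊕ m) refl

open LatticePoints

-- Comparison of the count with Riemann sums of 1 / (1 + t²).

module CircleProblem where

  open ℚ-Operations using (_+_; _*_; _-_; -_; _≤_; _<_; ∣_∣)
  open ℚ.≤-Reasoning

  2ℚ : ℚ
  2ℚ = 1ℚ + 1ℚ

  module _ (D E : ℕ) where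

    -- For D = m² + i² and E = m² n, this adds up the abscissae c ≤ s at which the slope i / m stays
    -- in the disc. It is close to E / (2 D), half of n / (1 + (i / m)²).
    J : ℕ → ℚ
    J s = ∑ⁿ s (λ c → fromℕℚ (suc c) * 𝟙 (suc c ℕ.* suc c ℕ.* D ℕ.≤? E))

    private
      d e : ℚ
      d = fromℕℚ D
      e = fromℕℚ E
      0≤d = 0≤fromℕℚ D

    triangular : ∀ s → 2ℚ * ∑ⁿ s (fromℕℚ ∘ suc) ≡ fromℕℚ s * (1ℚ + fromℕℚ s)
    triangular zero = refl
    triangular (suc s) = trans (ℚ.*-distribˡ-+ 2ℚ (∑ⁿ s (fromℕℚ ∘ suc)) (fromℕℚ (suc s))) (trans (cong (_+ 2ℚ * fromℕℚ (suc s)) (triangular s))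
      (trans (cong (λ z → fromℕℚ s * (1ℚ + fromℕℚ s) + 2ℚ * z) (fromℕℚ-suc s)) (trans (eq (fromℕℚ s))
        (cong (λ z → z * (1ℚ + z)) (sym (fromℕℚ-suc s))))))
      where
      eq = solve-ℚ 1 (λ s → s ⊗ (Κ 1ℚ ⊕ s) ⊕ (Κ 1ℚ ⊕ Κ 1ℚ) ⊗ (Κ 1ℚ ⊕ s) , (Κ 1ℚ ⊕ s) ⊗ (Κ 1ℚ ⊕ (Κ 1ℚ ⊕ s))) refl

    J≤triangular : ∀ s → J s ≤ ∑ⁿ s (fromℕℚ ∘ suc)
    J≤triangular s = ∑ⁿ-≤ s λ c _ → subst (fromℕℚ (suc c) * 𝟙 (suc c ℕ.* suc c ℕ.* D ℕ.≤? E) ≤_) (ℚ.*-identityʳ _)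
      (*-monoˡ-≤ (0≤fromℕℚ (suc c)) (𝟙≤1 (suc c ℕ.* suc c ℕ.* D ℕ.≤? E)))

    J≡triangular : ∀ s → s ℕ.* s ℕ.* D ℕ.≤ E → J s ≡ ∑ⁿ s (fromℕℚ ∘ suc)
    J≡triangular s le = ∑ⁿ-cong s λ c c<s → trans (cong (fromℕℚ (suc c) *_) (𝟙-yes (suc c ℕ.* suc c ℕ.* D ℕ.≤? E)
      (ℕ.≤-trans (ℕ.*-monoˡ-≤ D (ℕ.*-mono-≤ c<s c<s)) le))) (ℚ.*-identityʳ _)

    J-skip : ∀ s → ¬ suc s ℕ.* suc s ℕ.* D ℕ.≤ E → J (suc s) ≡ J s
    J-skip s ≰ = trans (cong (λ z → J s + fromℕℚ (suc s) * z) (𝟙-no (suc s ℕ.* suc s ℕ.* D ℕ.≤? E) ≰))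
      (trans (cong (J s +_) (ℚ.*-zeroʳ (fromℕℚ (suc s)))) (ℚ.+-identityʳ _))

    J-upper : ∀ s → 2ℚ * J s * d ≤ e + fromℕℚ s * d
    J-upper zero = begin
      2ℚ * 0ℚ * d ≡⟨ ℚ.*-zeroˡ d ⟩
      0ℚ ≤⟨ 0≤+ (0≤fromℕℚ E) (0≤* (0≤fromℕℚ 0) 0≤d) ⟩
      e + fromℕℚ 0 * d ∎
    J-upper (suc s) with suc s ℕ.* suc s ℕ.* D ℕ.≤? E
    ... | no ≰ = begin
      2ℚ * (J s + fromℕℚ (suc s) * 0ℚ) * d ≡⟨ cong (λ z → 2ℚ * z * d) (trans (cong (J s +_) (ℚ.*-zeroʳ (fromℕℚ (suc s)))) (ℚ.+-identityʳ (J s))) ⟩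
      2ℚ * J s * d ≤⟨ J-upper s ⟩
      e + fromℕℚ s * d ≤⟨ ℚ.+-monoʳ-≤ e (*-monoʳ-≤ 0≤d (fromℕℚ-mono (ℕ.n≤1+n s))) ⟩
      e + fromℕℚ (suc s) * d ∎
    ... | yes le = begin
      2ℚ * (J s + fromℕℚ (suc s) * 1ℚ) * d ≤⟨ *-monoʳ-≤ 0≤d (*-monoˡ-≤ {2ℚ} (ℚ.≤-trans 0≤1 (p≤p+q 0≤1))
                                                    (ℚ.+-mono-≤ (J≤triangular s) (ℚ.≤-reflexive (ℚ.*-identityʳ (fromℕℚ (suc s)))))) ⟩
      2ℚ * ∑ⁿ (suc s) (fromℕℚ ∘ suc) * d ≡⟨ cong (_* d) (triangular (suc s)) ⟩
      σ * (1ℚ + σ) * d ≡⟨ eq σ d ⟩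
      σ * σ * d + σ * d ≡⟨ cong (_+ σ * d) (sym (trans (fromℕℚ-* (suc s ℕ.* suc s) D) (cong (_* d) (fromℕℚ-* (suc s) (suc s))))) ⟩
      fromℕℚ (suc s ℕ.* suc s ℕ.* D) + σ * d ≤⟨ ℚ.+-monoˡ-≤ (σ * d) (fromℕℚ-mono le) ⟩
      e + σ * d ∎
      where
      σ = fromℕℚ (suc s)
      eq = solve-ℚ 2 (λ σ d → σ ⊗ (Κ 1ℚ ⊕ σ) ⊗ d , σ ⊗ σ ⊗ d ⊕ σ ⊗ d) refl

    J-lower : ∀ s → E ℕ.≤ suc s ℕ.* suc s ℕ.* D → e ≤ 2ℚ * J s * d + fromℕℚ (suc s) * d
    J-lower s E≤ with s ℕ.* s ℕ.* D ℕ.≤? E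
    ... | yes le = begin
      e ≤⟨ fromℕℚ-mono E≤ ⟩
      fromℕℚ (suc s ℕ.* suc s ℕ.* D) ≡⟨ trans (fromℕℚ-* (suc s ℕ.* suc s) D) (cong (_* d) (fromℕℚ-* (suc s) (suc s))) ⟩
      fromℕℚ (suc s) * fromℕℚ (suc s) * d ≡⟨ cong (λ z → z * fromℕℚ (suc s) * d) (fromℕℚ-suc s) ⟩
      (1ℚ + fromℕℚ s) * fromℕℚ (suc s) * d ≡⟨ eq (fromℕℚ s) (fromℕℚ (suc s)) d ⟩
      fromℕℚ s * fromℕℚ (suc s) * d + fromℕℚ (suc s) * d
        ≡⟨ cong (λ z → fromℕℚ s * z * d + fromℕℚ (suc s) * d) (fromℕℚ-suc s) ⟩
      fromℕℚ s * (1ℚ + fromℕℚ s) * d + fromℕℚ (suc s) * d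
        ≡⟨ cong (λ z → z * d + fromℕℚ (suc s) * d) (trans (sym (triangular s)) (cong (2ℚ *_) (sym (J≡triangular s le)))) ⟩
      2ℚ * J s * d + fromℕℚ (suc s) * d ∎
      where
      eq = solve-ℚ 3 (λ s t d → (Κ 1ℚ ⊕ s) ⊗ t ⊗ d , s ⊗ t ⊗ d ⊕ t ⊗ d) refl
    J-lower zero E≤ | no ≰ = ⊥-elim (≰ z≤n)
    J-lower (suc s) E≤ | no ≰ = begin
      e ≤⟨ J-lower s (ℕ.<⇒≤ (ℕ.≰⇒> ≰)) ⟩
      2ℚ * J s * d + fromℕℚ (suc s) * d ≤⟨ ℚ.+-monoʳ-≤ (2ℚ * J s * d) (*-monoʳ-≤ 0≤d (fromℕℚ-mono (ℕ.n≤1+n (suc s)))) ⟩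
      2ℚ * J s * d + fromℕℚ (suc (suc s)) * d ≡⟨ cong (λ z → 2ℚ * z * d + fromℕℚ (suc (suc s)) * d) (sym (J-skip s ≰)) ⟩
      2ℚ * J (suc s) * d + fromℕℚ (suc (suc s)) * d ∎

  node : ℕ → ℕ → ℚ
  node m i = fromℕℚ i * recip (fromℕℚ m)

  φ : ℚ → ℚ
  φ t = recip (1ℚ + t * t)

  riemann : ℕ → (ℚ → ℚ) → ℚ
  riemann m f = recip (fromℕℚ m) * ∑ⁿ m (f ∘ node m)

  0<1+t² : ∀ t → 0ℚ < 1ℚ + t * t
  0<1+t² t = ℚ.+-mono-<-≤ 0<1 (square≥0 t)

  module _ (n s m : ℕ) (0<m : 0 ℕ.< m) (s²≤n : s ℕ.* s ℕ.≤ n) (n<[1+s]² : n ℕ.< suc s ℕ.* suc s) where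

    open Circle n
    open Slopes m 0<m

    private
      μ ν σ : ℚ
      μ = fromℕℚ m
      ν = fromℕℚ n
      σ = fromℕℚ s
      0<μ = 0<fromℕℚ 0<m
      D : ℕ → ℕ
      D i = m ℕ.* m ℕ.+ i ℕ.* i
      E = m ℕ.* m ℕ.* n
      w : ℕ → ℚ
      w i = 1ℚ + node m i * node m i
      Jᵢ : ℕ → ℚ
      Jᵢ i = J (D i) E s

      D≡ : ∀ i → fromℕℚ (D i) ≡ μ * μ * w i
      D≡ i = trans (fromℕℚ-+ (m ℕ.* m) (i ℕ.* i)) (trans (cong₂ _+_ (fromℕℚ-* m m)
        (trans (fromℕℚ-* i i) (cong (λ z → z * z) i≡))) (eq μ (node m i)))
        where
        i≡ : fromℕℚ i ≡ μ * node m i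
        i≡ = sym (trans (e₁ μ (fromℕℚ i) (recip μ)) (trans (cong (fromℕℚ i *_) (recip-inverse (>⇒≢ 0<μ))) (ℚ.*-identityʳ (fromℕℚ i))))
          where
          e₁ = solve-ℚ 3 (λ m i r → m ⊗ (i ⊗ r) , i ⊗ (m ⊗ r)) refl
        eq = solve-ℚ 2 (λ m t → m ⊗ m ⊕ m ⊗ t ⊗ (m ⊗ t) , m ⊗ m ⊗ (Κ 1ℚ ⊕ t ⊗ t)) refl

      E≡ : fromℕℚ E ≡ μ * μ * ν
      E≡ = trans (fromℕℚ-* (m ℕ.* m) n) (cong (_* ν) (fromℕℚ-* m m))

      Jᵢ-upper : ∀ i → 2ℚ * Jᵢ i ≤ ν * φ (node m i) + σ
      Jᵢ-upper i = begin
        2ℚ * Jᵢ i ≤⟨ ≤-recip (0<1+t² (node m i)) (*-cancelˡ-≤ (0<* 0<μ 0<μ) (begin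
            μ * μ * (2ℚ * Jᵢ i * w i) ≡⟨ e₁ μ (2ℚ * Jᵢ i) (w i) ⟩
            2ℚ * Jᵢ i * (μ * μ * w i) ≡⟨ cong (2ℚ * Jᵢ i *_) (D≡ i) ⟨
            2ℚ * Jᵢ i * fromℕℚ (D i) ≤⟨ J-upper (D i) E s ⟩
            fromℕℚ E + σ * fromℕℚ (D i) ≡⟨ cong₂ (λ a b → a + σ * b) E≡ (D≡ i) ⟩
            μ * μ * ν + σ * (μ * μ * w i) ≡⟨ e₂ μ ν σ (w i) ⟩
            μ * μ * (ν + σ * w i) ∎)) ⟩
        (ν + σ * w i) * φ (node m i) ≡⟨ e₃ ν σ (w i) (φ (node m i)) ⟩
        ν * φ (node m i) + σ * (w i * φ (node m i))
                                         ≡⟨ cong (λ z → ν * φ (node m i) + σ * z) (recip-inverse (>⇒≢ (0<1+t² (node m i)))) ⟩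
        ν * φ (node m i) + σ * 1ℚ ≡⟨ cong (ν * φ (node m i) +_) (ℚ.*-identityʳ σ) ⟩
        ν * φ (node m i) + σ ∎
        where
        e₁ = solve-ℚ 3 (λ m j w → m ⊗ m ⊗ (j ⊗ w) , j ⊗ (m ⊗ m ⊗ w)) refl
        e₂ = solve-ℚ 4 (λ m n s w → m ⊗ m ⊗ n ⊕ s ⊗ (m ⊗ m ⊗ w) , m ⊗ m ⊗ (n ⊕ s ⊗ w)) refl
        e₃ = solve-ℚ 4 (λ n s w p → (n ⊕ s ⊗ w) ⊗ p , n ⊗ p ⊕ s ⊗ (w ⊗ p)) refl

      Jᵢ-lower : ∀ i → ν * φ (node m i) ≤ 2ℚ * Jᵢ i + fromℕℚ (suc s)
      Jᵢ-lower i = recip-*≤ (0<1+t² (node m i)) (*-cancelˡ-≤ (0<* 0<μ 0<μ) (begin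
        μ * μ * ν ≡⟨ E≡ ⟨
        fromℕℚ E ≤⟨ J-lower (D i) E s (ℕ.≤-trans (ℕ.*-monoʳ-≤ (m ℕ.* m) (ℕ.<⇒≤ n<[1+s]²))
                                                               (ℕ.≤-trans (ℕ.≤-reflexive (ℕ.*-comm (m ℕ.* m) (suc s ℕ.* suc s)))
                                                                 (ℕ.*-monoʳ-≤ (suc s ℕ.* suc s) (ℕ.m≤m+n (m ℕ.* m) (i ℕ.* i))))) ⟩
        2ℚ * Jᵢ i * fromℕℚ (D i) + fromℕℚ (suc s) * fromℕℚ (D i)
                                                         ≡⟨ cong (λ z → 2ℚ * Jᵢ i * z + fromℕℚ (suc s) * z) (D≡ i) ⟩
        2ℚ * Jᵢ i * (μ * μ * w i) + fromℕℚ (suc s) * (μ * μ * w i)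
                                                         ≡⟨ eq μ (2ℚ * Jᵢ i) (fromℕℚ (suc s)) (w i) ⟩
        μ * μ * ((2ℚ * Jᵢ i + fromℕℚ (suc s)) * w i) ∎))
        where
        eq = solve-ℚ 4 (λ m j s w → j ⊗ (m ⊗ m ⊗ w) ⊕ s ⊗ (m ⊗ m ⊗ w) , m ⊗ m ⊗ ((j ⊕ s) ⊗ w)) refl

      -- The exchange of summation that turns counting by gnomons into counting by slopes.
      regroup : ∀ (f : ℕ → ℕ) → ∑ⁿ s (λ c → fromℕℚ (suc c) * ∑ⁿ m (𝐘 (suc c) ∘ f)) ≡ ∑ⁿ m (Jᵢ ∘ f)
      regroup f = trans (∑ⁿ-cong s λ c _ → sym (∑ⁿ-* m (fromℕℚ (suc c)) (𝐘 (suc c) ∘ f)))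
        (∑ⁿ-swap s m (λ c i → fromℕℚ (suc c) * 𝐘 (suc c) (f i)))

      μcount : μ * count n ≡ ∑ⁿ s (λ c → μ * lower c + μ * upper c)
      μcount = trans (cong (μ *_) (count≡gnomons s s²≤n n<[1+s]²)) (trans (sym (∑ⁿ-* s μ (λ c → lower c + upper c)))
        (∑ⁿ-cong s λ c _ → ℚ.*-distribˡ-+ μ (lower c) (upper c)))

      twice : ∀ (f : ℕ → ℕ) → ∑ⁿ s (λ c → 2ℚ * (fromℕℚ (suc c) * ∑ⁿ m (𝐘 (suc c) ∘ f))) ≡ ∑ⁿ m (λ i → 2ℚ * Jᵢ (f i))
      twice f = trans (∑ⁿ-* s 2ℚ (λ c → fromℕℚ (suc c) * ∑ⁿ m (𝐘 (suc c) ∘ f)))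
        (trans (cong (2ℚ *_) (regroup f)) (sym (∑ⁿ-* m 2ℚ (Jᵢ ∘ f))))

      μcount≤ : μ * count n ≤ ∑ⁿ m (λ i → 2ℚ * Jᵢ i) + σ * μ
      μcount≤ = begin
        μ * count n
          ≡⟨ μcount ⟩
        ∑ⁿ s (λ c → μ * lower c + μ * upper c)
          ≤⟨ ∑ⁿ-≤ s (λ c _ → ℚ.≤-trans (ℚ.+-mono-≤ (lower≤ c) (upper≤ c))
               (ℚ.≤-reflexive (eq (fromℕℚ (suc c) * ∑ⁿ m (𝐘 (suc c))) μ))) ⟩
        ∑ⁿ s (λ c → 2ℚ * (fromℕℚ (suc c) * ∑ⁿ m (𝐘 (suc c))) + μ)
          ≡⟨ ∑ⁿ-+ s (λ c → 2ℚ * (fromℕℚ (suc c) * ∑ⁿ m (𝐘 (suc c)))) (λ _ → μ) ⟩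
        ∑ⁿ s (λ c → 2ℚ * (fromℕℚ (suc c) * ∑ⁿ m (𝐘 (suc c)))) + ∑ⁿ s (λ _ → μ)
          ≡⟨ cong₂ _+_ (twice id) (∑ⁿ-const s μ) ⟩
        ∑ⁿ m (λ i → 2ℚ * Jᵢ i) + σ * μ ∎
        where
        eq = solve-ℚ 2 (λ a m → a ⊕ m ⊕ a , (Κ 1ℚ ⊕ Κ 1ℚ) ⊗ a ⊕ m) refl

      μcount≥ : ∑ⁿ m (λ i → 2ℚ * Jᵢ (suc i)) ≤ μ * count n + σ * μ
      μcount≥ = begin
        ∑ⁿ m (λ i → 2ℚ * Jᵢ (suc i))
          ≡⟨ twice suc ⟨
        ∑ⁿ s (λ c → 2ℚ * (fromℕℚ (suc c) * ∑ⁿ m (𝐘 (suc c) ∘ suc)))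
          ≤⟨ ∑ⁿ-≤ s (λ c _ → ℚ.≤-trans (ℚ.≤-reflexive (eq (fromℕℚ (suc c) * ∑ⁿ m (𝐘 (suc c) ∘ suc))))
               (ℚ.≤-trans (ℚ.+-mono-≤ (lower≥ c) (upper≥ c)) (ℚ.≤-reflexive (sym (ℚ.+-assoc (μ * lower c) (μ * upper c) μ))))) ⟩
        ∑ⁿ s (λ c → μ * lower c + μ * upper c + μ)
          ≡⟨ ∑ⁿ-+ s (λ c → μ * lower c + μ * upper c) (λ _ → μ) ⟩
        ∑ⁿ s (λ c → μ * lower c + μ * upper c) + ∑ⁿ s (λ _ → μ)
          ≡⟨ cong₂ _+_ (sym μcount) (∑ⁿ-const s μ) ⟩
        μ * count n + σ * μ ∎
        where
        eq = solve-ℚ 1 (λ a → (Κ 1ℚ ⊕ Κ 1ℚ) ⊗ a , a ⊕ a) refl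

      φ-0 : φ (node m 0) ≡ 1ℚ
      φ-0 = cong (λ z → recip (1ℚ + z * z)) (ℚ.*-zeroˡ (recip μ))

      scale : ∀ {a b} → μ * a ≤ b → a ≤ recip μ * b
      scale {a} {b} le = subst (a ≤_) (ℚ.*-comm b (recip μ)) (≤-recip 0<μ (subst (_≤ b) (ℚ.*-comm μ a) le))

      unscale : ∀ c → recip μ * (c * μ) ≡ c
      unscale c = trans (eq (recip μ) c μ) (trans (cong (c *_) (recip-inverse (>⇒≢ 0<μ))) (ℚ.*-identityʳ c))
        where
        eq = solve-ℚ 3 (λ r c m → r ⊗ (c ⊗ m) , c ⊗ (m ⊗ r)) refl

    -- Two errors of size s arise: one from rounding the ordinates in each of the s gnomons, one
    -- from rounding the cutoff of c for each slope.
    count-upper : count n ≤ ν * riemann m φ + (σ + σ)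
    count-upper = ℚ.≤-trans (scale (begin
      μ * count n ≤⟨ μcount≤ ⟩
      ∑ⁿ m (λ i → 2ℚ * Jᵢ i) + σ * μ ≤⟨ ℚ.+-monoˡ-≤ (σ * μ) (∑ⁿ-≤ m λ i _ → Jᵢ-upper i) ⟩
      ∑ⁿ m (λ i → ν * φ (node m i) + σ) + σ * μ ≡⟨ cong (_+ σ * μ) (∑ⁿ-+ m (λ i → ν * φ (node m i)) (λ _ → σ)) ⟩
      ∑ⁿ m (λ i → ν * φ (node m i)) + ∑ⁿ m (λ _ → σ) + σ * μ
        ≡⟨ cong₂ (λ a b → a + b + σ * μ) (∑ⁿ-* m ν (φ ∘ node m)) (∑ⁿ-const m σ) ⟩
      ν * ∑ⁿ m (φ ∘ node m) + μ * σ + σ * μ ∎))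
      (ℚ.≤-reflexive (trans (e₁ (recip μ) ν (∑ⁿ m (φ ∘ node m)) μ σ) (cong (ν * riemann m φ +_) (unscale (σ + σ)))))
      where
      e₁ = solve-ℚ 5 (λ r n f m s → r ⊗ (n ⊗ f ⊕ m ⊗ s ⊕ s ⊗ m) , n ⊗ (r ⊗ f) ⊕ r ⊗ ((s ⊕ s) ⊗ m)) refl

    -- The estimate from below produces the nodes 1 / m to 1. Returning to the left Riemann sum
    -- costs φ(0) = 1 in the sum, that is n / m.
    count-lower : ν * riemann m φ ≤ count n + (σ + σ + 1ℚ) + ν * recip μ
    count-lower = begin
      ν * (recip μ * ∑ⁿ m (φ ∘ node m))
        ≤⟨ *-monoˡ-≤ (0≤fromℕℚ n) (*-monoˡ-≤ (0≤recip (0≤fromℕℚ m)) shift) ⟩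
      ν * (recip μ * (1ℚ + ∑ⁿ m (λ i → φ (node m (suc i)))))
        ≡⟨ e₁ ν (recip μ) (∑ⁿ m (λ i → φ (node m (suc i)))) ⟩
      recip μ * (ν * ∑ⁿ m (λ i → φ (node m (suc i)))) + ν * recip μ
        ≤⟨ ℚ.+-monoˡ-≤ (ν * recip μ) (*-monoˡ-≤ (0≤recip (0≤fromℕℚ m)) bound) ⟩
      recip μ * ((count n + (σ + σ + 1ℚ)) * μ) + ν * recip μ
        ≡⟨ cong (_+ ν * recip μ) (unscale (count n + (σ + σ + 1ℚ))) ⟩
      count n + (σ + σ + 1ℚ) + ν * recip μ ∎
      where
      e₁ = solve-ℚ 3 (λ n r f → n ⊗ (r ⊗ (Κ 1ℚ ⊕ f)) , r ⊗ (n ⊗ f) ⊕ n ⊗ r) refl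
      shift : ∑ⁿ m (φ ∘ node m) ≤ 1ℚ + ∑ⁿ m (λ i → φ (node m (suc i)))
      shift = ℚ.≤-trans (p≤p+q (ℚ.<⇒≤ (0<recip (0<1+t² (node m m)))))
        (ℚ.≤-reflexive (trans (∑ⁿ-suc m (φ ∘ node m)) (cong (_+ ∑ⁿ m (λ i → φ (node m (suc i)))) φ-0)))
      bound : ν * ∑ⁿ m (λ i → φ (node m (suc i))) ≤ (count n + (σ + σ + 1ℚ)) * μ
      bound = begin
        ν * ∑ⁿ m (λ i → φ (node m (suc i))) ≡⟨ ∑ⁿ-* m ν (λ i → φ (node m (suc i))) ⟨
        ∑ⁿ m (λ i → ν * φ (node m (suc i))) ≤⟨ ∑ⁿ-≤ m (λ i _ → Jᵢ-lower (suc i)) ⟩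
        ∑ⁿ m (λ i → 2ℚ * Jᵢ (suc i) + fromℕℚ (suc s)) ≡⟨ ∑ⁿ-+ m (λ i → 2ℚ * Jᵢ (suc i)) (λ _ → fromℕℚ (suc s)) ⟩
        ∑ⁿ m (λ i → 2ℚ * Jᵢ (suc i)) + ∑ⁿ m (λ _ → fromℕℚ (suc s))
                                                                 ≤⟨ ℚ.+-mono-≤ μcount≥ (ℚ.≤-reflexive (trans (∑ⁿ-const m (fromℕℚ (suc s))) (cong (μ *_) (fromℕℚ-suc s)))) ⟩
        μ * count n + σ * μ + μ * (1ℚ + σ) ≡⟨ e₂ μ (count n) σ ⟩
        (count n + (σ + σ + 1ℚ)) * μ ∎
        where
        e₂ = solve-ℚ 3 (λ m c s → m ⊗ c ⊕ s ⊗ m ⊕ m ⊗ (Κ 1ℚ ⊕ s) , (c ⊕ (s ⊕ s ⊕ Κ 1ℚ)) ⊗ m) refl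

open CircleProblem

-- The circle problem through the Leibniz series.

module LeibnizSeries where

  open ℚ-Operations using (_+_; _*_; _-_; -_; _≤_; _<_; ∣_∣)
  open ℚ.≤-Reasoning

  isqrt : ∀ n → ∃ λ s → s ℕ.* s ℕ.≤ n × n ℕ.< suc s ℕ.* suc s
  isqrt zero = 0 , z≤n , s≤s z≤n
  isqrt (suc n) with isqrt n
  ... | s , s²≤n , n<[1+s]² with suc s ℕ.* suc s ℕ.≤? suc n
  ... | yes le = suc s , le , ℕ.≤-<-trans n<[1+s]² (ℕ.*-mono-< {suc s} {suc (suc s)} ℕ.≤-refl ℕ.≤-refl)
  ... | no ≰ = s , ℕ.m≤n⇒m≤1+n s²≤n , ℕ.≰⇒> ≰

  telescope : ∀ m (f : ℕ → ℚ) → ∑ⁿ m (λ i → f (suc i) - f i) ≡ f m - f 0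
  telescope zero f = sym (ℚ.+-inverseʳ (f 0))
  telescope (suc m) f = trans (cong (_+ (f (suc m) - f m)) (telescope m f)) (eq (f 0) (f m) (f (suc m)))
    where
    eq = solve-ℚ 3 (λ a b c → b ⊕ ⊝ a ⊕ (c ⊕ ⊝ b) , c ⊕ ⊝ a) refl

  -- The mean value estimate for t^(j + 1) on [x, y]. It controls the Riemann sums of powers here
  -- and the increments of artanh later.
  power-increment : ∀ {x y} j → 0ℚ ≤ x → x ≤ y →
    fromℕℚ (suc j) * x ^ j * (y - x) ≤ y ^ suc j - x ^ suc j × y ^ suc j - x ^ suc j ≤ fromℕℚ (suc j) * y ^ j * (y - x)
  power-increment {x} {y} zero 0≤x x≤y = ℚ.≤-reflexive (eq x y) , ℚ.≤-reflexive (sym (eq x y))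
    where
    eq = solve-ℚ 2 (λ x y → Κ 1ℚ ⊗ Κ 1ℚ ⊗ (y ⊕ ⊝ x) , y ⊗ Κ 1ℚ ⊕ ⊝ (x ⊗ Κ 1ℚ)) refl
  power-increment {x} {y} (suc j) 0≤x x≤y with power-increment j 0≤x x≤y
  ... | lo , hi =
    (begin
      fromℕℚ (suc (suc j)) * (x * x ^ j) * (y - x) ≡⟨ cong (λ z → z * (x * x ^ j) * (y - x)) (fromℕℚ-suc (suc j)) ⟩
      (1ℚ + fromℕℚ (suc j)) * (x * x ^ j) * (y - x) ≡⟨ e₁ (fromℕℚ (suc j)) x (x ^ j) (y - x) ⟩
      x * (fromℕℚ (suc j) * x ^ j * (y - x)) + x * x ^ j * (y - x) ≤⟨ ℚ.+-monoˡ-≤ _ (*-monoˡ-≤ 0≤x lo) ⟩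
      x * (y * y ^ j - x * x ^ j) + x * x ^ j * (y - x) ≤⟨ ≤-by _ (e₂ x (x ^ j) y (y ^ j))
                                                                          (0≤* (p≤q⇒0≤q-p x≤y) (p≤q⇒0≤q-p (^-monoˡ-≤ (suc j) 0≤x x≤y))) ⟩
      y * (y * y ^ j) - x * (x * x ^ j) ∎) ,
    (begin
      y * (y * y ^ j) - x * (x * x ^ j) ≡⟨ e₃ x (x ^ j) y (y ^ j) ⟩
      y * (y * y ^ j - x * x ^ j) + x * x ^ j * (y - x) ≤⟨ ℚ.+-mono-≤ (*-monoˡ-≤ (ℚ.≤-trans 0≤x x≤y) hi)
                                                                          (*-monoʳ-≤ (p≤q⇒0≤q-p x≤y) (^-monoˡ-≤ (suc j) 0≤x x≤y)) ⟩
      y * (fromℕℚ (suc j) * y ^ j * (y - x)) + y * y ^ j * (y - x) ≡⟨ e₁ (fromℕℚ (suc j)) y (y ^ j) (y - x) ⟨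
      (1ℚ + fromℕℚ (suc j)) * (y * y ^ j) * (y - x) ≡⟨ cong (λ z → z * (y * y ^ j) * (y - x)) (sym (fromℕℚ-suc (suc j))) ⟩
      fromℕℚ (suc (suc j)) * (y * y ^ j) * (y - x) ∎)
    where
    e₁ = solve-ℚ 4 (λ j x p d → (Κ 1ℚ ⊕ j) ⊗ (x ⊗ p) ⊗ d , x ⊗ (j ⊗ p ⊗ d) ⊕ x ⊗ p ⊗ d) refl
    e₂ = solve-ℚ 4 (λ x p y q → y ⊗ (y ⊗ q) ⊕ ⊝ (x ⊗ (x ⊗ p)) , x ⊗ (y ⊗ q ⊕ ⊝ (x ⊗ p)) ⊕ x ⊗ p ⊗ (y ⊕ ⊝ x) ⊕ (y ⊕ ⊝ x) ⊗ (y ⊗ q ⊕ ⊝ (x ⊗ p))) refl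
    e₃ = solve-ℚ 4 (λ x p y q → y ⊗ (y ⊗ q) ⊕ ⊝ (x ⊗ (x ⊗ p)) , y ⊗ (y ⊗ q ⊕ ⊝ (x ⊗ p)) ⊕ x ⊗ p ⊗ (y ⊕ ⊝ x)) refl

  even-power : ∀ x k → (x * x) ^ k ≡ x ^ (2 ℕ.* k)
  even-power x k = trans (cong (_^ k) (cong (x *_) (sym (ℚ.*-identityʳ x)))) (^-assocʳ x 2 k)

  module _ (m : ℕ) (0<m : 0 ℕ.< m) where

    private
      r : ℚ
      r = recip (fromℕℚ m)
      0≤r : 0ℚ ≤ r
      0≤r = 0≤recip (0≤fromℕℚ m)
      t : ℕ → ℚ
      t = node m
      0≤t : ∀ i → 0ℚ ≤ t i
      0≤t i = 0≤* (0≤fromℕℚ i) 0≤r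
      t-suc : ∀ i → t (suc i) ≡ t i + r
      t-suc i = trans (cong (_* r) (fromℕℚ-suc i)) (eq (fromℕℚ i) r)
        where
        eq = solve-ℚ 2 (λ i r → (Κ 1ℚ ⊕ i) ⊗ r , i ⊗ r ⊕ r) refl
      t-step : ∀ i → t (suc i) - t i ≡ r
      t-step i = trans (cong (_- t i) (t-suc i)) (eq (t i) r)
        where
        eq = solve-ℚ 2 (λ t r → t ⊕ r ⊕ ⊝ t , r) refl
      t≤t : ∀ i → t i ≤ t (suc i)
      t≤t i = subst (t i ≤_) (sym (t-suc i)) (p≤p+q 0≤r)
      t-0 : t 0 ≡ 0ℚ
      t-0 = ℚ.*-zeroˡ r
      t-m : t m ≡ 1ℚ
      t-m = recip-inverse (>⇒≢ (0<fromℕℚ 0<m))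

      increments : ∀ j → ∑ⁿ m (λ i → t (suc i) ^ suc j - t i ^ suc j) ≡ 1ℚ
      increments j = trans (telescope m (λ i → t i ^ suc j)) (trans (cong₂ (λ a b → a ^ suc j - b * b ^ j) t-m t-0)
        (trans (cong₂ _-_ (1^ (suc j)) (ℚ.*-zeroˡ (0ℚ ^ j))) refl))

    -- The lower half of `power-increment` bounds each term by an increment of t^(j + 1), and these
    -- increments telescope to 1.
    riemann-power-upper : ∀ j → fromℕℚ (suc j) * riemann m (_^ j) ≤ 1ℚ
    riemann-power-upper j = begin
      fromℕℚ (suc j) * (r * ∑ⁿ m (λ i → t i ^ j)) ≡⟨ e₁ (fromℕℚ (suc j)) r (∑ⁿ m (λ i → t i ^ j)) ⟩
      fromℕℚ (suc j) * r * ∑ⁿ m (λ i → t i ^ j) ≡⟨ ∑ⁿ-* m (fromℕℚ (suc j) * r) (λ i → t i ^ j) ⟨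
      ∑ⁿ m (λ i → fromℕℚ (suc j) * r * t i ^ j) ≤⟨ ∑ⁿ-≤ m (λ i _ → ℚ.≤-trans (ℚ.≤-reflexive
                                                                            (trans (e₂ (fromℕℚ (suc j)) r (t i ^ j)) (cong (fromℕℚ (suc j) * t i ^ j *_) (sym (t-step i)))))
                                                                            (proj₁ (power-increment j (0≤t i) (t≤t i)))) ⟩
      ∑ⁿ m (λ i → t (suc i) ^ suc j - t i ^ suc j) ≡⟨ increments j ⟩
      1ℚ ∎
      where
      e₁ = solve-ℚ 3 (λ a b c → a ⊗ (b ⊗ c) , a ⊗ b ⊗ c) refl
      e₂ = solve-ℚ 3 (λ a b c → a ⊗ b ⊗ c , a ⊗ c ⊗ b) refl

    riemann-power-lower : ∀ j → 1ℚ ≤ fromℕℚ (suc j) * (riemann m (_^ j) + r)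
    riemann-power-lower j = begin
      1ℚ ≡⟨ increments j ⟨
      ∑ⁿ m (λ i → t (suc i) ^ suc j - t i ^ suc j) ≤⟨ ∑ⁿ-≤ m (λ i _ → ℚ.≤-trans (proj₂ (power-increment j (0≤t i) (t≤t i)))
                                                                            (ℚ.≤-reflexive (trans (cong (fromℕℚ (suc j) * t (suc i) ^ j *_) (t-step i))
                                                                              (e₂ (fromℕℚ (suc j)) (t (suc i) ^ j) r)))) ⟩
      ∑ⁿ m (λ i → fromℕℚ (suc j) * r * t (suc i) ^ j) ≡⟨ ∑ⁿ-* m (fromℕℚ (suc j) * r) (λ i → t (suc i) ^ j) ⟩
      fromℕℚ (suc j) * r * ∑ⁿ m (λ i → t (suc i) ^ j) ≤⟨ *-monoˡ-≤ (0≤* (0≤fromℕℚ (suc j)) 0≤r) shift ⟩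
      fromℕℚ (suc j) * r * (∑ⁿ m (λ i → t i ^ j) + 1ℚ) ≡⟨ e₁ (fromℕℚ (suc j)) r (∑ⁿ m (λ i → t i ^ j)) ⟩
      fromℕℚ (suc j) * (r * ∑ⁿ m (λ i → t i ^ j) + r) ∎
      where
      e₁ = solve-ℚ 3 (λ a b c → a ⊗ b ⊗ (c ⊕ Κ 1ℚ) , a ⊗ (b ⊗ c ⊕ b)) refl
      e₂ = solve-ℚ 3 (λ a b c → a ⊗ b ⊗ c , a ⊗ c ⊗ b) refl
      shift : ∑ⁿ m (λ i → t (suc i) ^ j) ≤ ∑ⁿ m (λ i → t i ^ j) + 1ℚ
      shift = begin
        ∑ⁿ m (λ i → t (suc i) ^ j) ≤⟨ q≤p+q (0≤^ j (0≤t 0)) ⟩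
        t 0 ^ j + ∑ⁿ m (λ i → t (suc i) ^ j) ≡⟨ ∑ⁿ-suc m (λ i → t i ^ j) ⟨
        ∑ⁿ m (λ i → t i ^ j) + t m ^ j ≡⟨ cong (λ z → ∑ⁿ m (λ i → t i ^ j) + z) (trans (cong (_^ j) t-m) (1^ j)) ⟩
        ∑ⁿ m (λ i → t i ^ j) + 1ℚ ∎

    riemann-power≤ : ∀ j → riemann m (_^ j) ≤ recip (fromℕℚ (suc j))
    riemann-power≤ j = *-cancelˡ-≤ (0<fromℕℚ-suc j) (subst (fromℕℚ (suc j) * riemann m (_^ j) ≤_)
      (sym (recip-inverse (>⇒≢ (0<fromℕℚ-suc j)))) (riemann-power-upper j))

    riemann-power-close : ∀ j → ∣ riemann m (_^ j) - recip (fromℕℚ (suc j)) ∣ ≤ r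
    riemann-power-close j = ∣p∣≤
      (ℚ.≤-trans (subst (riemann m (_^ j) - q ≤_) (ℚ.+-inverseʳ q) (ℚ.+-monoˡ-≤ (- q) (riemann-power≤ j))) 0≤r)
      (subst₂ _≤_ (e₁ (riemann m (_^ j)) q) (e₂ (riemann m (_^ j)) r)
        (ℚ.+-monoˡ-≤ (- riemann m (_^ j)) {q} {riemann m (_^ j) + r} (recip-≤ {fromℕℚ (suc j)} {riemann m (_^ j) + r} (0<fromℕℚ-suc j) (riemann-power-lower j))))
      where
      q = recip (fromℕℚ (suc j))
      e₁ = solve-ℚ 2 (λ a q → q ⊕ ⊝ a , ⊝ (a ⊕ ⊝ q)) refl
      e₂ = solve-ℚ 2 (λ a r → a ⊕ r ⊕ ⊝ a , r) refl

    ∣alternating∣≡1 : ∀ k → ∣ alternating k ∣ ≡ 1ℚ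
    ∣alternating∣≡1 zero = refl
    ∣alternating∣≡1 (suc k) = trans (ℚ.∣-p∣≡∣p∣ (alternating k)) (∣alternating∣≡1 k)

    leibniz≡ : ∀ K → leibniz K ≡ ∑ⁿ K (λ k → alternating k * recip (fromℕℚ (suc (2 ℕ.* k))))
    leibniz≡ zero = refl
    leibniz≡ (suc K) = cong (_+ alternating K * recip (fromℕℚ (suc (2 ℕ.* K)))) (leibniz≡ K)

    alternating-geometric : ∀ u K → (1ℚ + u) * ∑ⁿ K (λ k → alternating k * u ^ k) ≡ 1ℚ - alternating K * u ^ K
    alternating-geometric u zero = ℚ.*-zeroʳ (1ℚ + u)
    alternating-geometric u (suc K) = trans (ℚ.*-distribˡ-+ (1ℚ + u) (∑ⁿ K (λ k → alternating k * u ^ k)) (alternating K * u ^ K))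
      (trans (cong (_+ (1ℚ + u) * (alternating K * u ^ K)) (alternating-geometric u K)) (eq u (alternating K) (u ^ K)))
      where
      eq = solve-ℚ 3 (λ u a p → Κ 1ℚ ⊕ ⊝ (a ⊗ p) ⊕ (Κ 1ℚ ⊕ u) ⊗ (a ⊗ p) , Κ 1ℚ ⊕ ⊝ (⊝ a ⊗ (u ⊗ p))) refl

    partial : ℕ → ℚ → ℚ
    partial K x = ∑ⁿ K (λ k → alternating k * x ^ (2 ℕ.* k))

    -- The alternating geometric series for 1 / (1 + x²) has the exact remainder ± x^(2K) / (1 +
    -- x²).
    φ-remainder : ∀ x K → ∣ φ x - partial K x ∣ ≤ x ^ (2 ℕ.* K)
    φ-remainder x K = begin
      ∣ φ x - partial K x ∣
        ≡⟨ cong (λ z → ∣ φ x - z ∣) (trans (∑ⁿ-cong K λ k _ → cong (alternating k *_) (sym (even-power x k))) closed) ⟩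
      ∣ φ x - φ x * (1ℚ - alternating K * u ^ K) ∣
        ≡⟨ cong ∣_∣ (e₁ (φ x) (alternating K) (u ^ K)) ⟩
      ∣ φ x * u ^ K * alternating K ∣
        ≡⟨ ℚ.∣p*q∣≡∣p∣*∣q∣ (φ x * u ^ K) (alternating K) ⟩
      ∣ φ x * u ^ K ∣ * ∣ alternating K ∣
        ≡⟨ cong₂ _*_ (ℚ.0≤p⇒∣p∣≡p (0≤* (ℚ.<⇒≤ (0<recip (0<1+t² x))) (0≤^ K (square≥0 x)))) (∣alternating∣≡1 K) ⟩
      φ x * u ^ K * 1ℚ
        ≡⟨ ℚ.*-identityʳ (φ x * u ^ K) ⟩
      φ x * u ^ K
        ≤⟨ *-monoʳ-≤ (0≤^ K (square≥0 x)) (recip≤1 (p≤p+q (square≥0 x))) ⟩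
      1ℚ * u ^ K
        ≡⟨ trans (ℚ.*-identityˡ (u ^ K)) (even-power x K) ⟩
      x ^ (2 ℕ.* K) ∎
      where
      u = x * x
      closed : ∑ⁿ K (λ k → alternating k * u ^ k) ≡ φ x * (1ℚ - alternating K * u ^ K)
      closed = trans (sym (ℚ.*-identityˡ _)) (trans (cong (_* ∑ⁿ K (λ k → alternating k * u ^ k)) (sym (recip-inverse (>⇒≢ (0<1+t² x)))))
        (trans (e₂ (1ℚ + u) (φ x) (∑ⁿ K (λ k → alternating k * u ^ k))) (cong (φ x *_) (alternating-geometric u K))))
        where
        e₂ = solve-ℚ 3 (λ a b c → a ⊗ b ⊗ c , b ⊗ (a ⊗ c)) refl
      e₁ = solve-ℚ 3 (λ p a q → p ⊕ ⊝ (p ⊗ (Κ 1ℚ ⊕ ⊝ (a ⊗ q))) , p ⊗ q ⊗ a) refl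

    -- The remainder x^(2K) has Riemann sum at most 1 / (2K + 1), and each of the K powers is
    -- integrated with error at most 1 / m. Hence m has to grow faster than K.
    riemann-leibniz : ∀ K → ∣ riemann m φ - leibniz K ∣ ≤ recip (fromℕℚ (suc (2 ℕ.* K))) + fromℕℚ K * r
    riemann-leibniz K = ℚ.≤-trans (triangle (riemann m φ) (riemann m (partial K)) (leibniz K))
      (ℚ.+-mono-≤ (ℚ.≤-trans first (riemann-power≤ (2 ℕ.* K))) second)
      where
      ∑ⁿ-- : ∀ n (f g : ℕ → ℚ) → ∑ⁿ n f - ∑ⁿ n g ≡ ∑ⁿ n (λ i → f i - g i)
      ∑ⁿ-- zero f g = refl
      ∑ⁿ-- (suc n) f g = trans (eq (∑ⁿ n f) (f n) (∑ⁿ n g) (g n)) (cong (_+ (f n - g n)) (∑ⁿ-- n f g))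
        where
        eq = solve-ℚ 4 (λ a b c d → a ⊕ b ⊕ ⊝ (c ⊕ d) , a ⊕ ⊝ c ⊕ (b ⊕ ⊝ d)) refl
      first : ∣ riemann m φ - riemann m (partial K) ∣ ≤ riemann m (_^ (2 ℕ.* K))
      first = begin
        ∣ r * ∑ⁿ m (φ ∘ t) - r * ∑ⁿ m (partial K ∘ t) ∣
          ≡⟨ cong ∣_∣ (trans (eq r (∑ⁿ m (φ ∘ t)) (∑ⁿ m (partial K ∘ t))) (cong (r *_) (∑ⁿ-- m (φ ∘ t) (partial K ∘ t)))) ⟩
        ∣ r * ∑ⁿ m (λ i → φ (t i) - partial K (t i)) ∣
          ≡⟨ trans (ℚ.∣p*q∣≡∣p∣*∣q∣ r _) (cong (_* ∣ ∑ⁿ m (λ i → φ (t i) - partial K (t i)) ∣) (ℚ.0≤p⇒∣p∣≡p 0≤r)) ⟩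
        r * ∣ ∑ⁿ m (λ i → φ (t i) - partial K (t i)) ∣
          ≤⟨ *-monoˡ-≤ 0≤r (ℚ.≤-trans (∣∑ⁿ∣ m (λ i → φ (t i) - partial K (t i))) (∑ⁿ-≤ m λ i _ → φ-remainder (t i) K)) ⟩
        r * ∑ⁿ m (λ i → t i ^ (2 ℕ.* K)) ∎
        where
        eq = solve-ℚ 3 (λ r a b → r ⊗ a ⊕ ⊝ (r ⊗ b) , r ⊗ (a ⊕ ⊝ b)) refl
      R : ℕ → ℚ
      R k = riemann m (_^ (2 ℕ.* k))
      q : ℕ → ℚ
      q k = recip (fromℕℚ (suc (2 ℕ.* k)))
      expand : riemann m (partial K) ≡ ∑ⁿ K (λ k → alternating k * R k)
      expand = trans (cong (r *_) (∑ⁿ-swap m K (λ i k → alternating k * t i ^ (2 ℕ.* k))))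
        (trans (sym (∑ⁿ-* K r (λ k → ∑ⁿ m (λ i → alternating k * t i ^ (2 ℕ.* k)))))
          (∑ⁿ-cong K λ k _ → trans (cong (r *_) (∑ⁿ-* m (alternating k) (λ i → t i ^ (2 ℕ.* k))))
            (eq r (alternating k) (∑ⁿ m (λ i → t i ^ (2 ℕ.* k))))))
        where
        eq = solve-ℚ 3 (λ a b c → a ⊗ (b ⊗ c) , b ⊗ (a ⊗ c)) refl
      second : ∣ riemann m (partial K) - leibniz K ∣ ≤ fromℕℚ K * r
      second = begin
        ∣ riemann m (partial K) - leibniz K ∣
          ≡⟨ cong ∣_∣ (trans (cong₂ _-_ expand (leibniz≡ K)) (∑ⁿ-- K (λ k → alternating k * R k) (λ k → alternating k * q k))) ⟩
        ∣ ∑ⁿ K (λ k → alternating k * R k - alternating k * q k) ∣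
          ≤⟨ ∣∑ⁿ∣ K (λ k → alternating k * R k - alternating k * q k) ⟩
        ∑ⁿ K (λ k → ∣ alternating k * R k - alternating k * q k ∣)
          ≤⟨ ∑ⁿ-≤ K (λ k _ → ℚ.≤-trans (ℚ.≤-reflexive (trans (cong ∣_∣ (eq (alternating k) (R k) (q k)))
               (trans (ℚ.∣p*q∣≡∣p∣*∣q∣ (alternating k) (R k - q k)) (trans (cong (_* ∣ R k - q k ∣) (∣alternating∣≡1 k)) (ℚ.*-identityˡ ∣ R k - q k ∣)))))
               (riemann-power-close (2 ℕ.* k))) ⟩
        ∑ⁿ K (λ _ → r)
          ≡⟨ ∑ⁿ-const K r ⟩
        fromℕℚ K * r ∎
        where
        eq = solve-ℚ 3 (λ a b c → a ⊗ b ⊕ ⊝ (a ⊗ c) , a ⊗ (b ⊕ ⊝ c)) refl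

  frac≤1 : ∀ {m n} → 0 ℕ.< n → m ℕ.≤ n → fromℕℚ m * recip (fromℕℚ n) ≤ 1ℚ
  frac≤1 {m} {n} 0<n m≤n = recip-*≤ (0<fromℕℚ 0<n) (subst (fromℕℚ m ≤_) (sym (ℚ.*-identityˡ (fromℕℚ n))) (fromℕℚ-mono m≤n))

  -- The Riemann sums are taken with K * K steps, the Leibniz series with K terms.
  circle-problem : ∀ n s K → 0 ℕ.< s → n ℕ.≤ K → s ℕ.* s ℕ.≤ n → n ℕ.< suc s ℕ.* suc s →
    ∣ count n - leibniz K * fromℕℚ n ∣ ≤ fromℕℚ 6 * fromℕℚ s
  circle-problem n s K 0<s n≤K s²≤n n<[1+s]² = ∣p∣≤
    (begin
      count n - leibniz K * ν ≤⟨ ℚ.+-mono-≤ (count-upper n s m 0<m s²≤n n<[1+s]²) ℚ.≤-refl ⟩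
      ν * ρ + (σ + σ) - leibniz K * ν ≡⟨ e₁ ν ρ σ (leibniz K) ⟩
      ν * (ρ - leibniz K) + (σ + σ) ≤⟨ ℚ.+-monoˡ-≤ (σ + σ) (ℚ.≤-trans (*-monoˡ-≤ (0≤fromℕℚ n) (p≤∣p∣ (ρ - leibniz K))) ν∣ρ-λ∣≤) ⟩
      1ℚ + 1ℚ + (σ + σ) ≤⟨ ≤-by _ (e₂ σ) (0≤+ (0≤+ (p≤q⇒0≤q-p 1≤σ) (p≤q⇒0≤q-p 1≤σ)) (0≤+ (0≤fromℕℚ s) (0≤fromℕℚ s))) ⟩
      fromℕℚ 6 * σ ∎)
    (begin
      - (count n - leibniz K * ν) ≡⟨ e₃ (count n) (leibniz K) ν ρ ⟩
      ν * ρ - count n + ν * (leibniz K - ρ) ≤⟨ ℚ.+-mono-≤ (ℚ.+-monoˡ-≤ (- count n) (count-lower n s m 0<m s²≤n n<[1+s]²))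
                                                              (ℚ.≤-trans (*-monoˡ-≤ (0≤fromℕℚ n) (p≤∣p∣ (leibniz K - ρ)))
                                                                (subst (λ z → ν * z ≤ 1ℚ + 1ℚ) (∣p-q∣≡∣q-p∣ ρ (leibniz K)) ν∣ρ-λ∣≤)) ⟩
      count n + (σ + σ + 1ℚ) + ν * recip (fromℕℚ m) - count n + (1ℚ + 1ℚ)
                                                          ≡⟨ e₄ (count n) σ (ν * recip (fromℕℚ m)) ⟩
      σ + σ + (1ℚ + 1ℚ + 1ℚ) + ν * recip (fromℕℚ m) ≤⟨ ℚ.+-monoʳ-≤ (σ + σ + (1ℚ + 1ℚ + 1ℚ)) (frac≤1 0<m (ℕ.≤-trans n≤K (n≤n² K))) ⟩
      σ + σ + (1ℚ + 1ℚ + 1ℚ) + 1ℚ ≤⟨ ≤-by _ (e₅ σ) (0≤+ (0≤+ (p≤q⇒0≤q-p 1≤σ) (p≤q⇒0≤q-p 1≤σ)) (0≤+ (p≤q⇒0≤q-p 1≤σ) (p≤q⇒0≤q-p 1≤σ))) ⟩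
      fromℕℚ 6 * σ ∎)
    where
    m = K ℕ.* K
    ν = fromℕℚ n
    σ = fromℕℚ s
    0<n : 0 ℕ.< n
    0<n = ℕ.≤-trans (ℕ.*-mono-≤ 0<s 0<s) s²≤n
    0<K = ℕ.≤-trans 0<n n≤K
    0<m : 0 ℕ.< m
    0<m = ℕ.*-mono-≤ 0<K 0<K
    ρ = riemann m φ
    1≤σ : 1ℚ ≤ σ
    1≤σ = 1≤fromℕℚ 0<s
    ν∣ρ-λ∣≤ : ν * ∣ ρ - leibniz K ∣ ≤ 1ℚ + 1ℚ
    ν∣ρ-λ∣≤ = begin
      ν * ∣ ρ - leibniz K ∣ ≤⟨ *-monoˡ-≤ (0≤fromℕℚ n) (riemann-leibniz m 0<m K) ⟩
      ν * (recip (fromℕℚ (suc (2 ℕ.* K))) + fromℕℚ K * recip (fromℕℚ m))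
                                                                      ≡⟨ eq ν (recip (fromℕℚ (suc (2 ℕ.* K)))) (fromℕℚ K) (recip (fromℕℚ m)) ⟩
      ν * recip (fromℕℚ (suc (2 ℕ.* K))) + ν * fromℕℚ K * recip (fromℕℚ m)
        ≤⟨ ℚ.+-mono-≤ (frac≤1 {n} {suc (2 ℕ.* K)} (s≤s z≤n) (ℕ.m≤n⇒m≤1+n (ℕ.≤-trans n≤K (ℕ.m≤m+n K (K ℕ.+ 0)))))
             (subst (λ z → z * recip (fromℕℚ m) ≤ 1ℚ) (fromℕℚ-* n K) (frac≤1 {n ℕ.* K} {m} 0<m (ℕ.*-monoˡ-≤ K n≤K))) ⟩
      1ℚ + 1ℚ ∎
      where
      eq = solve-ℚ 4 (λ n a k b → n ⊗ (a ⊕ k ⊗ b) , n ⊗ a ⊕ n ⊗ k ⊗ b) refl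
    e₁ = solve-ℚ 4 (λ n r s l → n ⊗ r ⊕ (s ⊕ s) ⊕ ⊝ (l ⊗ n) , n ⊗ (r ⊕ ⊝ l) ⊕ (s ⊕ s)) refl
    e₂ = solve-ℚ 1 (λ s → Κ (fromℕℚ 6) ⊗ s , Κ 1ℚ ⊕ Κ 1ℚ ⊕ (s ⊕ s) ⊕ (s ⊕ ⊝ (Κ 1ℚ) ⊕ (s ⊕ ⊝ (Κ 1ℚ)) ⊕ (s ⊕ s))) refl
    e₃ = solve-ℚ 4 (λ c l n r → ⊝ (c ⊕ ⊝ (l ⊗ n)) , n ⊗ r ⊕ ⊝ c ⊕ n ⊗ (l ⊕ ⊝ r)) refl
    e₄ = solve-ℚ 3 (λ c s x → c ⊕ (s ⊕ s ⊕ Κ 1ℚ) ⊕ x ⊕ ⊝ c ⊕ (Κ 1ℚ ⊕ Κ 1ℚ) , s ⊕ s ⊕ (Κ 1ℚ ⊕ Κ 1ℚ ⊕ Κ 1ℚ) ⊕ x) refl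
    e₅ = solve-ℚ 1 (λ s → Κ (fromℕℚ 6) ⊗ s , s ⊕ s ⊕ (Κ 1ℚ ⊕ Κ 1ℚ ⊕ Κ 1ℚ) ⊕ Κ 1ℚ ⊕ (s ⊕ ⊝ (Κ 1ℚ) ⊕ (s ⊕ ⊝ (Κ 1ℚ)) ⊕ (s ⊕ ⊝ (Κ 1ℚ) ⊕ (s ⊕ ⊝ (Κ 1ℚ))))) refl

  -- The gnomon of c has at most 2 c points, and s (s + 1) ≤ 2 n.
  count≤ : ∀ n → count n ≤ 2ℚ * fromℕℚ n
  count≤ n with isqrt n
  ... | s , s²≤n , n<[1+s]² = begin
    count n ≡⟨ count≡gnomons s s²≤n n<[1+s]² ⟩
    ∑ⁿ s (λ c → lower c + upper c) ≤⟨ ∑ⁿ-≤ s (λ c _ → ℚ.≤-trans (ℚ.+-mono-≤ (ones (suc c) (λ b → 𝟙≤1 (X? (suc c) b)))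
                                                                                      (ones (suc c) (λ a → 𝟙≤1 (X? (suc c) (suc a)))))
                                                               (ℚ.≤-reflexive (e₁ (fromℕℚ (suc c))))) ⟩
    ∑ⁿ s (λ c → 2ℚ * fromℕℚ (suc c)) ≡⟨ ∑ⁿ-* s 2ℚ (fromℕℚ ∘ suc) ⟩
    2ℚ * ∑ⁿ s (fromℕℚ ∘ suc) ≡⟨ triangular 0 0 s ⟩
    fromℕℚ s * (1ℚ + fromℕℚ s) ≡⟨ e₂ (fromℕℚ s) ⟩
    fromℕℚ s + fromℕℚ s * fromℕℚ s ≡⟨ cong (fromℕℚ s +_) (fromℕℚ-* s s) ⟨
    fromℕℚ s + fromℕℚ (s ℕ.* s) ≤⟨ ℚ.+-mono-≤ (fromℕℚ-mono (ℕ.≤-trans (n≤n² s) s²≤n)) (fromℕℚ-mono s²≤n) ⟩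
    fromℕℚ n + fromℕℚ n ≡⟨ e₁ (fromℕℚ n) ⟩
    2ℚ * fromℕℚ n ∎
    where
    open Circle n
    ones : ∀ m {f : ℕ → ℚ} → (∀ i → f i ≤ 1ℚ) → ∑ⁿ m f ≤ fromℕℚ m
    ones m le = ℚ.≤-trans (∑ⁿ-≤ m λ i _ → le i) (ℚ.≤-reflexive (trans (∑ⁿ-const m 1ℚ) (ℚ.*-identityʳ (fromℕℚ m))))
    e₁ = solve-ℚ 1 (λ a → a ⊕ a , (Κ 1ℚ ⊕ Κ 1ℚ) ⊗ a) refl
    e₂ = solve-ℚ 1 (λ s → s ⊗ (Κ 1ℚ ⊕ s) , s ⊕ s ⊗ s) refl

open LeibnizSeries

-- The error term of the summatory function.

module ErrorTerm where

  open ℚ-Operations using (_+_; _*_; _-_; -_; _≤_; _<_; ∣_∣)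
  open ℚ.≤-Reasoning

  -- A rational above 1 / √2, hence above 1 / √N for N ≥ 2, and so small that its product with the
  -- growth rate `⁵/₄` stays below 1.
  ¾ : ℚ
  ¾ = 1ℚ - ½ * ½

  0≤¾ : 0ℚ ≤ ¾
  0≤¾ = ℚ.nonNegative⁻¹ ¾

  -- w² N^a ≥ 1, so that r w bounds the square root of y / N^a as soon as r bounds that of y. The value at 2
  -- is sharp, since it determines the power of the logarithm.
  weight : ℕ → ℕ → ℚ
  weight N 0 = 1ℚ
  weight N 1 = 1ℚ
  weight N 2 = recip (fromℕℚ N)
  weight N (suc (suc (suc a))) = recip (fromℕℚ N) * recip (fromℕℚ (proj₁ (isqrt N))) * ¾ ^ a

  isqrt-pos : ∀ {N} → 0 ℕ.< N → 0 ℕ.< proj₁ (isqrt N)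
  isqrt-pos {N} 0<N with isqrt N
  ... | zero , _ , N<1 = ⊥-elim (ℕ.<⇒≱ N<1 0<N)
  ... | suc s , _ , _ = s≤s z≤n

  0≤weight : ∀ N a → 0ℚ ≤ weight N a
  0≤weight N 0 = 0≤1
  0≤weight N 1 = 0≤1
  0≤weight N 2 = 0≤recip (0≤fromℕℚ N)
  0≤weight N (suc (suc (suc a))) = 0≤* (0≤* (0≤recip (0≤fromℕℚ N)) (0≤recip (0≤fromℕℚ (proj₁ (isqrt N))))) (0≤^ a 0≤¾)

  weight-spec : ∀ N a → 2 ℕ.≤ N → 1ℚ ≤ weight N a * weight N a * fromℕℚ (N ℕ.^ a)
  weight-spec N 0 _ = ℚ.≤-refl
  weight-spec N 1 2≤N = subst (1ℚ ≤_) (trans (cong fromℕℚ (sym (ℕ.*-identityʳ N))) (sym (ℚ.*-identityˡ (fromℕℚ (N ℕ.* 1)))))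
    (1≤fromℕℚ (ℕ.<⇒≤ 2≤N))
  weight-spec N 2 2≤N = ℚ.≤-reflexive (sym (trans (cong (recip ν * recip ν *_) (fromℕℚ-^ N 2)) (trans (eq (recip ν) ν)
    (cong₂ _*_ νr≡1 νr≡1))))
    where
    ν = fromℕℚ N
    νr≡1 : ν * recip ν ≡ 1ℚ
    νr≡1 = recip-inverse (>⇒≢ (0<fromℕℚ (ℕ.<⇒≤ 2≤N)))
    eq = solve-ℚ 2 (λ r n → r ⊗ r ⊗ (n ⊗ (n ⊗ Κ 1ℚ)) , n ⊗ r ⊗ (n ⊗ r)) refl
  weight-spec N (suc (suc (suc a))) 2≤N = subst (1ℚ ≤_) (sym total) (1≤* 1≤y²ν 1≤q²νᵃ)
    where
    ν = fromℕℚ N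
    s = proj₁ (isqrt N)
    σ = fromℕℚ s
    x = recip ν
    y = recip σ
    q = ¾ ^ a
    0<σ = 0<fromℕℚ (isqrt-pos (ℕ.<⇒≤ 2≤N))
    νx≡1 : ν * x ≡ 1ℚ
    νx≡1 = recip-inverse (>⇒≢ (0<fromℕℚ (ℕ.<⇒≤ 2≤N)))
    total : x * y * q * (x * y * q) * fromℕℚ (N ℕ.^ suc (suc (suc a))) ≡ y * y * ν * (¾ * ¾ * ν) ^ a
    total = trans (cong (x * y * q * (x * y * q) *_) (fromℕℚ-^ N (suc (suc (suc a))))) (trans (e₁ x y q ν (ν ^ a))
      (trans (cong₂ (λ u v → u * v * (y * y * ν) * (q * q * ν ^ a)) νx≡1 νx≡1) (trans (cong (_* (q * q * ν ^ a)) (ℚ.*-identityˡ (y * y * ν)))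
        (cong (y * y * ν *_) (sym (trans (^-distrib-* (¾ * ¾) ν a) (cong (_* ν ^ a) (^-distrib-* ¾ ¾ a))))))))
      where
      e₁ = solve-ℚ 5 (λ x y q n p → x ⊗ y ⊗ q ⊗ (x ⊗ y ⊗ q) ⊗ (n ⊗ (n ⊗ (n ⊗ p))) , n ⊗ x ⊗ (n ⊗ x) ⊗ (y ⊗ y ⊗ n) ⊗ (q ⊗ q ⊗ p)) refl
    1≤y²ν : 1ℚ ≤ y * y * ν
    1≤y²ν = begin
      1ℚ ≡⟨ sym (cong₂ _*_ σy≡1 σy≡1) ⟩
      σ * y * (σ * y) ≡⟨ e₂ σ y ⟩
      y * y * (σ * σ) ≡⟨ cong (y * y *_) (fromℕℚ-* s s) ⟨
      y * y * fromℕℚ (s ℕ.* s)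
                          ≤⟨ *-monoˡ-≤ (square≥0 y) (fromℕℚ-mono (proj₁ (proj₂ (isqrt N)))) ⟩
      y * y * ν ∎
      where
      σy≡1 : σ * y ≡ 1ℚ
      σy≡1 = recip-inverse (>⇒≢ 0<σ)
      e₂ = solve-ℚ 2 (λ s y → s ⊗ y ⊗ (s ⊗ y) , y ⊗ y ⊗ (s ⊗ s)) refl
    1≤q²νᵃ : 1ℚ ≤ (¾ * ¾ * ν) ^ a
    -- 9/16 times 2 is 1 + 1/8.
    1≤q²νᵃ = 1≤^ a (ℚ.≤-trans (≤-by (½ * ½ * ½) refl (ℚ.nonNegative⁻¹ (½ * ½ * ½))) (*-monoˡ-≤ {¾ * ¾} (square≥0 ¾) (fromℕℚ-mono 2≤N)))

  module _ (g : ℕ → ℕ) (T : ℕ) where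

    -- The exponents run up to T + 1: after a = 0 and a = 1 there remain T terms, as many as in the
    -- T-th partial sum of the `eulerTerm` series.
    factorᵀ : ℤ[i] → ℚ
    factorᵀ p = ∑ⁿ (suc (suc T)) (λ a → Δ g a * recip (fromℕℚ (norm p ℕ.^ a)))

    -- The factor by which the error bound grows when p is added to the list: dividing n by N(p)^a
    -- scales the root of n / d by at most `weight`.
    blowup : ℤ[i] → ℚ
    blowup p = ∑ⁿ (suc (suc T)) (λ a → ∣ Δ g a ∣ * weight (norm p) a)

    0≤blowup : ∀ p → 0ℚ ≤ blowup p
    0≤blowup p = 0≤∑ⁿ (suc (suc T)) (λ a → 0≤* (ℚ.0≤∣p∣ (Δ g a)) (0≤weight (norm p) a))

    Independent : List ℤ[i] → Set
    Independent = AllPairs (λ p q → ¬ q ∣ᵍ p)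

    -- The circle problem at n = 1 already bounds the Leibniz sums: 2 for the count and 6 for the
    -- error.
    ∣leibniz∣≤ : 0 ℕ.< T → ∣ leibniz T ∣ ≤ fromℕℚ 8
    ∣leibniz∣≤ 0<T = begin
      ∣ leibniz T ∣ ≡⟨ cong ∣_∣ (e₁ (leibniz T) (count 1)) ⟩
      ∣ count 1 - (count 1 - leibniz T * 1ℚ) ∣ ≤⟨ ℚ.∣p-q∣≤∣p∣+∣q∣ (count 1) (count 1 - leibniz T * 1ℚ) ⟩
      ∣ count 1 ∣ + ∣ count 1 - leibniz T * 1ℚ ∣ ≤⟨ ℚ.+-mono-≤ (subst (_≤ 2ℚ * 1ℚ) (sym (ℚ.0≤p⇒∣p∣≡p (0≤fromℕℚ (length (representatives 1))))) (count≤ 1))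
                                                     (circle-problem 1 1 T (s≤s z≤n) 0<T (s≤s z≤n) (s≤s (s≤s z≤n))) ⟩
      fromℕℚ 8 ∎
      where
      e₁ = solve-ℚ 2 (λ l c → l , c ⊕ ⊝ (c ⊕ ⊝ (l ⊗ Κ 1ℚ))) refl

    -- Let y = n / d, with r standing for √y. If the floor of y is 0, then y² ≤ y ≤ r², so that 8 y
    -- ≤ 8 r. Otherwise r ≥ 1; the circle problem costs 6 r and the rounding of y costs 8 ≤ 8 r.
    -- Together this gives 14.
    base : ∀ {n d r} → 0 ℕ.< T → n ℕ.≤ T → 0 ℕ.< d → 0ℚ ≤ r → fromℕℚ n ≤ r * r * fromℕℚ d →
      ∣ count (n ÷ d) - leibniz T * (fromℕℚ n * recip (fromℕℚ d)) ∣ ≤ fromℕℚ 14 * r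
    base {n} {d} {r} 0<T n≤T 0<d 0≤r n≤r²d = cases (n ÷ d) refl
      where
      Λ = leibniz T
      y = fromℕℚ n * recip (fromℕℚ d)
      0≤y : 0ℚ ≤ y
      0≤y = 0≤* (0≤fromℕℚ n) (0≤recip (0≤fromℕℚ d))
      y≤r² : y ≤ r * r
      y≤r² = recip-*≤ (0<fromℕℚ 0<d) n≤r²d
      q≤y : fromℕℚ (n ÷ d) ≤ y
      q≤y = ≤-recip (0<fromℕℚ 0<d) (subst (_≤ fromℕℚ n) (fromℕℚ-* (n ÷ d) d) (fromℕℚ-mono (÷≤ 0<d)))
      y≤1+q : y ≤ 1ℚ + fromℕℚ (n ÷ d)
      y≤1+q = recip-*≤ (0<fromℕℚ 0<d) (subst (fromℕℚ n ≤_) (trans (fromℕℚ-* (suc (n ÷ d)) d) (cong (_* fromℕℚ d) (fromℕℚ-suc (n ÷ d))))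
        (fromℕℚ-mono (ℕ.<⇒≤ (ℕ.≰⇒> λ le → ℕ.1+n≰n (≤÷ 0<d le)))))
      cases : ∀ q → n ÷ d ≡ q → ∣ count q - Λ * y ∣ ≤ fromℕℚ 14 * r
      cases zero eq = begin
        ∣ 0ℚ - Λ * y ∣ ≡⟨ trans (cong ∣_∣ (ℚ.+-identityˡ (- (Λ * y)))) (trans (ℚ.∣-p∣≡∣p∣ (Λ * y)) (ℚ.∣p*q∣≡∣p∣*∣q∣ Λ y)) ⟩
        ∣ Λ ∣ * ∣ y ∣ ≤⟨ *-mono-≤ (ℚ.0≤∣p∣ Λ) 0≤r (∣leibniz∣≤ 0<T) (subst (_≤ r) (sym (ℚ.0≤p⇒∣p∣≡p 0≤y)) y≤r) ⟩
        fromℕℚ 8 * r ≤⟨ *-monoʳ-≤ 0≤r (fromℕℚ-mono {8} {14} (ℕ.m≤m+n 8 6)) ⟩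
        fromℕℚ 14 * r ∎
        where
        y≤1 : y ≤ 1ℚ
        y≤1 = ℚ.≤-trans y≤1+q (ℚ.≤-reflexive (trans (cong (λ z → 1ℚ + fromℕℚ z) eq) (ℚ.+-identityʳ 1ℚ)))
        y≤r : y ≤ r
        y≤r = square-cancel-≤ 0≤r (ℚ.≤-trans (*-mono-≤ 0≤y 0≤1 ℚ.≤-refl y≤1) (ℚ.≤-trans (ℚ.≤-reflexive (ℚ.*-identityʳ y)) y≤r²))
      cases q@(suc q′) eq = begin
        ∣ count q - Λ * y ∣ ≤⟨ triangle (count q) (Λ * κ) (Λ * y) ⟩
        ∣ count q - Λ * κ ∣ + ∣ Λ * κ - Λ * y ∣ ≤⟨ ℚ.+-mono-≤ (circle-problem q s T 0<s q≤T s²≤q q<[1+s]²) shift ⟩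
        fromℕℚ 6 * σ + fromℕℚ 8 ≤⟨ ℚ.+-mono-≤ (*-monoˡ-≤ (0≤fromℕℚ 6) σ≤r) (≤8r (ℚ.≤-trans (1≤fromℕℚ 0<s) σ≤r)) ⟩
        fromℕℚ 6 * r + fromℕℚ 8 * r ≡⟨ ℚ.*-distribʳ-+ r (fromℕℚ 6) (fromℕℚ 8) ⟨
        fromℕℚ 14 * r ∎
        where
        κ = fromℕℚ q
        s = proj₁ (isqrt q)
        s²≤q = proj₁ (proj₂ (isqrt q))
        q<[1+s]² = proj₂ (proj₂ (isqrt q))
        0<s = isqrt-pos {q} (s≤s z≤n)
        σ = fromℕℚ s
        q≤T : q ℕ.≤ T
        q≤T = ℕ.≤-trans (subst (ℕ._≤ n) eq (ℕ.≤-trans (ℕ.m≤m*n (n ÷ d) d ⦃ ℕ.>-nonZero 0<d ⦄) (÷≤ 0<d))) n≤T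
        κ≤y : κ ≤ y
        κ≤y = subst (λ z → fromℕℚ z ≤ y) eq q≤y
        σ≤r : σ ≤ r
        σ≤r = square-cancel-≤ 0≤r (ℚ.≤-trans (subst (_≤ κ) (fromℕℚ-* s s) (fromℕℚ-mono s²≤q)) (ℚ.≤-trans κ≤y y≤r²))
        ≤8r : 1ℚ ≤ r → fromℕℚ 8 ≤ fromℕℚ 8 * r
        ≤8r 1≤r = ≤-scale (0≤fromℕℚ 8) 1≤r ℚ.≤-refl
        shift : ∣ Λ * κ - Λ * y ∣ ≤ fromℕℚ 8
        shift = begin
          ∣ Λ * κ - Λ * y ∣ ≡⟨ trans (cong ∣_∣ (e₁ Λ κ y)) (trans (ℚ.∣p*q∣≡∣p∣*∣q∣ Λ (κ - y)) (cong (∣ Λ ∣ *_) (∣p-q∣≡∣q-p∣ κ y))) ⟩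
          ∣ Λ ∣ * ∣ y - κ ∣ ≤⟨ *-mono-≤ (ℚ.0≤∣p∣ Λ) 0≤1 (∣leibniz∣≤ 0<T) (subst (_≤ 1ℚ) (sym (ℚ.0≤p⇒∣p∣≡p (p≤q⇒0≤q-p κ≤y))) y-κ≤1) ⟩
          fromℕℚ 8 * 1ℚ ≡⟨ ℚ.*-identityʳ (fromℕℚ 8) ⟩
          fromℕℚ 8 ∎
          where
          e₁ = solve-ℚ 3 (λ l a b → l ⊗ a ⊕ ⊝ (l ⊗ b) , l ⊗ (a ⊕ ⊝ b)) refl
          e₂ = solve-ℚ 1 (λ k → Κ 1ℚ ⊕ k ⊕ ⊝ k , Κ 1ℚ) refl
          y-κ≤1 : y - κ ≤ 1ℚ
          y-κ≤1 = subst (y - κ ≤_) (e₂ κ) (ℚ.+-monoˡ-≤ (- κ) (subst (λ z → y ≤ 1ℚ + fromℕℚ z) eq y≤1+q))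

    -- The divisor d and the root r are general because the recursion calls the estimate for d
    -- N(p)^a and r w, where w is `weight N a`. The main terms of these calls add up exactly to the
    -- factor at p.
    error-bound : ∀ {ps} → Primes ps → Independent ps → ∀ {n d r} → 0 ℕ.< T → n ℕ.≤ T → 0 ℕ.< d → 0ℚ ≤ r →
      fromℕℚ n ≤ r * r * fromℕℚ d →
      ∣ summatory g ps (n ÷ d) - leibniz T * ∏ᶠ factorᵀ ps * (fromℕℚ n * recip (fromℕℚ d)) ∣ ≤ fromℕℚ 14 * r * ∏ᶠ blowup ps
    error-bound {[]} [] [] {n} {d} {r} 0<T n≤T 0<d 0≤r n≤r²d =
      subst₂ _≤_ (cong ∣_∣ (cong₂ _-_ ones (cong (_* (fromℕℚ n * recip (fromℕℚ d))) (sym (ℚ.*-identityʳ (leibniz T))))))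
        (sym (ℚ.*-identityʳ (fromℕℚ 14 * r))) (base {n} {d} {r} 0<T n≤T 0<d 0≤r n≤r²d)
      where
      ones : count (n ÷ d) ≡ ∑ (λ _ → 1ℚ) (representatives (n ÷ d))
      ones = sym (trans (∑-const 1ℚ (representatives (n ÷ d))) (ℚ.*-identityʳ (count (n ÷ d))))
    error-bound {p ∷ ps} (P ∷ Ps) (C ∷ Cs) {n} {d} {r} 0<T n≤T 0<d 0≤r n≤r²d = begin
      ∣ summatory g (p ∷ ps) (n ÷ d) - Λ * (factorᵀ p * Φ) * y ∣
        -- The recursion is used with T + 1, so that it has exactly the T + 2 terms of `factorᵀ`.
        ≡⟨ cong ∣_∣ (cong₂ _-_ (trans (summatory-recursion g (n ÷ d) (suc T) (ℕ.m≤n⇒m≤1+n (ℕ.≤-trans n÷d≤n n≤T)) P Ps C)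
             (∑ⁿ-cong T⁺ λ a _ → cong (λ z → Δ g a * summatory g ps z) (sym (÷-* n 0<d (0<N^ a))))) main) ⟩
      ∣ ∑ⁿ T⁺ (λ a → Δ g a * S a) - ∑ⁿ T⁺ (λ a → Δ g a * M a) ∣
        ≡⟨ cong ∣_∣ (sym (difference T⁺)) ⟩
      ∣ ∑ⁿ T⁺ (λ a → Δ g a * (S a - M a)) ∣
        ≤⟨ ∣∑ⁿ∣ T⁺ (λ a → Δ g a * (S a - M a)) ⟩
      ∑ⁿ T⁺ (λ a → ∣ Δ g a * (S a - M a) ∣)
        ≤⟨ ∑ⁿ-≤ T⁺ (λ a _ → bound a) ⟩
      ∑ⁿ T⁺ (λ a → fromℕℚ 14 * r * ∏ᶠ blowup ps * (∣ Δ g a ∣ * weight N a))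
        ≡⟨ ∑ⁿ-* T⁺ (fromℕℚ 14 * r * ∏ᶠ blowup ps) (λ a → ∣ Δ g a ∣ * weight N a) ⟩
      fromℕℚ 14 * r * ∏ᶠ blowup ps * blowup p
        ≡⟨ e₁ (fromℕℚ 14 * r) (∏ᶠ blowup ps) (blowup p) ⟩
      fromℕℚ 14 * r * (blowup p * ∏ᶠ blowup ps) ∎
      where
      T⁺ = suc (suc T)
      Λ = leibniz T
      Φ = ∏ᶠ factorᵀ ps
      N = norm p
      y = fromℕℚ n * recip (fromℕℚ d)
      0<N : 0 ℕ.< N
      0<N = ℕ.<⇒≤ (2≤norm-prime P)
      0<N^ : ∀ a → 0 ℕ.< N ℕ.^ a
      0<N^ a = ℕ.m^n>0 N ⦃ ℕ.>-nonZero 0<N ⦄ a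
      S M : ℕ → ℚ
      S a = summatory g ps (n ÷ (d ℕ.* N ℕ.^ a))
      M a = Λ * Φ * (fromℕℚ n * recip (fromℕℚ (d ℕ.* N ℕ.^ a)))
      n÷d≤n : n ÷ d ℕ.≤ n
      n÷d≤n = ℕ.≤-trans (ℕ.m≤m*n (n ÷ d) d ⦃ ℕ.>-nonZero 0<d ⦄) (÷≤ 0<d)
      e₁ = solve-ℚ 3 (λ a b c → a ⊗ b ⊗ c , a ⊗ (c ⊗ b)) refl
      split : ∀ a → recip (fromℕℚ (d ℕ.* N ℕ.^ a)) ≡ recip (fromℕℚ d) * recip (fromℕℚ (N ℕ.^ a))
      split a = trans (cong recip (fromℕℚ-* d (N ℕ.^ a))) (recip-* (0<fromℕℚ 0<d) (0<fromℕℚ (0<N^ a)))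
      main : Λ * (factorᵀ p * Φ) * y ≡ ∑ⁿ T⁺ (λ a → Δ g a * M a)
      main = trans (e₂ Λ (factorᵀ p) Φ y) (trans (sym (∑ⁿ-* T⁺ (Λ * Φ * y) (λ a → Δ g a * recip (fromℕℚ (N ℕ.^ a)))))
        (∑ⁿ-cong T⁺ λ a _ → trans (e₃ (Λ * Φ) (fromℕℚ n) (recip (fromℕℚ d)) (Δ g a) (recip (fromℕℚ (N ℕ.^ a))))
          (cong (λ z → Δ g a * (Λ * Φ * (fromℕℚ n * z))) (sym (split a)))))
        where
        e₂ = solve-ℚ 4 (λ l f p y → l ⊗ (f ⊗ p) ⊗ y , l ⊗ p ⊗ y ⊗ f) refl
        e₃ = solve-ℚ 5 (λ l n r d s → l ⊗ (n ⊗ r) ⊗ (d ⊗ s) , d ⊗ (l ⊗ (n ⊗ (r ⊗ s)))) refl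
      difference : ∀ t → ∑ⁿ t (λ a → Δ g a * (S a - M a)) ≡ ∑ⁿ t (λ a → Δ g a * S a) - ∑ⁿ t (λ a → Δ g a * M a)
      difference zero = refl
      difference (suc t) = trans (cong (_+ Δ g t * (S t - M t)) (difference t))
        (e₄ (∑ⁿ t (λ a → Δ g a * S a)) (∑ⁿ t (λ a → Δ g a * M a)) (Δ g t) (S t) (M t))
        where
        e₄ = solve-ℚ 5 (λ a b d s m → a ⊕ ⊝ b ⊕ d ⊗ (s ⊕ ⊝ m) , a ⊕ d ⊗ s ⊕ ⊝ (b ⊕ d ⊗ m)) refl
      bound : ∀ a → ∣ Δ g a * (S a - M a) ∣ ≤ fromℕℚ 14 * r * ∏ᶠ blowup ps * (∣ Δ g a ∣ * weight N a)
      bound a = begin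
        ∣ Δ g a * (S a - M a) ∣
          ≡⟨ ℚ.∣p*q∣≡∣p∣*∣q∣ (Δ g a) (S a - M a) ⟩
        ∣ Δ g a ∣ * ∣ S a - M a ∣
          ≤⟨ *-monoˡ-≤ (ℚ.0≤∣p∣ (Δ g a)) (error-bound Ps Cs {n} {d ℕ.* N ℕ.^ a} {r * w} 0<T n≤T (ℕ.*-mono-≤ 0<d (0<N^ a)) (0≤* 0≤r (0≤weight N a)) n≤) ⟩
        ∣ Δ g a ∣ * (fromℕℚ 14 * (r * w) * ∏ᶠ blowup ps)
          ≡⟨ e₅ ∣ Δ g a ∣ (fromℕℚ 14) r w (∏ᶠ blowup ps) ⟩
        fromℕℚ 14 * r * ∏ᶠ blowup ps * (∣ Δ g a ∣ * w) ∎
        where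
        w = weight N a
        e₅ = solve-ℚ 5 (λ d c r w b → d ⊗ (c ⊗ (r ⊗ w) ⊗ b) , c ⊗ r ⊗ b ⊗ (d ⊗ w)) refl
        e₆ = solve-ℚ 4 (λ r d w n → r ⊗ r ⊗ d ⊗ (w ⊗ w ⊗ n) , r ⊗ w ⊗ (r ⊗ w) ⊗ (d ⊗ n)) refl
        n≤ : fromℕℚ n ≤ r * w * (r * w) * fromℕℚ (d ℕ.* N ℕ.^ a)
        n≤ = ℚ.≤-trans (≤-scale (0≤* (square≥0 r) (0≤fromℕℚ d)) (weight-spec N a (2≤norm-prime P)) n≤r²d)
          (ℚ.≤-reflexive (trans (e₆ r (fromℕℚ d) w (fromℕℚ (N ℕ.^ a))) (cong (r * w * (r * w) *_) (sym (fromℕℚ-* d (N ℕ.^ a))))))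

open ErrorTerm

-- A product over primes, bounded by a damped sum over Gaussian integers.

module PrimeProduct where

  open ℚ-Operations using (_+_; _*_; _-_; -_; _≤_; _<_; ∣_∣)
  open ℚ.≤-Reasoning

  ceilLog : ∀ N → ∃ λ e → N ℕ.≤ 2 ℕ.^ e × (∀ d → N ℕ.≤ 2 ℕ.^ d → e ℕ.≤ d)
  ceilLog N = search N (ℕ.<⇒≤ (n<2^n N))
    where
    search : ∀ k → N ℕ.≤ 2 ℕ.^ k → ∃ λ e → N ℕ.≤ 2 ℕ.^ e × (∀ d → N ℕ.≤ 2 ℕ.^ d → e ℕ.≤ d)
    search zero N≤ = 0 , N≤ , λ _ _ → z≤n
    search (suc k) N≤ with N ℕ.≤? 2 ℕ.^ k
    ... | yes N≤′ = search k N≤′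
    ... | no N≰ = suc k , N≤ , λ d N≤2^d → ℕ.≰⇒> λ d≤k → N≰ (ℕ.≤-trans N≤2^d (ℕ.^-monoʳ-≤ 2 d≤k))

  ℓ : ℕ → ℕ
  ℓ N = proj₁ (ceilLog N)

  ℓ-least : ∀ {N d} → N ℕ.≤ 2 ℕ.^ d → ℓ N ℕ.≤ d
  ℓ-least {N} = proj₂ (proj₂ (ceilLog N)) _

  ℓ-* : ∀ M N → ℓ (M ℕ.* N) ℕ.≤ ℓ M ℕ.+ ℓ N
  ℓ-* M N = ℓ-least (ℕ.≤-trans (ℕ.*-mono-≤ (proj₁ (proj₂ (ceilLog M))) (proj₁ (proj₂ (ceilLog N))))
    (ℕ.≤-reflexive (sym (ℕ.^-distribˡ-+-* 2 (ℓ M) (ℓ N)))))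

  -- Instead of N^{-1-σ} with σ = 1 / log n: only powers of the rational θ = 1 + δ occur.
  module Damped (δ : ℚ) (0<δ : 0ℚ < δ) (δ≤1 : δ ≤ 1ℚ) where

    θ : ℚ
    θ = 1ℚ + δ

    1≤θ : 1ℚ ≤ θ
    1≤θ = p≤p+q (ℚ.<⇒≤ 0<δ)

    0<θ : 0ℚ < θ
    0<θ = ℚ.<-≤-trans 0<1 1≤θ

    ω : ℕ → ℚ
    ω N = recip (fromℕℚ N * θ ^ ℓ N)

    0<Nθ : ∀ {N} e → 0 ℕ.< N → 0ℚ < fromℕℚ N * θ ^ e
    0<Nθ e 0<N = 0<* (0<fromℕℚ 0<N) (0<^ e 0<θ)

    0≤ω : ∀ N → 0ℚ ≤ ω N
    0≤ω N = 0≤recip (0≤* (0≤fromℕℚ N) (ℚ.<⇒≤ (0<^ (ℓ N) 0<θ)))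

    ω≤1 : ∀ {N} → 0 ℕ.< N → ω N ≤ 1ℚ
    ω≤1 {N} 0<N = recip≤1 (1≤* (1≤fromℕℚ 0<N) (1≤^ (ℓ N) 1≤θ))

    -- As `ℓ` is subadditive, `ω` is supermultiplicative, which is the direction that `sift`
    -- requires.
    ω-* : ∀ {M N} → 0 ℕ.< M → 0 ℕ.< N → ω M * ω N ≤ ω (M ℕ.* N)
    ω-* {M} {N} 0<M 0<N = subst (_≤ ω (M ℕ.* N)) (recip-* (0<Nθ (ℓ M) 0<M) (0<Nθ (ℓ N) 0<N))
      (recip-antitone (0<Nθ (ℓ (M ℕ.* N)) (ℕ.*-mono-≤ 0<M 0<N)) (begin
        fromℕℚ (M ℕ.* N) * θ ^ ℓ (M ℕ.* N) ≤⟨ *-monoˡ-≤ (0≤fromℕℚ (M ℕ.* N)) (^-monoʳ-≤ 1≤θ (ℓ-* M N)) ⟩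
        fromℕℚ (M ℕ.* N) * θ ^ (ℓ M ℕ.+ ℓ N) ≡⟨ cong₂ _*_ (fromℕℚ-* M N) (^-homo-* θ (ℓ M) (ℓ N)) ⟩
        fromℕℚ M * fromℕℚ N * (θ ^ ℓ M * θ ^ ℓ N) ≡⟨ eq (fromℕℚ M) (fromℕℚ N) (θ ^ ℓ M) (θ ^ ℓ N) ⟩
        fromℕℚ M * θ ^ ℓ M * (fromℕℚ N * θ ^ ℓ N) ∎))
      where
      eq = solve-ℚ 4 (λ a b c d → a ⊗ b ⊗ (c ⊗ d) , a ⊗ c ⊗ (b ⊗ d)) refl

    -- Removing the damping at N ≤ 2^m costs the factor θ^m, which is later kept close to 1 by the
    -- choice of δ.
    recip≤ω : ∀ {N m} → 0 ℕ.< N → N ℕ.≤ 2 ℕ.^ m → recip (fromℕℚ N) ≤ θ ^ m * ω N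
    recip≤ω {N} {m} 0<N N≤ = begin
      recip ν ≡⟨ ℚ.*-identityˡ (recip ν) ⟨
      1ℚ * recip ν ≡⟨ cong (_* recip ν) (recip-inverse (>⇒≢ (0<^ (ℓ N) 0<θ))) ⟨
      t * recip t * recip ν ≡⟨ eq t (recip t) (recip ν) ⟩
      t * (recip ν * recip t) ≡⟨ cong (t *_) (recip-* (0<fromℕℚ 0<N) (0<^ (ℓ N) 0<θ)) ⟨
      t * ω N ≤⟨ *-monoʳ-≤ (0≤ω N) (^-monoʳ-≤ {n = m} 1≤θ (ℓ-least {N} {m} N≤)) ⟩
      θ ^ m * ω N ∎
      where
      ν = fromℕℚ N
      t = θ ^ ℓ N
      eq = solve-ℚ 3 (λ t r s → t ⊗ r ⊗ s , t ⊗ (s ⊗ r)) refl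

    total : ℕ → ℚ
    total X = ∑ (ω ∘ norm) (representatives X)

    total-mono : ∀ {X Y} → X ℕ.≤ Y → total X ≤ total Y
    total-mono {X} {Y} X≤Y = ∑-⊆ (representatives-unique X)
      (λ α∈ → let q , N≤ = ∈-representatives⁻ X α∈ in ∈-representatives⁺ Y q (ℕ.≤-trans N≤ X≤Y)) (λ {α} _ → 0≤ω (norm α))

    private
      q = recip θ
      0≤q = ℚ.<⇒≤ (0<recip 0<θ)

    norm-representative : ∀ X {α} → α ∈ representatives X → 0 ℕ.< norm α
    norm-representative X α∈ = norm-pos (quadrant≢0 (proj₁ (∈-representatives⁻ X α∈)))

    -- Between 2^e and 2^(e + 1) there are at most 4 · 2^e representatives, each with `ω` at most 1
    -- / (2^e θ^(e + 1)), so that this range adds at most 4 q^(e + 1) with q = 1 / θ.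
    total-dyadic : ∀ e → total (2 ℕ.^ e) ≤ fromℕℚ 4 * ∑ⁿ (suc e) (q ^_)
    total-dyadic zero = begin
      total 1 ≤⟨ ∑≤ (representatives 1) (λ α∈ → ω≤1 (norm-representative 1 α∈)) ⟩
      ∑ (λ _ → 1ℚ) (representatives 1) ≡⟨ trans (∑-const 1ℚ (representatives 1)) (ℚ.*-identityʳ (count 1)) ⟩
      count 1 ≤⟨ count≤ 1 ⟩
      2ℚ * 1ℚ ≤⟨ fromℕℚ-mono {2} {4} (s≤s (s≤s z≤n)) ⟩
      fromℕℚ 4 * (0ℚ + 1ℚ) ∎
    total-dyadic (suc e) = begin
      total Y
        ≤⟨ ∑≤ (representatives Y) pointwise ⟩
      ∑ (λ α → 𝟙 (norm α ℕ.≤? X) * ω (norm α) + c) (representatives Y)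
        ≡⟨ ∑-+ (λ α → 𝟙 (norm α ℕ.≤? X) * ω (norm α)) (λ _ → c) (representatives Y) ⟩
      ∑ (λ α → 𝟙 (norm α ℕ.≤? X) * ω (norm α)) (representatives Y) + ∑ (λ _ → c) (representatives Y)
        ≤⟨ ℚ.+-mono-≤ (ℚ.≤-trans small (total-dyadic e)) large ⟩
      fromℕℚ 4 * ∑ⁿ (suc e) (q ^_) + fromℕℚ 4 * q ^ suc e
        ≡⟨ ℚ.*-distribˡ-+ (fromℕℚ 4) (∑ⁿ (suc e) (q ^_)) (q ^ suc e) ⟨
      fromℕℚ 4 * ∑ⁿ (suc (suc e)) (q ^_) ∎
      where
      X = 2 ℕ.^ e
      Y = 2 ℕ.^ suc e
      ξ = fromℕℚ X
      0<X : 0 ℕ.< X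
      0<X = ℕ.m^n>0 2 e
      c = recip (ξ * θ ^ suc e)
      0≤c : 0ℚ ≤ c
      0≤c = ℚ.<⇒≤ (0<recip (0<Nθ (suc e) 0<X))
      pointwise : ∀ {α} → α ∈ representatives Y → ω (norm α) ≤ 𝟙 (norm α ℕ.≤? X) * ω (norm α) + c
      pointwise {α} α∈ with norm α ℕ.≤? X
      ... | yes _ = ℚ.≤-trans (ℚ.≤-reflexive (sym (ℚ.*-identityˡ (ω (norm α))))) (p≤p+q 0≤c)
      ... | no ≰X = ℚ.≤-trans (recip-antitone (0<Nθ (suc e) 0<X) (*-mono-≤ (0≤fromℕℚ X) (0≤^ (ℓ (norm α)) (ℚ.<⇒≤ 0<θ))
              (fromℕℚ-mono (ℕ.<⇒≤ (ℕ.≰⇒> ≰X))) (^-monoʳ-≤ 1≤θ e<ℓ))) (q≤p+q (ℚ.≤-reflexive (sym (ℚ.*-zeroˡ (ω (norm α))))))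
        where
        e<ℓ : suc e ℕ.≤ ℓ (norm α)
        e<ℓ = ℕ.≰⇒> λ ℓ≤e → ≰X (ℕ.≤-trans (proj₁ (proj₂ (ceilLog (norm α)))) (ℕ.^-monoʳ-≤ 2 ℓ≤e))
      small : ∑ (λ α → 𝟙 (norm α ℕ.≤? X) * ω (norm α)) (representatives Y) ≤ total X
      small = subst (_≤ total X) (∑-filter (λ α → norm α ℕ.≤? X) (ω ∘ norm) (representatives Y))
        (∑-⊆ (Unique.filter⁺ (λ α → norm α ℕ.≤? X) (representatives-unique Y))
          (λ α∈ → let α∈′ , N≤ = ∈-filter⁻ (λ α → norm α ℕ.≤? X) {xs = representatives Y} α∈
                  in ∈-representatives⁺ X (proj₁ (∈-representatives⁻ Y α∈′)) N≤) (λ {α} _ → 0≤ω (norm α)))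
      large : ∑ (λ _ → c) (representatives Y) ≤ fromℕℚ 4 * q ^ suc e
      large = begin
        ∑ (λ _ → c) (representatives Y) ≡⟨ ∑-const c (representatives Y) ⟩
        count Y * c ≤⟨ *-monoʳ-≤ 0≤c (count≤ Y) ⟩
        2ℚ * fromℕℚ Y * c ≡⟨ cong₂ (λ a b → 2ℚ * a * b) (fromℕℚ-* 2 X) (recip-* (0<fromℕℚ 0<X) (0<^ (suc e) 0<θ)) ⟩
        2ℚ * (2ℚ * ξ) * (recip ξ * recip (θ ^ suc e)) ≡⟨ eq 2ℚ ξ (recip ξ) (recip (θ ^ suc e)) ⟩
        2ℚ * 2ℚ * (ξ * recip ξ) * recip (θ ^ suc e) ≡⟨ cong₂ (λ a b → 2ℚ * 2ℚ * a * b) (recip-inverse (>⇒≢ (0<fromℕℚ 0<X))) (recip-^ (suc e) 0<θ) ⟩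
        fromℕℚ 4 * q ^ suc e ∎
        where
        eq = solve-ℚ 4 (λ t x r s → t ⊗ (t ⊗ x) ⊗ (r ⊗ s) , t ⊗ t ⊗ (x ⊗ r) ⊗ s) refl

    -- The geometric series in 1 / θ is at most θ / δ, and θ ≤ 2.
    total≤ : ∀ X → δ * total X ≤ fromℕℚ 8
    total≤ X = begin
      δ * total X ≤⟨ *-monoˡ-≤ (ℚ.<⇒≤ 0<δ) (ℚ.≤-trans (total-mono (ℕ.<⇒≤ (n<2^n X))) (total-dyadic X)) ⟩
      δ * (fromℕℚ 4 * G) ≡⟨ cong (_* (fromℕℚ 4 * G)) δ≡ ⟩
      θ * (1ℚ - q) * (fromℕℚ 4 * G) ≡⟨ e₁ θ (1ℚ - q) (fromℕℚ 4) G ⟩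
      fromℕℚ 4 * θ * ((1ℚ - q) * G) ≡⟨ cong (fromℕℚ 4 * θ *_) (geometric-sum (suc X) q) ⟩
      fromℕℚ 4 * θ * (1ℚ - q ^ suc X) ≤⟨ *-mono-≤ (0≤* (0≤fromℕℚ 4) (ℚ.<⇒≤ 0<θ)) 0≤1 (*-monoˡ-≤ (0≤fromℕℚ 4) (ℚ.+-monoʳ-≤ 1ℚ δ≤1))
                                                          (≤-by (q ^ suc X) (e₂ (q ^ suc X)) (0≤^ (suc X) 0≤q)) ⟩
      fromℕℚ 8 ∎
      where
      G = ∑ⁿ (suc X) (q ^_)
      e₁ = solve-ℚ 4 (λ t u c g → t ⊗ u ⊗ (c ⊗ g) , c ⊗ t ⊗ (u ⊗ g)) refl
      e₂ = solve-ℚ 1 (λ a → Κ 1ℚ , Κ 1ℚ ⊕ ⊝ a ⊕ a) refl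
      δ≡ : δ ≡ θ * (1ℚ - q)
      δ≡ = trans (e₃ δ) (trans (cong (λ z → θ - z) (sym (recip-inverse (>⇒≢ 0<θ)))) (e₄ θ q))
        where
        e₃ = solve-ℚ 1 (λ d → d , Κ 1ℚ ⊕ d ⊕ ⊝ (Κ 1ℚ)) refl
        e₄ = solve-ℚ 2 (λ t q → t ⊕ ⊝ (t ⊗ q) , t ⊗ (Κ 1ℚ ⊕ ⊝ q)) refl

    isZero : ℕ → ℚ
    isZero zero = 1ℚ
    isZero (suc _) = 0ℚ

    0≤isZero : ∀ a → 0ℚ ≤ isZero a
    0≤isZero zero = 0≤1
    0≤isZero (suc a) = ℚ.≤-refl

    isZero≤1 : ∀ a → isZero a ≤ 1ℚ
    isZero≤1 zero = ℚ.≤-refl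
    isZero≤1 (suc a) = 0≤1

    -- The factor `local isZero ps α` is the indicator of α being divisible by no prime of `ps`.
    sifted : List ℤ[i] → ℕ → ℚ
    sifted ps X = ∑ (λ α → local isZero ps α * ω (norm α)) (representatives X)

    0≤local : ∀ ps α → 0ℚ ≤ local isZero ps α
    0≤local ps α = 0≤∏ ps λ {p} _ → 0≤isZero (valuation p α)

    sift : ∀ {p ps} X → Prime p → Primes ps → Coprime p ps →
      (1ℚ + ω (norm p)) * sifted (p ∷ ps) X ≤ sifted ps (X ℕ.* norm p)
    sift {p} {ps} X P Ps C = begin
      (1ℚ + ω N) * sifted (p ∷ ps) X
        ≡⟨ ℚ.*-distribʳ-+ (sifted (p ∷ ps) X) 1ℚ (ω N) ⟩
      1ℚ * sifted (p ∷ ps) X + ω N * sifted (p ∷ ps) X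
        ≤⟨ ℚ.+-mono-≤ (ℚ.≤-trans (ℚ.≤-reflexive (ℚ.*-identityˡ (sifted (p ∷ ps) X))) first) second ⟩
      ∑ (λ α → isZero (valuation p α) * F α) (representatives Y) + ∑ (λ α → 𝟙 (p ∣ᵍ? α) * F α) (representatives Y)
        ≡⟨ ∑-+ (λ α → isZero (valuation p α) * F α) (λ α → 𝟙 (p ∣ᵍ? α) * F α) (representatives Y) ⟨
      ∑ (λ α → isZero (valuation p α) * F α + 𝟙 (p ∣ᵍ? α) * F α) (representatives Y)
        ≡⟨ ∑-cong (representatives Y) (λ {α} α∈ → trans (sym (ℚ.*-distribʳ-+ (F α) (isZero (valuation p α)) (𝟙 (p ∣ᵍ? α))))
             (trans (cong (_* F α) (dichotomy α∈)) (ℚ.*-identityˡ (F α)))) ⟩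
      sifted ps Y ∎
      where
      N = norm p
      Y = X ℕ.* N
      0<N : 0 ℕ.< N
      0<N = norm-pos (prime≢0 P)
      F : ℤ[i] → ℚ
      F α = local isZero ps α * ω (norm α)
      0≤F : ∀ α → 0ℚ ≤ F α
      0≤F α = 0≤* (0≤local ps α) (0≤ω (norm α))
      F-unit : AssociateInvariant F
      F-unit U α = cong₂ (λ a b → a * ω b) (local-unit isZero Ps U α) (norm-unit-* U α)
      dichotomy : ∀ {α} → α ∈ representatives Y → isZero (valuation p α) + 𝟙 (p ∣ᵍ? α) ≡ 1ℚ
      dichotomy {α} α∈ = cases (valuation p α) refl
        where
        α≢0 = quadrant≢0 (proj₁ (∈-representatives⁻ Y α∈))
        cases : ∀ v → valuation p α ≡ v → isZero v + 𝟙 (p ∣ᵍ? α) ≡ 1ℚ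
        cases zero eq = cong (λ z → 1ℚ + z) (𝟙-no (p ∣ᵍ? α) λ p∣α →
          ℕ.<⇒≱ (ℕ.≤-refl {1}) (subst (1 ℕ.≤_) eq (^∣⇒≤valuation P α≢0 (p∣⇒p^1∣ {p} {α} p∣α))))
        cases (suc v) eq = cong (λ z → 0ℚ + z) (𝟙-yes (p ∣ᵍ? α) (p^1∣⇒p∣ {p} {α}
          (≤valuation⇒^∣ P α≢0 (subst (1 ℕ.≤_) (sym eq) (s≤s z≤n)))))
      first : sifted (p ∷ ps) X ≤ ∑ (λ α → isZero (valuation p α) * F α) (representatives Y)
      first = ℚ.≤-trans (ℚ.≤-reflexive (∑-cong (representatives X) λ {α} _ → ℚ.*-assoc (isZero (valuation p α)) (local isZero ps α) (ω (norm α))))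
        (∑-⊆ (representatives-unique X)
          (λ α∈ → let q , N≤ = ∈-representatives⁻ X α∈ in ∈-representatives⁺ Y q (ℕ.≤-trans N≤ (ℕ.m≤m*n X N ⦃ ℕ.>-nonZero 0<N ⦄)))
          (λ {α} _ → 0≤* (0≤isZero (valuation p α)) (0≤F α)))
      Y÷N≡X : Y ÷ N ≡ X
      Y÷N≡X = trans (÷≡/ Y N ⦃ ℕ.>-nonZero 0<N ⦄) (ℕ.m*n/n≡m X N ⦃ ℕ.>-nonZero 0<N ⦄)
      second : ω N * sifted (p ∷ ps) X ≤ ∑ (λ α → 𝟙 (p ∣ᵍ? α) * F α) (representatives Y)
      second = begin
        ω N * sifted (p ∷ ps) X
          ≡⟨ ∑-* (ω N) (λ β → local isZero (p ∷ ps) β * ω (norm β)) (representatives X) ⟨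
        ∑ (λ β → ω N * (isZero (valuation p β) * local isZero ps β * ω (norm β))) (representatives X)
          ≤⟨ ∑≤ (representatives X) bound ⟩
        ∑ (λ β → F (p *ᵍ β)) (representatives X)
          ≡⟨ cong (λ Z → ∑ (λ β → F (p *ᵍ β)) (representatives Z)) Y÷N≡X ⟨
        ∑ (λ β → F (p *ᵍ β)) (representatives (Y ÷ N))
          ≡⟨ ∑-multiples′ {p} Y (prime≢0 P) F-unit ⟨
        ∑ (λ α → 𝟙 (p ∣ᵍ? α) * F α) (representatives Y) ∎
        where
        bound : ∀ {β} → β ∈ representatives X → ω N * (isZero (valuation p β) * local isZero ps β * ω (norm β)) ≤ F (p *ᵍ β)
        bound {β} β∈ = begin
          ω N * (z * L * ω (norm β)) ≡⟨ eq (ω N) z L (ω (norm β)) ⟩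
          z * (L * (ω N * ω (norm β))) ≤⟨ *-monoʳ-≤ (0≤* (0≤local ps β) (0≤* (0≤ω N) (0≤ω (norm β)))) (isZero≤1 (valuation p β)) ⟩
          1ℚ * (L * (ω N * ω (norm β))) ≡⟨ ℚ.*-identityˡ _ ⟩
          L * (ω N * ω (norm β)) ≤⟨ *-monoˡ-≤ (0≤local ps β) (ω-* 0<N (norm-representative X β∈)) ⟩
          L * ω (N ℕ.* norm β) ≡⟨ cong₂ (λ a b → a * ω b)
                                                  (sym (local-coprime-* isZero Ps C β (quadrant≢0 (proj₁ (∈-representatives⁻ X β∈))))) (sym (norm-* p β)) ⟩
          F (p *ᵍ β) ∎
          where
          z = isZero (valuation p β)
          L = local isZero ps β
          eq = solve-ℚ 4 (λ w z l v → w ⊗ (z ⊗ l ⊗ v) , z ⊗ (l ⊗ (w ⊗ v))) refl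

    -- Each prime enlarges the range. Only the existence of the final range is recorded, since
    -- `total≤` is uniform in it.
    ∏≤sifted : ∀ {ps} → Primes ps → AllPairs (λ p q → ¬ q ∣ᵍ p) ps → ∀ X →
      ∃ λ Y → ∏ᶠ (λ p → 1ℚ + ω (norm p)) ps * sifted ps X ≤ total Y
    ∏≤sifted {[]} [] [] X = X , ℚ.≤-reflexive (trans (ℚ.*-identityˡ (sifted [] X)) (∑-cong (representatives X) λ {α} _ → ℚ.*-identityˡ (ω (norm α))))
    ∏≤sifted {p ∷ ps} (P ∷ Ps) (C ∷ Cs) X with ∏≤sifted Ps Cs (X ℕ.* norm p)
    ... | Y , le = Y , (begin
      (1ℚ + ω (norm p)) * Π * sifted (p ∷ ps) X ≡⟨ eq (1ℚ + ω (norm p)) Π (sifted (p ∷ ps) X) ⟩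
      Π * ((1ℚ + ω (norm p)) * sifted (p ∷ ps) X) ≤⟨ *-monoˡ-≤ (0≤∏ ps λ {p} _ → 0≤+ 0≤1 (0≤ω (norm p))) (sift X P Ps C) ⟩
      Π * sifted ps (X ℕ.* norm p) ≤⟨ le ⟩
      total Y ∎)
      where
      Π = ∏ᶠ (λ p → 1ℚ + ω (norm p)) ps
      eq = solve-ℚ 3 (λ a b c → a ⊗ b ⊗ c , b ⊗ (a ⊗ c)) refl

    ω-1 : ∀ {N} → N ≡ 1 → ω N ≡ 1ℚ
    ω-1 {N} N≡1 = cong recip (cong₂ (λ a e → a * θ ^ e) (cong fromℕℚ N≡1) (ℕ.n≤0⇒n≡0 (ℓ-least {N} {0} (ℕ.≤-reflexive N≡1))))

    1≤sifted : ∀ {ps X} → 0 ℕ.< X → Primes ps → 1ℚ ≤ sifted ps X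
    1≤sifted {ps} {X} 0<X Ps = begin
      1ℚ ≡⟨ F1≡1 ⟨
      F 1ᵍ ≡⟨ ℚ.+-identityʳ (F 1ᵍ) ⟨
      ∑ F (1ᵍ ∷ []) ≤⟨ ∑-⊆ {f = F} ([] ∷ []) (λ { (here eq) → subst (_∈ representatives X) (sym eq) (∈-representatives⁺ X quadrant-1 0<X) })
                                             (λ {α} _ → 0≤* (0≤local ps α) (0≤ω (norm α))) ⟩
      sifted ps X ∎
      where
      F : ℤ[i] → ℚ
      F α = local isZero ps α * ω (norm α)
      ones : ∀ qs → Primes qs → local isZero qs 1ᵍ ≡ 1ℚ
      ones [] _ = refl
      ones (p ∷ qs) (P ∷ Qs) = cong₂ (λ v l → isZero v * l) (ℕ.n<1⇒n≡0 (valuation<norm {p} {1ᵍ} P λ ())) (ones qs Qs)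
      F1≡1 : F 1ᵍ ≡ 1ℚ
      F1≡1 = cong₂ _*_ (ones ps Ps) (ω-1 {norm 1ᵍ} refl)

    -- The analogue of bounding the product of 1 + N(p)^(-1-σ) by a zeta value of order 1 / σ. The
    -- sifted sum is bounded below by its term at α = 1.
    ∏≤ : ∀ {ps} → Primes ps → AllPairs (λ p q → ¬ q ∣ᵍ p) ps → δ * ∏ᶠ (λ p → 1ℚ + ω (norm p)) ps ≤ fromℕℚ 8
    ∏≤ {ps} Ps Cs = from 1 (s≤s z≤n)
      where
      0≤Π : 0ℚ ≤ ∏ᶠ (λ p → 1ℚ + ω (norm p)) ps
      0≤Π = 0≤∏ ps λ {p} _ → 0≤+ 0≤1 (0≤ω (norm p))
      from : ∀ X → 0 ℕ.< X → δ * ∏ᶠ (λ p → 1ℚ + ω (norm p)) ps ≤ fromℕℚ 8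
      from X 0<X = let Y , le = ∏≤sifted Ps Cs X in
        ℚ.≤-trans (*-monoˡ-≤ (ℚ.<⇒≤ 0<δ) (ℚ.≤-trans (≤-scale 0≤Π (1≤sifted {ps} 0<X Ps) ℚ.≤-refl) le)) (total≤ Y)

open PrimeProduct

-- The power of the logarithm.

module LogarithmicBound where

  open ℚ-Operations using (_+_; _*_; _-_; -_; _≤_; _<_; ∣_∣)
  open ℚ.≤-Reasoning

  -- A growth rate above 1 whose product with `¾` is 15/16, so that the weighted coefficients remain
  -- summable.
  ⁵/₄ : ℚ
  ⁵/₄ = 1ℚ + ½ * ½

  0≤⁵/₄ : 0ℚ ≤ ⁵/₄
  0≤⁵/₄ = ℚ.nonNegative⁻¹ ⁵/₄

  -- By `g1≡1` the coefficient Δ g 1 vanishes, so that h lives on square-full numbers. The number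
  -- `M` bounds Δ g 2 and fixes the power of the logarithm; `growth` takes care of all later
  -- coefficients.
  record Admissible (g : ℕ → ℕ) (M : ℕ) : Set where
    field
      g1≡1 : g 1 ≡ 1
      1≤M : 1 ℕ.≤ M
      g2≤ : g 2 ℕ.≤ suc M
      C : ℚ
      0≤C : 0ℚ ≤ C
      growth : ∀ a → fromℕℚ (g (suc a)) ≤ C * ⁵/₄ ^ suc a

  ceiling : ∀ q → 0ℚ ≤ q → ∃ λ n → q ≤ fromℕℚ n
  ceiling q 0≤q = proj₁ a , ℚ.≤-trans (q≤p+q 0≤1) (begin
    1ℚ + q ≡⟨ ℚ.*-identityˡ (1ℚ + q) ⟨
    1ℚ * (1ℚ + q) ≤⟨ *-monoʳ-≤ (ℚ.<⇒≤ 0<1+q) (proj₂ a) ⟩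
    fromℕℚ (proj₁ a) * recip (1ℚ + q) * (1ℚ + q) ≡⟨ eq (fromℕℚ (proj₁ a)) (recip (1ℚ + q)) (1ℚ + q) ⟩
    fromℕℚ (proj₁ a) * ((1ℚ + q) * recip (1ℚ + q)) ≡⟨ cong (fromℕℚ (proj₁ a) *_) (recip-inverse (>⇒≢ 0<1+q)) ⟩
    fromℕℚ (proj₁ a) * 1ℚ ≡⟨ ℚ.*-identityʳ (fromℕℚ (proj₁ a)) ⟩
    fromℕℚ (proj₁ a) ∎)
    where
    0<1+q : 0ℚ < 1ℚ + q
    0<1+q = ℚ.+-mono-<-≤ 0<1 0≤q
    a = archimedean (0<recip 0<1+q)
    eq = solve-ℚ 3 (λ n r q → n ⊗ r ⊗ q , n ⊗ (q ⊗ r)) refl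

  primes-prime : ∀ n → Primes (primes n)
  primes-prime n = All.tabulate λ p∈ → proj₁ (∈-primes⁻ n p∈)

  primes-independent : ∀ n → AllPairs (λ p q → ¬ q ∣ᵍ p) (primes n)
  primes-independent n = independent (primes n) (λ p∈ → ∈-primes⁻ n p∈) (primes-unique n)
    where
    independent : ∀ ps → (∀ {p} → p ∈ ps → Prime p × Quadrant p × norm p ℕ.≤ n) → Unique ps → AllPairs (λ p q → ¬ q ∣ᵍ p) ps
    independent [] _ [] = []
    independent (p ∷ ps) ∈⁻ (p∉ ∷ u) = All.tabulate (λ q∈ q∣p → All.lookup p∉ q∈
        (sym (let P , p∈ , _ = ∈⁻ (here refl) ; Q , q∈′ , _ = ∈⁻ (there q∈) in prime-∣ᵍ⇒≡ P Q p∈ q∈′ q∣p))) ∷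
      independent ps (∈⁻ ∘ there) u

  -- Finitely many small primes are treated trivially.
  module SmallPrimes (h : ℕ) (B : ℚ) (1≤B : 1ℚ ≤ B) where

    pick : ∀ {P : Set} → Dec P → ℚ
    pick (yes _) = B
    pick (no _) = 1ℚ

    small : ℤ[i] → ℚ
    small p = pick (norm p ℕ.≤? h)

    0≤pick : ∀ {P : Set} (d : Dec P) → 0ℚ ≤ pick d
    0≤pick (yes _) = ℚ.≤-trans 0≤1 1≤B
    0≤pick (no _) = 0≤1

    ∏pick : ∀ {A : Set} {P : Pred A 0ℓ} (P? : Decidable P) xs → ∏ᶠ (λ x → pick (P? x)) xs ≡ B ^ length (filter P? xs)
    ∏pick P? [] = refl
    ∏pick P? (x ∷ xs) with P? x
    ... | yes _ = cong (B *_) (∏pick P? xs)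
    ... | no _ = trans (ℚ.*-identityˡ (∏ᶠ (λ x → pick (P? x)) xs)) (∏pick P? xs)

    L : ℕ
    L = length (representatives h)

    ∏small≤ : ∀ n → ∏ᶠ small (primes n) ≤ B ^ L
    ∏small≤ n = subst (_≤ B ^ L) (sym (∏pick (λ p → norm p ℕ.≤? h) (primes n))) (^-monoʳ-≤ 1≤B (fromℕℚ-cancel-≤
      (subst₂ _≤_ (ones ps) (ones (representatives h))
        (∑-⊆ (Unique.filter⁺ (λ p → norm p ℕ.≤? h) (primes-unique n))
          (λ p∈ → let p∈′ , N≤ = ∈-filter⁻ (λ p → norm p ℕ.≤? h) {xs = primes n} p∈
                  in ∈-representatives⁺ h (proj₁ (proj₂ (∈-primes⁻ n p∈′))) N≤) (λ _ → 0≤1)))))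
      where
      ps = filter (λ p → norm p ℕ.≤? h) (primes n)
      ones : ∀ {A : Set} (xs : List A) → ∑ (λ _ → 1ℚ) xs ≡ fromℕℚ (length xs)
      ones xs = trans (∑-const 1ℚ xs) (ℚ.*-identityʳ (fromℕℚ (length xs)))

  module _ {g M} (G : Admissible g M) where

    open Admissible G

    -- The bound proved in `∑∣Δ∣≤`; 16 is the sum of the geometric series of ratio 15/16.
    H : ℚ
    H = fromℕℚ 16 * (2ℚ * C * ⁵/₄ ^ 3)

    0≤H : 0ℚ ≤ H
    0≤H = 0≤* (0≤fromℕℚ 16) (0≤* (0≤* (0≤fromℕℚ 2) 0≤C) (0≤^ 3 0≤⁵/₄))

    Δ-1 : Δ g 1 ≡ 0ℚ
    Δ-1 = trans (cong (λ z → fromℕℚ z - 1ℚ) g1≡1) (ℚ.+-inverseʳ 1ℚ)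

    ∣Δ-2∣≤ : ∣ Δ g 2 ∣ ≤ fromℕℚ M
    ∣Δ-2∣≤ = subst (λ z → ∣ fromℕℚ (g 2) - fromℕℚ z ∣ ≤ fromℕℚ M) (sym g1≡1) (∣p∣≤
      (subst (fromℕℚ (g 2) - 1ℚ ≤_) (trans (cong (_- 1ℚ) (fromℕℚ-suc M)) (e₁ (fromℕℚ M))) (ℚ.+-monoˡ-≤ (- 1ℚ) (fromℕℚ-mono g2≤)))
      (ℚ.≤-trans (≤-by (fromℕℚ (g 2)) (e₂ (fromℕℚ (g 2))) (0≤fromℕℚ (g 2))) (1≤fromℕℚ 1≤M)))
      where
      e₁ = solve-ℚ 1 (λ m → Κ 1ℚ ⊕ m ⊕ ⊝ (Κ 1ℚ) , m) refl
      e₂ = solve-ℚ 1 (λ m → Κ 1ℚ , ⊝ (m ⊕ ⊝ (Κ 1ℚ)) ⊕ m) refl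

    ∣Δ∣≤ : ∀ a → ∣ Δ g (suc (suc a)) ∣ ≤ 2ℚ * C * ⁵/₄ ^ suc (suc a)
    ∣Δ∣≤ a = begin
      ∣ γ (suc a) - γ a ∣ ≤⟨ ℚ.∣p-q∣≤∣p∣+∣q∣ (γ (suc a)) (γ a) ⟩
      ∣ γ (suc a) ∣ + ∣ γ a ∣ ≡⟨ cong₂ _+_ (ℚ.0≤p⇒∣p∣≡p {γ (suc a)} (0≤fromℕℚ (g (suc (suc a))))) (ℚ.0≤p⇒∣p∣≡p {γ a} (0≤fromℕℚ (g (suc a)))) ⟩
      γ (suc a) + γ a ≤⟨ ℚ.+-mono-≤ (growth (suc a)) (ℚ.≤-trans (growth a)
                                                       (*-monoˡ-≤ 0≤C (^-monoʳ-≤ {⁵/₄} (≤-by (½ * ½) refl (ℚ.nonNegative⁻¹ (½ * ½))) (ℕ.n≤1+n (suc a))))) ⟩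
      C * ⁵/₄ ^ suc (suc a) + C * ⁵/₄ ^ suc (suc a) ≡⟨ eq C (⁵/₄ ^ suc (suc a)) ⟩
      2ℚ * C * ⁵/₄ ^ suc (suc a) ∎
      where
      γ : ℕ → ℚ
      γ b = fromℕℚ (g (suc b))
      eq = solve-ℚ 2 (λ c r → c ⊗ r ⊕ c ⊗ r , (Κ 1ℚ ⊕ Κ 1ℚ) ⊗ c ⊗ r) refl

    ∑∣Δ∣≤ : ∀ n → ∑ⁿ n (λ b → ∣ Δ g (suc (suc (suc b))) ∣ * ¾ ^ b) ≤ H
    ∑∣Δ∣≤ n = begin
      ∑ⁿ n (λ b → ∣ Δ g (suc (suc (suc b))) ∣ * ¾ ^ b) ≤⟨ ∑ⁿ-≤ n (λ b _ → *-monoʳ-≤ (0≤^ b 0≤¾) (∣Δ∣≤ (suc b))) ⟩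
      ∑ⁿ n (λ b → 2ℚ * C * ⁵/₄ ^ (3 ℕ.+ b) * ¾ ^ b) ≡⟨ ∑ⁿ-cong n (λ b _ → regroup b) ⟩
      ∑ⁿ n (λ b → c * q ^ b) ≡⟨ ∑ⁿ-* n c (q ^_) ⟩
      c * ∑ⁿ n (q ^_) ≤⟨ *-monoˡ-≤ 0≤c ∑≤16 ⟩
      c * fromℕℚ 16 ≡⟨ ℚ.*-comm c (fromℕℚ 16) ⟩
      H ∎
      where
      c = 2ℚ * C * ⁵/₄ ^ 3
      q = ⁵/₄ * ¾
      0≤c = 0≤* (0≤* (0≤fromℕℚ 2) 0≤C) (0≤^ 3 0≤⁵/₄)
      regroup : ∀ b → 2ℚ * C * ⁵/₄ ^ (3 ℕ.+ b) * ¾ ^ b ≡ c * q ^ b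
      regroup b = trans (cong (λ z → 2ℚ * C * z * ¾ ^ b) (^-homo-* ⁵/₄ 3 b))
        (trans (eq (2ℚ * C) (⁵/₄ ^ 3) (⁵/₄ ^ b) (¾ ^ b)) (cong (c *_) (sym (^-distrib-* ⁵/₄ ¾ b))))
        where
        eq = solve-ℚ 4 (λ x r s t → x ⊗ (r ⊗ s) ⊗ t , x ⊗ r ⊗ (s ⊗ t)) refl
      ∑≤16 : ∑ⁿ n (q ^_) ≤ fromℕℚ 16
      ∑≤16 = *-cancelˡ-≤ {1ℚ - q} (ℚ.positive⁻¹ (1ℚ - q)) (begin
        (1ℚ - q) * ∑ⁿ n (q ^_) ≡⟨ geometric-sum n q ⟩
        1ℚ - q ^ n ≤⟨ ≤-by (q ^ n) (e₁ (q ^ n)) (0≤^ {q} n (ℚ.nonNegative⁻¹ q)) ⟩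
        (1ℚ - q) * fromℕℚ 16 ∎)
        where
        e₁ = solve-ℚ 1 (λ a → Κ 1ℚ , Κ 1ℚ ⊕ ⊝ a ⊕ a) refl

    -- The terms a = 0, 1 and 2 contribute 1, 0 and at most M / N(p). From a = 3 on, `weight`
    -- provides the common factor of order N(p)^(-3/2).
    blowup≤ : ∀ T {p} → blowup g T p ≤ 1ℚ + recip (fromℕℚ (norm p)) * (fromℕℚ M + H * recip (fromℕℚ (proj₁ (isqrt (norm p)))))
    blowup≤ T {p} = begin
      ∑ⁿ (suc (suc T)) f
        ≡⟨ trans (∑ⁿ-suc (suc T) f) (cong (f 0 +_) (∑ⁿ-suc T (f ∘ suc))) ⟩
      f 0 + (f 1 + ∑ⁿ T (λ a → f (suc (suc a))))
        ≤⟨ ℚ.+-monoʳ-≤ (f 0) (ℚ.+-monoʳ-≤ (f 1) one-more) ⟩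
      f 0 + (f 1 + (f 2 + ∑ⁿ T (λ a → f (suc (suc (suc a))))))
        ≡⟨ cong (λ z → f 0 + (∣ z ∣ * 1ℚ + (f 2 + ∑ⁿ T (λ a → f (suc (suc (suc a))))))) Δ-1 ⟩
      1ℚ + (0ℚ + (f 2 + ∑ⁿ T (λ a → f (suc (suc (suc a))))))
        ≡⟨ cong (λ z → 1ℚ + z) (ℚ.+-identityˡ (f 2 + ∑ⁿ T (λ a → f (suc (suc (suc a)))))) ⟩
      1ℚ + (f 2 + ∑ⁿ T (λ a → f (suc (suc (suc a)))))
        ≤⟨ ℚ.+-monoʳ-≤ 1ℚ (ℚ.+-mono-≤ (*-monoʳ-≤ 0≤x ∣Δ-2∣≤) rest) ⟩
      1ℚ + (fromℕℚ M * x + x * y * H)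
        ≡⟨ eq (fromℕℚ M) x y H ⟩
      1ℚ + x * (fromℕℚ M + H * y) ∎
      where
      f : ℕ → ℚ
      f a = ∣ Δ g a ∣ * weight (norm p) a
      0≤f : ∀ a → 0ℚ ≤ f a
      0≤f a = 0≤* (ℚ.0≤∣p∣ (Δ g a)) (0≤weight (norm p) a)
      s = proj₁ (isqrt (norm p))
      x = recip (fromℕℚ (norm p))
      y = recip (fromℕℚ s)
      0≤x : 0ℚ ≤ x
      0≤x = 0≤recip (0≤fromℕℚ (norm p))
      0≤y : 0ℚ ≤ y
      0≤y = 0≤recip (0≤fromℕℚ s)
      eq = solve-ℚ 4 (λ m x y h → Κ 1ℚ ⊕ (m ⊗ x ⊕ x ⊗ y ⊗ h) , Κ 1ℚ ⊕ x ⊗ (m ⊕ h ⊗ y)) refl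
      e₁ = solve-ℚ 4 (λ d x y t → d ⊗ (x ⊗ y ⊗ t) , x ⊗ y ⊗ (d ⊗ t)) refl
      -- A further term is added so that a = 2 can be split off for T = 0 as well.
      one-more : ∑ⁿ T (λ a → f (suc (suc a))) ≤ f 2 + ∑ⁿ T (λ a → f (suc (suc (suc a))))
      one-more = subst (∑ⁿ T (λ a → f (suc (suc a))) ≤_) (∑ⁿ-suc T (λ a → f (suc (suc a)))) (∑ⁿ-mono (λ a → 0≤f (suc (suc a))) (ℕ.n≤1+n T))
      rest : ∑ⁿ T (λ a → f (suc (suc (suc a)))) ≤ x * y * H
      rest = begin
        ∑ⁿ T (λ a → f (suc (suc (suc a)))) ≡⟨ ∑ⁿ-cong T (λ a _ → e₁ ∣ Δ g (suc (suc (suc a))) ∣ x y (¾ ^ a)) ⟩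
        ∑ⁿ T (λ a → x * y * (∣ Δ g (suc (suc (suc a))) ∣ * ¾ ^ a)) ≡⟨ ∑ⁿ-* T (x * y) (λ a → ∣ Δ g (suc (suc (suc a))) ∣ * ¾ ^ a) ⟩
        x * y * ∑ⁿ T (λ a → ∣ Δ g (suc (suc (suc a))) ∣ * ¾ ^ a) ≤⟨ *-monoˡ-≤ (0≤* 0≤x 0≤y) (∑∣Δ∣≤ T) ⟩
        x * y * H ∎

    private module Bound (h : ℕ) (H≤h : H ≤ fromℕℚ h) where

      B : ℚ
      B = 1ℚ + (fromℕℚ M + H)
      1≤B : 1ℚ ≤ B
      1≤B = p≤p+q (0≤+ (0≤fromℕℚ M) 0≤H)
      -- M + 2: for N(p) > h² the part with `H` is at most 1 / N(p), which raises M to M + 1, and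
      -- the factor θ^m raises M + 1 to at most M + 2.
      e : ℕ
      e = suc (suc M)
      open SmallPrimes (h ℕ.* h) B 1≤B

      logPower : ℚ
      logPower = B ^ L * (fromℕℚ 8 * fromℕℚ e) ^ e

      0≤logPower : 0ℚ ≤ logPower
      0≤logPower = 0≤* (0≤^ L (ℚ.≤-trans 0≤1 1≤B)) (0≤^ e (0≤* (0≤fromℕℚ 8) (0≤fromℕℚ e)))

      ∏blowup≤ : ∀ T n m → n ℕ.≤ 2 ℕ.^ m → ∏ᶠ (blowup g T) (primes n) ≤ logPower * fromℕℚ (suc m) ^ suc (suc M)
      ∏blowup≤ T n m n≤2^m = begin
        ∏ᶠ (blowup g T) (primes n)
          ≤⟨ ∏≤∏ (primes n) (λ {p} _ → 0≤blowup g T p) local-bound ⟩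
        ∏ᶠ (λ p → small p * (1ℚ + ω (norm p)) ^ e) (primes n)
          ≡⟨ trans (∏-* small (λ p → (1ℚ + ω (norm p)) ^ e) (primes n)) (cong (∏ᶠ small (primes n) *_) (∏-^ (λ p → 1ℚ + ω (norm p)) e (primes n))) ⟩
        ∏ᶠ small (primes n) * Π ^ e
          ≤⟨ *-mono-≤ (0≤∏ (primes n) λ {p} _ → 0≤pick (norm p ℕ.≤? h ℕ.* h)) (0≤^ e (0≤* 0≤8e (0≤fromℕℚ (suc m)))) (∏small≤ n) (^-monoˡ-≤ e 0≤Π Π≤) ⟩
        B ^ L * (fromℕℚ 8 * fromℕℚ e * fromℕℚ (suc m)) ^ e
          ≡⟨ trans (cong (B ^ L *_) (^-distrib-* (fromℕℚ 8 * fromℕℚ e) (fromℕℚ (suc m)) e)) (sym (ℚ.*-assoc (B ^ L) _ _)) ⟩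
        logPower * fromℕℚ (suc m) ^ e ∎
        where
        -- δ has order 1 / m: then the bound 8 / δ for the product is linear in m, hence in log n,
        -- while θ^m stays bounded.
        E = fromℕℚ e * fromℕℚ (suc m)
        0<E : 0ℚ < E
        0<E = 0<* (0<fromℕℚ-suc (suc M)) (0<fromℕℚ-suc m)
        δ = recip E
        0<δ = 0<recip 0<E
        δ≤1 : δ ≤ 1ℚ
        δ≤1 = recip≤1 {E} (1≤* (1≤fromℕℚ {e} (s≤s z≤n)) (1≤fromℕℚ {suc m} (s≤s z≤n)))
        open Damped δ 0<δ δ≤1
        0≤8e = 0≤* (0≤fromℕℚ 8) (0≤fromℕℚ e)
        Π = ∏ᶠ (λ p → 1ℚ + ω (norm p)) (primes n)
        0≤Π : 0ℚ ≤ Π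
        0≤Π = 0≤∏ (primes n) λ {p} _ → 0≤+ 0≤1 (0≤ω (norm p))
        Π≤ : Π ≤ fromℕℚ 8 * fromℕℚ e * fromℕℚ (suc m)
        Π≤ = *-cancelˡ-≤ 0<δ (ℚ.≤-trans (∏≤ (primes-prime n) (primes-independent n)) (ℚ.≤-reflexive (sym (trans (e₁ δ (fromℕℚ 8) (fromℕℚ e) (fromℕℚ (suc m)))
          (trans (cong (fromℕℚ 8 *_) (recip-inverse (>⇒≢ 0<E))) (ℚ.*-identityʳ (fromℕℚ 8)))))))
          where
          e₁ = solve-ℚ 4 (λ d a b c → d ⊗ (a ⊗ b ⊗ c) , a ⊗ (b ⊗ c ⊗ d)) refl
        -- (1 + δ)^m ≤ (M + 2) / (M + 1) by the choice of δ.
        κ≤ : θ ^ m * fromℕℚ (suc M) ≤ fromℕℚ e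
        κ≤ = begin
          θ ^ m * fromℕℚ (suc M) ≤⟨ *-monoˡ-≤ (ℚ.<⇒≤ (0<^ m 0<θ)) M+1≤ ⟩
          θ ^ m * ((1ℚ - fromℕℚ m * δ) * fromℕℚ e) ≡⟨ ℚ.*-assoc (θ ^ m) (1ℚ - fromℕℚ m * δ) (fromℕℚ e) ⟨
          θ ^ m * (1ℚ - fromℕℚ m * δ) * fromℕℚ e ≤⟨ *-monoʳ-≤ (0≤fromℕℚ e) (bernoulli⁻ m (ℚ.<⇒≤ 0<δ)) ⟩
          1ℚ * fromℕℚ e ≡⟨ ℚ.*-identityˡ (fromℕℚ e) ⟩
          fromℕℚ e ∎
          where
          M+1≤ : fromℕℚ (suc M) ≤ (1ℚ - fromℕℚ m * δ) * fromℕℚ e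
          M+1≤ = begin
            fromℕℚ (suc M) ≡⟨ e₁ (fromℕℚ (suc M)) ⟩
            1ℚ + fromℕℚ (suc M) - 1ℚ ≡⟨ cong₂ _-_ (sym (fromℕℚ-suc (suc M))) (sym (recip-inverse (>⇒≢ 0<E))) ⟩
            fromℕℚ e - fromℕℚ e * fromℕℚ (suc m) * δ ≤⟨ ≤-by _ (e₂ (fromℕℚ e) (fromℕℚ m) (fromℕℚ (suc m)) δ)
                                                           (0≤* (0≤* (0≤fromℕℚ e) (ℚ.<⇒≤ 0<δ)) (p≤q⇒0≤q-p (fromℕℚ-mono (ℕ.n≤1+n m)))) ⟩
            (1ℚ - fromℕℚ m * δ) * fromℕℚ e ∎
            where
            e₁ = solve-ℚ 1 (λ a → a , Κ 1ℚ ⊕ a ⊕ ⊝ (Κ 1ℚ)) refl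
            e₂ = solve-ℚ 4 (λ e m n d → (Κ 1ℚ ⊕ ⊝ (m ⊗ d)) ⊗ e , e ⊕ ⊝ (e ⊗ n ⊗ d) ⊕ e ⊗ d ⊗ (n ⊕ ⊝ m)) refl
        local-bound : ∀ {p} → p ∈ primes n → blowup g T p ≤ small p * (1ℚ + ω (norm p)) ^ e
        local-bound {p} p∈ = ℚ.≤-trans (blowup≤ T {p}) (cases (N ℕ.≤? h ℕ.* h))
          where
          N = norm p
          x = recip (fromℕℚ N)
          s = proj₁ (isqrt N)
          y = recip (fromℕℚ s)
          0<N : 0 ℕ.< N
          0<N = norm-pos (prime≢0 (proj₁ (∈-primes⁻ n p∈)))
          N≤n = proj₂ (proj₂ (∈-primes⁻ n p∈))
          0≤x : 0ℚ ≤ x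
          0≤x = 0≤recip (0≤fromℕℚ N)
          0<s = isqrt-pos 0<N
          cases : (d : Dec (N ℕ.≤ h ℕ.* h)) → 1ℚ + x * (fromℕℚ M + H * y) ≤ pick d * (1ℚ + ω N) ^ e
          cases (yes _) = ≤-scale (ℚ.≤-trans 0≤1 1≤B) (1≤^ e (p≤p+q (0≤ω N))) (ℚ.+-monoʳ-≤ 1ℚ (begin
            x * (fromℕℚ M + H * y) ≤⟨ *-mono-≤ 0≤x (0≤+ (0≤fromℕℚ M) 0≤H) (recip≤1 (1≤fromℕℚ 0<N))
                                           (ℚ.+-monoʳ-≤ (fromℕℚ M) (ℚ.≤-trans (*-monoˡ-≤ 0≤H (recip≤1 (1≤fromℕℚ 0<s))) (ℚ.≤-reflexive (ℚ.*-identityʳ H)))) ⟩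
            1ℚ * (fromℕℚ M + H) ≡⟨ ℚ.*-identityˡ (fromℕℚ M + H) ⟩
            fromℕℚ M + H ∎))
          cases (no ≰h²) = begin
            1ℚ + x * (fromℕℚ M + H * y) ≤⟨ ℚ.+-monoʳ-≤ 1ℚ (*-monoˡ-≤ 0≤x (ℚ.+-monoʳ-≤ (fromℕℚ M) Hy≤1)) ⟩
            1ℚ + x * (fromℕℚ M + 1ℚ) ≡⟨ cong (λ z → 1ℚ + x * z) (trans (ℚ.+-comm (fromℕℚ M) 1ℚ) (sym (fromℕℚ-suc M))) ⟩
            1ℚ + x * fromℕℚ (suc M) ≤⟨ ℚ.+-monoʳ-≤ 1ℚ (*-monoʳ-≤ (0≤fromℕℚ (suc M)) (recip≤ω {N} {m} 0<N (ℕ.≤-trans N≤n n≤2^m))) ⟩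
            1ℚ + θ ^ m * ω N * fromℕℚ (suc M) ≡⟨ cong (λ z → 1ℚ + z) (e₁ (θ ^ m) (ω N) (fromℕℚ (suc M))) ⟩
            1ℚ + θ ^ m * fromℕℚ (suc M) * ω N ≤⟨ ℚ.+-monoʳ-≤ 1ℚ (*-monoʳ-≤ (0≤ω N) κ≤) ⟩
            1ℚ + fromℕℚ e * ω N ≤⟨ bernoulli e (0≤ω N) ⟩
            (1ℚ + ω N) ^ e ≡⟨ ℚ.*-identityˡ ((1ℚ + ω N) ^ e) ⟨
            1ℚ * (1ℚ + ω N) ^ e ∎
            where
            e₁ = solve-ℚ 3 (λ t w m → t ⊗ w ⊗ m , t ⊗ m ⊗ w) refl
            h≤s : h ℕ.≤ s
            h≤s = ℕ.≮⇒≥ λ s<h → ≰h² (ℕ.≤-trans (ℕ.<⇒≤ (proj₂ (proj₂ (isqrt N)))) (ℕ.*-mono-≤ s<h s<h))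
            Hy≤1 : H * y ≤ 1ℚ
            Hy≤1 = recip-*≤ (0<fromℕℚ 0<s) (ℚ.≤-trans H≤h (ℚ.≤-trans (fromℕℚ-mono h≤s) (ℚ.≤-reflexive (sym (ℚ.*-identityˡ (fromℕℚ s))))))

    ∏blowup-bound : ∃ λ K → 0ℚ ≤ K ×
      (∀ T n m → n ℕ.≤ 2 ℕ.^ m → ∏ᶠ (blowup g T) (primes n) ≤ K * fromℕℚ (suc m) ^ suc (suc M))
    ∏blowup-bound = from (ceiling H 0≤H)
      where
      from : (∃ λ h → H ≤ fromℕℚ h) → _
      from (h , H≤h) = Bound.logPower h H≤h , Bound.0≤logPower h H≤h , Bound.∏blowup≤ h H≤h

open LogarithmicBound

-- Counting tuples with prescribed product.

module DivisorFunctions where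

  open ℚ-Operations using (_+_; _*_; _-_; -_; _≤_; _<_; ∣_∣)

  private variable
    A B : Set

  # : {P : Pred A 0ℓ} → Decidable P → List A → ℕ
  # P? xs = length (filter P? xs)

  #-mono : ∀ {P Q : Pred A 0ℓ} (P? : Decidable P) (Q? : Decidable Q) xs → (∀ x → P x → Q x) → # P? xs ℕ.≤ # Q? xs
  #-mono P? Q? [] P⇒Q = z≤n
  #-mono P? Q? (x ∷ xs) P⇒Q with P? x | Q? x
  ... | yes p | yes _ = s≤s (#-mono P? Q? xs P⇒Q)
  ... | yes p | no ¬q = ⊥-elim (¬q (P⇒Q x p))
  ... | no _ | yes _ = ℕ.m≤n⇒m≤1+n (#-mono P? Q? xs P⇒Q)
  ... | no _ | no _ = #-mono P? Q? xs P⇒Q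

  #-none : ∀ {P : Pred A 0ℓ} (P? : Decidable P) xs → (∀ x → ¬ P x) → # P? xs ℕ.≤ 0
  #-none P? [] ¬P = z≤n
  #-none P? (x ∷ xs) ¬P with P? x
  ... | yes p = ⊥-elim (¬P x p)
  ... | no _ = #-none P? xs ¬P

  #-map : ∀ {P : Pred B 0ℓ} (P? : Decidable P) (f : A → B) xs → # P? (map f xs) ≡ # (P? ∘ f) xs
  #-map P? f [] = refl
  #-map P? f (x ∷ xs) with P? (f x)
  ... | yes _ = cong suc (#-map P? f xs)
  ... | no _ = #-map P? f xs

  #-++ : ∀ {P : Pred A 0ℓ} (P? : Decidable P) xs ys → # P? (xs ++ ys) ≡ # P? xs ℕ.+ # P? ys
  #-++ P? xs ys = trans (cong length (filter-++ P? xs ys)) (length-++ (filter P? xs))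

  #-tuples-∷ : ∀ {k} {P : Pred (Vec A (suc k)) 0ℓ} (P? : Decidable P) x xs vs →
    # P? (cartesianProductWith _∷_ (x ∷ xs) vs) ≡ # (P? ∘ (x ∷_)) vs ℕ.+ # P? (cartesianProductWith _∷_ xs vs)
  #-tuples-∷ P? x xs vs = trans (#-++ P? (map (x ∷_) vs) (cartesianProductWith _∷_ xs vs))
    (cong (ℕ._+ # P? (cartesianProductWith _∷_ xs vs)) (#-map P? (x ∷_) vs))

  length-tuples : ∀ k (xs : List A) → length (tuples k xs) ≡ length xs ℕ.^ k
  length-tuples zero xs = refl
  length-tuples (suc k) xs = trans (length-cartesianProductWith xs (tuples k xs)) (cong (length xs ℕ.*_) (length-tuples k xs))
    where
    length-cartesianProductWith : ∀ {k} xs (vs : List (Vec A k)) → length (cartesianProductWith _∷_ xs vs) ≡ length xs ℕ.* length vs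
    length-cartesianProductWith [] vs = refl
    length-cartesianProductWith (x ∷ xs) vs = trans (length-++ (map (x ∷_) vs))
      (cong₂ ℕ._+_ (length-map (x ∷_) vs) (length-cartesianProductWith xs vs))

  singleton-tuples : ∀ {x : A} k → tuples k (x ∷ []) ≡ replicate k x ∷ []
  singleton-tuples zero = refl
  singleton-tuples {x = x} (suc k) = cong (cartesianProductWith _∷_ (x ∷ [])) (singleton-tuples k)

  #-singleton : ∀ {P : Pred A 0ℓ} (P? : Decidable P) {x} → P x → # P? (x ∷ []) ≡ 1
  #-singleton P? {x} p with P? x
  ... | yes _ = refl
  ... | no ¬p = ⊥-elim (¬p p)

  module _ (ν : A → ℕ) where

    -- The parameter ν is the identity for `τ` and the norm for `𝔱`: a product associated to 2 has
    -- norm 4, and only this consequence is counted.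
    weightᵛ : ∀ {k} → Vec A k → ℕ
    weightᵛ [] = 1
    weightᵛ (x ∷ v) = ν x ℕ.* weightᵛ v

    #weight : ∀ k → List A → ℕ → ℕ
    #weight k xs n = # (λ v → weightᵛ v ℕ.≟ n) (tuples k xs)

  -- k (k + 1) / 2, the number of ways to distribute the two prime factors 1 + i of 2 over k places.
  sum-to : ℕ → ℕ
  sum-to zero = 0
  sum-to (suc k) = sum-to k ℕ.+ suc k

  module _ (ν : A → ℕ) where

    -- If the first entry is x, the product of the others has to be the quotient m of n by ν x. The
    -- remaining tuples begin in `xs`.
    #weight-cons : ∀ {k n} m x xs (vs : List (Vec A k)) → (∀ w → ν x ℕ.* w ≡ n → w ≡ m) →
      # (λ v → weightᵛ ν v ℕ.≟ n) (cartesianProductWith _∷_ (x ∷ xs) vs) ℕ.≤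
      # (λ v → weightᵛ ν v ℕ.≟ m) vs ℕ.+ # (λ v → weightᵛ ν v ℕ.≟ n) (cartesianProductWith _∷_ xs vs)
    #weight-cons m x xs vs div = ℕ.≤-trans (ℕ.≤-reflexive (#-tuples-∷ _ x xs vs))
      (ℕ.+-monoˡ-≤ _ (#-mono _ (λ v → weightᵛ ν v ℕ.≟ m) vs λ v → div (weightᵛ ν v)))

    #weight-skip : ∀ {k n} xs (vs : List (Vec A k)) → (∀ x → x ∈ xs → ∀ w → ν x ℕ.* w ≢ n) →
      # (λ v → weightᵛ ν v ℕ.≟ n) (cartesianProductWith _∷_ xs vs) ℕ.≤ 0
    #weight-skip [] vs none = z≤n
    #weight-skip (x ∷ xs) vs none = ℕ.≤-trans (ℕ.≤-reflexive (#-tuples-∷ _ x xs vs))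
      (ℕ.+-mono-≤ (#-none _ vs λ v → none x (here refl) (weightᵛ ν v)) (#weight-skip xs vs λ y y∈ → none y (there y∈)))

    *-divides : ∀ {x c n m} .⦃ _ : ℕ.NonZero c ⦄ → ν x ≡ c → c ℕ.* m ≡ n → ∀ w → ν x ℕ.* w ≡ n → w ≡ m
    *-divides {c = c} {m = m} νx≡c cm≡n w eq = ℕ.*-cancelˡ-≡ w m c (trans (trans (cong (ℕ._* w) (sym νx≡c)) eq) (sym cm≡n))

    *-too-small : ∀ {x c n} → ν x ≡ c → 0 ℕ.< n → n ℕ.< c → ∀ w → ν x ℕ.* w ≢ n
    *-too-small {x} νx≡c 0<n n<c zero eq = ℕ.<-irrefl (trans (sym (ℕ.*-zeroʳ (ν x))) eq) 0<n
    *-too-small {x} νx≡c 0<n n<c (suc w) eq = ℕ.<⇒≱ n<c (subst₂ ℕ._≤_ νx≡c eq (ℕ.m≤m*n (ν x) (suc w)))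

    #weight-1 : ∀ k {x₁ xs} → ν x₁ ≡ 1 → (∀ x → x ∈ xs → 1 ℕ.< ν x) → #weight ν k (x₁ ∷ xs) 1 ℕ.≤ 1
    #weight-1 zero ν₁ big = ℕ.≤-refl
    #weight-1 (suc k) {x₁} {xs} ν₁ big = ℕ.≤-trans (#weight-cons 1 x₁ xs vs (*-divides ν₁ refl))
      (ℕ.+-mono-≤ (#weight-1 k ν₁ big) (#weight-skip xs vs λ x x∈ → *-too-small refl (s≤s z≤n) (big x x∈)))
      where vs = tuples k (x₁ ∷ xs)

    #weight-2 : ∀ k {x₁ x₂ xs} → ν x₁ ≡ 1 → ν x₂ ≡ 2 → (∀ x → x ∈ xs → 2 ℕ.< ν x) → #weight ν k (x₁ ∷ x₂ ∷ xs) 2 ℕ.≤ k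
    #weight-2 zero ν₁ ν₂ big = z≤n
    #weight-2 (suc k) {x₁} {x₂} {xs} ν₁ ν₂ big = ℕ.≤-trans (#weight-cons 2 x₁ (x₂ ∷ xs) vs (*-divides ν₁ refl))
      (ℕ.≤-trans (ℕ.+-mono-≤ (#weight-2 k ν₁ ν₂ big) (ℕ.≤-trans (#weight-cons 1 x₂ xs vs (*-divides ν₂ refl))
        (ℕ.+-mono-≤ (#weight-1 k ν₁ λ { x (here refl) → subst (1 ℕ.<_) (sym ν₂) ℕ.≤-refl ; x (there x∈) → ℕ.<-trans (ℕ.n<1+n 1) (big x x∈) })
          (#weight-skip xs vs λ x x∈ → *-too-small refl (s≤s z≤n) (big x x∈)))))
        (ℕ.≤-reflexive (ℕ.+-comm k 1)))
      where vs = tuples k (x₁ ∷ x₂ ∷ xs)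

    -- For k + 1 entries the first one has weight 1, 2 or 4 and leaves 4, 2 or 1 to the other k,
    -- which admit at most `sum-to k`, k and 1 choices.
    #weight-4 : ∀ k {x₁ x₂ x₄} → ν x₁ ≡ 1 → ν x₂ ≡ 2 → ν x₄ ≡ 4 → #weight ν k (x₁ ∷ x₂ ∷ x₄ ∷ []) 4 ℕ.≤ sum-to k
    #weight-4 zero ν₁ ν₂ ν₄ = z≤n
    #weight-4 (suc k) {x₁} {x₂} {x₄} ν₁ ν₂ ν₄ = ℕ.≤-trans (#weight-cons 4 x₁ (x₂ ∷ x₄ ∷ []) vs (*-divides ν₁ refl))
      (ℕ.+-mono-≤ (#weight-4 k ν₁ ν₂ ν₄) (ℕ.≤-trans (#weight-cons 2 x₂ (x₄ ∷ []) vs (*-divides ν₂ refl))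
        (ℕ.≤-trans (ℕ.+-mono-≤ (#weight-2 k ν₁ ν₂ λ { x (here refl) → subst (2 ℕ.<_) (sym ν₄) (s≤s (s≤s (s≤s z≤n))) })
          (ℕ.≤-trans (#weight-cons 1 x₄ [] vs (*-divides ν₄ refl))
            (ℕ.+-monoˡ-≤ 0 (#weight-1 k ν₁ λ { x (here refl) → subst (1 ℕ.<_) (sym ν₂) ℕ.≤-refl
                                             ; x (there (here refl)) → subst (1 ℕ.<_) (sym ν₄) (s≤s (s≤s z≤n)) }))))
          (ℕ.≤-reflexive (ℕ.+-comm k 1)))))
      where vs = tuples k (x₁ ∷ x₂ ∷ x₄ ∷ [])

  2*sum-to : ∀ k → 2 ℕ.* sum-to k ≡ k ℕ.^ 2 ℕ.+ k
  2*sum-to zero = refl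
  2*sum-to (suc k) = trans (ℕ.*-distribˡ-+ 2 (sum-to k) (suc k)) (trans (cong (ℕ._+ 2 ℕ.* suc k) (2*sum-to k)) (eq k))
    where
    eq = solve-ℕ 1 (λ k → k ⊗ (k ⊗ Κ 1) ⊕ k ⊕ Κ 2 ⊗ (Κ 1 ⊕ k) , (Κ 1 ⊕ k) ⊗ ((Κ 1 ⊕ k) ⊗ Κ 1) ⊕ (Κ 1 ⊕ k)) refl

open DivisorFunctions

-- The exponential divisor functions satisfy the growth conditions.

module Admissibility where

  open ℚ-Operations using (_+_; _*_; _-_; -_; _≤_; _<_; ∣_∣)
  open ℚ.≤-Reasoning

  -- For b = 5 (D + 1), Bernoulli's inequality gives a ≤ b (1 + 1 / b)^a, and (1 + 1 / b)^D ≤ 5/4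
  -- follows from D / b ≤ 1/5 and `bernoulli⁻`.
  polynomial-growth : ∀ D → ∃ λ C → 0ℚ ≤ C × (∀ a → fromℕℚ a ^ D ≤ C * ⁵/₄ ^ a)
  polynomial-growth D = b ^ D , 0≤^ D 0≤b , bound
    where
    b = fromℕℚ (5 ℕ.* suc D)
    0<b : 0ℚ < b
    0<b = 0<fromℕℚ {5 ℕ.* suc D} (s≤s z≤n)
    0≤b = ℚ.<⇒≤ 0<b
    d = recip b
    0≤d = ℚ.<⇒≤ (0<recip 0<b)
    bd≡1 : b * d ≡ 1ℚ
    bd≡1 = recip-inverse (>⇒≢ 0<b)
    linear : ∀ a → fromℕℚ a ≤ b * (1ℚ + d) ^ a
    linear a = begin
      fromℕℚ a ≤⟨ q≤p+q 0≤b ⟩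
      b + fromℕℚ a ≡⟨ cong (b +_) (trans (sym (ℚ.*-identityʳ (fromℕℚ a))) (cong (fromℕℚ a *_) (sym bd≡1))) ⟩
      b + fromℕℚ a * (b * d) ≡⟨ eq b (fromℕℚ a) d ⟩
      b * (1ℚ + fromℕℚ a * d) ≤⟨ *-monoˡ-≤ 0≤b (bernoulli a 0≤d) ⟩
      b * (1ℚ + d) ^ a ∎
      where
      eq = solve-ℚ 3 (λ b a d → b ⊕ a ⊗ (b ⊗ d) , b ⊗ (Κ 1ℚ ⊕ a ⊗ d)) refl
    ⅘ : ℚ
    ⅘ = recip ⁵/₄
    Dd≤ : fromℕℚ D * d ≤ 1ℚ - ⅘
    Dd≤ = recip-*≤ 0<b (ℚ.≤-trans (fromℕℚ-mono (ℕ.n≤1+n D)) (ℚ.≤-reflexive (trans (eq (fromℕℚ (suc D))) (cong ((1ℚ - ⅘) *_) (sym (fromℕℚ-* 5 (suc D)))))))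
      where
      eq = solve-ℚ 1 (λ z → z , (Κ 1ℚ ⊕ ⊝ (Κ ⅘)) ⊗ (Κ (fromℕℚ 5) ⊗ z)) refl
    1+d^D≤ : (1ℚ + d) ^ D ≤ ⁵/₄
    1+d^D≤ = *-cancelˡ-≤ {⅘} (ℚ.positive⁻¹ ⅘) (begin
      ⅘ * (1ℚ + d) ^ D ≡⟨ ℚ.*-comm ⅘ ((1ℚ + d) ^ D) ⟩
      (1ℚ + d) ^ D * ⅘ ≤⟨ *-monoˡ-≤ (0≤^ D (0≤+ 0≤1 0≤d)) (≤-by _ (eq (fromℕℚ D * d) ⅘) (p≤q⇒0≤q-p Dd≤)) ⟩
      (1ℚ + d) ^ D * (1ℚ - fromℕℚ D * d) ≤⟨ bernoulli⁻ D 0≤d ⟩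
      1ℚ ∎)
      where
      eq = solve-ℚ 2 (λ x f → Κ 1ℚ ⊕ ⊝ x , f ⊕ (Κ 1ℚ ⊕ ⊝ f ⊕ ⊝ x)) refl
    bound : ∀ a → fromℕℚ a ^ D ≤ b ^ D * ⁵/₄ ^ a
    bound a = begin
      fromℕℚ a ^ D ≤⟨ ^-monoˡ-≤ D (0≤fromℕℚ a) (linear a) ⟩
      (b * (1ℚ + d) ^ a) ^ D ≡⟨ ^-distrib-* b ((1ℚ + d) ^ a) D ⟩
      b ^ D * ((1ℚ + d) ^ a) ^ D ≡⟨ cong (b ^ D *_) (trans (^-assocʳ (1ℚ + d) a D) (trans (cong ((1ℚ + d) ^_) (ℕ.*-comm a D)) (sym (^-assocʳ (1ℚ + d) D a)))) ⟩
      b ^ D * ((1ℚ + d) ^ D) ^ a ≤⟨ *-monoˡ-≤ (0≤^ D 0≤b) (^-monoˡ-≤ a (0≤^ D (0≤+ 0≤1 0≤d)) 1+d^D≤) ⟩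
      b ^ D * ⁵/₄ ^ a ∎

  tuples-bound : ∀ {A : Set} k (xs : List A) {P : Pred (Vec A k) 0ℓ} (P? : Decidable P) → # P? (tuples k xs) ℕ.≤ length xs ℕ.^ k
  tuples-bound k xs P? = subst (# P? (tuples k xs) ℕ.≤_) (length-tuples k xs) (length-filter P? (tuples k xs))

  foldr-weight : ∀ {k} (v : Vec ℕ k) → foldr′ ℕ._*_ 1 v ≡ weightᵛ id v
  foldr-weight [] = refl
  foldr-weight (x ∷ v) = cong (x ℕ.*_) (foldr-weight v)

  norm-foldr : ∀ {k} (v : Vec ℤ[i] k) → norm (foldr′ _*ᵍ_ 1ᵍ v) ≡ weightᵛ norm v
  norm-foldr [] = refl
  norm-foldr (α ∷ v) = trans (norm-* α (foldr′ _*ᵍ_ 1ᵍ v)) (cong (norm α ℕ.*_) (norm-foldr v))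

  #-single-tuple : ∀ {A : Set} {x : A} k {P : Pred (Vec A k) 0ℓ} (P? : Decidable P) → P (replicate k x) → # P? (tuples k (x ∷ [])) ≡ 1
  #-single-tuple k P? p = trans (cong (# P?) (singleton-tuples k)) (#-singleton P? p)

  m≤1+[m∸1] : ∀ m → m ℕ.≤ suc (m ℕ.∸ 1)
  m≤1+[m∸1] zero = z≤n
  m≤1+[m∸1] (suc m) = ℕ.≤-refl

  -- The value at 2 is at most k, whence M = k - 1. For the growth the trivial bound a^k is enough.
  τ-admissible : ∀ k → 2 ℕ.≤ k → Admissible (τ k) (k ℕ.∸ 1)
  τ-admissible k 2≤k = record
    { g1≡1 = #-single-tuple k (λ v → foldr′ ℕ._*_ 1 v ℕ.≟ 1) (trans (foldr-weight (replicate k 1)) (ones k))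
    ; 1≤M = ℕ.∸-monoˡ-≤ 1 2≤k
    ; g2≤ = ℕ.≤-trans (#-mono _ (λ v → weightᵛ id v ℕ.≟ 2) (tuples k (1 ∷ 2 ∷ [])) λ v → trans (sym (foldr-weight v)))
                 (ℕ.≤-trans (#weight-2 id k refl refl λ _ ()) (m≤1+[m∸1] k))
    ; C = proj₁ P
    ; 0≤C = proj₁ (proj₂ P)
    ; growth = λ a → ℚ.≤-trans (fromℕℚ-mono (τ≤ (suc a))) (subst (_≤ proj₁ P * ⁵/₄ ^ suc a) (sym (fromℕℚ-^ (suc a) k)) (proj₂ (proj₂ P) (suc a)))
    }
    where
    P = polynomial-growth k
    ones : ∀ k → weightᵛ id (replicate k 1) ≡ 1
    ones zero = refl
    ones (suc k) = trans (ℕ.*-identityˡ (weightᵛ id (replicate k 1))) (ones k)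
    τ≤ : ∀ a → τ k a ℕ.≤ a ℕ.^ k
    τ≤ a = ℕ.≤-trans (tuples-bound k (map suc (upTo a)) (λ v → foldr′ ℕ._*_ 1 v ℕ.≟ a)) (ℕ.≤-reflexive (cong (ℕ._^ k) (trans (length-map suc (upTo a)) (length-upTo a))))

  representatives-1 : representatives 1 ≡ 1ᵍ ∷ []
  representatives-1 = refl

  representatives-4 : representatives 4 ≡ 1ᵍ ∷ (ℤ.+ 1) +i (ℤ.+ 1) ∷ (ℤ.+ 2) +i (ℤ.+ 0) ∷ []
  representatives-4 = refl

  -- The factors of 2 are 1, 1 + i and 2 up to associates, so that the value at 2 is at most k (k +
  -- 1) / 2. The value at a is at most the k-th power of the number of representatives with norm up
  -- to a², hence at most (2 a²)^k.
  𝔱ℕ-admissible : ∀ k → 2 ℕ.≤ k → Admissible (𝔱ℕ k) (sum-to k ℕ.∸ 1)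
  𝔱ℕ-admissible k 2≤k = record
    { g1≡1 = trans (cong (λ xs → # unit? (tuples k xs)) representatives-1) (#-single-tuple k unit? (subst (_∈ associates 1ᵍ) (sym (ones k)) (here refl)))
    ; 1≤M = ℕ.∸-monoˡ-≤ 1 (2≤triangle 2≤k)
    ; g2≤ = ℕ.≤-trans (#-mono two? (λ v → weightᵛ norm v ℕ.≟ 4) (tuples k (representatives 4)) (λ v v∈ → trans (sym (norm-foldr v)) (All.lookup norms v∈)))
                 (ℕ.≤-trans (ℕ.≤-reflexive (cong (λ xs → #weight norm k xs 4) representatives-4)) (ℕ.≤-trans (#weight-4 norm k refl refl refl) (m≤1+[m∸1] (sum-to k))))
    ; C = 2ℚ ^ k * proj₁ P
    ; 0≤C = 0≤* (0≤^ {2ℚ} k (0≤fromℕℚ 2)) (proj₁ (proj₂ P))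
    ; growth = λ a → begin
        fromℕℚ (𝔱ℕ k (suc a)) ≤⟨ fromℕℚ-mono (tuples-bound k (representatives (N a)) _) ⟩
        fromℕℚ (length (representatives (N a)) ℕ.^ k) ≡⟨ fromℕℚ-^ (length (representatives (N a))) k ⟩
        count (N a) ^ k ≤⟨ ^-monoˡ-≤ k (0≤fromℕℚ (length (representatives (N a)))) (count≤ (N a)) ⟩
        (2ℚ * fromℕℚ (N a)) ^ k ≡⟨ ^-distrib-* 2ℚ (fromℕℚ (N a)) k ⟩
        2ℚ ^ k * fromℕℚ (N a) ^ k ≡⟨ cong (2ℚ ^ k *_) (trans (cong (_^ k) (trans (cong fromℕℚ (square a)) (fromℕℚ-^ (suc a) 2)))
                                                                     (^-assocʳ (fromℕℚ (suc a)) 2 k)) ⟩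
        2ℚ ^ k * fromℕℚ (suc a) ^ (2 ℕ.* k) ≤⟨ *-monoˡ-≤ (0≤^ {2ℚ} k (0≤fromℕℚ 2)) (proj₂ (proj₂ P) (suc a)) ⟩
        2ℚ ^ k * (proj₁ P * ⁵/₄ ^ suc a) ≡⟨ ℚ.*-assoc (2ℚ ^ k) (proj₁ P) (⁵/₄ ^ suc a) ⟨
        2ℚ ^ k * proj₁ P * ⁵/₄ ^ suc a ∎
    }
    where
    P = polynomial-growth (2 ℕ.* k)
    unit? = λ (v : Vec ℤ[i] k) → foldr′ _*ᵍ_ 1ᵍ v ∈ᵍ? associates ((ℤ.+ 1) +i (ℤ.+ 0))
    two? = λ (v : Vec ℤ[i] k) → foldr′ _*ᵍ_ 1ᵍ v ∈ᵍ? associates ((ℤ.+ 2) +i (ℤ.+ 0))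
    norms : All (λ α → norm α ≡ 4) (associates ((ℤ.+ 2) +i (ℤ.+ 0)))
    norms = refl ∷ refl ∷ refl ∷ refl ∷ []
    N : ℕ → ℕ
    N a = norm ((ℤ.+ suc a) +i (ℤ.+ 0))
    square : ∀ a → N a ≡ suc a ℕ.^ 2
    square a = eq (suc a)
      where
      eq = solve-ℕ 1 (λ a → a ⊗ a ⊕ Κ 0 , a ⊗ (a ⊗ Κ 1)) refl
    ones : ∀ k → foldr′ _*ᵍ_ 1ᵍ (replicate k 1ᵍ) ≡ 1ᵍ
    ones zero = refl
    ones (suc k) = trans (*ᵍ-identityˡ (foldr′ _*ᵍ_ 1ᵍ (replicate k 1ᵍ))) (ones k)
    2≤triangle : ∀ {k} → 2 ℕ.≤ k → 2 ℕ.≤ sum-to k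
    2≤triangle {suc k} 2≤k = ℕ.≤-trans 2≤k (ℕ.m≤n+m (suc k) (sum-to k))

open Admissibility

-- Products with factors near 1 and tails of the sum of inverse squares.

module EulerProduct where

  open ℚ-Operations using (_+_; _*_; _-_; -_; _≤_; _<_; ∣_∣)
  open ℚ.≤-Reasoning

  ∏ᶠ-++ : ∀ {A : Set} (f : A → ℚ) xs ys → ∏ᶠ f (xs ++ ys) ≡ ∏ᶠ f xs * ∏ᶠ f ys
  ∏ᶠ-++ f [] ys = sym (ℚ.*-identityˡ (∏ᶠ f ys))
  ∏ᶠ-++ f (x ∷ xs) ys = trans (cong (f x *_) (∏ᶠ-++ f xs ys)) (sym (ℚ.*-assoc (f x) (∏ᶠ f xs) (∏ᶠ f ys)))

  1≤∏ : ∀ {A : Set} {e : A → ℚ} xs → (∀ x → 0ℚ ≤ e x) → 1ℚ ≤ ∏ᶠ (λ x → 1ℚ + e x) xs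
  1≤∏ [] 0≤e = ℚ.≤-refl
  1≤∏ (x ∷ xs) 0≤e = 1≤* (p≤p+q (0≤e x)) (1≤∏ xs 0≤e)

  -- Replaces the bound exp(Σ e) for the product: when Σ e is below 1, the product is at most 1 / (1
  -- - Σ e).
  ∏-∑ : ∀ {A : Set} {e : A → ℚ} xs → (∀ x → 0ℚ ≤ e x) → ∏ᶠ (λ x → 1ℚ + e x) xs * (1ℚ - ∑ e xs) ≤ 1ℚ
  ∏-∑ [] 0≤e = ℚ.≤-reflexive (trans (ℚ.*-identityˡ (1ℚ - 0ℚ)) (ℚ.+-identityʳ 1ℚ))
  ∏-∑ {e = e} (x ∷ xs) 0≤e = begin
    (1ℚ + e x) * Π * (1ℚ - (e x + S)) ≤⟨ ≤-by _ (eq (e x) Π S) (0≤* (ℚ.≤-trans 0≤1 (1≤∏ xs 0≤e)) (0≤* (0≤e x) (0≤+ (0≤e x) (0≤∑ xs λ {y} _ → 0≤e y)))) ⟩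
    Π * (1ℚ - S) ≤⟨ ∏-∑ xs 0≤e ⟩
    1ℚ ∎
    where
    Π = ∏ᶠ (λ x → 1ℚ + e x) xs
    S = ∑ e xs
    eq = solve-ℚ 3 (λ e p s → p ⊗ (Κ 1ℚ ⊕ ⊝ s) , (Κ 1ℚ ⊕ e) ⊗ p ⊗ (Κ 1ℚ ⊕ ⊝ (e ⊕ s)) ⊕ p ⊗ (e ⊗ (e ⊕ s))) refl

  module _ {A : Set} {f e : A → ℚ} (close : ∀ x → ∣ f x - 1ℚ ∣ ≤ e x) where

    private
      0≤e : ∀ x → 0ℚ ≤ e x
      0≤e x = ℚ.≤-trans (ℚ.0≤∣p∣ (f x - 1ℚ)) (close x)

    ∣∏∣≤ : ∀ xs → ∣ ∏ᶠ f xs ∣ ≤ ∏ᶠ (λ x → 1ℚ + e x) xs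
    ∣∏∣≤ [] = ℚ.≤-refl
    ∣∏∣≤ (x ∷ xs) = ℚ.≤-trans (ℚ.≤-reflexive (ℚ.∣p*q∣≡∣p∣*∣q∣ (f x) (∏ᶠ f xs)))
      (*-mono-≤ (ℚ.0≤∣p∣ (f x)) (ℚ.≤-trans 0≤1 (1≤∏ xs 0≤e)) ∣f∣≤ (∣∏∣≤ xs))
      where
      eq = solve-ℚ 1 (λ a → a , Κ 1ℚ ⊕ (a ⊕ ⊝ (Κ 1ℚ))) refl
      ∣f∣≤ : ∣ f x ∣ ≤ 1ℚ + e x
      ∣f∣≤ = begin
        ∣ f x ∣ ≡⟨ cong ∣_∣ (eq (f x)) ⟩
        ∣ 1ℚ + (f x - 1ℚ) ∣ ≤⟨ ℚ.∣p+q∣≤∣p∣+∣q∣ 1ℚ (f x - 1ℚ) ⟩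
        1ℚ + ∣ f x - 1ℚ ∣ ≤⟨ ℚ.+-monoʳ-≤ 1ℚ (close x) ⟩
        1ℚ + e x ∎

    ∣∏-1∣≤ : ∀ xs → ∣ ∏ᶠ f xs - 1ℚ ∣ ≤ ∏ᶠ (λ x → 1ℚ + e x) xs - 1ℚ
    ∣∏-1∣≤ [] = ℚ.≤-refl
    ∣∏-1∣≤ (x ∷ xs) = begin
      ∣ f x * Π - 1ℚ ∣ ≡⟨ cong ∣_∣ (e₁ (f x) Π) ⟩
      ∣ (f x - 1ℚ) * Π + (Π - 1ℚ) ∣ ≤⟨ ℚ.∣p+q∣≤∣p∣+∣q∣ ((f x - 1ℚ) * Π) (Π - 1ℚ) ⟩
      ∣ (f x - 1ℚ) * Π ∣ + ∣ Π - 1ℚ ∣ ≤⟨ ℚ.+-mono-≤ (ℚ.≤-trans (ℚ.≤-reflexive (ℚ.∣p*q∣≡∣p∣*∣q∣ (f x - 1ℚ) Π))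
                                                          (*-mono-≤ (ℚ.0≤∣p∣ (f x - 1ℚ)) (ℚ.≤-trans 0≤1 (1≤∏ xs 0≤e)) (close x) (∣∏∣≤ xs))) (∣∏-1∣≤ xs) ⟩
      e x * Π⁺ + (Π⁺ - 1ℚ) ≡⟨ e₂ (e x) Π⁺ ⟩
      (1ℚ + e x) * Π⁺ - 1ℚ ∎
      where
      Π = ∏ᶠ f xs
      Π⁺ = ∏ᶠ (λ x → 1ℚ + e x) xs
      e₁ = solve-ℚ 2 (λ f p → f ⊗ p ⊕ ⊝ (Κ 1ℚ) , (f ⊕ ⊝ (Κ 1ℚ)) ⊗ p ⊕ (p ⊕ ⊝ (Κ 1ℚ))) refl
      e₂ = solve-ℚ 2 (λ e p → e ⊗ p ⊕ (p ⊕ ⊝ (Κ 1ℚ)) , (Κ 1ℚ ⊕ e) ⊗ p ⊕ ⊝ (Κ 1ℚ)) refl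

    -- For the product Π of the factors 1 + e, `∏-∑` rearranges to Π - 1 ≤ Π Σ e.
    ∣∏-1∣≤∑ : ∀ xs → ∣ ∏ᶠ f xs - 1ℚ ∣ ≤ ∏ᶠ (λ x → 1ℚ + e x) xs * ∑ e xs
    ∣∏-1∣≤∑ xs = ℚ.≤-trans (∣∏-1∣≤ xs) (≤-by _ (eq (∏ᶠ (λ x → 1ℚ + e x) xs) (∑ e xs)) (p≤q⇒0≤q-p (∏-∑ xs 0≤e)))
      where
      eq = solve-ℚ 2 (λ p s → p ⊗ s , p ⊕ ⊝ (Κ 1ℚ) ⊕ (Κ 1ℚ ⊕ ⊝ (p ⊗ (Κ 1ℚ ⊕ ⊝ s)))) refl

  inverseSquare : ℤ[i] → ℚ
  inverseSquare α = recip (fromℕℚ (norm α)) * recip (fromℕℚ (norm α))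

  0≤inverseSquare : ∀ α → 0ℚ ≤ inverseSquare α
  0≤inverseSquare α = square≥0 (recip (fromℕℚ (norm α)))

  beyond : ℕ → ℕ → ℚ
  beyond X Y = ∑ inverseSquare (filter (λ α → X ℕ.<? norm α) (representatives Y))

  -- The second summand is what remains for later dyadic ranges. Between Z = 2^i X and 2 Z there are
  -- at most 4 Z representatives, each contributing at most 1 / Z², and 4 / Z is exactly the amount
  -- by which that summand drops.
  beyond-dyadic : ∀ X → 0 ℕ.< X → ∀ i →
    beyond X (2 ℕ.^ i ℕ.* X) + fromℕℚ 8 * recip (fromℕℚ X) * ½ ^ i ≤ fromℕℚ 8 * recip (fromℕℚ X)
  beyond-dyadic X 0<X zero = ℚ.≤-reflexive (trans (cong (λ z → z + c * 1ℚ) empty) (trans (ℚ.+-identityˡ (c * 1ℚ)) (ℚ.*-identityʳ c)))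
    where
    c = fromℕℚ 8 * recip (fromℕℚ X)
    none : ∀ {α xs} → α ∈ filter (λ α → X ℕ.<? norm α) xs → (∀ {β} → β ∈ xs → norm β ℕ.≤ X) → inverseSquare α ≡ 0ℚ
    none {xs = xs} α∈ ≤X = let α∈′ , X<N = ∈-filter⁻ (λ α → X ℕ.<? norm α) {xs = xs} α∈ in ⊥-elim (ℕ.<⇒≱ X<N (≤X α∈′))
    empty : beyond X (1 ℕ.* X) ≡ 0ℚ
    empty = trans (∑-cong xs (λ α∈ → none {xs = representatives (1 ℕ.* X)} α∈ λ β∈ → ℕ.≤-trans (proj₂ (∈-representatives⁻ (1 ℕ.* X) β∈)) (ℕ.≤-reflexive (ℕ.*-identityˡ X))))
      (trans (∑-const 0ℚ xs) (ℚ.*-zeroʳ (fromℕℚ (length xs))))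
      where xs = filter (λ α → X ℕ.<? norm α) (representatives (1 ℕ.* X))
  beyond-dyadic X 0<X (suc i) = begin
    beyond X Y + c * (½ * h) ≤⟨ ℚ.+-monoˡ-≤ (c * (½ * h)) step ⟩
    beyond X Z + c * (½ * h) + c * (½ * h) ≡⟨ e₁ (beyond X Z) c h ⟩
    beyond X Z + c * h ≤⟨ beyond-dyadic X 0<X i ⟩
    c ∎
    where
    Z = 2 ℕ.^ i ℕ.* X
    Y = 2 ℕ.^ suc i ℕ.* X
    h = ½ ^ i
    x = recip (fromℕℚ X)
    z = recip (fromℕℚ Z)
    c = fromℕℚ 8 * x
    0<Z : 0 ℕ.< Z
    0<Z = ℕ.*-mono-≤ (ℕ.m^n>0 2 i) 0<X
    e₁ = solve-ℚ 3 (λ b c h → b ⊕ c ⊗ (Κ ½ ⊗ h) ⊕ c ⊗ (Κ ½ ⊗ h) , b ⊕ c ⊗ h) refl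
    outside : ℤ[i] → ℚ
    outside α = 𝟙 (X ℕ.<? norm α) * inverseSquare α
    0≤outside : ∀ α → 0ℚ ≤ outside α
    0≤outside α = 0≤* (0≤𝟙 (X ℕ.<? norm α)) (0≤inverseSquare α)
    z≡ : z ≡ ½ ^ i * x
    z≡ = trans (cong recip (trans (fromℕℚ-* (2 ℕ.^ i) X) (cong (_* fromℕℚ X) (fromℕℚ-^ 2 i))))
      (trans (recip-* (0<^ i (0<fromℕℚ-suc 1)) (0<fromℕℚ 0<X)) (cong (_* x) (recip-^ i (0<fromℕℚ-suc 1))))
    pointwise : ∀ {α} → α ∈ representatives Y → outside α ≤ 𝟙 (norm α ℕ.≤? Z) * outside α + z * z
    pointwise {α} α∈ = cases (norm α ℕ.≤? Z)
      where
      ν = fromℕℚ (norm α)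
      cases : (d : Dec (norm α ℕ.≤ Z)) → outside α ≤ 𝟙 d * outside α + z * z
      cases (yes _) = ℚ.≤-trans (ℚ.≤-reflexive (sym (ℚ.*-identityˡ (outside α)))) (p≤p+q (square≥0 z))
      cases (no ≰Z) = begin
        outside α ≤⟨ *-monoʳ-≤ (0≤inverseSquare α) (𝟙≤1 (X ℕ.<? norm α)) ⟩
        1ℚ * inverseSquare α ≡⟨ ℚ.*-identityˡ (inverseSquare α) ⟩
        recip ν * recip ν ≤⟨ *-mono-≤ (0≤recip (0≤fromℕℚ (norm α))) (ℚ.<⇒≤ (0<recip (0<fromℕℚ 0<Z))) ν≤z ν≤z ⟩
        z * z ≡⟨ trans (cong (_+ z * z) (ℚ.*-zeroˡ (outside α))) (ℚ.+-identityˡ (z * z)) ⟨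
        0ℚ * outside α + z * z ∎
        where
        ν≤z : recip ν ≤ z
        ν≤z = recip-antitone (0<fromℕℚ 0<Z) (fromℕℚ-mono (ℕ.<⇒≤ (ℕ.≰⇒> ≰Z)))
    step : beyond X Y ≤ beyond X Z + c * (½ * h)
    step = begin
      beyond X Y
        ≡⟨ ∑-filter (λ α → X ℕ.<? norm α) inverseSquare (representatives Y) ⟩
      ∑ outside (representatives Y)
        ≤⟨ ∑≤ (representatives Y) pointwise ⟩
      ∑ (λ α → 𝟙 (norm α ℕ.≤? Z) * outside α + z * z) (representatives Y)
        ≡⟨ ∑-+ (λ α → 𝟙 (norm α ℕ.≤? Z) * outside α) (λ _ → z * z) (representatives Y) ⟩
      ∑ (λ α → 𝟙 (norm α ℕ.≤? Z) * outside α) (representatives Y) + ∑ (λ _ → z * z) (representatives Y)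
        ≡⟨ cong₂ _+_ (sym (∑-filter (λ α → norm α ℕ.≤? Z) outside (representatives Y))) (∑-const (z * z) (representatives Y)) ⟩
      ∑ outside (filter (λ α → norm α ℕ.≤? Z) (representatives Y)) + count Y * (z * z)
        ≤⟨ ℚ.+-mono-≤ (∑-⊆ (Unique.filter⁺ (λ α → norm α ℕ.≤? Z) (representatives-unique Y))
             (λ α∈ → let α∈′ , N≤ = ∈-filter⁻ (λ α → norm α ℕ.≤? Z) {xs = representatives Y} α∈
                     in ∈-representatives⁺ Z (proj₁ (∈-representatives⁻ Y α∈′)) N≤) (λ {α} _ → 0≤outside α))
             (*-monoʳ-≤ (square≥0 z) (count≤ Y)) ⟩
      ∑ outside (representatives Z) + 2ℚ * fromℕℚ Y * (z * z)
        ≡⟨ cong₂ _+_ (sym (∑-filter (λ α → X ℕ.<? norm α) inverseSquare (representatives Z))) mass ⟩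
      beyond X Z + c * (½ * h) ∎
      where
      e₂ = solve-ℚ 2 (λ n z → (Κ 1ℚ ⊕ Κ 1ℚ) ⊗ ((Κ 1ℚ ⊕ Κ 1ℚ) ⊗ n) ⊗ (z ⊗ z) , (Κ 1ℚ ⊕ Κ 1ℚ) ⊗ (Κ 1ℚ ⊕ Κ 1ℚ) ⊗ (n ⊗ z) ⊗ z) refl
      e₃ = solve-ℚ 2 (λ h x → (Κ 1ℚ ⊕ Κ 1ℚ) ⊗ (Κ 1ℚ ⊕ Κ 1ℚ) ⊗ Κ 1ℚ ⊗ (h ⊗ x) , Κ (fromℕℚ 8) ⊗ x ⊗ (Κ ½ ⊗ h)) refl
      mass : 2ℚ * fromℕℚ Y * (z * z) ≡ c * (½ * h)
      mass = trans (cong (λ a → 2ℚ * a * (z * z)) (trans (cong fromℕℚ (ℕ.*-assoc 2 (2 ℕ.^ i) X)) (fromℕℚ-* 2 Z)))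
        (trans (e₂ (fromℕℚ Z) z) (trans (cong₂ (λ a b → 2ℚ * 2ℚ * a * b) (recip-inverse (>⇒≢ (0<fromℕℚ 0<Z))) z≡) (e₃ h x)))

  beyond≤ : ∀ X Y → 0 ℕ.< X → beyond X Y ≤ fromℕℚ 8 * recip (fromℕℚ X)
  beyond≤ X Y 0<X = begin
    beyond X Y ≤⟨ ∑-⊆ (Unique.filter⁺ (λ α → X ℕ.<? norm α) (representatives-unique Y))
                                                      (λ α∈ → let α∈′ , X<N = ∈-filter⁻ (λ α → X ℕ.<? norm α) {xs = representatives Y} α∈
                                                                  q , N≤ = ∈-representatives⁻ Y α∈′
                                                              in ∈-filter⁺ (λ α → X ℕ.<? norm α) (∈-representatives⁺ Z q (ℕ.≤-trans N≤ Y≤Z)) X<N)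
                                                      (λ {α} _ → 0≤inverseSquare α) ⟩
    beyond X Z ≤⟨ p≤p+q (0≤* (0≤* (0≤fromℕℚ 8) (0≤recip (0≤fromℕℚ X))) (0≤^ {½} Y (ℚ.<⇒≤ 0<½))) ⟩
    beyond X Z + fromℕℚ 8 * recip (fromℕℚ X) * ½ ^ Y ≤⟨ beyond-dyadic X 0<X Y ⟩
    fromℕℚ 8 * recip (fromℕℚ X) ∎
    where
    Z = 2 ℕ.^ Y ℕ.* X
    Y≤Z : Y ℕ.≤ Z
    Y≤Z = ℕ.≤-trans (ℕ.<⇒≤ (n<2^n Y)) (ℕ.m≤m*n (2 ℕ.^ Y) X ⦃ ℕ.>-nonZero 0<X ⦄)

  primes-split : ∀ {r T} → r ℕ.≤ T → primes T ↭ primes r ++ filter (λ p → r ℕ.<? norm p) (primes T)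
  primes-split {r} {T} r≤T = unique-set⇒↭ (primes-unique T)
    (Unique.++⁺ (primes-unique r) (Unique.filter⁺ (λ p → r ℕ.<? norm p) (primes-unique T))
      λ (p∈ , p∈′) → ℕ.<⇒≱ (proj₂ (∈-filter⁻ (λ p → r ℕ.<? norm p) {xs = primes T} p∈′)) (proj₂ (proj₂ (∈-primes⁻ r p∈))))
    to from
    where
    to : ∀ {p} → p ∈ primes T → p ∈ primes r ++ filter (λ p → r ℕ.<? norm p) (primes T)
    to {p} p∈ = [ (λ N≤r → ∈-++⁺ˡ (let P , q , _ = ∈-primes⁻ T p∈ in ∈-primes⁺ r P q N≤r))
                , (λ r<N → ∈-++⁺ʳ (primes r) (∈-filter⁺ (λ p → r ℕ.<? norm p) p∈ r<N)) ]′ (ℕ.≤-<-connex (norm p) r)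
    from : ∀ {p} → p ∈ primes r ++ filter (λ p → r ℕ.<? norm p) (primes T) → p ∈ primes T
    from p∈ = [ (λ p∈′ → let P , q , N≤ = ∈-primes⁻ r p∈′ in ∈-primes⁺ T P q (ℕ.≤-trans N≤ r≤T))
              , (λ p∈′ → proj₁ (∈-filter⁻ (λ p → r ℕ.<? norm p) {xs = primes T} p∈′)) ]′ (∈-++⁻ (primes r) p∈)

open EulerProduct

-- Convergence of the Euler factors and of their product.

module EulerConvergence where

  open ℚ-Operations using (_+_; _*_; _-_; -_; _≤_; _<_; ∣_∣)
  open ℚ.≤-Reasoning

  -- A geometric majorant, multiplied by 1 - q instead of dividing; for q > 1 the left side is not
  -- positive.
  ∑ⁿ-tail : ∀ f {c q} → 0ℚ ≤ c → 0ℚ ≤ q → (∀ j → ∣ f j ∣ ≤ c * q ^ j) → ∀ {m n} → m ℕ.≤ n →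
    (1ℚ - q) * ∣ ∑ⁿ n f - ∑ⁿ m f ∣ ≤ c * q ^ m
  ∑ⁿ-tail f {c} {q} 0≤c 0≤q le {m} {n} m≤n with q ℚ.≤? 1ℚ
  ... | no q≰1 = ℚ.≤-trans (subst (_≤ 0ℚ) (ℚ.*-comm ∣ ∑ⁿ n f - ∑ⁿ m f ∣ (1ℚ - q)) (subst (∣ ∑ⁿ n f - ∑ⁿ m f ∣ * (1ℚ - q) ≤_)
          (ℚ.*-zeroʳ ∣ ∑ⁿ n f - ∑ⁿ m f ∣) (*-monoˡ-≤ (ℚ.0≤∣p∣ (∑ⁿ n f - ∑ⁿ m f)) 1-q≤0))) (0≤* 0≤c (0≤^ m 0≤q))
    where
    1-q≤0 : 1ℚ - q ≤ 0ℚ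
    1-q≤0 = subst (1ℚ - q ≤_) (ℚ.+-inverseʳ q) (ℚ.+-monoˡ-≤ (- q) (ℚ.<⇒≤ (ℚ.≰⇒> q≰1)))
  ... | yes q≤1 = begin
    (1ℚ - q) * ∣ ∑ⁿ n f - ∑ⁿ m f ∣
      ≡⟨ cong (λ l → (1ℚ - q) * ∣ ∑ⁿ l f - ∑ⁿ m f ∣) (sym (ℕ.m∸n+n≡m m≤n)) ⟩
    (1ℚ - q) * ∣ ∑ⁿ (k ℕ.+ m) f - ∑ⁿ m f ∣
      ≡⟨ cong (λ z → (1ℚ - q) * ∣ z ∣) (trans (cong (_- ∑ⁿ m f) (∑ⁿ-split m k f)) (e₁ (∑ⁿ m f) (∑ⁿ k (λ i → f (i ℕ.+ m))))) ⟩
    (1ℚ - q) * ∣ ∑ⁿ k (λ i → f (i ℕ.+ m)) ∣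
      ≤⟨ *-monoˡ-≤ (p≤q⇒0≤q-p q≤1) (ℚ.≤-trans (∣∑ⁿ∣ k (λ i → f (i ℕ.+ m))) (∑ⁿ-≤ k λ i _ → ℚ.≤-trans (le (i ℕ.+ m)) (ℚ.≤-reflexive (regroup i)))) ⟩
    (1ℚ - q) * ∑ⁿ k (λ i → c * q ^ m * q ^ i)
      ≡⟨ cong ((1ℚ - q) *_) (∑ⁿ-* k (c * q ^ m) (q ^_)) ⟩
    (1ℚ - q) * (c * q ^ m * ∑ⁿ k (q ^_))
      ≡⟨ e₂ (1ℚ - q) (c * q ^ m) (∑ⁿ k (q ^_)) ⟩
    c * q ^ m * ((1ℚ - q) * ∑ⁿ k (q ^_))
      ≡⟨ cong (c * q ^ m *_) (geometric-sum k q) ⟩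
    c * q ^ m * (1ℚ - q ^ k)
      ≤⟨ *-monoˡ-≤ (0≤* 0≤c (0≤^ m 0≤q)) (≤-by (q ^ k) (e₃ (q ^ k)) (0≤^ k 0≤q)) ⟩
    c * q ^ m * 1ℚ
      ≡⟨ ℚ.*-identityʳ (c * q ^ m) ⟩
    c * q ^ m ∎
    where
    k = n ℕ.∸ m
    e₁ = solve-ℚ 2 (λ a b → a ⊕ b ⊕ ⊝ a , b) refl
    e₂ = solve-ℚ 3 (λ a b c → a ⊗ (b ⊗ c) , b ⊗ (a ⊗ c)) refl
    e₃ = solve-ℚ 1 (λ a → Κ 1ℚ , Κ 1ℚ ⊕ ⊝ a ⊕ a) refl
    e₄ = solve-ℚ 3 (λ a b c → a ⊗ (b ⊗ c) , a ⊗ c ⊗ b) refl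
    regroup : ∀ i → c * q ^ (i ℕ.+ m) ≡ c * q ^ m * q ^ i
    regroup i = trans (cong (c *_) (^-homo-* q i m)) (e₄ c (q ^ i) (q ^ m))

  small-multiple : ∀ {c ε} → 0ℚ ≤ c → 0ℚ < ε → ∃ λ N → 0 ℕ.< N × c ≤ fromℕℚ N * ε
  small-multiple {c} {ε} 0≤c 0<ε = suc (proj₁ a) , s≤s z≤n , (begin
    c ≡⟨ ℚ.*-identityʳ c ⟨
    c * 1ℚ ≡⟨ cong (c *_) (trans (ℚ.*-comm (recip ε) ε) (recip-inverse (>⇒≢ 0<ε))) ⟨
    c * (recip ε * ε) ≡⟨ ℚ.*-assoc c (recip ε) ε ⟨
    c * recip ε * ε ≤⟨ *-monoʳ-≤ (ℚ.<⇒≤ 0<ε) (ℚ.≤-trans (proj₂ a) (fromℕℚ-mono (ℕ.n≤1+n (proj₁ a)))) ⟩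
    fromℕℚ (suc (proj₁ a)) * ε ∎)
    where a = ceiling (c * recip ε) (0≤* 0≤c (ℚ.<⇒≤ (0<recip 0<ε)))

  module _ {g M} (G : Admissible g M) where

    open Admissible G

    private
      -- 5/8: the growth rate 5/4 of the coefficients against 1 / N(p) ≤ 1/2.
      q : ℚ
      q = ⁵/₄ * ½
      0≤q : 0ℚ ≤ q
      0≤q = ℚ.nonNegative⁻¹ q
      c : ℚ
      c = 2ℚ * C * (⁵/₄ * ⁵/₄)
      0≤c : 0ℚ ≤ c
      0≤c = 0≤* (0≤* (0≤fromℕℚ 2) 0≤C) (square≥0 ⁵/₄)
      -- 1 / (1 - q) = 8/3 is rounded up to 3.
      A : ℚ
      A = fromℕℚ 3 * c
      0≤A : 0ℚ ≤ A
      0≤A = 0≤* (0≤fromℕℚ 3) 0≤c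

    coefficient : ℤ[i] → ℕ → ℚ
    coefficient p j = Δ g (2 ℕ.+ j) * recip (fromℕℚ (norm p ℕ.^ (2 ℕ.+ j)))

    coefficient≤ : ∀ {p} → Prime p → ∀ j → ∣ coefficient p j ∣ ≤ c * inverseSquare p * q ^ j
    coefficient≤ {p} P j = begin
      ∣ Δ g (2 ℕ.+ j) * recip (fromℕℚ (N ℕ.^ (2 ℕ.+ j))) ∣
        ≡⟨ ℚ.∣p*q∣≡∣p∣*∣q∣ (Δ g (2 ℕ.+ j)) (recip (fromℕℚ (N ℕ.^ (2 ℕ.+ j)))) ⟩
      ∣ Δ g (2 ℕ.+ j) ∣ * ∣ recip (fromℕℚ (N ℕ.^ (2 ℕ.+ j))) ∣
        ≡⟨ cong (∣ Δ g (2 ℕ.+ j) ∣ *_) (trans (ℚ.0≤p⇒∣p∣≡p (0≤recip (0≤fromℕℚ (N ℕ.^ (2 ℕ.+ j)))))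
             (trans (cong recip (fromℕℚ-^ N (2 ℕ.+ j))) (recip-^ (2 ℕ.+ j) (0<fromℕℚ (ℕ.<⇒≤ (2≤norm-prime P)))))) ⟩
      ∣ Δ g (2 ℕ.+ j) ∣ * (x * (x * x ^ j))
        ≤⟨ *-mono-≤ (ℚ.0≤∣p∣ (Δ g (2 ℕ.+ j))) (0≤* 0≤x (0≤* 0≤x (0≤^ j (ℚ.<⇒≤ 0<½)))) (∣Δ∣≤ G j)
             (*-monoˡ-≤ 0≤x (*-monoˡ-≤ 0≤x (^-monoˡ-≤ j 0≤x (recip-antitone (0<fromℕℚ-suc 1) (fromℕℚ-mono (2≤norm-prime P)))))) ⟩
      2ℚ * C * (⁵/₄ * (⁵/₄ * ⁵/₄ ^ j)) * (x * (x * ½ ^ j))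
        ≡⟨ eq (2ℚ * C) ⁵/₄ (⁵/₄ ^ j) x (½ ^ j) ⟩
      2ℚ * C * (⁵/₄ * ⁵/₄) * (x * x) * (⁵/₄ ^ j * ½ ^ j)
        ≡⟨ cong (c * inverseSquare p *_) (^-distrib-* ⁵/₄ ½ j) ⟨
      c * inverseSquare p * q ^ j ∎
      where
      N = norm p
      x = recip (fromℕℚ N)
      0≤x : 0ℚ ≤ x
      0≤x = 0≤recip (0≤fromℕℚ N)
      eq = solve-ℚ 5 (λ k r a x b → k ⊗ (r ⊗ (r ⊗ a)) ⊗ (x ⊗ (x ⊗ b)) , k ⊗ (r ⊗ r) ⊗ (x ⊗ x) ⊗ (a ⊗ b)) refl

    factorᵀ≡ : ∀ T p → factorᵀ g T p ≡ 1ℚ + ∑ⁿ T (coefficient p)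
    factorᵀ≡ T p = trans (∑ⁿ-suc (suc T) f) (cong (λ z → 1ℚ + z) (trans (∑ⁿ-suc T (f ∘ suc))
      (trans (cong (_+ ∑ⁿ T (coefficient p)) (trans (cong (_* recip (fromℕℚ (norm p ℕ.^ 1))) (Δ-1 G)) (ℚ.*-zeroˡ (recip (fromℕℚ (norm p ℕ.^ 1))))))
        (ℚ.+-identityˡ (∑ⁿ T (coefficient p))))))
      where
      f : ℕ → ℚ
      f a = Δ g a * recip (fromℕℚ (norm p ℕ.^ a))

    private
      0≤ci : ∀ p → 0ℚ ≤ c * inverseSquare p
      0≤ci p = 0≤* 0≤c (0≤inverseSquare p)
      e₁ = solve-ℚ 2 (λ a b → Κ 1ℚ ⊕ a ⊕ ⊝ (Κ 1ℚ ⊕ b) , a ⊕ ⊝ b) refl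

    factorᵀ-tail : ∀ {p} → Prime p → ∀ {m n} → m ℕ.≤ n → (1ℚ - q) * ∣ factorᵀ g n p - factorᵀ g m p ∣ ≤ c * inverseSquare p * q ^ m
    factorᵀ-tail {p} P {m} {n} m≤n = subst (λ z → (1ℚ - q) * ∣ z ∣ ≤ c * inverseSquare p * q ^ m)
      (sym (trans (cong₂ _-_ (factorᵀ≡ n p) (factorᵀ≡ m p)) (e₁ (∑ⁿ n (coefficient p)) (∑ⁿ m (coefficient p)))))
      (∑ⁿ-tail (coefficient p) (0≤ci p) 0≤q (coefficient≤ P) m≤n)

    factorᵀ-close : ∀ T {p} → Prime p → ∣ factorᵀ g T p - 1ℚ ∣ ≤ A * inverseSquare p
    factorᵀ-close T {p} P = *-cancelˡ-≤ {1ℚ - q} (ℚ.positive⁻¹ (1ℚ - q)) (begin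
      (1ℚ - q) * ∣ factorᵀ g T p - 1ℚ ∣ ≡⟨ cong (λ z → (1ℚ - q) * ∣ z ∣) (cong₂ _-_ (factorᵀ≡ T p) (sym (ℚ.+-identityʳ 1ℚ))) ⟩
      (1ℚ - q) * ∣ 1ℚ + ∑ⁿ T (coefficient p) - (1ℚ + 0ℚ) ∣ ≡⟨ cong (λ z → (1ℚ - q) * ∣ z ∣) (e₁ (∑ⁿ T (coefficient p)) 0ℚ) ⟩
      (1ℚ - q) * ∣ ∑ⁿ T (coefficient p) - 0ℚ ∣ ≤⟨ ∑ⁿ-tail (coefficient p) (0≤ci p) 0≤q (coefficient≤ P) {0} {T} z≤n ⟩
      c * inverseSquare p * 1ℚ ≡⟨ e₂ c (inverseSquare p) ⟩
      1ℚ * (c * inverseSquare p) ≤⟨ *-monoʳ-≤ (0≤ci p) (ℚ.≤-trans (p≤p+q {1ℚ} {½ * ½ * ½} (ℚ.nonNegative⁻¹ (½ * ½ * ½))) ℚ.≤-refl) ⟩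
      (1ℚ - q) * fromℕℚ 3 * (c * inverseSquare p) ≡⟨ e₃ (1ℚ - q) (fromℕℚ 3) c (inverseSquare p) ⟩
      (1ℚ - q) * (A * inverseSquare p) ∎)
      where
      e₂ = solve-ℚ 2 (λ c i → c ⊗ i ⊗ Κ 1ℚ , Κ 1ℚ ⊗ (c ⊗ i)) refl
      e₃ = solve-ℚ 4 (λ a b c i → a ⊗ b ⊗ (c ⊗ i) , a ⊗ (b ⊗ c ⊗ i)) refl

    factorᵀ-cauchy : ∀ {p} → Prime p → Cauchy (λ T → factorᵀ g T p)
    factorᵀ-cauchy {p} P ε 0<ε = N , near
      where
      r : ℚ
      r = 1ℚ - q
      0<r : 0ℚ < r
      0<r = ℚ.positive⁻¹ r
      -- With q = 1 / (1 + d), Bernoulli's inequality bounds q^N by 1 / (N d).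
      d : ℚ
      d = recip q - 1ℚ
      0<d : 0ℚ < d
      0<d = ℚ.positive⁻¹ d
      K = c * inverseSquare p
      sm = small-multiple {K} {r * ε * d} (0≤ci p) (0<* (0<* 0<r 0<ε) 0<d)
      N = proj₁ sm
      decay : K * q ^ N ≤ r * ε
      decay = begin
        K * q ^ N ≡⟨ cong (K *_) (sym (recip-^ {1ℚ + d} N (ℚ.positive⁻¹ (1ℚ + d)))) ⟩
        K * recip ((1ℚ + d) ^ N) ≤⟨ recip-*≤ (0<^ {1ℚ + d} N (ℚ.positive⁻¹ (1ℚ + d))) (begin
            K ≤⟨ proj₂ (proj₂ sm) ⟩
            fromℕℚ N * (r * ε * d) ≡⟨ eq (fromℕℚ N) (r * ε) d ⟩
            r * ε * (fromℕℚ N * d) ≤⟨ *-monoˡ-≤ (ℚ.<⇒≤ (0<* 0<r 0<ε)) (ℚ.≤-trans (q≤p+q 0≤1) (bernoulli N (ℚ.<⇒≤ 0<d))) ⟩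
            r * ε * (1ℚ + d) ^ N ∎) ⟩
        r * ε ∎
        where
        eq = solve-ℚ 3 (λ n e d → n ⊗ (e ⊗ d) , e ⊗ (n ⊗ d)) refl
      ordered : ∀ {m n} → N ℕ.≤ m → m ℕ.≤ n → ∣ factorᵀ g n p - factorᵀ g m p ∣ ≤ ε
      ordered {m} {n} N≤m m≤n = *-cancelˡ-≤ 0<r (begin
        r * ∣ factorᵀ g n p - factorᵀ g m p ∣ ≤⟨ factorᵀ-tail P m≤n ⟩
        K * q ^ m ≤⟨ *-monoˡ-≤ (0≤ci p) antitone ⟩
        K * q ^ N ≤⟨ decay ⟩
        r * ε ∎)
        where
        antitone : q ^ m ≤ q ^ N
        antitone = subst (_≤ q ^ N) (trans (sym (^-homo-* q (m ℕ.∸ N) N)) (cong (q ^_) (ℕ.m∸n+n≡m N≤m)))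
          (subst (q ^ (m ℕ.∸ N) * q ^ N ≤_) (ℚ.*-identityˡ (q ^ N))
            (*-monoʳ-≤ (0≤^ N 0≤q) (^≤1 {q} (m ℕ.∸ N) 0≤q (≤-by (1ℚ - q) refl (ℚ.<⇒≤ 0<r)))))
      near : ∀ m n → N ℕ.≤ m → N ℕ.≤ n → ∣ factorᵀ g m p - factorᵀ g n p ∣ ≤ ε
      near m n N≤m N≤n = [ (λ m≤n → subst (_≤ ε) (∣p-q∣≡∣q-p∣ (factorᵀ g n p) (factorᵀ g m p)) (ordered N≤m m≤n)) , ordered N≤n ]′
        (ℕ.≤-total m n)

    private
      excess : ℤ[i] → ℚ
      excess p = A * inverseSquare p
      0≤excess : ∀ p → 0ℚ ≤ excess p
      0≤excess p = 0≤* 0≤A (0≤inverseSquare p)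
      majorant : List ℤ[i] → ℚ
      majorant = ∏ᶠ (λ p → 1ℚ + excess p)
      rest : ℕ → ℕ → List ℤ[i]
      rest r T = filter (λ p → r ℕ.<? norm p) (primes T)

      rest-sum : ∀ r T → 0 ℕ.< r → ∑ excess (rest r T) ≤ A * (fromℕℚ 8 * recip (fromℕℚ r))
      rest-sum r T 0<r = ℚ.≤-trans (ℚ.≤-reflexive (∑-* A inverseSquare (rest r T))) (*-monoˡ-≤ 0≤A (ℚ.≤-trans
        (∑-⊆ (Unique.filter⁺ (λ p → r ℕ.<? norm p) (primes-unique T))
          (λ p∈ → let p∈′ , r<N = ∈-filter⁻ (λ p → r ℕ.<? norm p) {xs = primes T} p∈
                      _ , q , N≤ = ∈-primes⁻ T p∈′
                  in ∈-filter⁺ (λ p → r ℕ.<? norm p) (∈-representatives⁺ T q N≤) r<N) (λ {α} _ → 0≤inverseSquare α))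
        (beyond≤ r T 0<r)))

      majorant-split : ∀ {r T} → r ℕ.≤ T → majorant (primes T) ≡ majorant (primes r) * majorant (rest r T)
      majorant-split {r} {T} r≤T = trans (∏ᶠ-↭ (λ p → 1ℚ + excess p) (primes-split r≤T)) (∏ᶠ-++ (λ p → 1ℚ + excess p) (primes r) (rest r T))

    -- For a suitable r the excess over the primes with N(p) > r sums to at most 1/2, so that by
    -- `∏-∑` they contribute at most 2. Passing to the maximum of r and T covers small T, as all
    -- factors are at least 1.
    majorant-bounded : ∃ λ U → 1ℚ ≤ U × (∀ T → majorant (primes T) ≤ U)
    majorant-bounded = bound (small-multiple {A * fromℕℚ 8} (0≤* 0≤A (0≤fromℕℚ 8)) 0<½)
      where
      bound : (∃ λ r → 0 ℕ.< r × A * fromℕℚ 8 ≤ fromℕℚ r * ½) → ∃ λ U → 1ℚ ≤ U × (∀ T → majorant (primes T) ≤ U)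
      bound (r , 0<r , le) = majorant (primes r) * 2ℚ , 1≤* (1≤∏ (primes r) 0≤excess) (p≤p+q {1ℚ} 0≤1) , λ T → begin
        majorant (primes T) ≤⟨ ≤-scale (ℚ.≤-trans 0≤1 (1≤∏ (primes T) 0≤excess)) (1≤∏ (rest T (r ℕ.⊔ T)) 0≤excess) ℚ.≤-refl ⟩
        majorant (primes T) * majorant (rest T (r ℕ.⊔ T)) ≡⟨ majorant-split (ℕ.m≤n⊔m r T) ⟨
        majorant (primes (r ℕ.⊔ T)) ≡⟨ majorant-split (ℕ.m≤m⊔n r T) ⟩
        majorant (primes r) * majorant (rest r (r ℕ.⊔ T)) ≤⟨ *-monoˡ-≤ (ℚ.≤-trans 0≤1 (1≤∏ (primes r) 0≤excess)) (≤2 (r ℕ.⊔ T)) ⟩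
        majorant (primes r) * 2ℚ ∎
        where
        ≤½ : ∀ T → ∑ excess (rest r T) ≤ ½
        ≤½ T = ℚ.≤-trans (rest-sum r T 0<r) (subst (_≤ ½) (ℚ.*-assoc A (fromℕℚ 8) (recip (fromℕℚ r))) (recip-*≤ (0<fromℕℚ 0<r)
          (ℚ.≤-trans le (ℚ.≤-reflexive (ℚ.*-comm (fromℕℚ r) ½)))))
        ≤2 : ∀ T → majorant (rest r T) ≤ 2ℚ
        ≤2 T = *-cancelˡ-≤ 0<½ (begin
          ½ * majorant (rest r T) ≡⟨ ℚ.*-comm ½ (majorant (rest r T)) ⟩
          majorant (rest r T) * ½ ≤⟨ *-monoˡ-≤ (ℚ.≤-trans 0≤1 (1≤∏ (rest r T) 0≤excess)) (≤-by _ (eq (∑ excess (rest r T))) (p≤q⇒0≤q-p (≤½ T))) ⟩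
          majorant (rest r T) * (1ℚ - ∑ excess (rest r T)) ≤⟨ ∏-∑ (rest r T) 0≤excess ⟩
          ½ * 2ℚ ∎)
          where
          eq = solve-ℚ 1 (λ s → Κ 1ℚ ⊕ ⊝ s , Κ ½ ⊕ (Κ ½ ⊕ ⊝ s)) refl

    -- r limits the primes and T the terms of each factor. The bounds that follow are uniform in T,
    -- which permits passing to the diagonal.
    product : ℕ → ℕ → ℚ
    product r T = ∏ᶠ (factorᵀ g T) (primes r)

    private
      -- factorᵀ made close to 1 at every Gaussian integer, so that the product lemmas apply without side conditions.
      factor⁰ : ℕ → ℤ[i] → ℚ
      factor⁰ T p with prime? p
      ... | yes _ = factorᵀ g T p
      ... | no _ = 1ℚ

      factor⁰-prime : ∀ T {p} → Prime p → factor⁰ T p ≡ factorᵀ g T p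
      factor⁰-prime T {p} P with prime? p
      ... | yes _ = refl
      ... | no ¬P = ⊥-elim (¬P P)

      factor⁰-close : ∀ T p → ∣ factor⁰ T p - 1ℚ ∣ ≤ excess p
      factor⁰-close T p with prime? p
      ... | yes P = factorᵀ-close T P
      ... | no _ = 0≤excess p

      product⁰ : ∀ r T → product r T ≡ ∏ᶠ (factor⁰ T) (primes r)
      product⁰ r T = ∏-cong (primes r) λ p∈ → sym (factor⁰-prime T (proj₁ (∈-primes⁻ r p∈)))

    product-bounded : ∃ λ U → 1ℚ ≤ U × (∀ r T → ∣ product r T ∣ ≤ U) ×
      (∀ r n T → 0 ℕ.< r → r ℕ.≤ n → ∣ product n T - product r T ∣ ≤ U * recip (fromℕℚ r))
    product-bounded = bound majorant-bounded
      where
      bound : (∃ λ U → 1ℚ ≤ U × (∀ T → majorant (primes T) ≤ U)) → _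
      bound (U , 1≤U , maj≤) = V , 1≤V , bounded′ , close
        where
        0≤U = ℚ.≤-trans 0≤1 1≤U
        W = A * fromℕℚ 8
        0≤W = 0≤* 0≤A (0≤fromℕℚ 8)
        V = U + U * (U * W)
        1≤V : 1ℚ ≤ V
        1≤V = ℚ.≤-trans 1≤U (p≤p+q (0≤* 0≤U (0≤* 0≤U 0≤W)))
        boundedᵁ : ∀ r T → ∣ ∏ᶠ (factor⁰ T) (primes r) ∣ ≤ U
        boundedᵁ r T = ℚ.≤-trans (∣∏∣≤ (factor⁰-close T) (primes r)) (maj≤ r)
        bounded′ : ∀ r T → ∣ product r T ∣ ≤ V
        bounded′ r T = ℚ.≤-trans (subst (λ z → ∣ z ∣ ≤ U) (sym (product⁰ r T)) (boundedᵁ r T)) (p≤p+q (0≤* 0≤U (0≤* 0≤U 0≤W)))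
        close : ∀ r n T → 0 ℕ.< r → r ℕ.≤ n → ∣ product n T - product r T ∣ ≤ V * recip (fromℕℚ r)
        close r n T 0<r r≤n = begin
          ∣ product n T - product r T ∣
            ≡⟨ cong₂ (λ a b → ∣ a - b ∣) (trans (product⁰ n T) (trans (∏ᶠ-↭ (factor⁰ T) (primes-split r≤n)) (∏ᶠ-++ (factor⁰ T) (primes r) (rest r n)))) (product⁰ r T) ⟩
          ∣ X * Y - X ∣
            ≡⟨ trans (cong ∣_∣ (eq X Y)) (ℚ.∣p*q∣≡∣p∣*∣q∣ X (Y - 1ℚ)) ⟩
          ∣ X ∣ * ∣ Y - 1ℚ ∣
            ≤⟨ *-mono-≤ (ℚ.0≤∣p∣ X) (0≤* 0≤U 0≤s) (boundedᵁ r T) (ℚ.≤-trans (∣∏-1∣≤∑ (factor⁰-close T) (rest r n))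
                 (*-mono-≤ (ℚ.≤-trans 0≤1 (1≤∏ (rest r n) 0≤excess)) 0≤s majorant-rest (rest-sum r n 0<r))) ⟩
          U * (U * (A * (fromℕℚ 8 * recip (fromℕℚ r))))
            ≡⟨ eq′ U A (fromℕℚ 8) (recip (fromℕℚ r)) ⟩
          U * (U * W) * recip (fromℕℚ r)
            ≤⟨ *-monoʳ-≤ (0≤recip (0≤fromℕℚ r)) (q≤p+q 0≤U) ⟩
          V * recip (fromℕℚ r) ∎
          where
          X = ∏ᶠ (factor⁰ T) (primes r)
          Y = ∏ᶠ (factor⁰ T) (rest r n)
          0≤s : 0ℚ ≤ A * (fromℕℚ 8 * recip (fromℕℚ r))
          0≤s = 0≤* 0≤A (0≤* (0≤fromℕℚ 8) (0≤recip (0≤fromℕℚ r)))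
          majorant-rest : majorant (rest r n) ≤ U
          majorant-rest = ℚ.≤-trans (subst (majorant (rest r n) ≤_) (trans (ℚ.*-comm (majorant (rest r n)) (majorant (primes r))) (sym (majorant-split r≤n)))
            (≤-scale (ℚ.≤-trans 0≤1 (1≤∏ (rest r n) 0≤excess)) (1≤∏ (primes r) 0≤excess) ℚ.≤-refl)) (maj≤ n)
          eq = solve-ℚ 2 (λ x y → x ⊗ y ⊕ ⊝ x , x ⊗ (y ⊕ ⊝ (Κ 1ℚ))) refl
          eq′ = solve-ℚ 4 (λ u a e r → u ⊗ (u ⊗ (a ⊗ (e ⊗ r))) , u ⊗ (u ⊗ (a ⊗ e)) ⊗ r) refl

open EulerConvergence

-- The Euler product as a real number.

module EulerLimit where

  open ℚ-Operations using (_+_; _*_; _-_; -_; _≤_; _<_; ∣_∣)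
  open ℚ.≤-Reasoning

  seq-∑< : ∀ n a T → seq (∑< n a) T ≡ ∑ⁿ n (λ j → seq (a j) T)
  seq-∑< zero a T = refl
  seq-∑< (suc n) a T = cong (_+ seq (a n) T) (seq-∑< n a T)

  module _ {g M} (G : Admissible g M) where

    -- The representing sequence is `factorᵀ` itself, so that the T-th approximations are the very
    -- numbers in `error-bound`. Outside the primes the value is 0.
    factor : ∀ p → Dec (Prime p) → ℝ
    factor p (yes P) = mkℝ (λ T → factorᵀ g T p) (factorᵀ-cauchy G P)
    factor p (no _) = 0ℝ

    eulerFactor : ℤ[i] → ℝ
    eulerFactor p = factor p (prime? p)

    seq-factor : ∀ {p} T → Prime p → (d : Dec (Prime p)) → seq (factor p d) T ≡ factorᵀ g T p
    seq-factor T P (yes _) = refl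
    seq-factor T P (no ¬P) = ⊥-elim (¬P P)

    partial-factor : ∀ p n T → seq (1ℝ Defs.+ ∑< n (λ j → eulerTerm g p (2 ℕ.+ j))) T ≡ factorᵀ g n p
    partial-factor p n T = trans (cong (λ z → 1ℚ + z) (trans (seq-∑< n (λ j → eulerTerm g p (2 ℕ.+ j)) T)
      (∑ⁿ-cong n λ j _ → cong (_* recip (fromℕℚ (norm p ℕ.^ (2 ℕ.+ j)))) (fromℤ-⊖ (g (2 ℕ.+ j)) (g (1 ℕ.+ j))))))
      (sym (factorᵀ≡ G n p))

    factor-limit : ∀ p → Prime p → (λ n → 1ℝ Defs.+ ∑< n (λ j → eulerTerm g p (2 ℕ.+ j))) ⟶ eulerFactor p
    factor-limit p P ε 0<ε = N , λ n N≤n δ 0<δ → N , λ T N≤T → ℚ.≤-trans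
      (subst₂ (λ a b → ∣ a - b ∣ ≤ ε) (sym (partial-factor p n T)) (sym (seq-factor T P (prime? p))) (close n T N≤n N≤T))
      (p≤p+q (ℚ.<⇒≤ 0<δ))
      where
      N = proj₁ (factorᵀ-cauchy G P ε 0<ε)
      close = proj₂ (factorᵀ-cauchy G P ε 0<ε)

    seq-∏ : ∀ {ps} T → Primes ps → seq (∏ (map eulerFactor ps)) T ≡ ∏ᶠ (factorᵀ g T) ps
    seq-∏ T [] = refl
    seq-∏ T (_∷_ {x = p} P Ps) = cong₂ _*_ (seq-factor T P (prime? p)) (seq-∏ T Ps)

    -- The rate 1 / n is recorded besides the convergence: multiplied by the n of the main term it
    -- leaves a bounded error.
    EulerLimit : Set
    EulerLimit = ∃ λ (P : ℝ) → IsEulerProduct g P × ∃ λ U → 1ℚ ≤ U × (∀ T → ∣ seq P T ∣ ≤ U) ×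
      (∀ n T → 0 ℕ.< n → n ℕ.≤ T → ∣ seq P T - product G n T ∣ ≤ U * recip (fromℕℚ n))

    eulerLimit : EulerLimit
    eulerLimit = limit (product-bounded G)
      where
      limit : (∃ λ U → 1ℚ ≤ U × (∀ r T → ∣ product G r T ∣ ≤ U) ×
        (∀ r n T → 0 ℕ.< r → r ℕ.≤ n → ∣ product G n T - product G r T ∣ ≤ U * recip (fromℕℚ r))) → EulerLimit
      limit (U , 1≤U , bounded′ , close) =
        mkℝ (λ T → product G T T) diagonal , (eulerFactor , factor-limit , converges) , U , 1≤U , (λ T → bounded′ T T) , (λ n T → close n T T)
        where
        0≤U = ℚ.≤-trans 0≤1 1≤U

        tail≤ : ∀ {η} → 0ℚ < η → ∃ λ r → 0 ℕ.< r × (∀ n T → r ℕ.≤ n → ∣ product G n T - product G r T ∣ ≤ η)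
        tail≤ {η} 0<η = r , 0<r , λ n T r≤n → ℚ.≤-trans (close r n T 0<r r≤n)
          (recip-*≤ (0<fromℕℚ 0<r) (ℚ.≤-trans (proj₂ (proj₂ sm)) (ℚ.≤-reflexive (ℚ.*-comm (fromℕℚ r) η))))
          where
          sm = small-multiple {U} {η} 0≤U 0<η
          r = proj₁ sm
          0<r = proj₁ (proj₂ sm)

        diagonal : Cauchy (λ T → product G T T)
        diagonal ε 0<ε = r ℕ.⊔ N , near
          where
          η = ½ * (½ * ε)
          tl = tail≤ {η} (0<half (0<half 0<ε))
          r = proj₁ tl
          -- For fixed r this is a finite product of reals, hence Cauchy in T.
          fixed = cauchy (∏ (map eulerFactor (primes r))) (½ * ε) (0<half 0<ε)
          N = proj₁ fixed
          near : ∀ m n → r ℕ.⊔ N ℕ.≤ m → r ℕ.⊔ N ℕ.≤ n → ∣ product G m m - product G n n ∣ ≤ ε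
          near m n ≤m ≤n = begin
            ∣ product G m m - product G n n ∣
              ≤⟨ triangle (product G m m) (product G r m) (product G n n) ⟩
            ∣ product G m m - product G r m ∣ + ∣ product G r m - product G n n ∣
              ≤⟨ ℚ.+-mono-≤ (proj₂ (proj₂ tl) m m (ℕ.m⊔n≤o⇒m≤o r N ≤m)) (triangle (product G r m) (product G r n) (product G n n)) ⟩
            η + (∣ product G r m - product G r n ∣ + ∣ product G r n - product G n n ∣)
              ≤⟨ ℚ.+-monoʳ-≤ η (ℚ.+-mono-≤ middle (subst (_≤ η) (∣p-q∣≡∣q-p∣ (product G n n) (product G r n)) (proj₂ (proj₂ tl) n n (ℕ.m⊔n≤o⇒m≤o r N ≤n)))) ⟩
            η + (½ * ε + η)
              ≡⟨ eq ε ⟩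
            ε ∎
            where
            middle : ∣ product G r m - product G r n ∣ ≤ ½ * ε
            middle = subst₂ (λ a b → ∣ a - b ∣ ≤ ½ * ε) (seq-∏ m (primes-prime r)) (seq-∏ n (primes-prime r))
              (proj₂ fixed m n (ℕ.m⊔n≤o⇒n≤o r N ≤m) (ℕ.m⊔n≤o⇒n≤o r N ≤n))
            eq = solve-ℚ 1 (λ e → Κ ½ ⊗ (Κ ½ ⊗ e) ⊕ (Κ ½ ⊗ e ⊕ Κ ½ ⊗ (Κ ½ ⊗ e)) , e) refl

        converges : (λ n → ∏ (map eulerFactor (primes n))) ⟶ mkℝ (λ T → product G T T) diagonal
        converges ε 0<ε = r , λ n r≤n δ 0<δ → n , λ T n≤T → begin
          ∣ seq (∏ (map eulerFactor (primes n))) T - product G T T ∣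
            ≡⟨ cong (λ z → ∣ z - product G T T ∣) (seq-∏ T (primes-prime n)) ⟩
          ∣ product G n T - product G T T ∣
            ≤⟨ triangle (product G n T) (product G r T) (product G T T) ⟩
          ∣ product G n T - product G r T ∣ + ∣ product G r T - product G T T ∣
            ≤⟨ ℚ.+-mono-≤ (within n T r≤n) (subst (_≤ ½ * ε) (∣p-q∣≡∣q-p∣ (product G T T) (product G r T)) (within T T (ℕ.≤-trans r≤n n≤T))) ⟩
          ½ * ε + ½ * ε
            ≡⟨ half ε ⟩
          ε
            ≤⟨ p≤p+q (ℚ.<⇒≤ 0<δ) ⟩
          ε + δ ∎
          where
          tl = tail≤ {½ * ε} (0<half 0<ε)
          r = proj₁ tl
          within = proj₂ (proj₂ tl)

open EulerLimit

-- Lower bounds for partial sums of exp and artanh.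

module PowersOfReals where

  open ℚ-Operations using (_+_; _*_; _-_; -_; _≤_; _<_; ∣_∣)
  open ℚ.≤-Reasoning

  expTermℚ : ℚ → ℕ → ℚ
  expTermℚ a zero = 1ℚ
  expTermℚ a (suc i) = expTermℚ a i * (a * recip (fromℕℚ (suc i)))

  expℚ : ℕ → ℚ → ℚ
  expℚ n a = ∑ⁿ n (expTermℚ a)

  seq-exp : ∀ x T → seq (exp x) T ≡ expℚ T (seq x T)
  seq-exp x T = trans (seq-∑< T (expTerm x) T) (∑ⁿ-cong T λ i _ → term i)
    where
    term : ∀ i → seq (expTerm x i) T ≡ expTermℚ (seq x T) i
    term zero = refl
    term (suc i) = cong (_* (seq x T * recip (fromℕℚ (suc i)))) (term i)

  0≤expTermℚ : ∀ {a} i → 0ℚ ≤ a → 0ℚ ≤ expTermℚ a i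
  0≤expTermℚ zero 0≤a = 0≤1
  0≤expTermℚ (suc i) 0≤a = 0≤* (0≤expTermℚ i 0≤a) (0≤* 0≤a (0≤recip (0≤fromℕℚ (suc i))))

  expTermℚ-mono : ∀ {a b} i → 0ℚ ≤ a → a ≤ b → expTermℚ a i ≤ expTermℚ b i
  expTermℚ-mono zero 0≤a a≤b = ℚ.≤-refl
  expTermℚ-mono (suc i) 0≤a a≤b = *-mono-≤ (0≤expTermℚ i 0≤a) (0≤* (ℚ.≤-trans 0≤a a≤b) (0≤recip (0≤fromℕℚ (suc i))))
    (expTermℚ-mono i 0≤a a≤b) (*-monoʳ-≤ (0≤recip (0≤fromℕℚ (suc i))) a≤b)

  expℚ-mono : ∀ {m n a b} → m ℕ.≤ n → 0ℚ ≤ a → a ≤ b → expℚ m a ≤ expℚ n b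
  expℚ-mono {n = n} m≤n 0≤a a≤b = ℚ.≤-trans (∑ⁿ-mono (λ i → 0≤expTermℚ i 0≤a) m≤n) (∑ⁿ-≤ n λ i _ → expTermℚ-mono i 0≤a a≤b)

  -- The left side consists of the first two terms of the binomial expansion of (a + δ)^(i + 1) / (i
  -- + 1)!.
  expTermℚ-step : ∀ {a δ} → 0ℚ ≤ a → 0ℚ ≤ δ → ∀ i → expTermℚ a (suc i) + δ * expTermℚ a i ≤ expTermℚ (a + δ) (suc i)
  expTermℚ-step {a} {δ} 0≤a 0≤δ zero = ℚ.≤-reflexive (eq a δ)
    where
    eq = solve-ℚ 2 (λ a d → Κ 1ℚ ⊗ (a ⊗ Κ 1ℚ) ⊕ d ⊗ Κ 1ℚ , Κ 1ℚ ⊗ ((a ⊕ d) ⊗ Κ 1ℚ)) refl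
  expTermℚ-step {a} {δ} 0≤a 0≤δ (suc i) = begin
    t * (a * r) + δ * t ≡⟨ cong (λ z → t * (a * r) + δ * z) t≡ ⟩
    t * (a * r) + δ * ((t + u * a) * r) ≤⟨ ≤-by _ (eq t u a δ r) (0≤* (0≤* (square≥0 δ) (0≤expTermℚ i 0≤a)) 0≤r) ⟩
    (t + δ * u) * ((a + δ) * r) ≤⟨ *-monoʳ-≤ (0≤* (0≤+ 0≤a 0≤δ) 0≤r) (expTermℚ-step 0≤a 0≤δ i) ⟩
    expTermℚ (a + δ) (suc i) * ((a + δ) * r) ∎
    where
    t = expTermℚ a (suc i)
    u = expTermℚ a i
    r = recip (fromℕℚ (suc (suc i)))
    0≤r = 0≤recip (0≤fromℕℚ (suc (suc i)))
    -- (i + 2) a^(i+1) / (i+1)! = a^(i+1) / (i+1)! + a · a^i / i!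
    t≡ : t ≡ (t + u * a) * r
    t≡ = trans (sym (ℚ.*-identityʳ t)) (trans (cong (t *_) (sym (recip-inverse (>⇒≢ (0<fromℕℚ-suc (suc i))))))
      (trans (sym (ℚ.*-assoc t (fromℕℚ (suc (suc i))) r)) (cong (_* r) (trans (cong (t *_) (fromℕℚ-suc (suc i)))
        (trans (ℚ.*-distribˡ-+ t 1ℚ σ) (cong₂ _+_ (ℚ.*-identityʳ t) ua≡))))))
      where
      σ = fromℕℚ (suc i)
      e = solve-ℚ 4 (λ u a r s → u ⊗ (a ⊗ r) ⊗ s , u ⊗ a ⊗ (s ⊗ r)) refl
      ua≡ : t * σ ≡ u * a
      ua≡ = trans (e u a (recip σ) σ) (trans (cong (u * a *_) (recip-inverse (>⇒≢ (0<fromℕℚ-suc i)))) (ℚ.*-identityʳ (u * a)))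
    eq = solve-ℚ 5 (λ t u a d r → (t ⊕ d ⊗ u) ⊗ ((a ⊕ d) ⊗ r) , t ⊗ (a ⊗ r) ⊕ d ⊗ ((t ⊕ u ⊗ a) ⊗ r) ⊕ d ⊗ d ⊗ u ⊗ r) refl

  -- A truncated form of exp(a + δ) ≥ (1 + δ) exp(a), at the cost of one more term of the series.
  expℚ-step : ∀ {a δ} n → 0ℚ ≤ a → 0ℚ ≤ δ → (1ℚ + δ) * expℚ n a ≤ expℚ (suc n) (a + δ)
  expℚ-step {a} {δ} n 0≤a 0≤δ = begin
    (1ℚ + δ) * expℚ n a ≡⟨ e₁ δ (expℚ n a) ⟩
    expℚ n a + δ * expℚ n a ≤⟨ ℚ.+-monoˡ-≤ (δ * expℚ n a) (p≤p+q {expℚ n a} (0≤expTermℚ n 0≤a)) ⟩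
    expℚ (suc n) a + δ * expℚ n a ≡⟨ cong (_+ δ * expℚ n a) (∑ⁿ-suc n (expTermℚ a)) ⟩
    1ℚ + ∑ⁿ n (expTermℚ a ∘ suc) + δ * expℚ n a ≡⟨ ℚ.+-assoc 1ℚ (∑ⁿ n (expTermℚ a ∘ suc)) (δ * expℚ n a) ⟩
    1ℚ + (∑ⁿ n (expTermℚ a ∘ suc) + δ * expℚ n a) ≡⟨ cong (λ z → 1ℚ + (∑ⁿ n (expTermℚ a ∘ suc) + z)) (∑ⁿ-* n δ (expTermℚ a)) ⟨
    1ℚ + (∑ⁿ n (expTermℚ a ∘ suc) + ∑ⁿ n (λ i → δ * expTermℚ a i))
                                                                  ≡⟨ cong (λ z → 1ℚ + z) (∑ⁿ-+ n (expTermℚ a ∘ suc) (λ i → δ * expTermℚ a i)) ⟨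
    1ℚ + ∑ⁿ n (λ i → expTermℚ a (suc i) + δ * expTermℚ a i) ≤⟨ ℚ.+-monoʳ-≤ 1ℚ (∑ⁿ-≤ n λ i _ → expTermℚ-step 0≤a 0≤δ i) ⟩
    1ℚ + ∑ⁿ n (expTermℚ (a + δ) ∘ suc) ≡⟨ ∑ⁿ-suc n (expTermℚ (a + δ)) ⟨
    expℚ (suc n) (a + δ) ∎
    where
    e₁ = solve-ℚ 2 (λ d e → (Κ 1ℚ ⊕ d) ⊗ e , e ⊕ d ⊗ e) refl

  expℚ-steps : ∀ {a δ} k n → 0ℚ ≤ a → 0ℚ ≤ δ → (1ℚ + δ) ^ k * expℚ n a ≤ expℚ (k ℕ.+ n) (a + fromℕℚ k * δ)
  expℚ-steps {a} {δ} zero n 0≤a 0≤δ = ℚ.≤-reflexive (trans (ℚ.*-identityˡ (expℚ n a)) (cong (expℚ n) (sym (trans (cong (a +_) (ℚ.*-zeroˡ δ)) (ℚ.+-identityʳ a)))))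
  expℚ-steps {a} {δ} (suc k) n 0≤a 0≤δ = begin
    (1ℚ + δ) * (1ℚ + δ) ^ k * expℚ n a ≡⟨ ℚ.*-assoc (1ℚ + δ) ((1ℚ + δ) ^ k) (expℚ n a) ⟩
    (1ℚ + δ) * ((1ℚ + δ) ^ k * expℚ n a) ≤⟨ *-monoˡ-≤ (0≤+ 0≤1 0≤δ) (expℚ-steps k n 0≤a 0≤δ) ⟩
    (1ℚ + δ) * expℚ (k ℕ.+ n) (a + fromℕℚ k * δ) ≤⟨ expℚ-step (k ℕ.+ n) (0≤+ 0≤a (0≤* (0≤fromℕℚ k) 0≤δ)) 0≤δ ⟩
    expℚ (suc k ℕ.+ n) (a + fromℕℚ k * δ + δ) ≡⟨ cong (expℚ (suc k ℕ.+ n)) (trans (eq a (fromℕℚ k) δ) (cong (λ z → a + z * δ) (sym (fromℕℚ-suc k)))) ⟩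
    expℚ (suc k ℕ.+ n) (a + fromℕℚ (suc k) * δ) ∎
    where
    eq = solve-ℚ 3 (λ a k d → a ⊕ k ⊗ d ⊕ d , a ⊕ (Κ 1ℚ ⊕ k) ⊗ d) refl

  -- A lower bound for the logarithm of i + 1, whose exponential is still of order i.
  harmonic : ℕ → ℚ
  harmonic i = ∑ⁿ i (λ l → recip (fromℕℚ (4 ℕ.+ l)))

  0≤harmonic : ∀ i → 0ℚ ≤ harmonic i
  0≤harmonic i = 0≤∑ⁿ i λ l → 0≤recip (0≤fromℕℚ (4 ℕ.+ l))

  -- (i + 4) / 4 is the telescoping product of 1 + 1 / (l + 4) over l < i.
  quarter : ℕ → ℚ
  quarter i = fromℕℚ (4 ℕ.+ i) * (½ * ½)

  -- For each l < i, k steps of length 1 / (l + 4) multiply the exponential by at least (1 + 1 / (l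
  -- + 4))^k and use k further terms of the series, whence k i + 1 terms.
  expℚ-harmonic : ∀ k i → quarter i ^ k ≤ expℚ (k ℕ.* i ℕ.+ 1) (fromℕℚ k * harmonic i)
  expℚ-harmonic k zero = ℚ.≤-reflexive (trans (1^ k) (cong (λ z → expℚ z (fromℕℚ k * 0ℚ)) (sym (cong (ℕ._+ 1) (ℕ.*-zeroʳ k)))))
  expℚ-harmonic k (suc i) = begin
    quarter (suc i) ^ k ≡⟨ cong (_^ k) step ⟩
    ((1ℚ + δ) * quarter i) ^ k ≡⟨ ^-distrib-* (1ℚ + δ) (quarter i) k ⟩
    (1ℚ + δ) ^ k * quarter i ^ k ≤⟨ *-monoˡ-≤ (0≤^ k (0≤+ 0≤1 0≤δ)) (expℚ-harmonic k i) ⟩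
    (1ℚ + δ) ^ k * expℚ (k ℕ.* i ℕ.+ 1) (fromℕℚ k * harmonic i) ≤⟨ expℚ-steps k (k ℕ.* i ℕ.+ 1) (0≤* (0≤fromℕℚ k) (0≤harmonic i)) 0≤δ ⟩
    expℚ (k ℕ.+ (k ℕ.* i ℕ.+ 1)) (fromℕℚ k * harmonic i + fromℕℚ k * δ) ≡⟨ cong₂ expℚ (trans (sym (ℕ.+-assoc k (k ℕ.* i) 1)) (cong (ℕ._+ 1) (sym (ℕ.*-suc k i))))
                                                                                    (sym (ℚ.*-distribˡ-+ (fromℕℚ k) (harmonic i) δ)) ⟩
    expℚ (k ℕ.* suc i ℕ.+ 1) (fromℕℚ k * harmonic (suc i)) ∎
    where
    ν = fromℕℚ (4 ℕ.+ i)
    δ = recip ν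
    0≤δ = 0≤recip (0≤fromℕℚ (4 ℕ.+ i))
    e₁ = solve-ℚ 2 (λ n d → (Κ 1ℚ ⊕ n) ⊗ (Κ ½ ⊗ Κ ½) , (n ⊕ Κ 1ℚ) ⊗ (Κ ½ ⊗ Κ ½)) refl
    e₂ = solve-ℚ 2 (λ n d → (n ⊕ n ⊗ d) ⊗ (Κ ½ ⊗ Κ ½) , (Κ 1ℚ ⊕ d) ⊗ (n ⊗ (Κ ½ ⊗ Κ ½))) refl
    step : quarter (suc i) ≡ (1ℚ + δ) * quarter i
    step = trans (cong (_* (½ * ½)) (fromℕℚ-suc (4 ℕ.+ i))) (trans (e₁ ν δ)
      (trans (cong (λ z → (ν + z) * (½ * ½)) (sym (recip-inverse (>⇒≢ (0<fromℕℚ-suc (3 ℕ.+ i)))))) (e₂ ν δ)))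

  -- Doubling i + 1 adds i + 1 terms, each at least 1 / (4 (i + 1)).
  harmonic-dyadic : ∀ e → ∃ λ i → suc i ≡ 2 ℕ.^ e × fromℕℚ e ≤ fromℕℚ 4 * harmonic i
  harmonic-dyadic zero = 0 , refl , ℚ.≤-refl
  harmonic-dyadic (suc e) with harmonic-dyadic e
  ... | i , 1+i≡ , le = suc i ℕ.+ i , trans (cong suc (ℕ.+-comm (suc i) i)) (trans (cong₂ ℕ._+_ 1+i≡ (trans 1+i≡ (sym (ℕ.+-identityʳ (2 ℕ.^ e))))) refl) , (begin
    fromℕℚ (suc e) ≡⟨ trans (fromℕℚ-suc e) (ℚ.+-comm 1ℚ (fromℕℚ e)) ⟩
    fromℕℚ e + 1ℚ ≤⟨ ℚ.+-mono-≤ le block ⟩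
    fromℕℚ 4 * harmonic i + fromℕℚ 4 * B ≡⟨ ℚ.*-distribˡ-+ (fromℕℚ 4) (harmonic i) B ⟨
    fromℕℚ 4 * (harmonic i + B) ≡⟨ cong (fromℕℚ 4 *_) (∑ⁿ-split i (suc i) (λ l → recip (fromℕℚ (4 ℕ.+ l)))) ⟨
    fromℕℚ 4 * harmonic (suc i ℕ.+ i) ∎)
    where
    B = ∑ⁿ (suc i) (λ l → recip (fromℕℚ (4 ℕ.+ (l ℕ.+ i))))
    w = recip (fromℕℚ (4 ℕ.* suc i))
    block : 1ℚ ≤ fromℕℚ 4 * B
    block = begin
      1ℚ ≡⟨ recip-inverse (>⇒≢ (0<fromℕℚ {4 ℕ.* suc i} (s≤s z≤n))) ⟨
      fromℕℚ (4 ℕ.* suc i) * w ≡⟨ trans (cong (_* w) (fromℕℚ-* 4 (suc i))) (ℚ.*-assoc (fromℕℚ 4) (fromℕℚ (suc i)) w) ⟩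
      fromℕℚ 4 * (fromℕℚ (suc i) * w) ≡⟨ cong (fromℕℚ 4 *_) (∑ⁿ-const (suc i) w) ⟨
      fromℕℚ 4 * ∑ⁿ (suc i) (λ _ → w) ≤⟨ *-monoˡ-≤ (0≤fromℕℚ 4) (∑ⁿ-≤ (suc i) λ l l≤i → recip-antitone (0<fromℕℚ {4 ℕ.+ (l ℕ.+ i)} (s≤s z≤n))
                                                    (fromℕℚ-mono (≤4[1+i] l (ℕ.s≤s⁻¹ l≤i)))) ⟩
      fromℕℚ 4 * B ∎
      where
      eq = solve-ℕ 1 (λ i → Κ 4 ⊕ (i ⊕ i) ⊕ (i ⊕ i) , Κ 4 ⊗ (Κ 1 ⊕ i)) refl
      ≤4[1+i] : ∀ l → l ℕ.≤ i → 4 ℕ.+ (l ℕ.+ i) ℕ.≤ 4 ℕ.* suc i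
      ≤4[1+i] l l≤i = ℕ.≤-trans (ℕ.+-monoʳ-≤ 4 (ℕ.+-monoˡ-≤ i l≤i)) (ℕ.≤-trans (ℕ.m≤m+n (4 ℕ.+ (i ℕ.+ i)) (i ℕ.+ i)) (ℕ.≤-reflexive (eq i)))

  artanhℚ : ℕ → ℚ → ℚ
  artanhℚ n z = ∑ⁿ n (λ l → z ^ suc (2 ℕ.* l) * recip (fromℕℚ (suc (2 ℕ.* l))))

  seq-artanh : ∀ z T → seq (∑< T (artanhTerm z)) T ≡ artanhℚ T (seq z T)
  seq-artanh z T = trans (seq-∑< T (artanhTerm z) T) (∑ⁿ-cong T λ l _ → cong (_* recip (fromℕℚ (suc (2 ℕ.* l))))
    (trans (odd l) (cong (seq z T *_) (even-power (seq z T) l))))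
    where
    eq = solve-ℚ 2 (λ z p → z ⊗ p ⊗ (z ⊗ z) , z ⊗ (z ⊗ z ⊗ p)) refl
    odd : ∀ l → seq (oddPower z l) T ≡ seq z T * (seq z T * seq z T) ^ l
    odd zero = sym (ℚ.*-identityʳ (seq z T))
    odd (suc l) = trans (cong (_* (seq z T * seq z T)) (odd l)) (eq (seq z T) ((seq z T * seq z T) ^ l))

  -- The truncated series has derivative Σ z^(2l), smallest at the left endpoint; term by term this
  -- is the lower half of `power-increment`.
  artanhℚ-increment : ∀ {z z′} n → 0ℚ ≤ z → z ≤ z′ → artanhℚ n z + (z′ - z) * ∑ⁿ n ((z * z) ^_) ≤ artanhℚ n z′
  artanhℚ-increment {z} {z′} n 0≤z z≤z′ = ℚ.≤-trans (ℚ.≤-reflexive (trans (cong (artanhℚ n z +_) (sym (∑ⁿ-* n (z′ - z) ((z * z) ^_))))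
      (sym (∑ⁿ-+ n (λ l → z ^ suc (2 ℕ.* l) * recip (fromℕℚ (suc (2 ℕ.* l)))) (λ l → (z′ - z) * (z * z) ^ l)))))
    (∑ⁿ-≤ n λ l _ → term l)
    where
    term : ∀ l → z ^ suc (2 ℕ.* l) * recip (fromℕℚ (suc (2 ℕ.* l))) + (z′ - z) * (z * z) ^ l ≤ z′ ^ suc (2 ℕ.* l) * recip (fromℕℚ (suc (2 ℕ.* l)))
    term l = begin
      a * r + (z′ - z) * (z * z) ^ l ≡⟨ cong (λ p → a * r + (z′ - z) * p) (even-power z l) ⟩
      a * r + (z′ - z) * p ≡⟨ cong (λ q → a * r + q) (trans (sym (ℚ.*-identityʳ ((z′ - z) * p))) (cong ((z′ - z) * p *_) (sym νr≡1))) ⟩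
      a * r + (z′ - z) * p * (ν * r) ≡⟨ eq a r (z′ - z) p ν ⟩
      (a + ν * p * (z′ - z)) * r ≤⟨ *-monoʳ-≤ (0≤recip (0≤fromℕℚ (suc (2 ℕ.* l)))) (ℚ.≤-trans (ℚ.+-monoʳ-≤ a (proj₁ (power-increment (2 ℕ.* l) 0≤z z≤z′)))
                                                  (ℚ.≤-reflexive (eq′ a (z′ ^ suc (2 ℕ.* l))))) ⟩
      z′ ^ suc (2 ℕ.* l) * r ∎
      where
      a = z ^ suc (2 ℕ.* l)
      p = z ^ (2 ℕ.* l)
      ν = fromℕℚ (suc (2 ℕ.* l))
      r = recip ν
      νr≡1 : ν * r ≡ 1ℚ
      νr≡1 = recip-inverse (>⇒≢ (0<fromℕℚ-suc (2 ℕ.* l)))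
      eq = solve-ℚ 5 (λ a r d p n → a ⊗ r ⊕ d ⊗ p ⊗ (n ⊗ r) , (a ⊕ n ⊗ p ⊗ d) ⊗ r) refl
      eq′ = solve-ℚ 2 (λ a b → a ⊕ (b ⊕ ⊝ a) , b) refl

  artanhℚ-mono : ∀ {z z′} n → 0ℚ ≤ z → z ≤ z′ → artanhℚ n z ≤ artanhℚ n z′
  artanhℚ-mono {z} {z′} n 0≤z z≤z′ = ℚ.≤-trans (p≤p+q (0≤* (p≤q⇒0≤q-p z≤z′) (0≤∑ⁿ n λ l → 0≤^ l (square≥0 z)))) (artanhℚ-increment n 0≤z z≤z′)

  decay-bernoulli : ∀ {u} n → 0ℚ ≤ u → u ≤ 1ℚ → u ^ n * (1ℚ + fromℕℚ n * (1ℚ - u)) ≤ 1ℚ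
  decay-bernoulli {u} zero 0≤u u≤1 = ℚ.≤-reflexive (trans (ℚ.*-identityˡ _) (trans (cong (λ z → 1ℚ + z) (ℚ.*-zeroˡ (1ℚ - u))) (ℚ.+-identityʳ 1ℚ)))
  decay-bernoulli {u} (suc n) 0≤u u≤1 = begin
    u * u ^ n * (1ℚ + fromℕℚ (suc n) * (1ℚ - u)) ≡⟨ cong (λ z → u * u ^ n * (1ℚ + z * (1ℚ - u))) (fromℕℚ-suc n) ⟩
    u * u ^ n * (1ℚ + (1ℚ + fromℕℚ n) * (1ℚ - u)) ≤⟨ ≤-by _ (eq u (u ^ n) (fromℕℚ n)) (0≤* (0≤^ n 0≤u) (0≤* (0≤+ 0≤1 (0≤fromℕℚ n)) (square≥0 (1ℚ - u)))) ⟩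
    u ^ n * (1ℚ + fromℕℚ n * (1ℚ - u)) ≤⟨ decay-bernoulli n 0≤u u≤1 ⟩
    1ℚ ∎
    where
    eq = solve-ℚ 3 (λ u p n → p ⊗ (Κ 1ℚ ⊕ n ⊗ (Κ 1ℚ ⊕ ⊝ u)) , u ⊗ p ⊗ (Κ 1ℚ ⊕ (Κ 1ℚ ⊕ n) ⊗ (Κ 1ℚ ⊕ ⊝ u)) ⊕ p ⊗ ((Κ 1ℚ ⊕ n) ⊗ ((Κ 1ℚ ⊕ ⊝ u) ⊗ (Κ 1ℚ ⊕ ⊝ u)))) refl

  -- The bound u^n ≤ 1 / (1 + n (1 - u)) of `decay-bernoulli` is inserted in the closed form of the
  -- sum.
  geometric-lower : ∀ {u} n → 0ℚ ≤ u → u < 1ℚ → fromℕℚ n ≤ (1ℚ + fromℕℚ n * (1ℚ - u)) * ∑ⁿ n (u ^_)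
  geometric-lower {u} n 0≤u u<1 = *-cancelˡ-≤ 0<g (begin
    g * ν ≤⟨ ≤-by _ (e₁ g ν (u ^ n)) (p≤q⇒0≤q-p (decay-bernoulli n 0≤u (ℚ.<⇒≤ u<1))) ⟩
    (1ℚ + ν * g) * (1ℚ - u ^ n) ≡⟨ cong ((1ℚ + ν * g) *_) (geometric-sum n u) ⟨
    (1ℚ + ν * g) * (g * ∑ⁿ n (u ^_)) ≡⟨ e₂ (1ℚ + ν * g) g (∑ⁿ n (u ^_)) ⟩
    g * ((1ℚ + ν * g) * ∑ⁿ n (u ^_)) ∎)
    where
    g = 1ℚ - u
    ν = fromℕℚ n
    0<g : 0ℚ < g
    0<g = subst (_< g) (ℚ.+-inverseʳ u) (ℚ.+-monoˡ-< (- u) u<1)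
    e₁ = solve-ℚ 3 (λ g n p → (Κ 1ℚ ⊕ n ⊗ g) ⊗ (Κ 1ℚ ⊕ ⊝ p) , g ⊗ n ⊕ (Κ 1ℚ ⊕ ⊝ (p ⊗ (Κ 1ℚ ⊕ n ⊗ g)))) refl
    e₂ = solve-ℚ 3 (λ a g s → a ⊗ (g ⊗ s) , g ⊗ (a ⊗ s)) refl

open PowersOfReals

-- Lower bounds for logarithms and powers of reals.

module LogarithmBounds where

  open ℚ-Operations using (_+_; _*_; _-_; -_; _≤_; _<_; ∣_∣)
  open ℚ.≤-Reasoning

  D : ℕ → ℕ
  D i = suc (suc i ℕ.* suc i)

  -- The Cayley transform of the square (i + 1)².
  ζ : ℕ → ℚ
  ζ i = 1ℚ - 2ℚ * recip (fromℕℚ (D i))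

  0<recipD : ∀ i → 0ℚ < recip (fromℕℚ (D i))
  0<recipD i = 0<recip (0<fromℕℚ-suc (suc i ℕ.* suc i))

  0≤ζ : ∀ i → 0ℚ ≤ ζ i
  0≤ζ i = p≤q⇒0≤q-p (subst (_≤ 1ℚ) refl (frac≤1 {2} {D i} (s≤s z≤n) (s≤s (s≤s z≤n))))

  ζ<1 : ∀ i → ζ i < 1ℚ
  ζ<1 i = subst (ζ i <_) (ℚ.+-identityʳ 1ℚ) (ℚ.+-monoʳ-< 1ℚ (ℚ.neg-antimono-< (0<* (0<fromℕℚ-suc 1) (0<recipD i))))

  D-mono : ∀ i → D i ℕ.≤ D (suc i)
  D-mono i = s≤s (ℕ.*-mono-≤ (ℕ.n≤1+n (suc i)) (ℕ.n≤1+n (suc i)))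

  -- As artanh(ζ i) is log(i + 1), a step should gain at least 1 / (i + 4). The tangent at ζ i
  -- yields (ζ (i + 1) - ζ i) / (1 - (ζ i)²), and after cross-multiplying this exceeds 1 / (i + 4)
  -- by the margin w P with P ≥ 1. For n as large as assumed, the margin also pays for cutting the
  -- series off after n terms.
  ζ-step : ∀ i n → D i ℕ.* D i ℕ.* D (suc i) ℕ.≤ n →
    1ℚ + fromℕℚ n * (1ℚ - ζ i * ζ i) ≤ fromℕℚ (4 ℕ.+ i) * (ζ (suc i) - ζ i) * fromℕℚ n
  ζ-step i n DDD′≤n = begin
    1ℚ + ν * (1ℚ - ζ i * ζ i) ≤⟨ ℚ.+-monoˡ-≤ (ν * (1ℚ - ζ i * ζ i)) 1≤ ⟩
    ν * (w * P) + ν * (1ℚ - ζ i * ζ i) ≡⟨ cong (λ z → ν * z + ν * (1ℚ - ζ i * ζ i)) gap≡ ⟨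
    ν * (κ * (ζ (suc i) - ζ i) - (1ℚ - ζ i * ζ i)) + ν * (1ℚ - ζ i * ζ i)
                                                                         ≡⟨ e₀ ν κ (ζ (suc i) - ζ i) (1ℚ - ζ i * ζ i) ⟩
    κ * (ζ (suc i) - ζ i) * ν ∎
    where
    ν = fromℕℚ n
    κ = fromℕℚ (4 ℕ.+ i)
    j = fromℕℚ (suc i)
    d d′ x y w P : ℚ
    d = 1ℚ + j * j
    d′ = 1ℚ + (1ℚ + j) * (1ℚ + j)
    x = recip (fromℕℚ (D i))
    y = recip (fromℕℚ (D (suc i)))
    w = x * x * y
    P = 1ℚ + (fromℕℚ 6 * (j * j * j) + fromℕℚ 2 * (j * j) + fromℕℚ 14 * j + fromℕℚ 5)
    D≡ : fromℕℚ (D i) ≡ d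
    D≡ = trans (fromℕℚ-suc (suc i ℕ.* suc i)) (cong (λ z → 1ℚ + z) (fromℕℚ-* (suc i) (suc i)))
    D′≡ : fromℕℚ (D (suc i)) ≡ d′
    D′≡ = trans (fromℕℚ-suc (suc (suc i) ℕ.* suc (suc i))) (cong (λ z → 1ℚ + z) (trans (fromℕℚ-* (suc (suc i)) (suc (suc i))) (cong (λ z → z * z) (fromℕℚ-suc (suc i)))))
    dx≡1 : d * x ≡ 1ℚ
    dx≡1 = trans (cong (_* x) (sym D≡)) (recip-inverse (>⇒≢ (0<fromℕℚ-suc (suc i ℕ.* suc i))))
    d′y≡1 : d′ * y ≡ 1ℚ
    d′y≡1 = trans (cong (_* y) (sym D′≡)) (recip-inverse (>⇒≢ (0<fromℕℚ-suc (suc (suc i) ℕ.* suc (suc i)))))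
    κ≡ : κ ≡ j + fromℕℚ 3
    κ≡ = trans (cong fromℕℚ (ℕ.+-comm 3 (suc i))) (fromℕℚ-+ (suc i) 3)
    x≡ : x ≡ w * (d * d′)
    x≡ = trans (e x) (trans (cong₂ (λ a b → x * a * b) (sym dx≡1) (sym d′y≡1)) (e′ x y d d′))
      where
      e = solve-ℚ 1 (λ x → x , x ⊗ Κ 1ℚ ⊗ Κ 1ℚ) refl
      e′ = solve-ℚ 4 (λ x y d f → x ⊗ (d ⊗ x) ⊗ (f ⊗ y) , x ⊗ x ⊗ y ⊗ (d ⊗ f)) refl
    y≡ : y ≡ w * (d * d)
    y≡ = trans (e y) (trans (cong₂ (λ a b → a * b * y) (sym dx≡1) (sym dx≡1)) (e′ x y d))
      where
      e = solve-ℚ 1 (λ y → y , Κ 1ℚ ⊗ Κ 1ℚ ⊗ y) refl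
      e′ = solve-ℚ 3 (λ x y d → d ⊗ x ⊗ (d ⊗ x) ⊗ y , x ⊗ x ⊗ y ⊗ (d ⊗ d)) refl
    xx≡ : x * x ≡ w * d′
    xx≡ = trans (sym (ℚ.*-identityʳ (x * x))) (trans (cong (x * x *_) (sym d′y≡1)) (e′ x y d′))
      where
      e′ = solve-ℚ 3 (λ x y f → x ⊗ x ⊗ (f ⊗ y) , x ⊗ x ⊗ y ⊗ f) refl
    gap≡ : κ * (ζ (suc i) - ζ i) - (1ℚ - ζ i * ζ i) ≡ w * P
    gap≡ = trans (cong (λ z → z * (ζ (suc i) - ζ i) - (1ℚ - ζ i * ζ i)) κ≡) (trans (e₁ j x y)
      (trans (cong₂ (λ a b → (j + fromℕℚ 3) * (2ℚ * (a - y)) - (fromℕℚ 4 * a - fromℕℚ 4 * b)) x≡ xx≡)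
        (trans (cong (λ b → (j + fromℕℚ 3) * (2ℚ * (w * (d * d′) - b)) - (fromℕℚ 4 * (w * (d * d′)) - fromℕℚ 4 * (w * d′))) y≡) (e₂ j w))))
      where
      e₁ = solve-ℚ 3 (λ j x y → (j ⊕ Κ (fromℕℚ 3)) ⊗ (Κ 1ℚ ⊕ ⊝ ((Κ 1ℚ ⊕ Κ 1ℚ) ⊗ y) ⊕ ⊝ (Κ 1ℚ ⊕ ⊝ ((Κ 1ℚ ⊕ Κ 1ℚ) ⊗ x))) ⊕ ⊝ (Κ 1ℚ ⊕ ⊝ ((Κ 1ℚ ⊕ ⊝ ((Κ 1ℚ ⊕ Κ 1ℚ) ⊗ x)) ⊗ (Κ 1ℚ ⊕ ⊝ ((Κ 1ℚ ⊕ Κ 1ℚ) ⊗ x)))) , (j ⊕ Κ (fromℕℚ 3)) ⊗ ((Κ 1ℚ ⊕ Κ 1ℚ) ⊗ (x ⊕ ⊝ y)) ⊕ ⊝ (Κ (fromℕℚ 4) ⊗ x ⊕ ⊝ (Κ (fromℕℚ 4) ⊗ (x ⊗ x)))) refl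
      e₂ = solve-ℚ 2 (λ j w → (j ⊕ Κ (fromℕℚ 3)) ⊗ ((Κ 1ℚ ⊕ Κ 1ℚ) ⊗ (w ⊗ ((Κ 1ℚ ⊕ j ⊗ j) ⊗ (Κ 1ℚ ⊕ (Κ 1ℚ ⊕ j) ⊗ (Κ 1ℚ ⊕ j))) ⊕ ⊝ (w ⊗ ((Κ 1ℚ ⊕ j ⊗ j) ⊗ (Κ 1ℚ ⊕ j ⊗ j))))) ⊕ ⊝ (Κ (fromℕℚ 4) ⊗ (w ⊗ ((Κ 1ℚ ⊕ j ⊗ j) ⊗ (Κ 1ℚ ⊕ (Κ 1ℚ ⊕ j) ⊗ (Κ 1ℚ ⊕ j)))) ⊕ ⊝ (Κ (fromℕℚ 4) ⊗ (w ⊗ (Κ 1ℚ ⊕ (Κ 1ℚ ⊕ j) ⊗ (Κ 1ℚ ⊕ j))))) , w ⊗ (Κ 1ℚ ⊕ (Κ (fromℕℚ 6) ⊗ (j ⊗ j ⊗ j) ⊕ Κ (fromℕℚ 2) ⊗ (j ⊗ j) ⊕ Κ (fromℕℚ 14) ⊗ j ⊕ Κ (fromℕℚ 5)))) refl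
    e₀ = solve-ℚ 4 (λ n k a b → n ⊗ (k ⊗ a ⊕ ⊝ b) ⊕ n ⊗ b , k ⊗ a ⊗ n) refl
    0≤j = 0≤fromℕℚ (suc i)
    0≤w : 0ℚ ≤ w
    0≤w = 0≤* (square≥0 x) (ℚ.<⇒≤ (0<recipD (suc i)))
    1≤ : 1ℚ ≤ ν * (w * P)
    1≤ = begin
      1ℚ ≡⟨ trans (cong₂ _*_ (cong₂ _*_ dx≡1 dx≡1) d′y≡1) refl ⟨
      d * x * (d * x) * (d′ * y) ≡⟨ e₃ d d′ x y ⟩
      d * d * d′ * w ≡⟨ cong (_* w) (sym (trans (fromℕℚ-* (D i ℕ.* D i) (D (suc i))) (cong₂ _*_ (trans (fromℕℚ-* (D i) (D i)) (cong₂ _*_ D≡ D≡)) D′≡))) ⟩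
      fromℕℚ (D i ℕ.* D i ℕ.* D (suc i)) * w
                                    ≤⟨ *-monoʳ-≤ 0≤w (fromℕℚ-mono DDD′≤n) ⟩
      ν * w ≤⟨ ≤-scale (0≤* (0≤fromℕℚ n) 0≤w) (p≤p+q {1ℚ} (0≤+ (0≤+ (0≤+ (0≤* (0≤fromℕℚ 6) (0≤* (0≤* 0≤j 0≤j) 0≤j))
                                         (0≤* (0≤fromℕℚ 2) (0≤* 0≤j 0≤j))) (0≤* (0≤fromℕℚ 14) 0≤j)) (0≤fromℕℚ 5))) ℚ.≤-refl ⟩
      ν * w * P ≡⟨ ℚ.*-assoc ν w P ⟩
      ν * (w * P) ∎
      where
      e₃ = solve-ℚ 4 (λ d f x y → d ⊗ x ⊗ (d ⊗ x) ⊗ (f ⊗ y) , d ⊗ d ⊗ f ⊗ (x ⊗ x ⊗ y)) refl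

  ζ-mono : ∀ i → ζ i ≤ ζ (suc i)
  ζ-mono i = ℚ.+-monoʳ-≤ 1ℚ (ℚ.neg-antimono-≤ (*-monoˡ-≤ {2ℚ} (0≤fromℕℚ 2)
    (recip-antitone (0<fromℕℚ-suc (suc i ℕ.* suc i)) (fromℕℚ-mono (D-mono i)))))

  artanhℚ-harmonic : ∀ i n → D i ℕ.* D i ℕ.* D i ℕ.≤ n → harmonic i ≤ artanhℚ n (ζ i)
  artanhℚ-harmonic zero n _ = 0≤∑ⁿ n λ l → 0≤* (0≤^ (suc (2 ℕ.* l)) (0≤ζ 0)) (0≤recip (0≤fromℕℚ (suc (2 ℕ.* l))))
  artanhℚ-harmonic (suc i) n D³≤n = ℚ.≤-trans (ℚ.+-mono-≤ (artanhℚ-harmonic i n (ℕ.≤-trans (ℕ.*-mono-≤ (ℕ.*-mono-≤ (D-mono i) (D-mono i)) (D-mono i)) D³≤n)) increment)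
    (artanhℚ-increment n (0≤ζ i) (ζ-mono i))
    where
    u = ζ i * ζ i
    0≤u = square≥0 (ζ i)
    u<1 : u < 1ℚ
    u<1 = ℚ.≤-<-trans (subst (u ≤_) (ℚ.*-identityʳ (ζ i)) (*-monoˡ-≤ (0≤ζ i) (ℚ.<⇒≤ (ζ<1 i)))) (ζ<1 i)
    ν = fromℕℚ n
    κ = fromℕℚ (4 ℕ.+ i)
    δ = ζ (suc i) - ζ i
    S = ∑ⁿ n (u ^_)
    b = 1ℚ + ν * (1ℚ - u)
    0<b : 0ℚ < b
    0<b = ℚ.+-mono-<-≤ 0<1 (0≤* (0≤fromℕℚ n) (p≤q⇒0≤q-p (ℚ.<⇒≤ u<1)))
    increment : recip κ ≤ δ * S
    increment = recip-≤ (0<fromℕℚ-suc (3 ℕ.+ i)) (*-cancelˡ-≤ 0<b (begin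
      b * 1ℚ ≡⟨ ℚ.*-identityʳ b ⟩
      b ≤⟨ ζ-step i n (ℕ.≤-trans (ℕ.*-monoˡ-≤ (D (suc i)) (ℕ.*-mono-≤ (D-mono i) (D-mono i))) D³≤n) ⟩
      κ * δ * ν ≤⟨ *-monoˡ-≤ (0≤* (0≤fromℕℚ (4 ℕ.+ i)) (p≤q⇒0≤q-p (ζ-mono i))) (geometric-lower n 0≤u u<1) ⟩
      κ * δ * (b * S) ≡⟨ eq κ δ b S ⟩
      b * (κ * (δ * S)) ∎))
      where
      eq = solve-ℚ 4 (λ k d b s → k ⊗ d ⊗ (b ⊗ s) , b ⊗ (k ⊗ (d ⊗ s))) refl

  ζ≤cayley : ∀ i X → fromℕℚ (suc i ℕ.* suc i) ≤ X → ζ i ≤ (X - 1ℚ) * recip (X + 1ℚ)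
  ζ≤cayley i X le = subst (ζ i ≤_) (sym cayley≡) (ℚ.+-monoʳ-≤ 1ℚ (ℚ.neg-antimono-≤ (*-monoˡ-≤ {2ℚ} (0≤fromℕℚ 2) (recip-antitone (0<fromℕℚ-suc (suc i ℕ.* suc i)) D≤))))
    where
    D≤ : fromℕℚ (D i) ≤ X + 1ℚ
    D≤ = subst (_≤ X + 1ℚ) (trans (ℚ.+-comm (fromℕℚ (suc i ℕ.* suc i)) 1ℚ) (sym (fromℕℚ-suc (suc i ℕ.* suc i)))) (ℚ.+-monoˡ-≤ 1ℚ le)
    0<X+1 = ℚ.<-≤-trans (0<fromℕℚ-suc (suc i ℕ.* suc i)) D≤
    e₁ = solve-ℚ 2 (λ X r → (X ⊕ ⊝ (Κ 1ℚ)) ⊗ r , (X ⊕ Κ 1ℚ) ⊗ r ⊕ ⊝ ((Κ 1ℚ ⊕ Κ 1ℚ) ⊗ r)) refl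
    cayley≡ : (X - 1ℚ) * recip (X + 1ℚ) ≡ 1ℚ - 2ℚ * recip (X + 1ℚ)
    cayley≡ = trans (e₁ X (recip (X + 1ℚ))) (cong (_- 2ℚ * recip (X + 1ℚ)) (recip-inverse (>⇒≢ 0<X+1)))

  log-lower : ∀ x 0<x i T → D i ℕ.* D i ℕ.* D i ℕ.≤ T → fromℕℚ (suc i ℕ.* suc i) ≤ seq x T → 2ℚ * harmonic i ≤ seq (log x 0<x) T
  log-lower x 0<x i T D³≤T le = *-monoˡ-≤ {2ℚ} (0≤fromℕℚ 2) (ℚ.≤-trans (artanhℚ-harmonic i T D³≤T)
    (ℚ.≤-trans (artanhℚ-mono T (0≤ζ i) (ζ≤cayley i (seq x T) le)) (ℚ.≤-reflexive (sym (seq-artanh (cayley x 0<x) T)))))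

  -- Bounds are taken at squares so that q = 1/2 corresponds to k = 1: the root of an x ≥ (i + 1)²
  -- is at least (i + 4) / 4. The conditions on T provide enough terms of the series for log and
  -- exp.
  power-lower : ∀ x 0<x q i k T → D i ℕ.* D i ℕ.* D i ℕ.≤ T → k ℕ.* i ℕ.+ 1 ℕ.≤ T → 0ℚ ≤ q → fromℕℚ k ≤ q * 2ℚ →
    fromℕℚ (suc i ℕ.* suc i) ≤ seq x T → quarter i ^ k ≤ seq (x ^⟨ 0<x ⟩ q) T
  power-lower x 0<x q i k T D³≤T ki≤T 0≤q k≤2q le = begin
    quarter i ^ k ≤⟨ expℚ-harmonic k i ⟩
    expℚ (k ℕ.* i ℕ.+ 1) (fromℕℚ k * harmonic i) ≤⟨ expℚ-mono ki≤T (0≤* (0≤fromℕℚ k) (0≤harmonic i)) (begin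
        fromℕℚ k * harmonic i ≤⟨ *-monoʳ-≤ (0≤harmonic i) k≤2q ⟩
        q * 2ℚ * harmonic i ≡⟨ ℚ.*-assoc q 2ℚ (harmonic i) ⟩
        q * (2ℚ * harmonic i) ≤⟨ *-monoˡ-≤ 0≤q (log-lower x 0<x i T D³≤T le) ⟩
        q * seq (log x 0<x) T ∎) ⟩
    expℚ T (q * seq (log x 0<x) T) ≡⟨ seq-exp (fromℚ q Defs.* log x 0<x) T ⟨
    seq (x ^⟨ 0<x ⟩ q) T ∎

open LogarithmBounds

-- The asymptotic formula for admissible g.

module Assembly where

  open ℚ-Operations using (_+_; _*_; _-_; -_; _≤_; _<_; ∣_∣)
  open ℝ-Lemmas using (eventually-×)
  open ℚ.≤-Reasoning

  floorLog : ∀ s → 0 ℕ.< s → ∃ λ e → 2 ℕ.^ e ℕ.≤ s × s ℕ.< 2 ℕ.^ suc e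
  floorLog (suc zero) _ = 0 , s≤s z≤n , s≤s (s≤s z≤n)
  floorLog (suc (suc s)) _ with floorLog (suc s) (s≤s z≤n)
  ... | e , lo , hi with 2 ℕ.^ suc e ℕ.≤? suc (suc s)
  ... | yes le = suc e , le , ℕ.≤-<-trans hi (ℕ.^-monoʳ-< 2 (s≤s (s≤s z≤n)) (ℕ.n<1+n (suc e)))
  ... | no ≰ = e , ℕ.m≤n⇒m≤1+n lo , ℕ.≰⇒> ≰

  1≤quarter : ∀ i → 1ℚ ≤ quarter i
  1≤quarter i = *-monoʳ-≤ {½ * ½} (square≥0 ½) (fromℕℚ-mono {4} {4 ℕ.+ i} (ℕ.m≤m+n 4 i))

  -- The scales attached to n: s = i + 1 is the integer square root of n - 1, e the binary logarithm of s
  -- and s′ = i′ + 1 the integer square root of e / 2.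
  record Scales (n : ℕ) : Set where
    field
      i i′ e : ℕ
      s²<n : suc i ℕ.* suc i ℕ.< n
      n≤ : n ℕ.≤ suc (suc i) ℕ.* suc (suc i)
      2^e≤s : 2 ℕ.^ e ℕ.≤ suc i
      s<2^1+e : suc i ℕ.< 2 ℕ.^ suc e
      2s′²≤e : suc i′ ℕ.* suc i′ ℕ.* 2 ℕ.≤ e
      e< : e ℕ.< suc (suc i′) ℕ.* suc (suc i′) ℕ.* 2

  -- From n - 1 ≥ 16 follow s ≥ 4, then e ≥ 2 and s′ ≥ 1; this is the origin of 17.
  scales : ∀ n → 17 ℕ.≤ n → Scales n
  scales (suc n′) (s≤s 16≤n′) with isqrt n′
  ... | zero , s²≤ , <s² = ⊥-elim (ℕ.<⇒≱ <s² (ℕ.≤-trans (s≤s z≤n) 16≤n′))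
  ... | suc i , s²≤ , <s² with floorLog (suc i) (s≤s z≤n)
  ... | e , lo , hi with isqrt (e ÷ 2) | isqrt-pos {e ÷ 2} 1≤u
    where
    4≤s : 4 ℕ.≤ suc i
    4≤s = ℕ.≮⇒≥ λ s<4 → ℕ.<⇒≱ <s² (ℕ.≤-trans (ℕ.*-mono-≤ s<4 s<4) 16≤n′)
    2≤e : 2 ℕ.≤ e
    2≤e = ℕ.≮⇒≥ λ e<2 → ℕ.<⇒≱ hi (ℕ.≤-trans (ℕ.^-monoʳ-≤ 2 e<2) 4≤s)
    1≤u : 1 ℕ.≤ e ÷ 2
    1≤u = ≤÷ (s≤s z≤n) 2≤e
  ... | zero , _ , _ | ()
  ... | suc i′ , t²≤u , u<t² | _ = record
    { i = i ; i′ = i′ ; e = e ; s²<n = s≤s s²≤ ; n≤ = <s² ; 2^e≤s = lo ; s<2^1+e = hi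
    ; 2s′²≤e = ℕ.≤-trans (ℕ.*-monoˡ-≤ 2 t²≤u) (÷≤ {2} {e} (s≤s z≤n))
    ; e< = ℕ.<-≤-trans (ℕ.≰⇒> λ le → ℕ.1+n≰n (≤÷ {suc (e ÷ 2)} {2} (s≤s z≤n) le)) (ℕ.*-monoˡ-≤ 2 u<t²)
    }

  module _ {g M} (G : Admissible g M) where

    private
      t : ℕ
      t = suc (suc M)

    module Estimate (U Kb : ℚ) (P : ℝ) (1≤U : 1ℚ ≤ U) (0≤Kb : 0ℚ ≤ Kb) (∣P∣≤ : ∀ T → ∣ seq P T ∣ ≤ U)
      (close : ∀ n T → 0 ℕ.< n → n ℕ.≤ T → ∣ seq P T - product G n T ∣ ≤ U * recip (fromℕℚ n))
      (∏blowup≤ : ∀ T n m → n ℕ.≤ 2 ℕ.^ m → ∏ᶠ (blowup g T) (primes n) ≤ Kb * fromℕℚ (suc m) ^ t) where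

      0≤U = ℚ.≤-trans 0≤1 1≤U

      main-error : ∀ n m r T → 0 ℕ.< n → n ℕ.≤ T → n ℕ.≤ r ℕ.* r → n ℕ.≤ 2 ℕ.^ m →
        ∣ fromℕℚ (∑′ n (multiplicative g)) - leibniz T * product G n T * fromℕℚ n ∣ ≤ fromℕℚ 14 * fromℕℚ r * (Kb * fromℕℚ (suc m) ^ t)
      main-error n m r T 0<n n≤T n≤r² n≤2^m = ℚ.≤-trans
        (subst₂ (λ a b → ∣ a - leibniz T * product G n T * b ∣ ≤ fromℕℚ 14 * fromℕℚ r * ∏ᶠ (blowup g T) (primes n))
          (trans (cong (summatory g (primes n)) (ℕ.n/1≡n n)) (sym (∑′-summatory g n)))
          (ℚ.*-identityʳ (fromℕℚ n))
          (error-bound g T (primes-prime n) (primes-independent n) {n} {1} {fromℕℚ r} (ℕ.≤-trans 0<n n≤T) n≤T (s≤s z≤n) (0≤fromℕℚ r)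
            (ℚ.≤-trans (fromℕℚ-mono n≤r²) (ℚ.≤-reflexive (trans (fromℕℚ-* r r) (sym (ℚ.*-identityʳ (fromℕℚ r * fromℕℚ r))))))))
        (*-monoˡ-≤ (0≤* (0≤fromℕℚ 14) (0≤fromℕℚ r)) (∏blowup≤ T n m n≤2^m))

      -- Two replacements, each at the cost 8 U: the finite product by P, where the rate U / n meets
      -- the factor n, and n by ξ, which differs from it by at most 1.
      constant-error : ∀ n T ξ → 0 ℕ.< n → n ℕ.≤ T → fromℕℚ n ≤ ξ + 1ℚ → ξ ≤ fromℕℚ n + 1ℚ →
        ∣ leibniz T * product G n T * fromℕℚ n - leibniz T * seq P T * ξ ∣ ≤ fromℕℚ 16 * U
      constant-error n T ξ 0<n n≤T ν≤ξ+1 ξ≤ν+1 = begin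
        ∣ l * p * ν - l * p∞ * ξ ∣ ≤⟨ triangle (l * p * ν) (l * p∞ * ν) (l * p∞ * ξ) ⟩
        ∣ l * p * ν - l * p∞ * ν ∣ + ∣ l * p∞ * ν - l * p∞ * ξ ∣
          ≡⟨ cong₂ _+_ (trans (cong ∣_∣ (e₁ l p p∞ ν)) (trans (ℚ.∣p*q∣≡∣p∣*∣q∣ l ((p - p∞) * ν)) (cong (∣ l ∣ *_) (trans (ℚ.∣p*q∣≡∣p∣*∣q∣ (p - p∞) ν)
               (cong₂ _*_ (∣p-q∣≡∣q-p∣ p p∞) (ℚ.0≤p⇒∣p∣≡p (0≤fromℕℚ n)))))))
               (trans (cong ∣_∣ (e₂ l p∞ ν ξ)) (trans (ℚ.∣p*q∣≡∣p∣*∣q∣ l (p∞ * (ν - ξ))) (cong (∣ l ∣ *_) (ℚ.∣p*q∣≡∣p∣*∣q∣ p∞ (ν - ξ))))) ⟩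
        ∣ l ∣ * (∣ p∞ - p ∣ * ν) + ∣ l ∣ * (∣ p∞ ∣ * ∣ ν - ξ ∣)
          ≤⟨ ℚ.+-mono-≤ (*-mono-≤ (ℚ.0≤∣p∣ l) 0≤U l≤8 first) (*-mono-≤ (ℚ.0≤∣p∣ l) 0≤U l≤8 second) ⟩
        fromℕℚ 8 * U + fromℕℚ 8 * U ≡⟨ ℚ.*-distribʳ-+ U (fromℕℚ 8) (fromℕℚ 8) ⟨
        fromℕℚ 16 * U ∎
        where
        l = leibniz T
        p = product G n T
        p∞ = seq P T
        ν = fromℕℚ n
        l≤8 = ∣leibniz∣≤ g T (ℕ.≤-trans 0<n n≤T)
        e₁ = solve-ℚ 4 (λ l p q n → l ⊗ p ⊗ n ⊕ ⊝ (l ⊗ q ⊗ n) , l ⊗ ((p ⊕ ⊝ q) ⊗ n)) refl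
        e₂ = solve-ℚ 4 (λ l q n x → l ⊗ q ⊗ n ⊕ ⊝ (l ⊗ q ⊗ x) , l ⊗ (q ⊗ (n ⊕ ⊝ x))) refl
        e₃ = solve-ℚ 3 (λ u r n → u ⊗ r ⊗ n , u ⊗ (n ⊗ r)) refl
        e₄ = solve-ℚ 1 (λ a → a ⊕ Κ 1ℚ ⊕ ⊝ a , Κ 1ℚ) refl
        first : ∣ p∞ - p ∣ * ν ≤ U
        first = ℚ.≤-trans (*-monoʳ-≤ (0≤fromℕℚ n) (close n T 0<n n≤T)) (ℚ.≤-reflexive (trans (e₃ U (recip ν) ν)
          (trans (cong (U *_) (recip-inverse (>⇒≢ (0<fromℕℚ 0<n)))) (ℚ.*-identityʳ U))))
        ν-ξ≤1 : ∣ ν - ξ ∣ ≤ 1ℚ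
        ν-ξ≤1 = ∣p∣≤ (subst (ν - ξ ≤_) (e₄ ξ) (ℚ.+-monoˡ-≤ (- ξ) ν≤ξ+1))
          (subst₂ _≤_ (e₅ ξ ν) (e₄ ν) (ℚ.+-monoˡ-≤ (- ν) ξ≤ν+1))
          where
          e₅ = solve-ℚ 2 (λ x n → x ⊕ ⊝ n , ⊝ (n ⊕ ⊝ x)) refl
        second : ∣ p∞ ∣ * ∣ ν - ξ ∣ ≤ U
        second = ℚ.≤-trans (*-mono-≤ (ℚ.0≤∣p∣ p∞) 0≤1 (∣P∣≤ T) ν-ξ≤1) (ℚ.≤-reflexive (ℚ.*-identityʳ U))

      -- 56 is 14 times the 4 in r ≤ 4 X, and 128^t compares the binary logarithm m + 1 with log x.
      κ : ℚ
      κ = fromℕℚ 56 * Kb * fromℕℚ 128 ^ t + fromℕℚ 16 * U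

      module _ (c : ℚ) (0≤c : 0ℚ ≤ c) (2t≤2c : fromℕℚ (2 ℕ.* t) ≤ c * 2ℚ) where

        module _ (x : ℝ) (0<x : 0ℝ Defs.< x) (0<log : 0ℝ Defs.< log x 0<x) {n : ℕ} (S : Scales n) (T : ℕ) (n≤T : n ℕ.≤ T)
          (n≤x+1 : fromℕℚ n ≤ seq x T + 1ℚ) (x≤n+1 : seq x T ≤ fromℕℚ n + 1ℚ) where

          open Scales S

          private
            ξ X Y : ℚ
            ξ = seq x T
            X = seq (x ^⟨ 0<x ⟩ ½) T
            Y = seq (log x 0<x ^⟨ 0<log ⟩ c) T
            m : ℕ
            m = suc e ℕ.+ suc e
            iₑ = proj₁ (harmonic-dyadic e)

          estimate : D i ℕ.* D i ℕ.* D i ℕ.≤ T → 1 ℕ.* i ℕ.+ 1 ℕ.≤ T → D iₑ ℕ.* D iₑ ℕ.* D iₑ ℕ.≤ T →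
            D i′ ℕ.* D i′ ℕ.* D i′ ℕ.≤ T → 2 ℕ.* t ℕ.* i′ ℕ.+ 1 ℕ.≤ T →
            ∣ fromℕℚ (∑′ n (multiplicative g)) - leibniz T * seq P T * ξ ∣ ≤ κ * (X * Y)
          estimate T₁ T₂ T₃ T₄ T₅ = begin
            ∣ F - l * seq P T * ξ ∣
              ≤⟨ triangle F (l * product G n T * fromℕℚ n) (l * seq P T * ξ) ⟩
            ∣ F - l * product G n T * fromℕℚ n ∣ + ∣ l * product G n T * fromℕℚ n - l * seq P T * ξ ∣
              ≤⟨ ℚ.+-mono-≤ (main-error n m (suc (suc i)) T 0<n n≤T n≤ n≤2^m) (constant-error n T ξ 0<n n≤T n≤x+1 x≤n+1) ⟩
            fromℕℚ 14 * r * (Kb * fromℕℚ (suc m) ^ t) + fromℕℚ 16 * U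
              ≤⟨ ℚ.+-mono-≤ (*-mono-≤ (0≤* (0≤fromℕℚ 14) (0≤fromℕℚ (suc (suc i)))) (0≤* 0≤Kb (0≤* 0≤128^t 0≤Y)) (*-monoˡ-≤ (0≤fromℕℚ 14) r≤4X) (*-monoˡ-≤ 0≤Kb m^t≤))
                   (≤-scale (0≤* (0≤fromℕℚ 16) 0≤U) (1≤* 1≤X 1≤Y) ℚ.≤-refl) ⟩
            fromℕℚ 14 * (fromℕℚ 4 * X) * (Kb * (fromℕℚ 128 ^ t * Y)) + fromℕℚ 16 * U * (X * Y)
              ≡⟨ eq X Kb (fromℕℚ 128 ^ t) Y U ⟩
            κ * (X * Y) ∎
            where
            F = fromℕℚ (∑′ n (multiplicative g))
            l = leibniz T
            r = fromℕℚ (suc (suc i))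
            eq = solve-ℚ 5 (λ x k p y u → Κ (fromℕℚ 14) ⊗ (Κ (fromℕℚ 4) ⊗ x) ⊗ (k ⊗ (p ⊗ y)) ⊕ Κ (fromℕℚ 16) ⊗ u ⊗ (x ⊗ y) , (Κ (fromℕℚ 56) ⊗ k ⊗ p ⊕ Κ (fromℕℚ 16) ⊗ u) ⊗ (x ⊗ y)) refl
            0<n : 0 ℕ.< n
            0<n = ℕ.≤-trans (s≤s z≤n) s²<n
            -- Only ξ ≥ n - 1 is known; the strict inequality s² < n pays for the difference.
            s²≤ξ : fromℕℚ (suc i ℕ.* suc i) ≤ ξ
            s²≤ξ = subst₂ _≤_ (e₁ (fromℕℚ (suc i ℕ.* suc i))) (e₂ ξ) (ℚ.+-monoˡ-≤ (- 1ℚ)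
              (ℚ.≤-trans (ℚ.≤-reflexive (sym (fromℕℚ-suc (suc i ℕ.* suc i)))) (ℚ.≤-trans (fromℕℚ-mono s²<n) n≤x+1)))
              where
              e₁ = solve-ℚ 1 (λ a → Κ 1ℚ ⊕ a ⊕ ⊝ (Κ 1ℚ) , a) refl
              e₂ = solve-ℚ 1 (λ a → a ⊕ Κ 1ℚ ⊕ ⊝ (Κ 1ℚ) , a) refl
            X≥ : quarter i ≤ X
            X≥ = ℚ.≤-trans (ℚ.≤-reflexive (sym (ℚ.*-identityʳ (quarter i)))) (power-lower x 0<x ½ i 1 T T₁ T₂ (ℚ.<⇒≤ 0<½) ℚ.≤-refl s²≤ξ)
            1≤X = ℚ.≤-trans (1≤quarter i) X≥
            r≤4X : r ≤ fromℕℚ 4 * X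
            r≤4X = begin
              r ≤⟨ fromℕℚ-mono (ℕ.m≤n+m (suc (suc i)) 2) ⟩
              fromℕℚ (4 ℕ.+ i) ≡⟨ e₁ (fromℕℚ (4 ℕ.+ i)) ⟩
              fromℕℚ 4 * quarter i ≤⟨ *-monoˡ-≤ (0≤fromℕℚ 4) X≥ ⟩
              fromℕℚ 4 * X ∎
              where
              e₁ = solve-ℚ 1 (λ a → a , Κ (fromℕℚ 4) ⊗ (a ⊗ (Κ ½ ⊗ Κ ½))) refl
            n≤2^m : n ℕ.≤ 2 ℕ.^ m
            n≤2^m = ℕ.≤-trans n≤ (ℕ.≤-trans (ℕ.*-mono-≤ s<2^1+e s<2^1+e) (ℕ.≤-reflexive (sym (ℕ.^-distribˡ-+-* 2 (suc e) (suc e)))))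
            -- 2^e ≤ s makes log x at least 2 `harmonic iₑ` ≥ e / 2 ≥ s′². Being above a square, log
            -- x can in turn be fed to `power-lower`.
            log≥ : fromℕℚ (suc i′ ℕ.* suc i′) ≤ seq (log x 0<x) T
            log≥ = ℚ.≤-trans (*-cancelˡ-≤ {2ℚ} (0<fromℕℚ-suc 1) (begin
                2ℚ * fromℕℚ (suc i′ ℕ.* suc i′) ≡⟨ trans (ℚ.*-comm 2ℚ (fromℕℚ (suc i′ ℕ.* suc i′))) (sym (fromℕℚ-* (suc i′ ℕ.* suc i′) 2)) ⟩
                fromℕℚ (suc i′ ℕ.* suc i′ ℕ.* 2) ≤⟨ fromℕℚ-mono 2s′²≤e ⟩
                fromℕℚ e ≤⟨ proj₂ (proj₂ (harmonic-dyadic e)) ⟩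
                fromℕℚ 4 * harmonic iₑ ≡⟨ e₁ (harmonic iₑ) ⟩
                2ℚ * (2ℚ * harmonic iₑ) ∎))
              (log-lower x 0<x iₑ T T₃ (ℚ.≤-trans (fromℕℚ-mono (ℕ.*-mono-≤ 1+iₑ≤ 1+iₑ≤)) s²≤ξ))
              where
              e₁ = solve-ℚ 1 (λ h → Κ (fromℕℚ 4) ⊗ h , (Κ 1ℚ ⊕ Κ 1ℚ) ⊗ ((Κ 1ℚ ⊕ Κ 1ℚ) ⊗ h)) refl
              1+iₑ≤ : suc iₑ ℕ.≤ suc i
              1+iₑ≤ = subst (ℕ._≤ suc i) (sym (proj₁ (proj₂ (harmonic-dyadic e)))) 2^e≤s
            Y≥ : quarter i′ ^ (2 ℕ.* t) ≤ Y
            Y≥ = power-lower (log x 0<x) 0<log c i′ (2 ℕ.* t) T T₄ T₅ 0≤c 2t≤2c log≥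
            1≤Y = ℚ.≤-trans (1≤^ (2 ℕ.* t) (1≤quarter i′)) Y≥
            0≤Y = ℚ.≤-trans 0≤1 1≤Y
            0≤128^t : 0ℚ ≤ fromℕℚ 128 ^ t
            0≤128^t = 0≤^ t (0≤fromℕℚ 128)
            m^t≤ : fromℕℚ (suc m) ^ t ≤ fromℕℚ 128 ^ t * Y
            m^t≤ = begin
              fromℕℚ (suc m) ^ t ≤⟨ ^-monoˡ-≤ t (0≤fromℕℚ (suc m)) m≤ ⟩
              (fromℕℚ 128 * (quarter i′ * quarter i′)) ^ t ≡⟨ ^-distrib-* (fromℕℚ 128) (quarter i′ * quarter i′) t ⟩
              fromℕℚ 128 ^ t * (quarter i′ * quarter i′) ^ t ≡⟨ cong (fromℕℚ 128 ^ t *_) (even-power (quarter i′) t) ⟩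
              fromℕℚ 128 ^ t * quarter i′ ^ (2 ℕ.* t) ≤⟨ *-monoˡ-≤ 0≤128^t Y≥ ⟩
              fromℕℚ 128 ^ t * Y ∎
              where
              e₁ = solve-ℚ 1 (λ a → Κ (fromℕℚ 8) ⊗ (a ⊗ a) , Κ (fromℕℚ 128) ⊗ (a ⊗ (Κ ½ ⊗ Κ ½) ⊗ (a ⊗ (Κ ½ ⊗ Κ ½)))) refl
              e₂ : ∀ e → suc (suc e ℕ.+ suc e) ≡ suc e ℕ.+ suc e ℕ.+ 1
              e₂ e = ℕ.+-comm 1 (suc e ℕ.+ suc e)
              e₃ = solve-ℕ 1 (λ j → (Κ 1 ⊕ (Κ 1 ⊕ j)) ⊗ (Κ 1 ⊕ (Κ 1 ⊕ j)) ⊗ Κ 2 ⊕ (Κ 1 ⊕ (Κ 1 ⊕ j)) ⊗ (Κ 1 ⊕ (Κ 1 ⊕ j)) ⊗ Κ 2 ⊕ Κ 1 ⊕ (Κ 4 ⊗ (j ⊗ j) ⊕ Κ 48 ⊗ j ⊕ Κ 111) , Κ 8 ⊗ ((Κ 4 ⊕ j) ⊗ (Κ 4 ⊕ j))) refl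
              m≤ : fromℕℚ (suc m) ≤ fromℕℚ 128 * (quarter i′ * quarter i′)
              m≤ = begin
                fromℕℚ (suc m) ≤⟨ fromℕℚ-mono (ℕ.≤-trans (ℕ.≤-reflexive (e₂ e)) (ℕ.≤-trans (ℕ.+-monoˡ-≤ 1 (ℕ.+-mono-≤ e< e<))
                                                                         (ℕ.≤-trans (ℕ.m≤m+n _ (4 ℕ.* (i′ ℕ.* i′) ℕ.+ 48 ℕ.* i′ ℕ.+ 111)) (ℕ.≤-reflexive (e₃ i′))))) ⟩
                fromℕℚ (8 ℕ.* ((4 ℕ.+ i′) ℕ.* (4 ℕ.+ i′))) ≡⟨ trans (fromℕℚ-* 8 ((4 ℕ.+ i′) ℕ.* (4 ℕ.+ i′))) (cong (fromℕℚ 8 *_) (fromℕℚ-* (4 ℕ.+ i′) (4 ℕ.+ i′))) ⟩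
                fromℕℚ 8 * (fromℕℚ (4 ℕ.+ i′) * fromℕℚ (4 ℕ.+ i′)) ≡⟨ e₁ (fromℕℚ (4 ℕ.+ i′)) ⟩
                fromℕℚ 128 * (quarter i′ * quarter i′) ∎

        asymptotic : SummatoryAsymptotic (multiplicative g) (fromℚ (ℤ.+ 1 ℚ./ 4) Defs.* π Defs.* P) c
        -- Two of the hypotheses on reals are evaluated with tolerance 1: x ≥ 19 makes the
        -- approximations of x at least 18, and x < n + 1 then gives n ≥ 17.
        asymptotic = fromℚ κ , fromℕ 19 , λ x 1<x x₀≤x n (n≤x , (ε₀ , 0<ε₀ , x<1+n)) ε 0<ε →
          let 0<x = 1<x⇒0<x {x} 1<x
              0<log = log-positive x 0<x 1<x
              lo = n≤x 1ℚ 0<1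
              x₀ = x₀≤x 1ℚ 0<1
              17≤n = large x n ε₀ (eventually-× x₀ x<1+n) 0<ε₀
              S = scales n 17≤n
              open Scales S
              iₑ = proj₁ (harmonic-dyadic e)
              N , all = eventually-× lo (eventually-× x<1+n (eventually-× (from n) (eventually-× (from (D i ℕ.* D i ℕ.* D i)) (eventually-× (from (1 ℕ.* i ℕ.+ 1))
                (eventually-× (from (D iₑ ℕ.* D iₑ ℕ.* D iₑ)) (eventually-× (from (D i′ ℕ.* D i′ ℕ.* D i′)) (from (2 ℕ.* t ℕ.* i′ ℕ.+ 1))))))))
          in N , λ T N≤T →
            let a , b , n≤T , T₁ , T₂ , T₃ , T₄ , T₅ = all T N≤T
            in ℚ.≤-trans (ℚ.≤-reflexive (cong (λ z → ∣ fromℕℚ (∑′ n (multiplicative g)) - z * seq P T * seq x T ∣) (quarter-π (leibniz T))))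
                 (ℚ.≤-trans (estimate x 0<x 0<log S T n≤T a (below x n T 0<ε₀ b) T₁ T₂ T₃ T₄ T₅) (p≤p+q (ℚ.<⇒≤ 0<ε)))
          where
          from : ∀ a → Eventually (a ℕ.≤_)
          from a = a , λ _ a≤T → a≤T
          -- As π is represented by four times the Leibniz sums, a quarter of it is represented by
          -- the sums themselves.
          quarter-π : ∀ l → (ℤ.+ 1 ℚ./ 4) * (fromℕℚ 4 * l) ≡ l
          quarter-π l = trans (sym (ℚ.*-assoc (ℤ.+ 1 ℚ./ 4) (fromℕℚ 4) l)) (ℚ.*-identityˡ l)
          below : ∀ x n T {ε₀} → 0ℚ < ε₀ → seq x T + ε₀ ≤ fromℕℚ (suc n) → seq x T ≤ fromℕℚ n + 1ℚ
          below x n T 0<ε₀ le = ℚ.≤-trans (p≤p+q (ℚ.<⇒≤ 0<ε₀)) (ℚ.≤-trans le (ℚ.≤-reflexive (trans (fromℕℚ-suc n) (ℚ.+-comm 1ℚ (fromℕℚ n)))))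
          large : ∀ x n ε₀ → Eventually (λ T → fromℕℚ 19 ≤ seq x T + 1ℚ × seq x T + ε₀ ≤ fromℕℚ (suc n)) → 0ℚ < ε₀ → 17 ℕ.≤ n
          large x n ε₀ (N , all) 0<ε₀ = ℕ.s≤s⁻¹ (ℕ.s≤s⁻¹ (fromℕℚ-cancel-≤ {19} {suc (suc n)} (begin
            fromℕℚ 19 ≤⟨ proj₁ (all N ℕ.≤-refl) ⟩
            seq x N + 1ℚ ≤⟨ ℚ.+-monoˡ-≤ 1ℚ (ℚ.≤-trans (p≤p+q {seq x N} {ε₀} (ℚ.<⇒≤ 0<ε₀)) (proj₂ (all N ℕ.≤-refl))) ⟩
            fromℕℚ (suc n) + 1ℚ ≡⟨ trans (ℚ.+-comm (fromℕℚ (suc n)) 1ℚ) (sym (fromℕℚ-suc (suc n))) ⟩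
            fromℕℚ (suc (suc n)) ∎)))

    summatory-asymptotic : (c : ℚ) → 0ℚ ≤ c → fromℕℚ (2 ℕ.* suc (suc M)) ≤ c * 2ℚ →
      ∃ λ (P : ℝ) → IsEulerProduct g P × SummatoryAsymptotic (multiplicative g) (fromℚ (ℤ.+ 1 ℚ./ 4) Defs.* π Defs.* P) c
    summatory-asymptotic c 0≤c 2t≤2c = combine (eulerLimit G) (∏blowup-bound G)
      where
      combine : EulerLimit G → (∃ λ K → 0ℚ ≤ K × (∀ T n m → n ℕ.≤ 2 ℕ.^ m → ∏ᶠ (blowup g T) (primes n) ≤ K * fromℕℚ (suc m) ^ suc (suc M))) →
        ∃ λ (P : ℝ) → IsEulerProduct g P × SummatoryAsymptotic (multiplicative g) (fromℚ (ℤ.+ 1 ℚ./ 4) Defs.* π Defs.* P) c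
      combine (P , isEP , U , 1≤U , ∣P∣≤ , close) (K , 0≤K , bound) = P , isEP , Estimate.asymptotic U K P 1≤U 0≤K ∣P∣≤ close bound c 0≤c 2t≤2c

open Assembly

-- The exponents of the theorem.

module Exponents where

  open ℚ-Operations using (_+_; _*_; _≤_)
  open ℚ.≤-Reasoning

  M≤N/3 : ∀ {M N} → 4 ℕ.* M ≡ N → fromℕℚ M ≤ ℤ.+ N ℚ./ 3
  M≤N/3 {M} {N} refl = ℚ.toℚᵘ-cancel-≤ (ℚᵘ.≤-respʳ-≃ (ℚᵘ.≃-sym (ℚ.toℚᵘ-fromℚᵘ (ℚᵘ.mkℚᵘ (ℤ.+ N) 2)))
    (ℚᵘ.*≤* (subst₂ ℤ._≤_ (ℤ.pos-* M 3) (ℤ.pos-* N 1) (ℤ.+≤+ (ℕ.≤-trans (ℕ.≤-reflexive (ℕ.*-comm M 3))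
      (ℕ.≤-trans (ℕ.*-monoˡ-≤ M (ℕ.n≤1+n 3)) (ℕ.≤-reflexive (sym (ℕ.*-identityʳ N)))))))))

  0≤exponent : ∀ N → 0ℚ ≤ ℤ.+ 3 ℚ./ 1 + ℤ.+ N ℚ./ 3
  0≤exponent N = 0≤+ (0≤fromℕℚ 3) (ℚ.toℚᵘ-cancel-≤ (ℚᵘ.≤-respʳ-≃ (ℚᵘ.≃-sym (ℚ.toℚᵘ-fromℚᵘ (ℚᵘ.mkℚᵘ (ℤ.+ N) 2)))
    (ℚᵘ.*≤* (subst (ℤ.+ 0 ℤ.≤_) (ℤ.pos-* N 1) (ℤ.+≤+ z≤n)))))

  -- Both exponents have the form 3 + 4 M / 3, which is at least M + 3, while the estimate asks for
  -- M + 2.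
  exponent-suffices : ∀ M {N} → 4 ℕ.* M ≡ N → fromℕℚ (2 ℕ.* suc (suc M)) ≤ (ℤ.+ 3 ℚ./ 1 + ℤ.+ N ℚ./ 3) * 2ℚ
  exponent-suffices M {N} 4M≡N = begin
    fromℕℚ (2 ℕ.* suc (suc M)) ≤⟨ fromℕℚ-mono (ℕ.*-monoʳ-≤ 2 (ℕ.n≤1+n (suc (suc M)))) ⟩
    fromℕℚ (2 ℕ.* (3 ℕ.+ M)) ≡⟨ trans (fromℕℚ-* 2 (3 ℕ.+ M)) (trans (ℚ.*-comm 2ℚ (fromℕℚ (3 ℕ.+ M))) (cong (_* 2ℚ) (fromℕℚ-+ 3 M))) ⟩
    (fromℕℚ 3 + fromℕℚ M) * 2ℚ ≤⟨ *-monoʳ-≤ {2ℚ} (0≤fromℕℚ 2) (ℚ.+-monoʳ-≤ (fromℕℚ 3) (M≤N/3 {M} {N} 4M≡N)) ⟩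
    (ℤ.+ 3 ℚ./ 1 + ℤ.+ N ℚ./ 3) * 2ℚ ∎

  -- Here M = k (k + 1) / 2 - 1, and twice `sum-to k` is k² + k.
  sum-to-exponent : ∀ k → 4 ℕ.* (sum-to k ℕ.∸ 1) ≡ 2 ℕ.* (k ℕ.^ 2 ℕ.+ k ℕ.∸ 2)
  sum-to-exponent k = trans (ℕ.*-assoc 2 2 (sum-to k ℕ.∸ 1)) (cong (2 ℕ.*_)
    (trans (ℕ.*-distribˡ-∸ 2 (sum-to k) 1) (cong (ℕ._∸ 2) (2*sum-to k))))

open Exponents

open import Defs
open import Data.Integer.Base using (+_)

theorem4 : (k : ℕ) → 2 ℕ.≤ k →
    (∃ λ (P : ℝ) → IsEulerProduct (τ k) P ×
    SummatoryAsymptotic (𝔱ᵉ k) (fromℚ (+ 1 ℚ./ 4) * π * P)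
    (+ 3 ℚ./ 1 ℚ.+ + (4 ℕ.* (k ℕ.∸ 1)) ℚ./ 3))
    ×
    (∃ λ (P : ℝ) → IsEulerProduct (𝔱ℕ k) P ×
    SummatoryAsymptotic (𝔱ᵉ* k) (fromℚ (+ 1 ℚ./ 4) * π * P)
    (+ 3 ℚ./ 1 ℚ.+ + (2 ℕ.* (k ℕ.^ 2 ℕ.+ k ℕ.∸ 2)) ℚ./ 3))
theorem4 k 2≤k =
  summatory-asymptotic (τ-admissible k 2≤k) (+ 3 ℚ./ 1 ℚ.+ + (4 ℕ.* (k ℕ.∸ 1)) ℚ./ 3)
    (0≤exponent (4 ℕ.* (k ℕ.∸ 1))) (exponent-suffices (k ℕ.∸ 1) refl) ,
  summatory-asymptotic (𝔱ℕ-admissible k 2≤k) (+ 3 ℚ./ 1 ℚ.+ + (2 ℕ.* (k ℕ.^ 2 ℕ.+ k ℕ.∸ 2)) ℚ./ 3)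
    (0≤exponent (2 ℕ.* (k ℕ.^ 2 ℕ.+ k ℕ.∸ 2))) (exponent-suffices (sum-to k ℕ.∸ 1) (sum-to-exponent k))
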